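{- For $|q|<1$, $$\mathrm{C}\Phi_{15}(q)=\frac{1}{(q;q)_\infty^{15}}\Big(\tfrac{18125225}{1156}B_{15,1}-\tfrac{845079}{34}B_{15,2}-\tfrac{87564447}{1156}B_{15,3}+\tfrac{2491641}{34}B_{15,4}+\tfrac{147166525}{1156}B_{15,5}+\tfrac{341957}{68}B_{15,6}$$ $$-\tfrac{483081}{17}B_{15,7}-\tfrac{28623}{4}B_{15,8}-\tfrac{9784683}{68}B_{15,9}-\tfrac{1168839}{34}B_{15,10}+\tfrac{7263781}{68}B_{15,11}-\tfrac{97629}{4}B_{15,12}+3375B_{15,13}-3374B_{15,14}\Big),$$ where, with $q=e^{2\pi i\tau}$, $f_{15}=\frac{\eta^2(\tau)\eta^2(15\tau)}{\eta(3\tau)\eta(5\tau)}$, $h_{15}=\eta^4(\tau)\eta^4(5\tau)-9\eta^4(3\tau)\eta^4(15\tau)$, $g_{15,1}=-\frac18(E_2(\tau)+3E_2(3\tau)-5E_2(5\tau)-15E_2(15\tau))$, $g_{15,2}=-\frac1{12}(E_2(\tau)-3E_2(3\tau)+5E_2(5\tau)-15E_2(15\tau))$, $g_{15,3}=\eta(\tau)\eta(3\tau)\eta(5\tau)\eta(15\tau)$, $g_{15,4}=\frac18(E_2(\tau)-3E_2(3\tau)-5E_2(5\tau)+15E_2(15\tau))$, and $B_{15,1}=f_{15}g_{15,1}^3$, $B_{15,2}=f_{15}g_{15,1}^2g_{15,2}$, $B_{15,3}=f_{15}g_{15,1}g_{15,2}^2$, $B_{15,4}=f_{15}g_{15,2}^3$,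 $B_{15,5}=f_{15}g_{15,1}^2g_{15,3}$, $B_{15,6}=f_{15}g_{15,1}^2g_{15,4}$, $B_{15,7}=f_{15}g_{15,1}g_{15,2}g_{15,3}$, $B_{15,8}=f_{15}g_{15,1}g_{15,2}g_{15,4}$, $B_{15,9}=f_{15}g_{15,2}^2g_{15,3}$, $B_{15,10}=f_{15}g_{15,2}^2g_{15,4}$, $B_{15,11}=f_{15}g_{15,1}h_{15}$, $B_{15,12}=f_{15}g_{15,2}h_{15}$, $B_{15,13}=\frac{\eta^{14}(3\tau)\eta^{14}(5\tau)}{\eta^7(\tau)\eta^7(15\tau)}$, $B_{15,14}=\frac{\eta^{17}(\tau)\eta^2(5\tau)}{\eta^4(3\tau)\eta(15\tau)}$.
   Context: A $k$-colored generalized Frobenius symbol is a two-row array with $d\ge 0$ columns whose entries are colored nonnegative integers $\ell_c$ ($\ell\ge 0$, color $c\in\{1,\dots,k\}$), each row strictly decreasing with respect to the total order $0_1\prec 0_2\prec\cdots\prec 0_k\prec 1_1\prec\cdots\prec 1_k\prec 2_1\prec\cdots$. It is a $k$-colored generalized Frobenius partition of $n=d+\sum(\text{integer values of all entries})$. $c\phi_k(n)$ is the number of such partitions of $n$ (with $c\phi_k(0)=1$), and $\mathrm{C}\Phi_k(q)=\sum_{n\ge0}c\phi_k(n)q^n$. $(a;q)_\infty=\prod_{j\ge1}(1-aq^{j-1})$, $\eta(\tau)=q^{1/24}\prod_{n\ge1}(1-q^n)$, and $E_2(\tau)=1-24\sum_{k\ge1}\frac{kq^k}{1-q^k}$. 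-}

module Defs where

open import Data.Nat as ℕ using (ℕ; zero; suc; _∸_; _<ᵇ_)
open import Data.Nat.Divisibility using (_∣?_)
open import Data.Fin as Fin using (Fin)
open import Data.Integer using (+_)
open import Data.Rational as ℚ using (ℚ; 0ℚ; 1ℚ; _/_)
open import Data.List using (List; []; _∷_; length; map)
open import Data.Nat.ListAction using (sum)
open import Data.List.Relation.Unary.Linked using (Linked)
open import Data.Product using (_×_; _,_; proj₁; Σ-syntax)
open import Data.Sum using (_⊎_)
open import Data.Bool using (if_then_else_)
open import Relation.Nullary.Decidable using (does)
open import Relation.Binary.PropositionalEquality using (_≡_)

ColInt : ℕ → Set
ColInt k = ℕ × Fin k

_≺_ : ∀ {k} → ColInt k → ColInt k → Set
(a , c) ≺ (b , d) = (a ℕ.< b) ⊎ ((a ≡ b) × (c Fin.< d))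

_≻_ : ∀ {k} → ColInt k → ColInt k → Set
x ≻ y = y ≺ x

StrictDec : ∀ {k} → List (ColInt k) → Set
StrictDec = Linked _≻_

record FrobSymbol (k : ℕ) : Set where
  constructor frob
  field
    top      : List (ColInt k)
    bottom   : List (ColInt k)
    sameLen  : length top ≡ length bottom
    topDec   : StrictDec top
    bottomDec : StrictDec bottom

weight : ∀ {k} → FrobSymbol k → ℕ
weight s = length (FrobSymbol.top s)
         ℕ.+ sum (map proj₁ (FrobSymbol.top s))
         ℕ.+ sum (map proj₁ (FrobSymbol.bottom s))

FrobPartition : ℕ → ℕ → Set
FrobPartition k n = Σ[ s ∈ FrobSymbol k ] (weight s ≡ n)

Series : Set
Series = ℕ → ℚ

sumTo : (ℕ → ℚ) → ℕ → ℚ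
sumTo f zero    = f zero
sumTo f (suc n) = sumTo f n ℚ.+ f (suc n)

_⊕_ : Series → Series → Series
(a ⊕ b) n = a n ℚ.+ b n

_⊛_ : Series → Series → Series
(a ⊛ b) n = sumTo (λ i → a i ℚ.* b (n ∸ i)) n

infixl 6 _⊕_
infixl 7 _⊛_ _·_

_·_ : ℚ → Series → Series
(c · a) n = c ℚ.* a n

one : Series
one zero    = 1ℚ
one (suc _) = 0ℚ

_^^_ : Series → ℕ → Series
a ^^ zero  = one
a ^^ suc m = a ⊛ (a ^^ m)

qshift : ℕ → Series → Series
qshift s a n = if n <ᵇ s then 0ℚ else a (n ∸ s)

-- multiplicative inverse of a series with constant term 1:
-- b 0 = 1, b (n+1) = - Σ_{i=1}^{n+1} a i * b (n+1-i)
-- invList a n = [b n, b (n-1), …, b 0]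
invList : Series → ℕ → List ℚ
invList a zero    = 1ℚ ∷ []
invList a (suc n) = ℚ.- (go 0 bs) ∷ bs
  where
  bs = invList a n
  go : ℕ → List ℚ → ℚ
  go j []       = 0ℚ
  go j (b ∷ rs) = a (suc j) ℚ.* b ℚ.+ go (suc j) rs

invUnit : Series → Series
invUnit a n with invList a n
... | []    = 0ℚ
... | b ∷ _ = b

oneMinusQ : ℕ → Series
oneMinusQ j n = if does (n ℕ.≟ 0) then 1ℚ else (if does (n ℕ.≟ j) then ℚ.- 1ℚ else 0ℚ)

finEuler : ℕ → ℕ → Series
finEuler m zero    = one
finEuler m (suc N) = finEuler m N ⊛ oneMinusQ (m ℕ.* suc N)

-- (q^m; q^m)_∞ for m ≥ 1: its q^n coefficient equals that of the finite
-- product over j = 1..n (factors with j > n do not affect it)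
qpoch : ℕ → Series
qpoch m n = finEuler m n n

-- E_2(τ) = 1 - 24 Σ_{k≥1} k q^k/(1-q^k); coefficient of q^n (n ≥ 1) of
-- Σ_k k q^k/(1-q^k) is Σ_{k ∣ n} k
sigmaSum : ℕ → ℚ
sigmaSum n = sumTo (λ k → if does (k ∣? n) then (+ k) / 1 else 0ℚ) n

E2 : Series
E2 zero    = 1ℚ
E2 (suc n) = ℚ.- ((+ 24) / 1) ℚ.* sigmaSum (suc n)

-- τ ↦ mτ, i.e. q ↦ q^m  (m ≥ 1)
dilate : ℕ → Series → Series
dilate m a n = if does (m ∣? n) then a (n ℕ./ m') else 0ℚ
  where
  m' = suc (m ∸ 1)

E2at : ℕ → Series
E2at m = dilate m E2

-- the q-series of Theorem 5.4 (k = 15).  We write Em m = (q^m;q^m)_∞,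
-- so η(mτ) = q^{m/24} Em m; every eta quotient below has an integral
-- total power of q, which is made explicit with qshift.

Em : ℕ → Series
Em = qpoch

-- η²(τ)η²(15τ)/(η(3τ)η(5τ)) = q · E1² E15² / (E3 E5)
f15 : Series
f15 = qshift 1 ((Em 1 ^^ 2) ⊛ (Em 15 ^^ 2) ⊛ invUnit (Em 3 ⊛ Em 5))

-- η⁴(τ)η⁴(5τ) - 9 η⁴(3τ)η⁴(15τ) = q E1⁴E5⁴ - 9 q³ E3⁴E15⁴
h15 : Series
h15 = qshift 1 ((Em 1 ^^ 4) ⊛ (Em 5 ^^ 4))
    ⊕ (ℚ.- ((+ 9) / 1)) · qshift 3 ((Em 3 ^^ 4) ⊛ (Em 15 ^^ 4))

g1 : Series
g1 = (ℚ.- ((+ 1) / 8)) · (E2at 1 ⊕ ((+ 3) / 1) · E2at 3 ⊕ (ℚ.- ((+ 5) / 1)) · E2at 5 ⊕ (ℚ.- ((+ 15) / 1)) · E2at 15)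

g2 : Series
g2 = (ℚ.- ((+ 1) / 12)) · (E2at 1 ⊕ (ℚ.- ((+ 3) / 1)) · E2at 3 ⊕ ((+ 5) / 1) · E2at 5 ⊕ (ℚ.- ((+ 15) / 1)) · E2at 15)

-- η(τ)η(3τ)η(5τ)η(15τ) = q E1 E3 E5 E15
g3 : Series
g3 = qshift 1 (Em 1 ⊛ Em 3 ⊛ Em 5 ⊛ Em 15)

g4 : Series
g4 = ((+ 1) / 8) · (E2at 1 ⊕ (ℚ.- ((+ 3) / 1)) · E2at 3 ⊕ (ℚ.- ((+ 5) / 1)) · E2at 5 ⊕ ((+ 15) / 1) · E2at 15)

B1 B2 B3 B4 B5 B6 B7 B8 B9 B10 B11 B12 B13 B14 : Series
B1  = f15 ⊛ (g1 ^^ 3)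
B2  = f15 ⊛ (g1 ^^ 2) ⊛ g2
B3  = f15 ⊛ g1 ⊛ (g2 ^^ 2)
B4  = f15 ⊛ (g2 ^^ 3)
B5  = f15 ⊛ (g1 ^^ 2) ⊛ g3
B6  = f15 ⊛ (g1 ^^ 2) ⊛ g4
B7  = f15 ⊛ g1 ⊛ g2 ⊛ g3
B8  = f15 ⊛ g1 ⊛ g2 ⊛ g4
B9  = f15 ⊛ (g2 ^^ 2) ⊛ g3
B10 = f15 ⊛ (g2 ^^ 2) ⊛ g4
B11 = f15 ⊛ g1 ⊛ h15
B12 = f15 ⊛ g2 ⊛ h15
-- η¹⁴(3τ)η¹⁴(5τ)/(η⁷(τ)η⁷(15τ)) = E3¹⁴E5¹⁴/(E1⁷E15⁷)   (q-power 0)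
B13 = (Em 3 ^^ 14) ⊛ (Em 5 ^^ 14) ⊛ invUnit ((Em 1 ^^ 7) ⊛ (Em 15 ^^ 7))
-- η¹⁷(τ)η²(5τ)/(η⁴(3τ)η(15τ)) = E1¹⁷E5²/(E3⁴E15)   (q-power 0)
B14 = (Em 1 ^^ 17) ⊛ (Em 5 ^^ 2) ⊛ invUnit ((Em 3 ^^ 4) ⊛ Em 15)

pos neg : ℕ → (d : ℕ) → .{{_ : ℕ.NonZero d}} → ℚ
pos p d = (+ p) / d
neg p d = ℚ.- ((+ p) / d)

bracket15 : Series
bracket15 =
    pos 18125225 1156 · B1 ⊕ neg 845079 34 · B2 ⊕ neg 87564447 1156 · B3
  ⊕ pos 2491641 34 · B4 ⊕ pos 147166525 1156 · B5 ⊕ pos 341957 68 · B6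
  ⊕ neg 483081 17 · B7 ⊕ neg 28623 4 · B8 ⊕ neg 9784683 68 · B9
  ⊕ neg 1168839 34 · B10 ⊕ pos 7263781 68 · B11 ⊕ neg 97629 4 · B12
  ⊕ pos 3375 1 · B13 ⊕ neg 3374 1 · B14

rhs15 : Series
rhs15 = invUnit (Em 1 ^^ 15) ⊛ bracket15

module Submission where

-- The generating function of the partitions is the constant term in z of Π (1 + z q^j)^15 (1 + q^(j-1)/z)^15,
-- so the fifteenth power of the Jacobi triple product, averaged over z = ζ^a with ζ^15 = 1, expresses
-- C₀ = (q;q)^15 CΦ₁₅ through the theta values p_a and their logarithmic derivatives λ_a: the sum of
-- p_a^15 λ_a over a = 1, …, 7 is - 15 C₀ (q^15;q^15)^3. The three-term (Plücker) relations of theta functions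
-- present the quotients p_a / p_b as functions of X = p_1 / p_4 and Y = p_2 / p_7 on the curve
-- X + 1/X + 1 = Y + 1/Y, a model of X_1(15). Their degenerate cases express the λ_a, and, with the heat
-- equation and Ramanujan's identity for the Rogers-Ramanujan quotient, also the Eisenstein series and q, as a
-- power of one modular form times a Laurent polynomial in X and Y. The claim thus becomes an identity
-- in the coordinate ring of the curve, which is verified by computation.

-- Why a derivative is needed: θ is odd in z, so the plain average of its fifteenth power vanishes.
-- After one Euler derivative the surviving terms carry the weights 15 (2j - 1) and form Jacobi's
-- series for (q^15;q^15)^3, which is invertible, so that CΦ₁₅ can be solved for. Everything is
-- formal: coefficients lie in an extension of ℚ containing a root of the fifteenth cyclotomic
-- polynomial, derivatives in z come from dual numbers, and q d/dq acts coefficientwise. All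
-- relations of theta functions have one source: θ(x + y) θ(x - y) is a 2 × 2 determinant in even
-- theta functions, and such determinants satisfy Plücker relations. The forms are eta quotients
-- with explicit powers of q, and q alone is not modular; it is reached through the differential
-- equation D u = u, whose solutions are the constant multiples of q. No dimension count and no
-- comparison of finitely many coefficients enters: once every form is a Laurent polynomial in X and
-- Y times a power of one form of weight one, equality is a normal-form computation.

open import Level using (0ℓ)
open import Algebra.Bundles using (CommutativeRing)
import Algebra.Properties.Ring as RingProperties
open import Data.Bool using (Bool; true; false; _∧_; if_then_else_) renaming (T to IsTrue)
open import Data.Empty using (⊥-elim)
open import Data.Fin using (Fin; zero; suc; #_)
open import Data.Integer as ℤ using (ℤ; +_; -[1+_])
open import Data.Integer.DivMod using (_%ℕ_; _/ℕ_; a≡a%ℕn+[a/ℕn]*n; n%ℕd<d)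
import Data.Integer.Properties as ℤP
open import Data.List using (List; []; _∷_)
open import Data.Nat as ℕ using (ℕ; zero; suc; _≤_; _<_; z≤n; s≤s; _∸_; _≡ᵇ_)
open import Data.Nat.DivMod using (m<n⇒m/n≡0; m/n≡1+[m∸n]/n)
import Data.Nat.Properties as ℕP
open import Data.Product using (_×_; _,_; proj₁; proj₂; Σ-syntax)
open import Data.Rational as ℚ using (ℚ; 0ℚ; 1ℚ; _/_)
import Data.Rational.Properties as ℚP
open import Data.Sum using (_⊎_; inj₁; inj₂)
open import Data.Vec as Vec using (Vec; []; _∷_)
open import Data.Vec.N-ary using (N-ary; Eq; curryⁿ; curryⁿ-cong; _$ⁿ_)
open import Data.Vec.Properties using (lookup-map)
open import Data.Vec.Relation.Binary.Pointwise.Inductive as Pointwise using (Pointwise; []; _∷_)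
open import Function.Bundles using (_↔_)
open import Relation.Nullary using (Dec; yes; no; does; ¬_)
open import Relation.Binary.PropositionalEquality as ≡ using (_≡_)
import Relation.Binary.Reasoning.Setoid as SetoidReasoning

-- Polynomial normal forms

module Expressions where
  infixl 6 _:+_ _:-_
  infixl 7 _:*_
  infixr 8 _:^_
  infix  8 :-_
  infix  4 _:=_

  data Expr (n : ℕ) : Set where
    :v          : Fin n → Expr n
    :c          : ℤ → Expr n
    :0 :1       : Expr n
    _:+_ _:*_   : Expr n → Expr n → Expr n
    _:-_        : Expr n → Expr n → Expr n
    :-_         : Expr n → Expr n
    _:^_        : Expr n → ℕ → Expr n

  -- Multivariate polynomials in dense Horner form.
  Pol : ℕ → Set
  Pol zero    = ℤ
  Pol (suc n) = List (Pol n)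

  con : ∀ {n} → ℤ → Pol n
  con {zero}  c = c
  con {suc n} (+ zero) = []
  con {suc n} c        = con c ∷ []

  var : ∀ {n} → Fin n → Pol n
  var {suc n} zero    = con (+ 0) ∷ con (+ 1) ∷ []
  var {suc n} (suc i) = var i ∷ []

  add : ∀ {n} → Pol n → Pol n → Pol n
  add {zero}  a b             = a ℤ.+ b
  add {suc n} []       q      = q
  add {suc n} (p ∷ ps) []     = p ∷ ps
  add {suc n} (p ∷ ps) (q ∷ qs) = add p q ∷ add {suc n} ps qs

  neg : ∀ {n} → Pol n → Pol n
  neg {zero}  a        = ℤ.- a
  neg {suc n} []       = []
  neg {suc n} (p ∷ ps) = neg p ∷ neg {suc n} ps

  isZero : ∀ {n} → Pol n → Bool
  isZero {zero}  (+ zero)  = true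
  isZero {zero}  (+ suc _) = false
  isZero {zero}  -[1+ _ ]  = false
  isZero {suc n} []        = true
  isZero {suc n} (p ∷ ps)  = isZero p ∧ isZero {suc n} ps

  mutual
    -- Zero coefficients are skipped: the dense form of a polynomial in many variables consists
    -- mostly of zeros, and some identities below have more than twenty variables.
    mul : ∀ {n} → Pol n → Pol n → Pol n
    mul {zero}  a b        = a ℤ.* b
    mul {suc n} []       q = []
    mul {suc n} (p ∷ ps) q = add {suc n} (if isZero p then [] else scale p q) (con (+ 0) ∷ mul {suc n} ps q)

    scale : ∀ {n} → Pol n → List (Pol n) → List (Pol n)
    scale p []       = []
    scale p (q ∷ qs) = mul p q ∷ scale p qs

  powP : ∀ {n} → Pol n → ℕ → Pol n
  powP p zero    = con (+ 1)
  powP p (suc k) = mul p (powP p k)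

  norm : ∀ {n} → Expr n → Pol n
  norm (:v i)   = var i
  norm (:c c)   = con c
  norm :0       = con (+ 0)
  norm :1       = con (+ 1)
  norm (a :+ b) = add (norm a) (norm b)
  norm (a :* b) = mul (norm a) (norm b)
  norm (a :- b) = add (norm a) (neg (norm b))
  norm (:- a)   = neg (norm a)
  norm (a :^ k) = powP (norm a) k

  _:=_ : ∀ {n} → Expr n → Expr n → Expr n × Expr n
  a := b = a , b

  vars : ∀ {n} → Vec (Fin n) n
  vars = Vec.allFin _

  close : ∀ n → N-ary n (Expr n) (Expr n × Expr n) → Expr n × Expr n
  close n f = f $ⁿ Vec.map :v (vars {n})

module Solver (R : CommutativeRing 0ℓ 0ℓ) where
  open CommutativeRing R
  open RingProperties ring using (-‿distribˡ-*; -‿distribʳ-*; -‿involutive; -0#≈0#; -‿+-comm; +-inverseʳ-unique)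
  open SetoidReasoning setoid
  open Expressions public

  -- The separate clause for one makes `fromℤ (+ 1)` compute to the unit of the ring itself, with no
  -- zero added.
  fromℕ : ℕ → Carrier
  fromℕ zero          = 0#
  fromℕ (suc zero)    = 1#
  fromℕ (suc (suc n)) = 1# + fromℕ (suc n)

  fromℤ : ℤ → Carrier
  fromℤ (+ n)    = fromℕ n
  fromℤ -[1+ n ] = - fromℕ (suc n)

  fromℕ-suc : ∀ n → fromℕ (suc n) ≈ 1# + fromℕ n
  fromℕ-suc zero    = sym (+-identityʳ 1#)
  fromℕ-suc (suc n) = refl

  fromℕ-+ : ∀ m n → fromℕ (m ℕ.+ n) ≈ fromℕ m + fromℕ n
  fromℕ-+ zero n = sym (+-identityˡ _)
  fromℕ-+ (suc m) n = begin
    fromℕ (suc (m ℕ.+ n))      ≈⟨ fromℕ-suc (m ℕ.+ n) ⟩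
    1# + fromℕ (m ℕ.+ n)       ≈⟨ +-congˡ (fromℕ-+ m n) ⟩
    1# + (fromℕ m + fromℕ n)   ≈⟨ sym (+-assoc _ _ _) ⟩
    1# + fromℕ m + fromℕ n     ≈⟨ +-congʳ (sym (fromℕ-suc m)) ⟩
    fromℕ (suc m) + fromℕ n    ∎

  fromℕ-* : ∀ m n → fromℕ (m ℕ.* n) ≈ fromℕ m * fromℕ n
  fromℕ-* zero n = sym (zeroˡ _)
  fromℕ-* (suc m) n = begin
    fromℕ (n ℕ.+ m ℕ.* n)            ≈⟨ fromℕ-+ n (m ℕ.* n) ⟩
    fromℕ n + fromℕ (m ℕ.* n)        ≈⟨ +-cong (sym (*-identityˡ _)) (fromℕ-* m n) ⟩
    1# * fromℕ n + fromℕ m * fromℕ n ≈⟨ sym (distribʳ _ _ _) ⟩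
    (1# + fromℕ m) * fromℕ n         ≈⟨ *-congʳ (sym (fromℕ-suc m)) ⟩
    fromℕ (suc m) * fromℕ n          ∎

  fromℤ-neg : ∀ i → fromℤ (ℤ.- i) ≈ - fromℤ i
  fromℤ-neg (+ zero)  = sym -0#≈0#
  fromℤ-neg (+ suc n) = refl
  fromℤ-neg -[1+ n ]  = sym (-‿involutive _)

  fromℤ-⊖ : ∀ m n → fromℤ (m ℤ.⊖ n) ≈ fromℕ m + - fromℕ n
  fromℤ-⊖ zero zero       = sym (-‿inverseʳ _)
  fromℤ-⊖ zero (suc n)    = sym (+-identityˡ _)
  fromℤ-⊖ (suc m) zero    = sym (trans (+-congˡ -0#≈0#) (+-identityʳ _))
  fromℤ-⊖ (suc m) (suc n) = begin
    fromℤ (suc m ℤ.⊖ suc n)              ≡⟨ ≡.cong fromℤ (ℤP.[1+m]⊖[1+n]≡m⊖n m n) ⟩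
    fromℤ (m ℤ.⊖ n)                      ≈⟨ fromℤ-⊖ m n ⟩
    fromℕ m + - fromℕ n                  ≈⟨ +-congʳ (sym (+-identityʳ _)) ⟩
    fromℕ m + 0# + - fromℕ n             ≈⟨ +-congʳ (+-congˡ (sym (-‿inverseʳ 1#))) ⟩
    fromℕ m + (1# + - 1#) + - fromℕ n    ≈⟨ +-congʳ (sym (+-assoc _ _ _)) ⟩
    fromℕ m + 1# + - 1# + - fromℕ n      ≈⟨ +-assoc _ _ _ ⟩
    fromℕ m + 1# + (- 1# + - fromℕ n)    ≈⟨ +-cong (+-comm _ _) (-‿+-comm _ _) ⟩
    1# + fromℕ m + - (1# + fromℕ n)      ≈⟨ +-cong (sym (fromℕ-suc m)) (-‿cong (sym (fromℕ-suc n))) ⟩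
    fromℕ (suc m) + - fromℕ (suc n)      ∎

  fromℤ-+ : ∀ i j → fromℤ (i ℤ.+ j) ≈ fromℤ i + fromℤ j
  fromℤ-+ (+ m)    (+ n)    = fromℕ-+ m n
  fromℤ-+ (+ m)    -[1+ n ] = fromℤ-⊖ m (suc n)
  fromℤ-+ -[1+ m ] (+ n)    = trans (fromℤ-⊖ n (suc m)) (+-comm _ _)
  fromℤ-+ -[1+ m ] -[1+ n ] = begin
    - fromℕ (suc (suc (m ℕ.+ n)))      ≡⟨ ≡.cong (λ k → - fromℕ (suc k)) (≡.sym (Data.Nat.Properties.+-suc m n)) ⟩
    - fromℕ (suc m ℕ.+ suc n)          ≈⟨ -‿cong (fromℕ-+ (suc m) (suc n)) ⟩
    - (fromℕ (suc m) + fromℕ (suc n))  ≈⟨ sym (-‿+-comm _ _) ⟩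
    - fromℕ (suc m) + - fromℕ (suc n)  ∎
    where import Data.Nat.Properties

  fromℤ-*⁺ : ∀ m j → fromℤ (+ m ℤ.* j) ≈ fromℕ m * fromℤ j
  fromℤ-*⁺ m (+ n) = begin
    fromℤ (+ m ℤ.* + n)    ≡⟨ ≡.cong fromℤ (≡.sym (ℤP.pos-* m n)) ⟩
    fromℕ (m ℕ.* n)        ≈⟨ fromℕ-* m n ⟩
    fromℕ m * fromℕ n      ∎
  fromℤ-*⁺ m -[1+ n ] = begin
    fromℤ (+ m ℤ.* ℤ.- (+ suc n))   ≡⟨ ≡.cong fromℤ (≡.sym (ℤP.neg-distribʳ-* (+ m) (+ suc n))) ⟩
    fromℤ (ℤ.- (+ m ℤ.* + suc n))   ≈⟨ fromℤ-neg (+ m ℤ.* + suc n) ⟩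
    - fromℤ (+ m ℤ.* + suc n)       ≈⟨ -‿cong (fromℤ-*⁺ m (+ suc n)) ⟩
    - (fromℕ m * fromℕ (suc n))     ≈⟨ -‿distribʳ-* _ _ ⟩
    fromℕ m * - fromℕ (suc n)       ∎

  fromℤ-* : ∀ i j → fromℤ (i ℤ.* j) ≈ fromℤ i * fromℤ j
  fromℤ-* (+ m) j = fromℤ-*⁺ m j
  fromℤ-* -[1+ m ] j = begin
    fromℤ (ℤ.- (+ suc m) ℤ.* j)   ≡⟨ ≡.cong fromℤ (≡.sym (ℤP.neg-distribˡ-* (+ suc m) j)) ⟩
    fromℤ (ℤ.- (+ suc m ℤ.* j))   ≈⟨ fromℤ-neg (+ suc m ℤ.* j) ⟩
    - fromℤ (+ suc m ℤ.* j)       ≈⟨ -‿cong (fromℤ-*⁺ (suc m) j) ⟩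
    - (fromℕ (suc m) * fromℤ j)   ≈⟨ -‿distribˡ-* _ _ ⟩
    - fromℕ (suc m) * fromℤ j     ∎

  infixr 8 _^_
  _^_ : Carrier → ℕ → Carrier
  x ^ zero  = 1#
  x ^ suc n = x * x ^ n

  ^-cong : ∀ {x y} n → x ≈ y → x ^ n ≈ y ^ n
  ^-cong zero    e = refl
  ^-cong (suc n) e = *-cong e (^-cong n e)

  +-interchange : ∀ a b c d → (a + b) + (c + d) ≈ (a + c) + (b + d)
  +-interchange a b c d = begin
    (a + b) + (c + d)  ≈⟨ +-assoc a b (c + d) ⟩
    a + (b + (c + d))  ≈⟨ +-congˡ (sym (+-assoc b c d)) ⟩
    a + ((b + c) + d)  ≈⟨ +-congˡ (+-congʳ (+-comm b c)) ⟩
    a + ((c + b) + d)  ≈⟨ +-congˡ (+-assoc c b d) ⟩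
    a + (c + (b + d))  ≈⟨ sym (+-assoc a c (b + d)) ⟩
    (a + c) + (b + d)  ∎

  ev : ∀ {n} → Pol n → Vec Carrier n → Carrier
  ev {zero}  c        _       = fromℤ c
  ev {suc n} []       _       = 0#
  ev {suc n} (p ∷ ps) (x ∷ ρ) = ev p ρ + x * ev {suc n} ps (x ∷ ρ)

  ev-con : ∀ {n} c (ρ : Vec Carrier n) → ev (con c) ρ ≈ fromℤ c
  ev-con {zero}  c ρ       = refl
  ev-con {suc n} (+ zero) (x ∷ ρ) = refl
  ev-con {suc n} (+ suc m) (x ∷ ρ) = trans (+-cong (ev-con (+ suc m) ρ) (zeroʳ x)) (+-identityʳ _)
  ev-con {suc n} -[1+ m ] (x ∷ ρ) = trans (+-cong (ev-con -[1+ m ] ρ) (zeroʳ x)) (+-identityʳ _)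

  ev-var : ∀ {n} (i : Fin n) ρ → ev (var i) ρ ≈ Vec.lookup ρ i
  ev-var {suc n} zero (x ∷ ρ) = begin
    ev (con {n} (+ 0)) ρ + x * (ev (con {n} (+ 1)) ρ + x * 0#)
      ≈⟨ +-cong (ev-con (+ 0) ρ) (*-congˡ (trans (+-cong (ev-con (+ 1) ρ) (zeroʳ x)) (+-identityʳ _))) ⟩
    0# + x * 1#  ≈⟨ trans (+-identityˡ _) (*-identityʳ x) ⟩
    x            ∎
  ev-var {suc n} (suc i) (x ∷ ρ) = trans (+-cong (ev-var i ρ) (zeroʳ x)) (+-identityʳ _)

  ev-add : ∀ {n} (p q : Pol n) ρ → ev (add p q) ρ ≈ ev p ρ + ev q ρ
  ev-add {zero}  a b ρ = fromℤ-+ a b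
  ev-add {suc n} [] q (x ∷ ρ) = sym (+-identityˡ _)
  ev-add {suc n} (p ∷ ps) [] (x ∷ ρ) = sym (+-identityʳ _)
  ev-add {suc n} (p ∷ ps) (q ∷ qs) (x ∷ ρ) = begin
    ev (add p q) ρ + x * ev {suc n} (add {suc n} ps qs) (x ∷ ρ)
      ≈⟨ +-cong (ev-add p q ρ) (trans (*-congˡ (ev-add {suc n} ps qs (x ∷ ρ))) (distribˡ x _ _)) ⟩
    (ev p ρ + ev q ρ) + (x * ev {suc n} ps (x ∷ ρ) + x * ev {suc n} qs (x ∷ ρ))
      ≈⟨ +-interchange _ _ _ _ ⟩
    (ev p ρ + x * ev {suc n} ps (x ∷ ρ)) + (ev q ρ + x * ev {suc n} qs (x ∷ ρ)) ∎

  ev-neg : ∀ {n} (p : Pol n) ρ → ev (neg p) ρ ≈ - ev p ρ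
  ev-neg {zero}  a ρ = fromℤ-neg a
  ev-neg {suc n} [] (x ∷ ρ) = sym -0#≈0#
  ev-neg {suc n} (p ∷ ps) (x ∷ ρ) = begin
    ev (neg p) ρ + x * ev {suc n} (neg {suc n} ps) (x ∷ ρ)
      ≈⟨ +-cong (ev-neg p ρ) (trans (*-congˡ (ev-neg {suc n} ps (x ∷ ρ))) (sym (-‿distribʳ-* x _))) ⟩
    - ev p ρ + - (x * ev {suc n} ps (x ∷ ρ))  ≈⟨ -‿+-comm _ _ ⟩
    - (ev p ρ + x * ev {suc n} ps (x ∷ ρ))    ∎

  ∧-true : ∀ {a b : Bool} → a ∧ b ≡ true → a ≡ true × b ≡ true
  ∧-true {true} {true} _ = ≡.refl , ≡.refl

  isZero-sound : ∀ {n} (p : Pol n) ρ → isZero p ≡ true → ev p ρ ≈ 0#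
  isZero-sound {zero}  (+ zero) ρ _ = refl
  isZero-sound {suc n} [] (x ∷ ρ) _ = refl
  isZero-sound {suc n} (p ∷ ps) (x ∷ ρ) e = begin
    ev p ρ + x * ev {suc n} ps (x ∷ ρ)
      ≈⟨ +-cong (isZero-sound p ρ (proj₁ (∧-true e))) (*-congˡ (isZero-sound {suc n} ps (x ∷ ρ) (proj₂ (∧-true {isZero p} e)))) ⟩
    0# + x * 0#  ≈⟨ trans (+-identityˡ _) (zeroʳ x) ⟩
    0#           ∎

  mutual
    ev-mul : ∀ {n} (p q : Pol n) ρ → ev (mul p q) ρ ≈ ev p ρ * ev q ρ
    ev-mul {zero}  a b ρ = fromℤ-* a b
    ev-mul {suc n} [] q (x ∷ ρ) = sym (zeroˡ _)
    ev-mul {suc n} (p ∷ ps) q (x ∷ ρ) = begin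
      ev {suc n} (add {suc n} (if isZero p then [] else scale p q) (con (+ 0) ∷ mul {suc n} ps q)) (x ∷ ρ)
        ≈⟨ ev-add {suc n} (if isZero p then [] else scale p q) (con (+ 0) ∷ mul {suc n} ps q) (x ∷ ρ) ⟩
      ev {suc n} (if isZero p then [] else scale p q) (x ∷ ρ) + (ev (con {n} (+ 0)) ρ + x * ev {suc n} (mul {suc n} ps q) (x ∷ ρ))
        ≈⟨ +-cong (ev-skip p q x ρ) (trans (+-cong (ev-con (+ 0) ρ) (*-congˡ (ev-mul {suc n} ps q (x ∷ ρ)))) (+-identityˡ _)) ⟩
      ev p ρ * ev {suc n} q (x ∷ ρ) + x * (ev {suc n} ps (x ∷ ρ) * ev {suc n} q (x ∷ ρ))
        ≈⟨ +-congˡ (sym (*-assoc _ _ _)) ⟩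
      ev p ρ * ev {suc n} q (x ∷ ρ) + x * ev {suc n} ps (x ∷ ρ) * ev {suc n} q (x ∷ ρ)
        ≈⟨ sym (distribʳ _ _ _) ⟩
      (ev p ρ + x * ev {suc n} ps (x ∷ ρ)) * ev {suc n} q (x ∷ ρ) ∎

    ev-skip : ∀ {n} (p : Pol n) (q : List (Pol n)) x ρ →
              ev {suc n} (if isZero p then [] else scale p q) (x ∷ ρ) ≈ ev p ρ * ev {suc n} q (x ∷ ρ)
    ev-skip p q x ρ with isZero p in e
    ... | true  = sym (trans (*-congʳ (isZero-sound p ρ e)) (zeroˡ _))
    ... | false = ev-scale p q x ρ

    ev-scale : ∀ {n} (p : Pol n) (qs : List (Pol n)) x ρ →
               ev {suc n} (scale p qs) (x ∷ ρ) ≈ ev p ρ * ev {suc n} qs (x ∷ ρ)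
    ev-scale p [] x ρ = sym (zeroʳ _)
    ev-scale {n} p (q ∷ qs) x ρ = begin
      ev (mul p q) ρ + x * ev {suc n} (scale p qs) (x ∷ ρ)
        ≈⟨ +-cong (ev-mul p q ρ) (*-congˡ (ev-scale p qs x ρ)) ⟩
      ev p ρ * ev q ρ + x * (ev p ρ * ev {suc n} qs (x ∷ ρ))
        ≈⟨ +-congˡ (trans (sym (*-assoc _ _ _)) (trans (*-congʳ (*-comm _ _)) (*-assoc _ _ _))) ⟩
      ev p ρ * ev q ρ + ev p ρ * (x * ev {suc n} qs (x ∷ ρ))
        ≈⟨ sym (distribˡ _ _ _) ⟩
      ev p ρ * (ev q ρ + x * ev {suc n} qs (x ∷ ρ)) ∎

  ⟦_⟧ : ∀ {n} → Expr n → Vec Carrier n → Carrier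
  ⟦ :v i ⟧ ρ   = Vec.lookup ρ i
  ⟦ :c c ⟧ ρ   = fromℤ c
  ⟦ :0 ⟧ ρ     = 0#
  ⟦ :1 ⟧ ρ     = 1#
  ⟦ a :+ b ⟧ ρ = ⟦ a ⟧ ρ + ⟦ b ⟧ ρ
  ⟦ a :* b ⟧ ρ = ⟦ a ⟧ ρ * ⟦ b ⟧ ρ
  ⟦ a :- b ⟧ ρ = ⟦ a ⟧ ρ + - ⟦ b ⟧ ρ
  ⟦ :- a ⟧ ρ   = - ⟦ a ⟧ ρ
  ⟦ a :^ k ⟧ ρ = ⟦ a ⟧ ρ ^ k

  ⟦⟧-cong : ∀ {n} (a : Expr n) {ρ ρ′} → Pointwise _≈_ ρ ρ′ → ⟦ a ⟧ ρ ≈ ⟦ a ⟧ ρ′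
  ⟦⟧-cong (:v i)   p = Pointwise.lookup p i
  ⟦⟧-cong (:c k)   p = refl
  ⟦⟧-cong :0       p = refl
  ⟦⟧-cong :1       p = refl
  ⟦⟧-cong (a :+ b) p = +-cong (⟦⟧-cong a p) (⟦⟧-cong b p)
  ⟦⟧-cong (a :* b) p = *-cong (⟦⟧-cong a p) (⟦⟧-cong b p)
  ⟦⟧-cong (a :- b) p = +-cong (⟦⟧-cong a p) (-‿cong (⟦⟧-cong b p))
  ⟦⟧-cong (:- a)   p = -‿cong (⟦⟧-cong a p)
  ⟦⟧-cong (a :^ k) p = ^-cong k (⟦⟧-cong a p)

  ev-pow : ∀ {n} (p : Pol n) k ρ → ev (powP p k) ρ ≈ ev p ρ ^ k
  ev-pow p zero    ρ = ev-con (+ 1) ρ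
  ev-pow p (suc k) ρ = trans (ev-mul p (powP p k) ρ) (*-congˡ (ev-pow p k ρ))

  norm-sound : ∀ {n} (e : Expr n) ρ → ev (norm e) ρ ≈ ⟦ e ⟧ ρ
  norm-sound (:v i)   ρ = ev-var i ρ
  norm-sound (:c c)   ρ = ev-con c ρ
  norm-sound :0       ρ = ev-con (+ 0) ρ
  norm-sound :1       ρ = ev-con (+ 1) ρ
  norm-sound (a :+ b) ρ = trans (ev-add (norm a) (norm b) ρ) (+-cong (norm-sound a ρ) (norm-sound b ρ))
  norm-sound (a :* b) ρ = trans (ev-mul (norm a) (norm b) ρ) (*-cong (norm-sound a ρ) (norm-sound b ρ))
  norm-sound (a :- b) ρ = trans (ev-add (norm a) (neg (norm b)) ρ)
    (+-cong (norm-sound a ρ) (trans (ev-neg (norm b) ρ) (-‿cong (norm-sound b ρ))))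
  norm-sound (:- a)   ρ = trans (ev-neg (norm a) ρ) (-‿cong (norm-sound a ρ))
  norm-sound (a :^ k) ρ = trans (ev-pow (norm a) k ρ) (^-cong k (norm-sound a ρ))

  -≈0⇒≈ : ∀ {x y} → x + - y ≈ 0# → x ≈ y
  -≈0⇒≈ {x} {y} e = begin
    x              ≈⟨ sym (+-identityʳ x) ⟩
    x + 0#         ≈⟨ +-congˡ (sym (-‿inverseˡ y)) ⟩
    x + (- y + y)  ≈⟨ sym (+-assoc x (- y) y) ⟩
    x + - y + y    ≈⟨ +-congʳ e ⟩
    0# + y         ≈⟨ +-identityˡ y ⟩
    y              ∎

  prove : ∀ {n} (a b : Expr n) → isZero (norm (a :- b)) ≡ true → ∀ ρ → ⟦ a ⟧ ρ ≈ ⟦ b ⟧ ρ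
  prove a b e ρ = -≈0⇒≈ (begin
    ⟦ a ⟧ ρ + - ⟦ b ⟧ ρ    ≈⟨ sym (norm-sound (a :- b) ρ) ⟩
    ev (norm (a :- b)) ρ   ≈⟨ isZero-sound (norm (a :- b)) ρ e ⟩
    0#                     ∎)

  -- The hidden premise computes to the unit type exactly when the difference of the two sides has
  -- zero normal form. It is then inferred, so a polynomial identity is checked by evaluation alone.
  solve : ∀ n (f : N-ary n (Expr n) (Expr n × Expr n)) →
          {_ : IsTrue (isZero (norm (proj₁ (close n f) :- proj₂ (close n f))))} →
          Eq n _≈_ (curryⁿ ⟦ proj₁ (close n f) ⟧) (curryⁿ ⟦ proj₂ (close n f) ⟧)
  solve n f {e} = curryⁿ-cong _≈_ ⟦ proj₁ (close n f) ⟧ ⟦ proj₂ (close n f) ⟧ (prove (proj₁ (close n f)) (proj₂ (close n f)) (T⇒≡ e))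
    where
    T⇒≡ : ∀ {b} → IsTrue b → b ≡ true
    T⇒≡ {true} _ = ≡.refl

-- Sums over finite windows of ℤ

module FiniteSums (R : CommutativeRing 0ℓ 0ℓ) where
  open CommutativeRing R
  open Solver R using (+-interchange)
  open SetoidReasoning setoid

  sum : ℕ → (ℕ → Carrier) → Carrier
  sum zero    f = 0#
  sum (suc n) f = f 0 + sum n (λ i → f (suc i))

  sum-cong< : ∀ n {f g : ℕ → Carrier} → (∀ i → i < n → f i ≈ g i) → sum n f ≈ sum n g
  sum-cong< zero    e = refl
  sum-cong< (suc n) e = +-cong (e 0 (s≤s z≤n)) (sum-cong< n (λ i i<n → e (suc i) (s≤s i<n)))

  sum-cong : ∀ n {f g : ℕ → Carrier} → (∀ i → f i ≈ g i) → sum n f ≈ sum n g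
  sum-cong n e = sum-cong< n (λ i _ → e i)

  sum-0 : ∀ n {f : ℕ → Carrier} → (∀ i → i < n → f i ≈ 0#) → sum n f ≈ 0#
  sum-0 zero    e = refl
  sum-0 (suc n) e = trans (+-cong (e 0 (s≤s z≤n)) (sum-0 n (λ i i<n → e (suc i) (s≤s i<n)))) (+-identityˡ _)

  sum-+ : ∀ n (f g : ℕ → Carrier) → sum n (λ i → f i + g i) ≈ sum n f + sum n g
  sum-+ zero    f g = sym (+-identityˡ _)
  sum-+ (suc n) f g = trans (+-congˡ (sum-+ n _ _)) (+-interchange _ _ _ _)

  sum-*ˡ : ∀ n c (f : ℕ → Carrier) → sum n (λ i → c * f i) ≈ c * sum n f
  sum-*ˡ zero    c f = sym (zeroʳ c)
  sum-*ˡ (suc n) c f = trans (+-congˡ (sum-*ˡ n c _)) (sym (distribˡ _ _ _))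

  sum-*ʳ : ∀ n c (f : ℕ → Carrier) → sum n (λ i → f i * c) ≈ sum n f * c
  sum-*ʳ n c f = trans (sum-cong n (λ i → *-comm (f i) c)) (trans (sum-*ˡ n c f) (*-comm c _))

  sum-swap : ∀ m n (f : ℕ → ℕ → Carrier) → sum m (λ i → sum n (f i)) ≈ sum n (λ j → sum m (λ i → f i j))
  sum-swap zero    n f = sym (sum-0 n (λ _ _ → refl))
  sum-swap (suc m) n f = trans (+-congˡ (sum-swap m n _)) (sym (sum-+ n _ _))

  sum-split : ∀ m n (f : ℕ → Carrier) → sum (m ℕ.+ n) f ≈ sum m f + sum n (λ i → f (m ℕ.+ i))
  sum-split zero    n f = sym (+-identityˡ _)
  sum-split (suc m) n f = trans (+-congˡ (sum-split m n _)) (sym (+-assoc _ _ _))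

  sum-last : ∀ n (f : ℕ → Carrier) → sum (suc n) f ≈ sum n f + f n
  sum-last zero    f = +-comm _ _
  sum-last (suc n) f = trans (+-congˡ (sum-last n _)) (sym (+-assoc _ _ _))

  sum-extend : ∀ {m n} (f : ℕ → Carrier) → m ≤ n → (∀ i → m ≤ i → f i ≈ 0#) → sum n f ≈ sum m f
  sum-extend {m} {n} f m≤n z = begin
    sum n f                                        ≡⟨ ≡.cong (λ k → sum k f) (≡.sym (ℕP.m+[n∸m]≡n m≤n)) ⟩
    sum (m ℕ.+ (n ∸ m)) f                          ≈⟨ sum-split m (n ∸ m) f ⟩
    sum m f + sum (n ∸ m) (λ i → f (m ℕ.+ i))      ≈⟨ +-congˡ (sum-0 (n ∸ m) (λ i _ → z (m ℕ.+ i) (ℕP.m≤m+n m i))) ⟩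
    sum m f + 0#                                   ≈⟨ +-identityʳ _ ⟩
    sum m f                                        ∎

  sum-parity : ∀ n (f : ℕ → Carrier) → sum (n ℕ.+ n) f ≈ sum n (λ k → f (k ℕ.+ k)) + sum n (λ k → f (suc (k ℕ.+ k)))
  sum-parity zero    f = sym (+-identityˡ _)
  sum-parity (suc n) f = begin
    sum (suc n ℕ.+ suc n) f  ≡⟨ ≡.cong (λ k → sum (suc k) f) (ℕP.+-suc n n) ⟩
    f 0 + (f 1 + sum (n ℕ.+ n) (λ i → f (suc (suc i))))
      ≈⟨ sym (+-assoc _ _ _) ⟩
    (f 0 + f 1) + sum (n ℕ.+ n) (λ i → f (suc (suc i)))
      ≈⟨ +-congˡ (sum-parity n (λ i → f (suc (suc i)))) ⟩
    (f 0 + f 1) + (sum n (λ k → f (suc (suc (k ℕ.+ k)))) + sum n (λ k → f (suc (suc (suc (k ℕ.+ k))))))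
      ≈⟨ +-interchange _ _ _ _ ⟩
    (f 0 + sum n (λ k → f (suc (suc (k ℕ.+ k))))) + (f 1 + sum n (λ k → f (suc (suc (suc (k ℕ.+ k))))))
      ≈⟨ +-cong (+-congˡ (sum-cong n (λ k → reflexive (≡.cong (λ j → f (suc j)) (≡.sym (ℕP.+-suc k k))))))
                (+-congˡ (sum-cong n (λ k → reflexive (≡.cong (λ j → f (suc (suc j))) (≡.sym (ℕP.+-suc k k)))))) ⟩
    (f 0 + sum n (λ k → f (suc k ℕ.+ suc k))) + (f 1 + sum n (λ k → f (suc (suc k ℕ.+ suc k)))) ∎

  -- An integer i lies in the window -B ≤ i < B exactly when `sz i` is less than B.
  sz : ℤ → ℕ
  sz (+ n)    = n
  sz -[1+ n ] = n

  -- The window -B ≤ i < B, so that the windows exhaust ℤ.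
  opaque
    sumℤ : ℕ → (ℤ → Carrier) → Carrier
    sumℤ B g = sum B (λ n → g (+ n)) + sum B (λ n → g -[1+ n ])

  Supp : ℕ → (ℤ → Carrier) → Set
  Supp B g = ∀ i → B ≤ sz i → g i ≈ 0#

  opaque
    unfolding sumℤ
    sumℤ-cong : ∀ B {f g : ℤ → Carrier} → (∀ i → f i ≈ g i) → sumℤ B f ≈ sumℤ B g
    sumℤ-cong B e = +-cong (sum-cong B (λ n → e (+ n))) (sum-cong B (λ n → e -[1+ n ]))

    sumℤ-0 : ∀ B {f : ℤ → Carrier} → (∀ i → f i ≈ 0#) → sumℤ B f ≈ 0#
    sumℤ-0 B e = trans (+-cong (sum-0 B (λ n _ → e (+ n))) (sum-0 B (λ n _ → e -[1+ n ]))) (+-identityˡ _)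

    sumℤ-+ : ∀ B (f g : ℤ → Carrier) → sumℤ B (λ i → f i + g i) ≈ sumℤ B f + sumℤ B g
    sumℤ-+ B f g = trans (+-cong (sum-+ B _ _) (sum-+ B _ _)) (+-interchange _ _ _ _)

    sumℤ-*ˡ : ∀ B c (f : ℤ → Carrier) → sumℤ B (λ i → c * f i) ≈ c * sumℤ B f
    sumℤ-*ˡ B c f = trans (+-cong (sum-*ˡ B c _) (sum-*ˡ B c _)) (sym (distribˡ _ _ _))

    sumℤ-*ʳ : ∀ B c (f : ℤ → Carrier) → sumℤ B (λ i → f i * c) ≈ sumℤ B f * c
    sumℤ-*ʳ B c f = trans (+-cong (sum-*ʳ B c _) (sum-*ʳ B c _)) (sym (distribʳ _ _ _))

    sum-sumℤ : ∀ n B (f : ℕ → ℤ → Carrier) → sum n (λ i → sumℤ B (f i)) ≈ sumℤ B (λ z → sum n (λ i → f i z))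
    sum-sumℤ n B f = trans (sum-+ n _ _) (+-cong (sum-swap n B _) (sum-swap n B _))

    sumℤ-swap : ∀ A B (f : ℤ → ℤ → Carrier) → sumℤ A (λ i → sumℤ B (f i)) ≈ sumℤ B (λ j → sumℤ A (λ i → f i j))
    sumℤ-swap A B f = trans (+-cong (sum-sumℤ A B (λ i → f (+ i))) (sum-sumℤ A B (λ i → f -[1+ i ])))
      (sym (sumℤ-+ B (λ j → sum A (λ i → f (+ i) j)) (λ j → sum A (λ i → f -[1+ i ] j))))

    sumℤ-extend : ∀ {A B} (g : ℤ → Carrier) → Supp A g → A ≤ B → sumℤ B g ≈ sumℤ A g
    sumℤ-extend g s A≤B = +-cong (sum-extend _ A≤B (λ i → s (+ i))) (sum-extend _ A≤B (λ i → s -[1+ i ]))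

  sumℤ-unique : ∀ {A B} (g : ℤ → Carrier) → Supp A g → Supp B g → sumℤ A g ≈ sumℤ B g
  sumℤ-unique {A} {B} g sA sB with ℕP.≤-total A B
  ... | inj₁ A≤B = sym (sumℤ-extend g sA A≤B)
  ... | inj₂ B≤A = sumℤ-extend g sB B≤A

  -- The two sides differ by g B and g (-B-1).
  opaque
    unfolding sumℤ
    sumℤ-suc : ∀ {B} (g : ℤ → Carrier) → Supp B g → sumℤ (suc B) (λ i → g (ℤ.suc i)) ≈ sumℤ B g
    sumℤ-suc {B} g s = begin
      sum (suc B) (λ n → g (+ suc n)) + (g (+ 0) + sum B (λ n → g -[1+ n ]))
        ≈⟨ trans (sym (+-assoc _ _ _)) (+-congʳ (+-comm _ _)) ⟩
      sum (suc (suc B)) (λ n → g (+ n)) + sum B (λ n → g -[1+ n ])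
        ≈⟨ +-congʳ (sum-extend _ (ℕP.≤-trans (ℕP.n≤1+n B) (ℕP.n≤1+n _)) (λ i → s (+ i))) ⟩
      sumℤ B g ∎

  Supp-suc : ∀ {B} (g : ℤ → Carrier) → Supp B g → Supp (suc B) (λ i → g (ℤ.suc i))
  Supp-suc g s (+ n)      B<n       = s (+ suc n) (ℕP.≤-trans (ℕP.n≤1+n _) (ℕP.≤-trans B<n (ℕP.n≤1+n n)))
  Supp-suc g s -[1+ suc n ] (s≤s B≤n) = s -[1+ n ] B≤n

  opaque
    unfolding sumℤ
    sumℤ-pred : ∀ {B} (g : ℤ → Carrier) → Supp B g → sumℤ (suc B) (λ i → g (ℤ.pred i)) ≈ sumℤ B g
    sumℤ-pred {B} g s = begin
      (g -[1+ 0 ] + sum B (λ n → g (+ n))) + sum (suc B) (λ n → g -[1+ suc n ])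
        ≈⟨ +-congʳ (+-comm _ _) ⟩
      (sum B (λ n → g (+ n)) + g -[1+ 0 ]) + sum (suc B) (λ n → g -[1+ suc n ])
        ≈⟨ +-assoc _ _ _ ⟩
      sum B (λ n → g (+ n)) + sum (suc (suc B)) (λ n → g -[1+ n ])
        ≈⟨ +-congˡ (sum-extend _ (ℕP.≤-trans (ℕP.n≤1+n B) (ℕP.n≤1+n _)) (λ i → s -[1+ i ])) ⟩
      sumℤ B g ∎

  Supp-pred : ∀ {B} (g : ℤ → Carrier) → Supp B g → Supp (suc B) (λ i → g (ℤ.pred i))
  Supp-pred g s (+ suc n) (s≤s B≤n) = s (+ n) B≤n
  Supp-pred g s -[1+ n ] B<n = s -[1+ suc n ] (ℕP.≤-trans (ℕP.n≤1+n _) (ℕP.≤-trans B<n (ℕP.n≤1+n n)))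

  Supp-cong : ∀ {B} {f g : ℤ → Carrier} → (∀ i → f i ≈ g i) → Supp B f → Supp B g
  Supp-cong e s i p = trans (sym (e i)) (s i p)

  -- The window widens by |t|, so that it still contains the support of the shifted family. Support
  -- and sum are proved together because every unit shift needs the support found at the previous
  -- one.
  Shifted : ℕ → (ℤ → Carrier) → ℤ → Set
  Shifted B g t = Supp (ℤ.∣ t ∣ ℕ.+ B) (λ i → g (i ℤ.+ t)) × sumℤ (ℤ.∣ t ∣ ℕ.+ B) (λ i → g (i ℤ.+ t)) ≈ sumℤ B g

  shift⁺ : ∀ {B} (g : ℤ → Carrier) → Supp B g → ∀ n → Shifted B g (+ n)
  shift⁺ {B} g s zero = (λ i p → trans (≈i i) (s i p)) , sumℤ-cong B ≈i
    where
    ≈i : ∀ i → g (i ℤ.+ + 0) ≈ g i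
    ≈i i = reflexive (≡.cong g (ℤP.+-identityʳ i))
  shift⁺ {B} g s (suc n) =
    Supp-cong ≈i (Supp-suc g' (proj₁ ih)) ,
    trans (sym (sumℤ-cong (suc (n ℕ.+ B)) ≈i)) (trans (sumℤ-suc g' (proj₁ ih)) (proj₂ ih))
    where
    g' : ℤ → Carrier
    g' i = g (i ℤ.+ + n)
    ih : Shifted B g (+ n)
    ih = shift⁺ g s n
    ≈i : ∀ i → g' (ℤ.suc i) ≈ g (i ℤ.+ + suc n)
    ≈i i = reflexive (≡.cong g (≡.trans (≡.cong (ℤ._+ + n) (ℤP.+-comm (+ 1) i)) (ℤP.+-assoc i (+ 1) (+ n))))

  shift⁻ : ∀ {B} (g : ℤ → Carrier) → Supp B g → ∀ n → Shifted B g -[1+ n ]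
  shift⁻ {B} g s zero = Supp-cong ≈i (Supp-pred g s) , trans (sym (sumℤ-cong (suc B) ≈i)) (sumℤ-pred g s)
    where
    ≈i : ∀ i → g (ℤ.pred i) ≈ g (i ℤ.+ -[1+ 0 ])
    ≈i i = reflexive (≡.cong g (ℤP.+-comm -[1+ 0 ] i))
  shift⁻ {B} g s (suc n) =
    Supp-cong ≈i (Supp-pred g' (proj₁ ih)) ,
    trans (sym (sumℤ-cong (suc (suc n ℕ.+ B)) ≈i)) (trans (sumℤ-pred g' (proj₁ ih)) (proj₂ ih))
    where
    g' : ℤ → Carrier
    g' i = g (i ℤ.+ -[1+ n ])
    ih : Shifted B g -[1+ n ]
    ih = shift⁻ g s n
    ≈i : ∀ i → g' (ℤ.pred i) ≈ g (i ℤ.+ -[1+ suc n ])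
    ≈i i = reflexive (≡.cong g (≡.trans (≡.cong (ℤ._+ -[1+ n ]) (ℤP.+-comm -[1+ 0 ] i)) (ℤP.+-assoc i -[1+ 0 ] -[1+ n ])))

  shift-lemma : ∀ {B} (g : ℤ → Carrier) → Supp B g → ∀ t → Shifted B g t
  shift-lemma g s (+ n)    = shift⁺ g s n
  shift-lemma g s -[1+ n ] = shift⁻ g s n

  sumℤ-shift : ∀ {A B} (g : ℤ → Carrier) t → Supp B g → Supp A (λ i → g (i ℤ.+ t)) →
               sumℤ A (λ i → g (i ℤ.+ t)) ≈ sumℤ B g
  sumℤ-shift g t sB sA = trans (sumℤ-unique _ sA (proj₁ (shift-lemma g sB t))) (proj₂ (shift-lemma g sB t))

  dbl dbl+1 : ℤ → ℤ
  dbl i   = i ℤ.+ i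
  dbl+1 i = i ℤ.+ i ℤ.+ + 1

  opaque
    unfolding sumℤ
    sumℤ-parity : ∀ B (g : ℤ → Carrier) → sumℤ (B ℕ.+ B) g ≈ sumℤ B (λ i → g (dbl i)) + sumℤ B (λ i → g (dbl+1 i))
    sumℤ-parity B g = begin
      -- On the negative half the integer -1 - i is even when i is odd, hence the exchange of the
      -- two sums there.
      sumℤ (B ℕ.+ B) g  ≈⟨ +-cong (sum-parity B _) (trans (sum-parity B _) (+-comm _ _)) ⟩
      (sum B (λ k → g (+ (k ℕ.+ k))) + sum B (λ k → g (+ suc (k ℕ.+ k)))) +
      (sum B (λ k → g -[1+ suc (k ℕ.+ k) ]) + sum B (λ k → g -[1+ (k ℕ.+ k) ]))
        ≈⟨ +-interchange _ _ _ _ ⟩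
      (sum B (λ k → g (+ (k ℕ.+ k))) + sum B (λ k → g -[1+ suc (k ℕ.+ k) ])) +
      (sum B (λ k → g (+ suc (k ℕ.+ k))) + sum B (λ k → g -[1+ (k ℕ.+ k) ]))
        ≈⟨ +-congˡ (+-cong (sum-cong B (λ k → reflexive (≡.cong (λ j → g (+ j)) (ℕP.+-comm 1 (k ℕ.+ k))))) refl) ⟩
      sumℤ B (λ i → g (dbl i)) + sumℤ B (λ i → g (dbl+1 i)) ∎

  sum2 : ℕ → (ℤ → ℤ → Carrier) → Carrier
  sum2 B g = sumℤ B (λ m → sumℤ B (g m))

  Supp2 : ℕ → (ℤ → ℤ → Carrier) → Set
  Supp2 B g = ∀ m n → B ≤ sz m ⊎ B ≤ sz n → g m n ≈ 0#

  Supp2-mono : ∀ {A B} {g : ℤ → ℤ → Carrier} → A ≤ B → Supp2 A g → Supp2 B g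
  Supp2-mono A≤B s m n (inj₁ p) = s m n (inj₁ (ℕP.≤-trans A≤B p))
  Supp2-mono A≤B s m n (inj₂ p) = s m n (inj₂ (ℕP.≤-trans A≤B p))

  sum2-cong : ∀ B {f g : ℤ → ℤ → Carrier} → (∀ m n → f m n ≈ g m n) → sum2 B f ≈ sum2 B g
  sum2-cong B e = sumℤ-cong B (λ m → sumℤ-cong B (e m))

  sum2-extend : ∀ {A B} (g : ℤ → ℤ → Carrier) → Supp2 A g → A ≤ B → sum2 B g ≈ sum2 A g
  sum2-extend {A} {B} g s A≤B = trans
    (sumℤ-cong B (λ m → sumℤ-extend (g m) (λ n p → s m n (inj₂ p)) A≤B))
    (sumℤ-extend _ (λ m p → sumℤ-0 A (λ n → s m n (inj₁ p))) A≤B)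

  sum2-unique : ∀ {A B} (g : ℤ → ℤ → Carrier) → Supp2 A g → Supp2 B g → sum2 A g ≈ sum2 B g
  sum2-unique {A} {B} g sA sB with ℕP.≤-total A B
  ... | inj₁ A≤B = sym (sum2-extend g sA A≤B)
  ... | inj₂ B≤A = sum2-extend g sB B≤A

  sz≤∣∣ : ∀ i → sz i ≤ ℤ.∣ i ∣
  sz≤∣∣ (+ n)    = ℕP.≤-refl
  sz≤∣∣ -[1+ n ] = ℕP.n≤1+n n

  ∣∣≤sz : ∀ i → ℤ.∣ i ∣ ≤ suc (sz i)
  ∣∣≤sz (+ n)    = ℕP.n≤1+n n
  ∣∣≤sz -[1+ n ] = ℕP.≤-refl

  -- If i is large, then one of i + j and j is.
  sz-far : ∀ B i j → suc (suc (B ℕ.+ B)) ≤ sz i → B ≤ sz (i ℤ.+ j) ⊎ B ≤ sz j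
  sz-far B i j p with ℕP.≤-total B (sz (i ℤ.+ j)) | ℕP.≤-total B (sz j)
  ... | inj₁ q | _ = inj₁ q
  ... | inj₂ _ | inj₁ q = inj₂ q
  ... | inj₂ _ | inj₂ r = inj₁ (ℕP.+-cancelʳ-≤ B B (sz (i ℤ.+ j)) (ℕP.≤-pred (ℕP.≤-pred (ℕP.≤-trans p bound))))
    where
    triangle : ℤ.∣ i ∣ ≤ ℤ.∣ i ℤ.+ j ∣ ℕ.+ ℤ.∣ j ∣
    triangle = ≡.subst₂ (λ a b → ℤ.∣ a ∣ ≤ ℤ.∣ i ℤ.+ j ∣ ℕ.+ b)
      (≡.trans (ℤP.+-assoc i j (ℤ.- j)) (≡.trans (≡.cong (λ k → i ℤ.+ k) (ℤP.+-inverseʳ j)) (ℤP.+-identityʳ i)))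
      (ℤP.∣-i∣≡∣i∣ j) (ℤP.∣i+j∣≤∣i∣+∣j∣ (i ℤ.+ j) (ℤ.- j))
    bound : sz i ≤ suc (suc (sz (i ℤ.+ j) ℕ.+ B))
    bound = ℕP.≤-trans (sz≤∣∣ i) (ℕP.≤-trans triangle
      (ℕP.≤-trans (ℕP.+-mono-≤ (∣∣≤sz (i ℤ.+ j)) (∣∣≤sz j))
      (ℕP.≤-trans (ℕP.≤-reflexive (≡.cong suc (ℕP.+-suc _ (sz j)))) (s≤s (s≤s (ℕP.+-monoʳ-≤ (sz (i ℤ.+ j)) r))))))

  -- The substitutions m = d + n, n = n and, according to the parity of d,
  -- (d , n) = (2k , n - k) or (2k + 1 , n - k).
  sum2-rotate : ∀ {B} (g : ℤ → ℤ → Carrier) → Supp2 B g →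
                ∀ {A} → Supp2 A (λ k n → g (k ℤ.+ n) (n ℤ.- k)) → Supp2 A (λ k n → g (k ℤ.+ n ℤ.+ + 1) (n ℤ.- k)) →
                sum2 B g ≈ sum2 A (λ k n → g (k ℤ.+ n) (n ℤ.- k)) + sum2 A (λ k n → g (k ℤ.+ n ℤ.+ + 1) (n ℤ.- k))
  sum2-rotate {B} g s {A} s₀ s₁ = begin
    sum2 B g                                           ≈⟨ sum2-shear ⟩
    sum2 K g₁                                          ≈⟨ sym (sum2-extend g₁ supp₁ (ℕP.m≤m+n K K)) ⟩
    sum2 (K ℕ.+ K) g₁                                  ≈⟨ sumℤ-parity K (λ d → sumℤ (K ℕ.+ K) (g₁ d)) ⟩
    sumℤ K (λ k → sumℤ (K ℕ.+ K) (g₁ (dbl k))) + sumℤ K (λ k → sumℤ (K ℕ.+ K) (g₁ (dbl+1 k)))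
      ≈⟨ +-cong (sumℤ-cong K (λ k → sumℤ-extend (g₁ (dbl k)) (λ n p → supp₁ (dbl k) n (inj₂ p)) (ℕP.m≤m+n K K)))
                (sumℤ-cong K (λ k → sumℤ-extend (g₁ (dbl+1 k)) (λ n p → supp₁ (dbl+1 k) n (inj₂ p)) (ℕP.m≤m+n K K))) ⟩
    sumℤ K (λ k → sumℤ K (g₁ (dbl k))) + sumℤ K (λ k → sumℤ K (g₁ (dbl+1 k)))
      ≈⟨ +-cong (sumℤ-cong K (λ k → row dbl h₀ ev≡ s₀ k)) (sumℤ-cong K (λ k → row dbl+1 h₁ odd≡ s₁ k)) ⟩
    sumℤ K (λ k → sumℤ A (λ n → g (k ℤ.+ n) (n ℤ.- k))) + sumℤ K (λ k → sumℤ A (λ n → g (k ℤ.+ n ℤ.+ + 1) (n ℤ.- k)))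
      ≈⟨ +-cong (outer dbl h₀ ev≡ s₀ grow) (outer dbl+1 h₁ odd≡ s₁ grow') ⟩
    sum2 A (λ k n → g (k ℤ.+ n) (n ℤ.- k)) + sum2 A (λ k n → g (k ℤ.+ n ℤ.+ + 1) (n ℤ.- k)) ∎
    where
    g₁ : ℤ → ℤ → Carrier
    g₁ d n = g (d ℤ.+ n) n
    h₀ h₁ : ℤ → ℤ → Carrier
    h₀ k n = g (k ℤ.+ n) (n ℤ.- k)
    h₁ k n = g (k ℤ.+ n ℤ.+ + 1) (n ℤ.- k)
    K : ℕ
    -- The radius at which `sz-far` applies, so that the sheared family `g₁` vanishes outside the
    -- window.
    K = suc (suc (B ℕ.+ B))
    B≤K : B ≤ K
    B≤K = ℕP.≤-trans (ℕP.m≤m+n B B) (ℕP.≤-trans (ℕP.n≤1+n _) (ℕP.n≤1+n _))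
    supp₁ : Supp2 K g₁
    supp₁ d n (inj₁ p) = s _ _ (sz-far B d n p)
    supp₁ d n (inj₂ p) = s _ _ (inj₂ (ℕP.≤-trans B≤K p))
    sum2-shear : sum2 B g ≈ sum2 K g₁
    sum2-shear = begin
      sum2 B g                                      ≈⟨ sum2-unique g s (Supp2-mono B≤K s) ⟩
      sum2 K g                                      ≈⟨ sumℤ-swap K K g ⟩
      sumℤ K (λ n → sumℤ K (λ m → g m n))           ≈⟨ sumℤ-cong K (λ n → sym (sumℤ-shift (λ m → g m n) n
        (λ m p → s m n (inj₁ (ℕP.≤-trans B≤K p))) (λ d p → supp₁ d n (inj₁ p)))) ⟩
      sumℤ K (λ n → sumℤ K (λ d → g (d ℤ.+ n) n))   ≈⟨ sym (sumℤ-swap K K g₁) ⟩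
      sum2 K g₁                                     ∎
    ev≡ : ∀ k n → g₁ (dbl k) (n ℤ.- k) ≈ g (k ℤ.+ n) (n ℤ.- k)
    ev≡ k n = reflexive (≡.cong (λ i → g i (n ℤ.- k)) (cancel k n))
      where
      cancel : ∀ k n → k ℤ.+ k ℤ.+ (n ℤ.- k) ≡ k ℤ.+ n
      cancel = Solver.solve ℤP.+-*-commutativeRing 2 (λ k n → k :+ k :+ (n :- k) := k :+ n)
        where open Solver ℤP.+-*-commutativeRing
    odd≡ : ∀ k n → g₁ (dbl+1 k) (n ℤ.- k) ≈ g (k ℤ.+ n ℤ.+ + 1) (n ℤ.- k)
    odd≡ k n = reflexive (≡.cong (λ i → g i (n ℤ.- k)) (cancel k n))
      where
      cancel : ∀ k n → k ℤ.+ k ℤ.+ + 1 ℤ.+ (n ℤ.- k) ≡ k ℤ.+ n ℤ.+ + 1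
      cancel = Solver.solve ℤP.+-*-commutativeRing 2 (λ k n → k :+ k :+ :1 :+ (n :- k) := k :+ n :+ :1)
        where open Solver ℤP.+-*-commutativeRing
    grow : ∀ k → K ≤ sz k → K ≤ sz (dbl k)
    grow (+ n)    p = ℕP.≤-trans p (ℕP.m≤m+n n n)
    grow -[1+ n ] p = ℕP.≤-trans p (ℕP.≤-trans (ℕP.m≤m+n n n) (ℕP.n≤1+n _))
    grow' : ∀ k → K ≤ sz k → K ≤ sz (dbl+1 k)
    grow' (+ n)    p = ℕP.≤-trans p (ℕP.≤-trans (ℕP.m≤m+n n n) (ℕP.m≤m+n _ 1))
    grow' -[1+ n ] p = ℕP.≤-trans p (ℕP.m≤m+n n n)
    module _ (δ : ℤ → ℤ) (h : ℤ → ℤ → Carrier) (e : ∀ k n → g₁ (δ k) (n ℤ.- k) ≈ h k n) (sh : Supp2 A h) where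
      row : ∀ k → sumℤ K (g₁ (δ k)) ≈ sumℤ A (h k)
      row k = begin
        sumℤ K (g₁ (δ k))                  ≈⟨ sym (sumℤ-shift (g₁ (δ k)) (ℤ.- k) (λ n p → supp₁ (δ k) n (inj₂ p))
                                                (Supp-cong (λ n → sym (e k n)) (λ n p → sh k n (inj₂ p)))) ⟩
        sumℤ A (λ n → g₁ (δ k) (n ℤ.- k))  ≈⟨ sumℤ-cong A (e k) ⟩
        sumℤ A (h k)                       ∎
      outer : (∀ k → K ≤ sz k → K ≤ sz (δ k)) → sumℤ K (λ k → sumℤ A (h k)) ≈ sum2 A h
      outer grow = sumℤ-unique (λ k → sumℤ A (h k))
        (λ k p → trans (sym (row k)) (sumℤ-0 K (λ n → supp₁ (δ k) n (inj₁ (grow k p)))))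
        (λ k p → sumℤ-0 A (λ n → sh k n (inj₁ p)))

  opaque
    unfolding sumℤ
    sumℤ-nonneg : ∀ B (g : ℤ → Carrier) → (∀ n → g -[1+ n ] ≈ 0#) → sumℤ B g ≈ sum B (λ n → g (+ n))
    sumℤ-nonneg B g z = trans (+-congˡ (sum-0 B (λ n _ → z n))) (+-identityʳ _)

  -- The substitution m = d + n collects the terms with a fixed difference d. It extracts the
  -- coefficient of z^d from a product of an expansion in z and one in 1/z.
  sum2-shear : ∀ {B K} (g : ℤ → ℤ → Carrier) → Supp2 B g → suc (suc (B ℕ.+ B)) ≤ K →
               sum2 B g ≈ sum2 K (λ d n → g (d ℤ.+ n) n)
  sum2-shear {B} {K} g s B<K = begin
    sum2 B g                                      ≈⟨ sum2-unique g s (Supp2-mono B≤K s) ⟩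
    sum2 K g                                      ≈⟨ sumℤ-swap K K g ⟩
    sumℤ K (λ n → sumℤ K (λ m → g m n))           ≈⟨ sumℤ-cong K (λ n → sym (sumℤ-shift (λ m → g m n) n
      (λ m p → s m n (inj₁ (ℕP.≤-trans B≤K p))) (λ d p → s _ _ (sz-far B d n (ℕP.≤-trans B<K p))))) ⟩
    sumℤ K (λ n → sumℤ K (λ d → g (d ℤ.+ n) n))   ≈⟨ sym (sumℤ-swap K K (λ d n → g (d ℤ.+ n) n)) ⟩
    sum2 K (λ d n → g (d ℤ.+ n) n)                ∎
    where
    B≤K : B ≤ K
    B≤K = ℕP.≤-trans (ℕP.≤-trans (ℕP.m≤m+n B B) (ℕP.≤-trans (ℕP.n≤1+n _) (ℕP.n≤1+n _))) B<K

  sum-blocks : ∀ n k (f : ℕ → Carrier) → sum (n ℕ.* k) f ≈ sum n (λ j → sum k (λ r → f (j ℕ.* k ℕ.+ r)))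
  sum-blocks zero    k f = refl
  sum-blocks (suc n) k f = trans (sum-split k (n ℕ.* k) f) (+-congˡ (trans (sum-blocks n k (λ i → f (k ℕ.+ i)))
    (sum-cong n (λ j → sum-cong k (λ r → reflexive (≡.cong f (≡.sym (ℕP.+-assoc k (j ℕ.* k) r))))))))

  sum-reverse : ∀ n (f : ℕ → Carrier) → sum n f ≈ sum n (λ i → f (n ∸ suc i))
  sum-reverse zero    f = refl
  sum-reverse (suc n) f = trans (sum-last n f) (trans (+-comm _ _) (+-congˡ (sum-reverse n f)))

  sumℤ-residues : ∀ n k (g : ℤ → Carrier) → sumℤ (n ℕ.* k) g ≈ sum k (λ r → sumℤ n (λ j → g (j ℤ.* + k ℤ.+ + r)))
  sumℤ-residues n k g = trans (split (n ℕ.* k) g) (trans (+-cong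
      (trans (sum-blocks n k _) (sum-cong n (λ j → sum-cong k (λ r → reflexive (≡.cong g (≡.cong (λ i → i ℤ.+ + r) (ℤP.pos-* j k)))))))
      -- On the negative side the residues of a block come in decreasing order: -1 - (jk + (k - 1 -
      -- r)) = (-1 - j) k + r.
      (trans (sum-blocks n k _) (sum-cong n (λ j → trans (sum-reverse k _) (sum-cong< k (λ r r<k → reflexive (≡.cong g (index j r r<k))))))))
    (trans (sym (split n (λ j → sum k (λ r → g (j ℤ.* + k ℤ.+ + r))))) (sym (sum-sumℤ k n (λ r j → g (j ℤ.* + k ℤ.+ + r))))))
    where
    opaque
      unfolding sumℤ
      split : ∀ B f → sumℤ B f ≈ sum B (λ i → f (+ i)) + sum B (λ i → f -[1+ i ])
      split B f = refl
    index : ∀ j r → r < k → -[1+ j ℕ.* k ℕ.+ (k ∸ suc r) ] ≡ -[1+ j ] ℤ.* + k ℤ.+ + r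
    index j r r<k = ≡.sym (≡.trans (≡.cong (λ i → -[1+ j ] ℤ.* i ℤ.+ + r) k≡)
      (≡.trans (solveℤ 3 (λ j d r → (⁻ (₁ ⊹ j)) ⊗ (d ⊹ (₁ ⊹ r)) ⊹ r ≔ ⁻ (₁ ⊹ (j ⊗ (d ⊹ (₁ ⊹ r)) ⊹ d))) (+ j) (+ (k ∸ suc r)) (+ r))
      (≡.cong (λ i → ℤ.- (+ 1 ℤ.+ (i ℤ.+ + (k ∸ suc r)))) (≡.trans (≡.cong (λ i → + j ℤ.* i) (≡.sym k≡)) (≡.sym (ℤP.pos-* j k))))))
      where
      k≡ : + k ≡ + (k ∸ suc r) ℤ.+ (+ 1 ℤ.+ + r)
      k≡ = ≡.cong +_ (≡.sym (ℕP.m∸n+n≡m r<k))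
      open Solver ℤP.+-*-commutativeRing using () renaming (solve to solveℤ; _:+_ to _⊹_; _:*_ to _⊗_; :-_ to ⁻_; _:=_ to _≔_; :1 to ₁)

-- Formal power series

module Series (R : CommutativeRing 0ℓ 0ℓ) where
  open CommutativeRing R
  open Solver R using (+-interchange; fromℕ; fromℕ-suc; fromℤ; solve; _:+_; _:*_; _:-_; :-_; _:^_; _:=_; :0; :1; :c)
  open FiniteSums R
  open SetoidReasoning setoid
  open RingProperties ring using (-0#≈0#)

  Ser : Set
  Ser = ℕ → Carrier

  infix 4 _≋_
  _≋_ : Ser → Ser → Set
  a ≋ b = ∀ n → a n ≈ b n

  tail : Ser → Ser
  tail a n = a (suc n)

  infixl 6 _⊞_
  infixl 7 _⊠_

  -- The Cauchy product is defined by recursion on the left factor, one coefficient at a time, so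
  -- that the ring laws follow by induction; `⊠-coeff` recovers the finite sum.
  _⊞_ _⊠_ : Ser → Ser → Ser
  (a ⊞ b) n = a n + b n
  (a ⊠ b) zero    = a 0 * b 0
  (a ⊠ b) (suc n) = a 0 * b (suc n) + (tail a ⊠ b) n

  ⊟_ : Ser → Ser
  (⊟ a) n = - a n

  𝟘 𝟙 : Ser
  𝟘 _ = 0#
  𝟙 zero    = 1#
  𝟙 (suc _) = 0#

  ⊠-cong≤ : ∀ n {a b c d : Ser} → (∀ i → i ≤ n → a i ≈ b i) → (∀ i → i ≤ n → c i ≈ d i) → (a ⊠ c) n ≈ (b ⊠ d) n
  ⊠-cong≤ zero    e f = *-cong (e 0 z≤n) (f 0 z≤n)
  ⊠-cong≤ (suc n) e f = +-cong (*-cong (e 0 z≤n) (f (suc n) ℕP.≤-refl))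
    (⊠-cong≤ n (λ i i≤n → e (suc i) (s≤s i≤n)) (λ i i≤n → f i (ℕP.m≤n⇒m≤1+n i≤n)))

  ⊠-cong : ∀ {a b c d} → a ≋ b → c ≋ d → a ⊠ c ≋ b ⊠ d
  ⊠-cong e f n = ⊠-cong≤ n (λ i _ → e i) (λ i _ → f i)

  ⊠-zeroˡ : ∀ {a} b → a ≋ 𝟘 → a ⊠ b ≋ 𝟘
  ⊠-zeroˡ b e zero    = trans (*-congʳ (e 0)) (zeroˡ _)
  ⊠-zeroˡ b e (suc n) = trans (+-cong (trans (*-congʳ (e 0)) (zeroˡ _)) (⊠-zeroˡ b (λ i → e (suc i)) n)) (+-identityˡ _)

  ⊠-distribʳ : ∀ c a b → (a ⊞ b) ⊠ c ≋ (a ⊠ c) ⊞ (b ⊠ c)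
  ⊠-distribʳ c a b zero    = distribʳ _ _ _
  ⊠-distribʳ c a b (suc n) = trans (+-cong (distribʳ _ _ _) (⊠-distribʳ c (tail a) (tail b) n)) (+-interchange _ _ _ _)

  ⊠-scaleˡ : ∀ k a b n → ((λ i → k * a i) ⊠ b) n ≈ k * (a ⊠ b) n
  ⊠-scaleˡ k a b zero    = *-assoc _ _ _
  ⊠-scaleˡ k a b (suc n) = trans (+-cong (*-assoc _ _ _) (⊠-scaleˡ k (tail a) b n)) (sym (distribˡ _ _ _))

  ⊠-assoc : ∀ a b c → (a ⊠ b) ⊠ c ≋ a ⊠ (b ⊠ c)
  ⊠-assoc a b c zero    = *-assoc _ _ _
  ⊠-assoc a b c (suc n) = begin
    a 0 * b 0 * c (suc n) + (((λ i → a 0 * tail b i) ⊞ (tail a ⊠ b)) ⊠ c) n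
      ≈⟨ +-cong (*-assoc _ _ _) (trans (⊠-distribʳ c _ _ n) (+-cong (⊠-scaleˡ (a 0) (tail b) c n) (⊠-assoc (tail a) b c n))) ⟩
    a 0 * (b 0 * c (suc n)) + (a 0 * (tail b ⊠ c) n + (tail a ⊠ (b ⊠ c)) n)
      ≈⟨ sym (+-assoc _ _ _) ⟩
    a 0 * (b 0 * c (suc n)) + a 0 * (tail b ⊠ c) n + (tail a ⊠ (b ⊠ c)) n
      ≈⟨ +-congʳ (sym (distribˡ _ _ _)) ⟩
    a 0 * (b ⊠ c) (suc n) + (tail a ⊠ (b ⊠ c)) n ∎

  ⊠-sucʳ : ∀ a b n → (a ⊠ b) (suc n) ≈ a (suc n) * b 0 + (a ⊠ tail b) n
  ⊠-sucʳ a b zero    = +-comm _ _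
  ⊠-sucʳ a b (suc n) = begin
    a 0 * b (suc (suc n)) + (tail a ⊠ b) (suc n)
      ≈⟨ +-congˡ (⊠-sucʳ (tail a) b n) ⟩
    a 0 * b (suc (suc n)) + (a (suc (suc n)) * b 0 + (tail a ⊠ tail b) n)
      ≈⟨ trans (sym (+-assoc _ _ _)) (trans (+-congʳ (+-comm _ _)) (+-assoc _ _ _)) ⟩
    a (suc (suc n)) * b 0 + (a ⊠ tail b) (suc n) ∎

  ⊠-comm : ∀ a b → a ⊠ b ≋ b ⊠ a
  ⊠-comm a b zero    = *-comm _ _
  ⊠-comm a b (suc n) = begin
    a 0 * b (suc n) + (tail a ⊠ b) n  ≈⟨ +-cong (*-comm _ _) (⊠-comm (tail a) b n) ⟩
    b (suc n) * a 0 + (b ⊠ tail a) n  ≈⟨ sym (⊠-sucʳ b a n) ⟩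
    (b ⊠ a) (suc n)                   ∎

  ⊠-identityˡ : ∀ a → 𝟙 ⊠ a ≋ a
  ⊠-identityˡ a zero    = *-identityˡ _
  ⊠-identityˡ a (suc n) = trans (+-cong (*-identityˡ _) (⊠-zeroˡ a (λ _ → refl) n)) (+-identityʳ _)

  ring𝕊 : CommutativeRing 0ℓ 0ℓ
  ring𝕊 = record
    { Carrier = Ser
    ; _≈_ = _≋_
    ; _+_ = _⊞_
    ; _*_ = _⊠_
    ; -_ = ⊟_
    ; 0# = 𝟘
    ; 1# = 𝟙
    ; isCommutativeRing = record
      { isRing = record
        { +-isAbelianGroup = record
          { isGroup = record
            { isMonoid = record
              { isSemigroup = record
                { isMagma = record
                  { isEquivalence = record
                    { refl = λ _ → refl ; sym = λ e n → sym (e n) ; trans = λ e f n → trans (e n) (f n) }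
                  ; ∙-cong = λ e f n → +-cong (e n) (f n) }
                ; assoc = λ a b c n → +-assoc _ _ _ }
              ; identity = (λ a n → +-identityˡ _) , (λ a n → +-identityʳ _) }
            ; inverse = (λ a n → -‿inverseˡ _) , (λ a n → -‿inverseʳ _)
            ; ⁻¹-cong = λ e n → -‿cong (e n) }
          ; comm = λ a b n → +-comm _ _ }
        ; *-cong = ⊠-cong
        ; *-assoc = ⊠-assoc
        ; *-identity = ⊠-identityˡ , (λ a n → trans (⊠-comm a 𝟙 n) (⊠-identityˡ a n))
        ; distrib = (λ a b c n → trans (⊠-comm a (b ⊞ c) n) (trans (⊠-distribʳ a b c n) (+-cong (⊠-comm b a n) (⊠-comm c a n))))
                  , ⊠-distribʳ }
      ; *-comm = ⊠-comm } }

  private module 𝕊 = CommutativeRing ring𝕊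

  ⊠-coeff : ∀ a b n → (a ⊠ b) n ≈ sum (suc n) (λ i → a i * b (n ∸ i))
  ⊠-coeff a b zero    = sym (+-identityʳ _)
  ⊠-coeff a b (suc n) = +-congˡ (⊠-coeff (tail a) b n)

  C : Carrier → Ser
  C c zero    = c
  C c (suc _) = 0#

  C-⊠ : ∀ c a n → (C c ⊠ a) n ≈ c * a n
  C-⊠ c a zero    = refl
  C-⊠ c a (suc n) = trans (+-congˡ (⊠-zeroˡ a (λ _ → refl) n)) (+-identityʳ _)

  C-cong : ∀ {c d} → c ≈ d → C c ≋ C d
  C-cong e zero    = e
  C-cong e (suc n) = refl

  C-* : ∀ c d → C (c * d) ≋ C c ⊠ C d
  C-* c d zero    = refl
  C-* c d (suc n) = sym (trans (C-⊠ c (C d) (suc n)) (zeroʳ c))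

  C-+ : ∀ c d → C (c + d) ≋ C c ⊞ C d
  C-+ c d zero    = refl
  C-+ c d (suc n) = sym (+-identityˡ _)

  C-neg : ∀ c → C (- c) ≋ ⊟ C c
  C-neg c zero    = refl
  C-neg c (suc n) = sym -0#≈0#

  C-1 : C 1# ≋ 𝟙
  C-1 zero    = refl
  C-1 (suc n) = refl

  C-0 : C 0# ≋ 𝟘
  C-0 zero    = refl
  C-0 (suc n) = refl

  sh : ℕ → Ser → Ser
  sh zero    a n       = a n
  sh (suc k) a zero    = 0#
  sh (suc k) a (suc n) = sh k a n

  q^ : ℕ → Ser
  q^ k = sh k 𝟙

  sh-cong : ∀ k {a b} → a ≋ b → sh k a ≋ sh k b
  sh-cong zero    e n       = e n
  sh-cong (suc k) e zero    = refl
  sh-cong (suc k) e (suc n) = sh-cong k e n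

  sh-⊠ : ∀ k a b → sh k a ⊠ b ≋ sh k (a ⊠ b)
  sh-⊠ zero    a b n       = refl
  sh-⊠ (suc k) a b zero    = zeroˡ _
  sh-⊠ (suc k) a b (suc n) = trans (+-congʳ (zeroˡ _)) (trans (+-identityˡ _) (sh-⊠ k a b n))

  q^-⊠ : ∀ k a → q^ k ⊠ a ≋ sh k a
  q^-⊠ k a = 𝕊.trans (sh-⊠ k 𝟙 a) (sh-cong k (⊠-identityˡ a))

  sh-sh : ∀ j k a → sh j (sh k a) ≋ sh (j ℕ.+ k) a
  sh-sh zero    k a n       = refl
  sh-sh (suc j) k a zero    = refl
  sh-sh (suc j) k a (suc n) = sh-sh j k a n

  q^-+ : ∀ j k → q^ (j ℕ.+ k) ≋ q^ j ⊠ q^ k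
  q^-+ j k = 𝕊.sym (𝕊.trans (q^-⊠ j (q^ k)) (sh-sh j k 𝟙))

  sh-at : ∀ k a n → sh k a (k ℕ.+ n) ≡ a n
  sh-at zero    a n = ≡.refl
  sh-at (suc k) a n = sh-at k a n

  -- a ∈O N means that a is divisible by q^N.
  infix 4 _∈O_
  _∈O_ : Ser → ℕ → Set
  a ∈O N = ∀ i → i < N → a i ≈ 0#

  O-mono : ∀ {a M N} → M ≤ N → a ∈O N → a ∈O M
  O-mono M≤N o i i<M = o i (ℕP.<-≤-trans i<M M≤N)

  O-cong : ∀ {a b N} → a ≋ b → a ∈O N → b ∈O N
  O-cong e o i p = trans (sym (e i)) (o i p)

  O-⊞ : ∀ {a b N} → a ∈O N → b ∈O N → a ⊞ b ∈O N
  O-⊞ o p i i<N = trans (+-cong (o i i<N) (p i i<N)) (+-identityˡ _)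

  O-sh : ∀ k {a N} → a ∈O N → sh k a ∈O k ℕ.+ N
  O-sh zero    o i       p       = o i p
  O-sh (suc k) o zero    p       = refl
  O-sh (suc k) o (suc i) (s≤s p) = O-sh k o i p

  O-q^ : ∀ k a → q^ k ⊠ a ∈O k
  O-q^ k a = O-cong (𝕊.sym (q^-⊠ k a)) (O-mono (ℕP.≤-reflexive (≡.sym (ℕP.+-identityʳ k))) (O-sh k (λ _ ())))

  O-⊠ˡ : ∀ {a N} b → a ∈O N → a ⊠ b ∈O N
  O-⊠ˡ b o zero    p       = trans (*-congʳ (o 0 p)) (zeroˡ _)
  O-⊠ˡ {N = suc N} b o (suc i) (s≤s p) = trans (+-cong (trans (*-congʳ (o 0 (s≤s z≤n))) (zeroˡ _))
    (O-⊠ˡ {N = N} b (λ j j<N → o (suc j) (s≤s j<N)) i p)) (+-identityˡ _)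

  O-⊠ʳ : ∀ {b N} a → b ∈O N → a ⊠ b ∈O N
  O-⊠ʳ {b} a o = O-cong (⊠-comm b a) (O-⊠ˡ a o)

  -- An infinite sum whose l-th term is divisible by q^(l - c). The slack c is the number of
  -- colours: that many distinct entries can have level zero and contribute no power of q.
  Σ∞ : ℕ → (ℕ → Ser) → Ser
  Σ∞ c f n = sum (suc (n ℕ.+ c)) (λ l → f l n)

  Summable : ℕ → (ℕ → Ser) → Set
  Summable c f = ∀ l n → n ℕ.+ c < l → f l n ≈ 0#

  Σ∞-cong : ∀ c {f g : ℕ → Ser} → (∀ l → f l ≋ g l) → Σ∞ c f ≋ Σ∞ c g
  Σ∞-cong c e n = sum-cong (suc (n ℕ.+ c)) (λ l → e l n)

  Σ∞-upto : ∀ c f → Summable c f → ∀ n M → n ℕ.+ c < M → Σ∞ c f n ≈ sum M (λ l → f l n)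
  Σ∞-upto c f s n M p = sym (sum-extend (λ l → f l n) p (λ l q → s l n q))

  Σ∞-suc : ∀ c f → Summable c f → Σ∞ c f ≋ f 0 ⊞ Σ∞ c (λ l → f (suc l))
  Σ∞-suc c f s n = begin
    Σ∞ c f n                                                ≈⟨ Σ∞-upto c f s n (suc (suc (n ℕ.+ c))) (s≤s (ℕP.n≤1+n _)) ⟩
    f 0 n + sum (suc (n ℕ.+ c)) (λ l → f (suc l) n)         ∎

  Σ∞-shift : ∀ c f → Summable c f → ∀ k → (∀ l → l < k → f l ≋ 𝟘) → Σ∞ c f ≋ Σ∞ c (λ l → f (k ℕ.+ l))
  Σ∞-shift c f s zero    z n = refl
  Σ∞-shift c f s (suc k) z n = begin
    Σ∞ c f n                                   ≈⟨ Σ∞-suc c f s n ⟩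
    f 0 n + Σ∞ c (λ l → f (suc l)) n           ≈⟨ trans (+-congʳ (z 0 (s≤s z≤n) n)) (+-identityˡ _) ⟩
    Σ∞ c (λ l → f (suc l)) n
      ≈⟨ Σ∞-shift c (λ l → f (suc l)) (λ l m p → s (suc l) m (ℕP.m≤n⇒m≤1+n p)) k (λ l l<k → z (suc l) (s≤s l<k)) n ⟩
    Σ∞ c (λ l → f (suc (k ℕ.+ l))) n           ∎

  sumS : ℕ → (ℕ → Ser) → Ser
  sumS k f n = sum k (λ i → f i n)

  sum-⊠ : ∀ k (f : ℕ → Ser) b n → sum k (λ i → (f i ⊠ b) n) ≈ (sumS k f ⊠ b) n
  sum-⊠ k f b zero    = sum-*ʳ k (b 0) _
  sum-⊠ k f b (suc n) = trans (sum-+ k _ _) (+-cong (sum-*ʳ k _ _) (sum-⊠ k (λ i → tail (f i)) b n))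

  Σ∞-⊠ : ∀ c f b → Summable c f → Σ∞ c f ⊠ b ≋ Σ∞ c (λ l → f l ⊠ b)
  Σ∞-⊠ c f b s n = begin
    (Σ∞ c f ⊠ b) n   ≈⟨ ⊠-cong≤ n (λ i i≤n → Σ∞-upto c f s i (suc (n ℕ.+ c)) (s≤s (ℕP.+-monoˡ-≤ c i≤n))) (λ _ _ → refl) ⟩
    (sumS (suc (n ℕ.+ c)) f ⊠ b) n   ≈⟨ sym (sum-⊠ (suc (n ℕ.+ c)) f b n) ⟩
    Σ∞ c (λ l → f l ⊠ b) n           ∎

  D : Ser → Ser
  D a n = fromℕ n * a n

  D-cong : ∀ {a b} → a ≋ b → D a ≋ D b
  D-cong e n = *-congˡ (e n)

  D-⊞ : ∀ a b → D (a ⊞ b) ≋ D a ⊞ D b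
  D-⊞ a b n = distribˡ _ _ _

  D-⊠ : ∀ a b → D (a ⊠ b) ≋ D a ⊠ b ⊞ a ⊠ D b
  D-⊠ a b zero = solve 2 (λ x y → :0 :* (x :* y) := :0 :* x :* y :+ x :* (:0 :* y)) (a 0) (b 0)
  D-⊠ a b (suc n) = begin
    fromℕ (suc n) * (a 0 * b (suc n) + (tail a ⊠ b) n)
      ≈⟨ distribˡ _ _ _ ⟩
    fromℕ (suc n) * (a 0 * b (suc n)) + fromℕ (suc n) * (tail a ⊠ b) n
      ≈⟨ +-congˡ (trans (*-congʳ (fromℕ-suc n)) (trans (distribʳ _ _ _) (+-cong (*-identityˡ _) (D-⊠ (tail a) b n)))) ⟩
    fromℕ (suc n) * (a 0 * b (suc n)) + ((tail a ⊠ b) n + ((D (tail a) ⊠ b) n + (tail a ⊠ D b) n))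
      ≈⟨ solve 6 (λ k x y t u v → k :* (x :* y) :+ (t :+ (u :+ v)) := :0 :* x :* y :+ (t :+ u) :+ (x :* (k :* y) :+ v))
           (fromℕ (suc n)) (a 0) (b (suc n)) ((tail a ⊠ b) n) ((D (tail a) ⊠ b) n) ((tail a ⊠ D b) n) ⟩
    0# * a 0 * b (suc n) + ((tail a ⊠ b) n + (D (tail a) ⊠ b) n) + (a 0 * (fromℕ (suc n) * b (suc n)) + (tail a ⊠ D b) n)
      ≈⟨ +-congʳ (+-congˡ (trans (sym (⊠-distribʳ b (tail a) (D (tail a)) n)) (⊠-cong tailD (λ _ → refl) n))) ⟩
    0# * a 0 * b (suc n) + (tail (D a) ⊠ b) n + (a 0 * (fromℕ (suc n) * b (suc n)) + (tail a ⊠ D b) n) ∎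
    where
    tailD : tail a ⊞ D (tail a) ≋ tail (D a)
    tailD m = sym (trans (*-congʳ (fromℕ-suc m)) (trans (distribʳ _ _ _) (+-congʳ (*-identityˡ _))))

  D-C : ∀ c → D (C c) ≋ 𝟘
  D-C c zero    = zeroˡ c
  D-C c (suc n) = zeroʳ _

  fromℤ-C : ∀ z → Solver.fromℤ ring𝕊 z ≋ C (fromℤ z)
  fromℤ-C z = go z
    where
    goℕ : ∀ n → Solver.fromℕ ring𝕊 n ≋ C (fromℕ n)
    goℕ zero          = 𝕊.sym C-0
    goℕ (suc zero)    = 𝕊.sym C-1
    goℕ (suc (suc n)) = 𝕊.trans (𝕊.+-cong (𝕊.sym C-1) (goℕ (suc n))) (𝕊.sym (C-+ 1# (fromℕ (suc n))))
    go : ∀ z → Solver.fromℤ ring𝕊 z ≋ C (fromℤ z)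
    go (+ n)    = goℕ n
    go -[1+ n ] = 𝕊.trans (𝕊.-‿cong (goℕ (suc n))) (𝕊.sym (C-neg (fromℕ (suc n))))

  Stable : (ℕ → Ser) → Set
  Stable f = ∀ M n → n ≤ M → f (suc M) n ≈ f M n

  -- For a `Stable` sequence the n-th coefficient is final from index n on, so the diagonal is the
  -- limit.
  Lim : (ℕ → Ser) → Ser
  Lim f n = f n n

  Lim-at : ∀ f → Stable f → ∀ M n → n ≤ M → f M n ≈ Lim f n
  Lim-at f s M n n≤M = trans (reflexive (≡.cong (λ k → f k n) (≡.sym (ℕP.m∸n+n≡m n≤M)))) (go (M ∸ n))
    where
    go : ∀ k → f (k ℕ.+ n) n ≈ f n n
    go zero    = refl
    go (suc k) = trans (s (k ℕ.+ n) n (ℕP.m≤n+m n k)) (go k)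

  Lim-cong : ∀ {f g : ℕ → Ser} → (∀ M → f M ≋ g M) → Lim f ≋ Lim g
  Lim-cong e n = e n n

  Lim-⊠ : ∀ f g → Stable f → Stable g → Lim (λ M → f M ⊠ g M) ≋ Lim f ⊠ Lim g
  Lim-⊠ f g s t n = ⊠-cong≤ n (λ i i≤n → Lim-at f s n i i≤n) (λ i i≤n → Lim-at g t n i i≤n)

  Stable-⊠ : ∀ f g → Stable f → Stable g → Stable (λ M → f M ⊠ g M)
  Stable-⊠ f g s t M n p = ⊠-cong≤ n (λ i i≤n → s M i (ℕP.≤-trans i≤n p)) (λ i i≤n → t M i (ℕP.≤-trans i≤n p))

  Stable-const : ∀ a → Stable (λ _ → a)
  Stable-const a M n p = refl

  -- Step M multiplies by 1 + q^(M + 1) g, which leaves the coefficients up to q^M alone.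
  Stable-Π : ∀ (f g : ℕ → Ser) → (∀ M → f (suc M) ≋ f M ⊞ f M ⊠ (q^ (suc M) ⊠ g M)) → Stable f
  Stable-Π f g e M n n≤M = trans (e M n) (trans (+-congˡ (O-⊠ʳ {N = suc M} (f M) (O-q^ (suc M) (g M)) n (s≤s n≤M))) (+-identityʳ _))

module IntegerSolver where
  open Solver ℤP.+-*-commutativeRing using () renaming
    (solve to solveℤ; _:+_ to _⊹_; _:-_ to _⊝_; _:*_ to _⊗_; :-_ to ⁻_; _:=_ to _≔_; :1 to ₁; :c to cℤ) public

tri : ℕ → ℕ
tri zero    = 0
tri (suc n) = suc n ℕ.+ tri n

-- Theta series

module Lattice (R : CommutativeRing 0ℓ 0ℓ) where
  open IntegerSolver
  open CommutativeRing R
  open Solver R using (_^_; ^-cong; fromℤ; fromℤ-+; fromℤ-neg; solve; _:+_; _:*_; _:-_; :-_; _:^_; _:=_; :0; :1; :c)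
  open FiniteSums R
  open Series R
  open SetoidReasoning setoid
  open RingProperties ring using (-‿distribˡ-*; -‿involutive; -0#≈0#; -‿+-comm)
  private module 𝕊 = CommutativeRing ring𝕊

  module Power (x y : Carrier) (xy : x * y ≈ 1#) where
    zpow : ℤ → Carrier
    zpow (+ n)    = x ^ n
    zpow -[1+ n ] = y ^ suc n

    zpow-suc : ∀ i → zpow (ℤ.suc i) ≈ x * zpow i
    zpow-suc (+ n)    = refl
    zpow-suc -[1+ zero ]  = sym (trans (*-congˡ (*-identityʳ y)) xy)
    zpow-suc -[1+ suc n ] = begin
      y ^ suc n                ≈⟨ sym (*-identityˡ _) ⟩
      1# * y ^ suc n           ≈⟨ *-congʳ (sym xy) ⟩
      x * y * y ^ suc n        ≈⟨ *-assoc _ _ _ ⟩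
      x * (y * y ^ suc n)      ∎

    zpow-pred : ∀ i → zpow (ℤ.pred i) ≈ y * zpow i
    zpow-pred -[1+ n ] = refl
    zpow-pred (+ zero) = refl
    zpow-pred (+ suc n) = begin
      x ^ n                    ≈⟨ sym (*-identityˡ _) ⟩
      1# * x ^ n               ≈⟨ *-congʳ (trans (sym xy) (*-comm x y)) ⟩
      y * x * x ^ n            ≈⟨ *-assoc _ _ _ ⟩
      y * (x * x ^ n)          ∎

    zpow-cong : ∀ {i j} → i ≡ j → zpow i ≈ zpow j
    zpow-cong e = reflexive (≡.cong zpow e)

    zpow-+⁺ : ∀ n j → zpow (+ n ℤ.+ j) ≈ zpow (+ n) * zpow j
    zpow-+⁺ zero    j = trans (zpow-cong (ℤP.+-identityˡ j)) (sym (*-identityˡ _))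
    zpow-+⁺ (suc n) j = begin
      zpow (+ suc n ℤ.+ j)           ≈⟨ zpow-cong (ℤP.+-assoc (+ 1) (+ n) j) ⟩
      zpow (ℤ.suc (+ n ℤ.+ j))       ≈⟨ zpow-suc (+ n ℤ.+ j) ⟩
      x * zpow (+ n ℤ.+ j)           ≈⟨ *-congˡ (zpow-+⁺ n j) ⟩
      x * (x ^ n * zpow j)           ≈⟨ sym (*-assoc _ _ _) ⟩
      x * x ^ n * zpow j             ∎

    zpow-+⁻ : ∀ n j → zpow (-[1+ n ] ℤ.+ j) ≈ zpow -[1+ n ] * zpow j
    zpow-+⁻ zero    j = trans (zpow-pred j) (*-congʳ (sym (*-identityʳ y)))
    zpow-+⁻ (suc n) j = begin
      zpow (-[1+ suc n ] ℤ.+ j)          ≈⟨ zpow-cong (ℤP.+-assoc -[1+ 0 ] -[1+ n ] j) ⟩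
      zpow (ℤ.pred (-[1+ n ] ℤ.+ j))     ≈⟨ zpow-pred (-[1+ n ] ℤ.+ j) ⟩
      y * zpow (-[1+ n ] ℤ.+ j)          ≈⟨ *-congˡ (zpow-+⁻ n j) ⟩
      y * (y ^ suc n * zpow j)           ≈⟨ sym (*-assoc _ _ _) ⟩
      y * y ^ suc n * zpow j             ∎

    zpow-+ : ∀ i j → zpow (i ℤ.+ j) ≈ zpow i * zpow j
    zpow-+ (+ n)    j = zpow-+⁺ n j
    zpow-+ -[1+ n ] j = zpow-+⁻ n j

  open Power (- 1#) (- 1#) (solve 0 ((:- :1) :* (:- :1) := :1)) public
    using () renaming (zpow to sgn; zpow-+ to sgn-+; zpow-suc to sgn-suc; zpow-cong to sgn-cong)

  sgn-sq : ∀ i → sgn (i ℤ.+ i) ≈ 1#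
  sgn-sq i = trans (sgn-+ i i) (sq i)
    where
    sqⁿ : ∀ n → (- 1#) ^ n * (- 1#) ^ n ≈ 1#
    sqⁿ zero    = *-identityˡ 1#
    sqⁿ (suc n) = trans (solve 1 (λ a → (:- :1) :* a :* ((:- :1) :* a) := a :* a) ((- 1#) ^ n)) (sqⁿ n)
    sq : ∀ i → sgn i * sgn i ≈ 1#
    sq (+ n)    = sqⁿ n
    sq -[1+ n ] = sqⁿ (suc n)

  -- The shift by one anticipates s = n + 1 in the triple product, where s numbers the powers of z.
  sg : ℤ → Carrier
  sg n = sgn (n ℤ.+ + 1)

  pick : ℕ → ℕ → Carrier → Carrier
  pick e N c = if e ≡ᵇ N then c else 0#

  pick-cong : ∀ e N {c d} → c ≈ d → pick e N c ≈ pick e N d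
  pick-cong e N p with e ≡ᵇ N
  ... | true  = p
  ... | false = refl

  pick-cong₂ : ∀ {e f} N {c d} → e ≡ f → c ≈ d → pick e N c ≈ pick f N d
  pick-cong₂ {e} N ≡.refl p = pick-cong e N p

  pick-0 : ∀ e N → pick e N 0# ≈ 0#
  pick-0 e N with e ≡ᵇ N
  ... | true  = refl
  ... | false = refl

  pick-+ : ∀ e N c d → pick e N (c + d) ≈ pick e N c + pick e N d
  pick-+ e N c d with e ≡ᵇ N
  ... | true  = refl
  ... | false = sym (+-identityˡ _)

  pick-* : ∀ e N c d → pick e N (c * d) ≈ c * pick e N d
  pick-* e N c d with e ≡ᵇ N
  ... | true  = refl
  ... | false = sym (zeroʳ c)

  pick-neg : ∀ e N c → pick e N (- c) ≈ - pick e N c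
  pick-neg e N c with e ≡ᵇ N
  ... | true  = refl
  ... | false = sym -0#≈0#

  pick-< : ∀ e N c → N < e → pick e N c ≈ 0#
  pick-< (suc e) zero    c p       = refl
  pick-< (suc e) (suc N) c (s≤s p) = pick-< e N c p

  pick-conv : ∀ e e' N c d → sum (suc N) (λ i → pick e i c * pick e' (N ∸ i) d) ≈ pick (e ℕ.+ e') N (c * d)
  pick-conv zero e' N c d = begin
    c * pick e' N d + sum N (λ i → 0# * pick e' (N ∸ suc i) d)
      ≈⟨ +-cong (sym (pick-* e' N c d)) (sum-0 N (λ _ _ → zeroˡ _)) ⟩
    pick e' N (c * d) + 0#  ≈⟨ +-identityʳ _ ⟩
    pick e' N (c * d)       ∎
  pick-conv (suc e) e' zero    c d = trans (+-identityʳ _) (zeroˡ _)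
  pick-conv (suc e) e' (suc N) c d = trans (+-cong (zeroˡ _) (pick-conv e e' N c d)) (+-identityˡ _)

  -- The series Σ c(n) q^(e(n)) over ℤ. For the coefficient of q^N the window 2 + N is wide enough
  -- as soon as sz n ≤ e(n) + 1, which is the condition `Proper`.
  lat : (ℤ → ℕ) → (ℤ → Carrier) → Ser
  lat e c N = sumℤ (2 ℕ.+ N) (λ n → pick (e n) N (c n))

  Proper : (ℤ → ℕ) → Set
  Proper e = ∀ n → sz n ≤ suc (e n)

  pick-far : ∀ e e' N c → e ≤ suc e' → 2 ℕ.+ N ≤ e → pick e' N c ≈ 0#
  pick-far e e' N c p q = pick-< e' N c (ℕP.≤-pred (ℕP.≤-trans q p))

  lat-supp : ∀ {e} → Proper e → ∀ (c : ℤ → Carrier) N → Supp (2 ℕ.+ N) (λ n → pick (e n) N (c n))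
  lat-supp {e} pr c N n p = pick-far (sz n) (e n) N (c n) (pr n) p

  lat-cong : ∀ {e f c d} → (∀ n → e n ≡ f n) → (∀ n → c n ≈ d n) → lat e c ≋ lat f d
  lat-cong p q N = sumℤ-cong (2 ℕ.+ N) (λ n → pick-cong₂ N (p n) (q n))

  lat-+ : ∀ e c d → lat e (λ n → c n + d n) ≋ lat e c ⊞ lat e d
  lat-+ e c d N = trans (sumℤ-cong (2 ℕ.+ N) (λ n → pick-+ (e n) N (c n) (d n)))
    (sumℤ-+ (2 ℕ.+ N) (λ n → pick (e n) N (c n)) (λ n → pick (e n) N (d n)))

  lat-suc : ∀ e c → Proper e → Proper (λ n → e (n ℤ.+ + 1)) → lat (λ n → e (n ℤ.+ + 1)) (λ n → c (n ℤ.+ + 1)) ≋ lat e c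
  lat-suc e c pr pr' N = sumℤ-shift (λ n → pick (e n) N (c n)) (+ 1) (lat-supp {e} pr c N) (lat-supp {λ n → e (n ℤ.+ + 1)} pr' (λ n → c (n ℤ.+ + 1)) N)

  lat2 : (ℤ → ℤ → ℕ) → (ℤ → ℤ → Carrier) → Ser
  lat2 e h N = sum2 (2 ℕ.+ N) (λ m n → pick (e m n) N (h m n))

  lat-⊠ : ∀ e e' c c' → Proper e → Proper e' → lat e c ⊠ lat e' c' ≋ lat2 (λ m n → e m ℕ.+ e' n) (λ m n → c m * c' n)
  lat-⊠ e e' c c' pr pr' N = begin
    (lat e c ⊠ lat e' c') N
      ≈⟨ ⊠-coeff (lat e c) (lat e' c') N ⟩
    sum (suc N) (λ i → lat e c i * lat e' c' (N ∸ i))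
      ≈⟨ sum-cong< (suc N) (λ i i<N → *-cong
           (sym (sumℤ-extend (λ m → a m i) (lat-supp {e} pr c i) (s≤s (s≤s (ℕP.≤-pred i<N)))))
           (sym (sumℤ-extend (λ n → b n (N ∸ i)) (lat-supp {e'} pr' c' (N ∸ i)) (s≤s (s≤s (ℕP.m∸n≤m N i)))))) ⟩
    sum (suc N) (λ i → sumℤ B (λ m → a m i) * sumℤ B (λ n → b n (N ∸ i)))
      ≈⟨ sum-cong (suc N) (λ i → trans (sym (sumℤ-*ʳ B (sumℤ B (λ n → b n (N ∸ i))) (λ m → a m i)))
           (sumℤ-cong B (λ m → sym (sumℤ-*ˡ B (a m i) (λ n → b n (N ∸ i)))))) ⟩
    sum (suc N) (λ i → sumℤ B (λ m → sumℤ B (λ n → a m i * b n (N ∸ i))))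
      ≈⟨ sum-sumℤ (suc N) B (λ i m → sumℤ B (λ n → a m i * b n (N ∸ i))) ⟩
    sumℤ B (λ m → sum (suc N) (λ i → sumℤ B (λ n → a m i * b n (N ∸ i))))
      ≈⟨ sumℤ-cong B (λ m → sum-sumℤ (suc N) B (λ i n → a m i * b n (N ∸ i))) ⟩
    sumℤ B (λ m → sumℤ B (λ n → sum (suc N) (λ i → a m i * b n (N ∸ i))))
      ≈⟨ sum2-cong B (λ m n → pick-conv (e m) (e' n) N (c m) (c' n)) ⟩
    lat2 (λ m n → e m ℕ.+ e' n) (λ m n → c m * c' n) N ∎
    where
    B : ℕ
    B = 2 ℕ.+ N
    a b : ℤ → ℕ → Carrier
    a m i = pick (e m) i (c m)
    b n j = pick (e' n) j (c' n)

  -- The exponents i(i + 1)/2, i² and i(i + 1) for all integers i; the first is written through `sz`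
  -- because it is invariant under i ↦ -1 - i, which exchanges the two halves of a window.
  trs sq pr : ℤ → ℕ
  trs i = tri (sz i)
  sq i  = ℤ.∣ i ∣ ℕ.* ℤ.∣ i ∣
  pr i  = trs i ℕ.+ trs i

  n≤T : ∀ n → n ≤ tri n
  n≤T zero    = z≤n
  n≤T (suc n) = ℕP.m≤m+n (suc n) (tri n)

  proper-trs : Proper trs
  proper-trs i = ℕP.m≤n⇒m≤1+n (n≤T (sz i))

  proper-pr : Proper pr
  proper-pr i = ℕP.≤-trans (proper-trs i) (s≤s (ℕP.m≤m+n (trs i) (trs i)))

  n≤n*n : ∀ n → n ≤ n ℕ.* n
  n≤n*n zero    = z≤n
  n≤n*n (suc n) = ℕP.m≤m+n (suc n) (n ℕ.* suc n)

  proper-sq : Proper sq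
  proper-sq i = ℕP.≤-trans (sz≤∣∣ i) (ℕP.m≤n⇒m≤1+n (n≤n*n ℤ.∣ i ∣))

  T-double : ∀ n → + (tri n ℕ.+ tri n) ≡ + n ℤ.* (+ n ℤ.+ + 1)
  T-double zero    = ≡.refl
  T-double (suc n) = ≡.trans
    (solveℤ 2 (λ t n → (₁ ⊹ n ⊹ t) ⊹ (₁ ⊹ n ⊹ t) ≔ ₁ ⊹ n ⊹ (₁ ⊹ n) ⊹ (t ⊹ t)) (+ tri n) (+ n))
    (≡.trans (≡.cong (λ k → + 1 ℤ.+ + n ℤ.+ (+ 1 ℤ.+ + n) ℤ.+ k) (T-double n))
    (solveℤ 1 (λ n → ₁ ⊹ n ⊹ (₁ ⊹ n) ⊹ n ⊗ (n ⊹ ₁) ≔ (₁ ⊹ n) ⊗ ((₁ ⊹ n) ⊹ ₁)) (+ n)))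

  trs-double : ∀ i → + pr i ≡ i ℤ.* (i ℤ.+ + 1)
  trs-double (+ n)    = T-double n
  trs-double -[1+ n ] = ≡.trans (T-double n)
    (≡.trans (solveℤ 1 (λ n → n ⊗ (n ⊹ ₁) ≔ (⁻ (₁ ⊹ n)) ⊗ ((⁻ (₁ ⊹ n)) ⊹ ₁)) (+ n)) ≡.refl)

  sq-square : ∀ i → + sq i ≡ i ℤ.* i
  sq-square (+ n)    = ℤP.pos-* n n
  sq-square -[1+ n ] = ≡.refl

  half-inj : ∀ {a b} → + (a ℕ.+ a) ≡ + (b ℕ.+ b) → a ≡ b
  half-inj {a} {b} e = ℕP.*-cancelˡ-≡ a b 2
    (≡.trans (≡.cong (a ℕ.+_) (ℕP.+-identityʳ a)) (≡.trans (ℤP.+-injective e) (≡.sym (≡.cong (b ℕ.+_) (ℕP.+-identityʳ b)))))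

  -- Proved after doubling, where triangular numbers become the polynomials i(i + 1).
  exponent₀ : ∀ k n → trs (k ℤ.+ n) ℕ.+ trs (n ℤ.- k) ≡ pr n ℕ.+ sq k
  exponent₀ k n = half-inj (≡.trans
    (solveℤ 2 (λ a b → a ⊹ b ⊹ (a ⊹ b) ≔ a ⊹ a ⊹ (b ⊹ b)) (+ trs (k ℤ.+ n)) (+ trs (n ℤ.- k)))
    (≡.trans (≡.cong₂ ℤ._+_ (trs-double (k ℤ.+ n)) (trs-double (n ℤ.- k)))
    (≡.trans (solveℤ 2 (λ k n → (k ⊹ n) ⊗ (k ⊹ n ⊹ ₁) ⊹ (n ⊝ k) ⊗ (n ⊝ k ⊹ ₁)
                             ≔ n ⊗ (n ⊹ ₁) ⊹ k ⊗ k ⊹ (n ⊗ (n ⊹ ₁) ⊹ k ⊗ k)) k n)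
    (≡.cong₂ (λ a b → a ℤ.+ b ℤ.+ (a ℤ.+ b)) (≡.sym (trs-double n)) (≡.sym (sq-square k))))))

  exponent₁ : ∀ k n → trs (k ℤ.+ n ℤ.+ + 1) ℕ.+ trs (n ℤ.- k) ≡ sq (n ℤ.+ + 1) ℕ.+ pr k
  exponent₁ k n = half-inj (≡.trans
    (solveℤ 2 (λ a b → a ⊹ b ⊹ (a ⊹ b) ≔ a ⊹ a ⊹ (b ⊹ b)) (+ trs (k ℤ.+ n ℤ.+ + 1)) (+ trs (n ℤ.- k)))
    (≡.trans (≡.cong₂ ℤ._+_ (trs-double (k ℤ.+ n ℤ.+ + 1)) (trs-double (n ℤ.- k)))
    (≡.trans (solveℤ 2 (λ k n → (k ⊹ n ⊹ ₁) ⊗ (k ⊹ n ⊹ ₁ ⊹ ₁) ⊹ (n ⊝ k) ⊗ (n ⊝ k ⊹ ₁)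
                             ≔ (n ⊹ ₁) ⊗ (n ⊹ ₁) ⊹ k ⊗ (k ⊹ ₁) ⊹ ((n ⊹ ₁) ⊗ (n ⊹ ₁) ⊹ k ⊗ (k ⊹ ₁))) k n)
    (≡.cong₂ (λ a b → a ℤ.+ b ℤ.+ (a ℤ.+ b)) (≡.sym (sq-square (n ℤ.+ + 1))) (≡.sym (trs-double k))))))

  odd : ℤ → ℤ
  odd n = n ℤ.+ n ℤ.+ + 1

  -- Up to fractional powers of q and constants these are θ₁ at τ, and θ₃ and θ₂ at 2τ, with an
  -- arbitrary function φ in place of the exponential of the argument. This covers values and all
  -- derivatives at once.
  Θ 𝔼 𝕆 : (ℤ → Carrier) → Ser
  Θ φ = lat trs (λ n → sg n * φ (odd n))
  𝔼 φ = lat sq (λ n → φ (n ℤ.+ n))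
  𝕆 φ = lat pr (λ n → φ (odd n))

  Θ-cong : ∀ {φ ψ} → (∀ u → φ u ≈ ψ u) → Θ φ ≋ Θ ψ
  Θ-cong e = lat-cong {trs} (λ _ → ≡.refl) (λ n → *-congˡ (e (odd n)))

  Θ₂ : (ℤ → ℤ → Carrier) → Ser
  Θ₂ h = lat2 (λ m n → trs m ℕ.+ trs n) (λ m n → sg m * sg n * h (odd m) (odd n))

  Θ₂-cong : ∀ {h h'} → (∀ u v → h u v ≈ h' u v) → Θ₂ h ≋ Θ₂ h'
  Θ₂-cong e N = sum2-cong (2 ℕ.+ N) (λ m n → pick-cong (trs m ℕ.+ trs n) N (*-congˡ (e (odd m) (odd n))))

  Θ₂-⊠ : ∀ φ ψ → Θ φ ⊠ Θ ψ ≋ Θ₂ (λ u v → φ u * ψ v)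
  Θ₂-⊠ φ ψ N = trans (lat-⊠ trs trs _ _ proper-trs proper-trs N)
    (sum2-cong (2 ℕ.+ N) (λ m n → pick-cong (trs m ℕ.+ trs n) N
      (solve 4 (λ a b c d → a :* b :* (c :* d) := a :* c :* (b :* d)) (sg m) (φ (odd m)) (sg n) (ψ (odd n)))))

  Θ₂-+ : ∀ h h' → Θ₂ (λ u v → h u v + h' u v) ≋ Θ₂ h ⊞ Θ₂ h'
  Θ₂-+ h h' N = trans
    (sum2-cong B (λ m n → trans (pick-cong (trs m ℕ.+ trs n) N (distribˡ _ _ _)) (pick-+ (trs m ℕ.+ trs n) N _ _)))
    (trans (sumℤ-cong B (λ m → sumℤ-+ B (F h m) (F h' m)))
    (sumℤ-+ B (λ m → sumℤ B (F h m)) (λ m → sumℤ B (F h' m))))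
    where
    B : ℕ
    B = 2 ℕ.+ N
    F : (ℤ → ℤ → Carrier) → ℤ → ℤ → Carrier
    F h m n = pick (trs m ℕ.+ trs n) N (sg m * sg n * h (odd m) (odd n))

  Θ₂-neg : ∀ h → Θ₂ (λ u v → - h u v) ≋ ⊟ Θ₂ h
  Θ₂-neg h = 𝕊+.inverseˡ-unique (Θ₂ (λ u v → - h u v)) (Θ₂ h) (𝕊.trans (𝕊.sym (Θ₂-+ (λ u v → - h u v) h))
    (λ N → sumℤ-0 (2 ℕ.+ N) (λ m → sumℤ-0 (2 ℕ.+ N) (λ n → trans (pick-cong (trs m ℕ.+ trs n) N
      (trans (*-congˡ (-‿inverseˡ _)) (zeroʳ _))) (pick-0 (trs m ℕ.+ trs n) N)))))
    where module 𝕊+ = RingProperties 𝕊.ring renaming (+-inverseˡ-unique to inverseˡ-unique)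

  -- A theta function in two variables, rewritten in the variables (u ± v) / 2.
  Θ₂-split : ∀ h f g → (∀ s d → h (s ℤ.+ d) (s ℤ.- d) ≈ f s * g d) → Θ₂ h ≋ 𝕆 f ⊠ 𝔼 g ⊞ ⊟ (𝔼 f ⊠ 𝕆 g)
  Θ₂-split h f g hyp N = begin
    Θ₂ h N
      ≈⟨ sum2-rotate F suppF
           (λ k n p → trans (first k n) (suppE (pr n ℕ.+ sq k) _ (bound (proper-sq k) (proper-pr n) p)))
           (λ k n p → trans (second k n) (trans (-‿cong (suppE (sq (n ℤ.+ + 1) ℕ.+ pr k) _ (bound' k n p))) -0#≈0#)) ⟩
    sum2 B (λ k n → F (k ℤ.+ n) (n ℤ.- k)) + sum2 B (λ k n → F (k ℤ.+ n ℤ.+ + 1) (n ℤ.- k))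
      ≈⟨ +-cong (sum2-cong B first) (trans (sum2-cong B second) (neg-sum G₁)) ⟩
    sum2 B G₀ + - sum2 B G₁
      ≈⟨ +-cong (sumℤ-swap B B G₀) (-‿cong (sumℤ-swap B B G₁)) ⟩
    lat2 (λ n k → pr n ℕ.+ sq k) (λ n k → f (odd n) * g (k ℤ.+ k)) N
      + - lat2 (λ n k → sq (n ℤ.+ + 1) ℕ.+ pr k) (λ n k → f (n ℤ.+ + 1 ℤ.+ (n ℤ.+ + 1)) * g (odd k)) N
      ≈⟨ +-cong (sym (lat-⊠ pr sq (λ n → f (odd n)) (λ k → g (k ℤ.+ k)) proper-pr proper-sq N))
           (-‿cong (trans (sym (lat-⊠ (λ n → sq (n ℤ.+ + 1)) pr (λ n → f (n ℤ.+ + 1 ℤ.+ (n ℤ.+ + 1))) (λ k → g (odd k)) proper-sq' proper-pr N))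
             (⊠-cong (lat-suc sq (λ n → f (n ℤ.+ n)) proper-sq proper-sq') (λ _ → refl) N))) ⟩
    (𝕆 f ⊠ 𝔼 g) N + - (𝔼 f ⊠ 𝕆 g) N ∎
    where
    B : ℕ
    B = 2 ℕ.+ N
    F : ℤ → ℤ → Carrier
    F m n = pick (trs m ℕ.+ trs n) N (sg m * sg n * h (odd m) (odd n))
    G₀ G₁ : ℤ → ℤ → Carrier
    G₀ k n = pick (pr n ℕ.+ sq k) N (f (odd n) * g (k ℤ.+ k))
    G₁ k n = pick (sq (n ℤ.+ + 1) ℕ.+ pr k) N (f (n ℤ.+ + 1 ℤ.+ (n ℤ.+ + 1)) * g (odd k))
    proper-sq' : Proper (λ n → sq (n ℤ.+ + 1))
    proper-sq' (+ n) = ℕP.≤-trans (ℕP.m≤m+n n 1) (ℕP.m≤n⇒m≤1+n (n≤n*n (n ℕ.+ 1)))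
    proper-sq' -[1+ zero ]  = z≤n
    proper-sq' -[1+ suc n ] = ℕP.m≤n⇒m≤1+n (n≤n*n (suc n))
    suppE : ∀ e c → N < e → pick e N c ≈ 0#
    suppE e c p = pick-< e N c p
    bound : ∀ {a b x y} → a ≤ suc x → b ≤ suc y → B ≤ a ⊎ B ≤ b → N < y ℕ.+ x
    bound {x = x} {y} p q (inj₁ r) = ℕP.≤-trans (ℕP.≤-pred (ℕP.≤-trans r p)) (ℕP.m≤n+m x y)
    bound {x = x} {y} p q (inj₂ r) = ℕP.≤-trans (ℕP.≤-pred (ℕP.≤-trans r q)) (ℕP.m≤m+n y x)
    bound' : ∀ k n → B ≤ sz k ⊎ B ≤ sz n → N < sq (n ℤ.+ + 1) ℕ.+ pr k
    bound' k n = bound (proper-pr k) (proper-sq' n)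
    suppF : Supp2 B F
    suppF m n p = suppE (trs m ℕ.+ trs n) _ (bound (proper-trs n) (proper-trs m) (swap p))
      where
      swap : ∀ {X Y : Set} → X ⊎ Y → Y ⊎ X
      swap (inj₁ x) = inj₂ x
      swap (inj₂ y) = inj₁ y
    first : ∀ k n → F (k ℤ.+ n) (n ℤ.- k) ≈ pick (pr n ℕ.+ sq k) N (f (odd n) * g (k ℤ.+ k))
    first k n = pick-cong₂ N (exponent₀ k n) (begin
      sg (k ℤ.+ n) * sg (n ℤ.- k) * h (odd (k ℤ.+ n)) (odd (n ℤ.- k))
        ≈⟨ *-cong
             (trans (sym (sgn-+ (k ℤ.+ n ℤ.+ + 1) (n ℤ.- k ℤ.+ + 1)))
               (trans (sgn-cong (solveℤ 2 (λ k n → (k ⊹ n ⊹ ₁) ⊹ (n ⊝ k ⊹ ₁) ≔ (n ⊹ ₁) ⊹ (n ⊹ ₁)) k n)) (sgn-sq (n ℤ.+ + 1))))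
             (reflexive (≡.cong₂ h
               (solveℤ 2 (λ k n → (k ⊹ n) ⊹ (k ⊹ n) ⊹ ₁ ≔ (n ⊹ n ⊹ ₁) ⊹ (k ⊹ k)) k n)
               (solveℤ 2 (λ k n → (n ⊝ k) ⊹ (n ⊝ k) ⊹ ₁ ≔ (n ⊹ n ⊹ ₁) ⊝ (k ⊹ k)) k n))) ⟩
      1# * h (odd n ℤ.+ (k ℤ.+ k)) (odd n ℤ.- (k ℤ.+ k))
        ≈⟨ trans (*-identityˡ _) (hyp (odd n) (k ℤ.+ k)) ⟩
      f (odd n) * g (k ℤ.+ k) ∎)
    second : ∀ k n → F (k ℤ.+ n ℤ.+ + 1) (n ℤ.- k)
           ≈ - pick (sq (n ℤ.+ + 1) ℕ.+ pr k) N (f (n ℤ.+ + 1 ℤ.+ (n ℤ.+ + 1)) * g (odd k))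
    -- The two signs multiply to (-1)^(2n + 3), whence the minus in front of the second product.
    second k n = trans (pick-cong₂ N (exponent₁ k n) (begin
      sg (k ℤ.+ n ℤ.+ + 1) * sg (n ℤ.- k) * h (odd (k ℤ.+ n ℤ.+ + 1)) (odd (n ℤ.- k))
        ≈⟨ *-cong
             (trans (sym (sgn-+ (k ℤ.+ n ℤ.+ + 1 ℤ.+ + 1) (n ℤ.- k ℤ.+ + 1)))
               (trans (sgn-cong (solveℤ 2 (λ k n → (k ⊹ n ⊹ ₁ ⊹ ₁) ⊹ (n ⊝ k ⊹ ₁) ≔ ₁ ⊹ ((n ⊹ ₁) ⊹ (n ⊹ ₁))) k n))
               (trans (sgn-suc ((n ℤ.+ + 1) ℤ.+ (n ℤ.+ + 1))) (*-congˡ (sgn-sq (n ℤ.+ + 1))))))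
             (reflexive (≡.cong₂ h
               (solveℤ 2 (λ k n → (k ⊹ n ⊹ ₁) ⊹ (k ⊹ n ⊹ ₁) ⊹ ₁ ≔ ((n ⊹ ₁) ⊹ (n ⊹ ₁)) ⊹ (k ⊹ k ⊹ ₁)) k n)
               (solveℤ 2 (λ k n → (n ⊝ k) ⊹ (n ⊝ k) ⊹ ₁ ≔ ((n ⊹ ₁) ⊹ (n ⊹ ₁)) ⊝ (k ⊹ k ⊹ ₁)) k n))) ⟩
      - 1# * 1# * h ((n ℤ.+ + 1) ℤ.+ (n ℤ.+ + 1) ℤ.+ odd k) ((n ℤ.+ + 1) ℤ.+ (n ℤ.+ + 1) ℤ.- odd k)
        ≈⟨ *-cong (*-identityʳ _) (hyp ((n ℤ.+ + 1) ℤ.+ (n ℤ.+ + 1)) (odd k)) ⟩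
      - 1# * (f (n ℤ.+ + 1 ℤ.+ (n ℤ.+ + 1)) * g (odd k))
        ≈⟨ solve 1 (λ a → (:- :1) :* a := :- a) _ ⟩
      - (f (n ℤ.+ + 1 ℤ.+ (n ℤ.+ + 1)) * g (odd k)) ∎)) (pick-neg (sq (n ℤ.+ + 1) ℕ.+ pr k) N _)
    neg-sum : ∀ (G : ℤ → ℤ → Carrier) → sum2 B (λ k n → - G k n) ≈ - sum2 B G
    neg-sum G = trans (sum2-cong B (λ k n → solve 1 (λ a → :- a := (:- :1) :* a) (G k n)))
      (trans (sumℤ-cong B (λ k → sumℤ-*ˡ B (- 1#) (G k)))
      (trans (sumℤ-*ˡ B (- 1#) (λ k → sumℤ B (G k))) (solve 1 (λ a → (:- :1) :* a := :- a) _)))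

  opaque
    unfolding sumℤ

    -- The involution n ↦ -1 - n fixes the exponent of q, negates 2n + 1 and changes the sign of the
    -- term; it exchanges the two halves of the window.
    Θ-reflect : ∀ φ → Θ (λ u → φ (ℤ.- u)) ≋ ⊟ Θ φ
    Θ-reflect φ N = begin
      sum B (λ n → F φ⁻ (+ n)) + sum B (λ n → F φ⁻ -[1+ n ])
        ≈⟨ +-cong (sum-cong B pos) (sum-cong B neg) ⟩
      sum B (λ n → - 1# * F φ -[1+ n ]) + sum B (λ n → - 1# * F φ (+ n))
        ≈⟨ +-cong (sum-*ˡ B (- 1#) (λ n → F φ -[1+ n ])) (sum-*ˡ B (- 1#) (λ n → F φ (+ n))) ⟩
      - 1# * sum B (λ n → F φ -[1+ n ]) + - 1# * sum B (λ n → F φ (+ n))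
        ≈⟨ solve 2 (λ a b → (:- :1) :* a :+ (:- :1) :* b := :- (b :+ a)) _ _ ⟩
      - (sum B (λ n → F φ (+ n)) + sum B (λ n → F φ -[1+ n ])) ∎
      where
      B : ℕ
      B = 2 ℕ.+ N
      φ⁻ : ℤ → Carrier
      φ⁻ u = φ (ℤ.- u)
      F : (ℤ → Carrier) → ℤ → Carrier
      F φ n = pick (trs n) N (sg n * φ (odd n))
      refl-sgn : ∀ n → sg n ≈ - 1# * sg (ℤ.- (+ 1) ℤ.- n)
      refl-sgn n = begin
        sgn (n ℤ.+ + 1)                              ≈⟨ sgn-cong (solveℤ 1 (λ n → n ⊹ ₁ ≔ ₁ ⊹ (⁻ ₁ ⊝ n ⊹ ₁) ⊹ (n ⊹ n)) n) ⟩
        sgn (+ 1 ℤ.+ (ℤ.- (+ 1) ℤ.- n ℤ.+ + 1) ℤ.+ (n ℤ.+ n)) ≈⟨ sgn-+ (+ 1 ℤ.+ (ℤ.- (+ 1) ℤ.- n ℤ.+ + 1)) (n ℤ.+ n) ⟩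
        sgn (+ 1 ℤ.+ (ℤ.- (+ 1) ℤ.- n ℤ.+ + 1)) * sgn (n ℤ.+ n) ≈⟨ trans (*-congˡ (sgn-sq n)) (*-identityʳ _) ⟩
        sgn (+ 1 ℤ.+ (ℤ.- (+ 1) ℤ.- n ℤ.+ + 1))      ≈⟨ sgn-suc (ℤ.- (+ 1) ℤ.- n ℤ.+ + 1) ⟩
        - 1# * sg (ℤ.- (+ 1) ℤ.- n)                  ∎
      reflected : ∀ i j → trs i ≡ trs j → ℤ.- (+ 1) ℤ.- i ≡ j → F φ⁻ i ≈ - 1# * F φ j
      reflected i j e ≡.refl = trans (pick-cong₂ N e (trans (*-cong (refl-sgn i) (reflexive (≡.cong φ
        (solveℤ 1 (λ n → ⁻ (n ⊹ n ⊹ ₁) ≔ (⁻ ₁ ⊝ n) ⊹ (⁻ ₁ ⊝ n) ⊹ ₁) i)))) (*-assoc _ _ _))) (pick-* (trs j) N (- 1#) _)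
      pos : ∀ n → F φ⁻ (+ n) ≈ - 1# * F φ -[1+ n ]
      pos n = reflected (+ n) -[1+ n ] ≡.refl (minus n)
        where
        minus : ∀ n → ℤ.- (+ 1) ℤ.- + n ≡ -[1+ n ]
        minus zero    = ≡.refl
        minus (suc n) = ≡.refl
      neg : ∀ n → F φ⁻ -[1+ n ] ≈ - 1# * F φ (+ n)
      neg n = reflected -[1+ n ] (+ n) ≡.refl ≡.refl

    -- Terms paired by n ↦ -1 - n cancel. The sum is cancelled in pairs rather than derived from
    -- `Θ-reflect`, which would only give that twice the series is zero.
    Θ-even : ∀ φ → (∀ u → φ (ℤ.- u) ≈ φ u) → Θ φ ≋ 𝟘
    Θ-even φ even N = begin
      sum B (λ n → F (+ n)) + sum B (λ n → F -[1+ n ])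
        ≈⟨ sym (sum-+ B (λ n → F (+ n)) (λ n → F -[1+ n ])) ⟩
      sum B (λ n → F (+ n) + F -[1+ n ])
        ≈⟨ sum-0 B (λ n _ → pair n) ⟩
      0# ∎
      where
      B : ℕ
      B = 2 ℕ.+ N
      F : ℤ → Carrier
      F n = pick (trs n) N (sg n * φ (odd n))
      pair : ∀ n → F (+ n) + F -[1+ n ] ≈ 0#
      pair n = begin
        F (+ n) + F -[1+ n ]  ≈⟨ sym (pick-+ (tri n) N _ _) ⟩
        pick (tri n) N (sg (+ n) * φ (odd (+ n)) + sg -[1+ n ] * φ (odd -[1+ n ]))
          ≈⟨ pick-cong (tri n) N (trans (+-cong (*-congʳ sg-pos) (*-cong (sg-neg n) (trans (sym (even _)) (reflexive (≡.cong φ (opp n))))))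
               (solve 2 (λ s t → (:- :1) :* s :* t :+ s :* t := :0) ((- 1#) ^ n) (φ (odd (+ n))))) ⟩
        pick (tri n) N 0#  ≈⟨ pick-0 (tri n) N ⟩
        0# ∎
        where
        sg-pos : sg (+ n) ≈ - 1# * (- 1#) ^ n
        sg-pos = reflexive (≡.cong (λ k → (- 1#) ^ k) (ℕP.+-comm n 1))
        sg-neg : ∀ n → sg -[1+ n ] ≈ (- 1#) ^ n
        sg-neg zero    = refl
        sg-neg (suc n) = refl
        opp : ∀ n → ℤ.- odd -[1+ n ] ≡ odd (+ n)
        opp n = ≡.cong +_ (ℕP.+-comm 1 (n ℕ.+ n))

record Unit (R : CommutativeRing 0ℓ 0ℓ) : Set where
  open CommutativeRing R
  field
    unit inverse : Carrier
    unit-inverse : unit * inverse ≈ 1#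

module ThetaValues (R : CommutativeRing 0ℓ 0ℓ) (ξ : Unit R) where
  open IntegerSolver
  open CommutativeRing R
  open Solver R using (_^_; ^-cong; fromℕ; fromℤ; fromℤ-+; fromℤ-*; fromℤ-neg; solve; _:+_; _:*_; _:-_; :-_; _:^_; _:=_; :0; :1; :c)
  open Series R
  open Lattice R
  open Power (Unit.unit ξ) (Unit.inverse ξ) (Unit.unit-inverse ξ)
  open SetoidReasoning setoid
  private module 𝕊 = CommutativeRing ring𝕊

  char : ℤ → ℤ → Carrier
  char a u = zpow (a ℤ.* u)

  weighted : ℕ → ℤ → ℤ → Carrier
  weighted i a u = fromℤ u ^ i * char a u

  -- p 0 a = Σ (-1)^(n+1) q^(n(n+1)/2) ξ^(a(2n+1)); the i-th Euler derivative
  -- in ξ^a gives p i a.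
  p : ℕ → ℤ → Ser
  p i a = Θ (weighted i a)

  even-weighted : ℕ → ℤ → ℤ → Carrier
  even-weighted i x s = fromℤ (s ℤ.+ s) ^ i * zpow ((x ℤ.+ x) ℤ.* s)

  E O : ℕ → ℤ → Ser
  E i x = 𝔼 (even-weighted i x)
  O i x = 𝕆 (even-weighted i x)

  -- A 2 × 2 determinant of the vectors (O, E) at x and y. By `bracket₀₀` the one without
  -- derivatives is the product of the theta values at x + y and x - y, so the Plücker relations
  -- between four vectors become relations between theta values.
  bracket : ℕ → ℤ → ℕ → ℤ → Ser
  bracket i x j y = O i x ⊠ E j y ⊞ ⊟ (E i x ⊠ O j y)

  kernel : ℕ → ℕ → ℤ → ℤ → ℤ → ℤ → Carrier
  kernel i j x y u v = (fromℤ u + fromℤ v) ^ i * (fromℤ u + - fromℤ v) ^ j * (char (x ℤ.+ y) u * char (x ℤ.- y) v)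

  -- With u = s + d and v = s - d the exponent (x + y) u + (x - y) v becomes 2xs + 2yd and the
  -- kernel separates. The factors u + v = 2s and u - v = 2d act as derivatives in x and in y;
  -- expanding their powers gives the Leibniz formulas that follow.
  bracket-kernel : ∀ i x j y → Θ₂ (kernel i j x y) ≋ bracket i x j y
  bracket-kernel i x j y = Θ₂-split (kernel i j x y) (even-weighted i x) (even-weighted j y) λ s d → begin
    (fromℤ (s ℤ.+ d) + fromℤ (s ℤ.- d)) ^ i * (fromℤ (s ℤ.+ d) + - fromℤ (s ℤ.- d)) ^ j * (char (x ℤ.+ y) (s ℤ.+ d) * char (x ℤ.- y) (s ℤ.- d))
      ≈⟨ *-cong (*-cong (^-cong i (plus s d)) (^-cong j (minus s d))) (chars s d) ⟩
    fromℤ (s ℤ.+ s) ^ i * fromℤ (d ℤ.+ d) ^ j * (zpow ((x ℤ.+ x) ℤ.* s) * zpow ((y ℤ.+ y) ℤ.* d))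
      ≈⟨ solve 4 (λ a b c d → a :* b :* (c :* d) := a :* c :* (b :* d)) _ _ _ _ ⟩
    even-weighted i x s * even-weighted j y d ∎
    where
    plus : ∀ s d → fromℤ (s ℤ.+ d) + fromℤ (s ℤ.- d) ≈ fromℤ (s ℤ.+ s)
    plus s d = trans (sym (fromℤ-+ (s ℤ.+ d) (s ℤ.- d)))
      (reflexive (≡.cong fromℤ (solveℤ 2 (λ s d → (s ⊹ d) ⊹ (s ⊝ d) ≔ s ⊹ s) s d)))
    minus : ∀ s d → fromℤ (s ℤ.+ d) + - fromℤ (s ℤ.- d) ≈ fromℤ (d ℤ.+ d)
    minus s d = trans (+-congˡ (sym (fromℤ-neg (s ℤ.- d)))) (trans (sym (fromℤ-+ (s ℤ.+ d) (ℤ.- (s ℤ.- d))))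
      (reflexive (≡.cong fromℤ (solveℤ 2 (λ s d → (s ⊹ d) ⊹ (⁻ (s ⊝ d)) ≔ d ⊹ d) s d))))
    chars : ∀ s d → char (x ℤ.+ y) (s ℤ.+ d) * char (x ℤ.- y) (s ℤ.- d) ≈ zpow ((x ℤ.+ x) ℤ.* s) * zpow ((y ℤ.+ y) ℤ.* d)
    chars s d = trans (sym (zpow-+ ((x ℤ.+ y) ℤ.* (s ℤ.+ d)) ((x ℤ.- y) ℤ.* (s ℤ.- d))))
      (trans (zpow-cong (solveℤ 4 (λ x y s d → (x ⊹ y) ⊗ (s ⊹ d) ⊹ (x ⊝ y) ⊗ (s ⊝ d) ≔ (x ⊹ x) ⊗ s ⊹ (y ⊹ y) ⊗ d) x y s d))
        (zpow-+ ((x ℤ.+ x) ℤ.* s) ((y ℤ.+ y) ℤ.* d)))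

  term : ℕ → ℕ → ℤ → ℤ → ℤ → ℤ → Carrier
  term i j a b u v = weighted i a u * weighted j b v

  module _ (x y : ℤ) where
    private
      a b : ℤ
      a = x ℤ.+ y
      b = x ℤ.- y
      U : ∀ i j → Θ₂ (term i j a b) ≋ p i a ⊠ p j b
      U i j = 𝕊.sym (Θ₂-⊠ (weighted i a) (weighted j b))
      expand : ∀ {h h'} → (∀ u v → h u v ≈ h' u v) → Θ₂ h' ≋ Θ₂ h
      expand e = Θ₂-cong (λ u v → sym (e u v))

    bracket₀₀ : bracket 0 x 0 y ≋ p 0 a ⊠ p 0 b
    bracket₀₀ = 𝕊.trans (𝕊.sym (bracket-kernel 0 x 0 y)) (𝕊.trans
      (Θ₂-cong (λ u v → solve 4 (λ u v c d → (u :+ v) :^ 0 :* (u :- v) :^ 0 :* (c :* d) := u :^ 0 :* c :* (v :^ 0 :* d))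
        (fromℤ u) (fromℤ v) (char a u) (char b v)))
      (U 0 0))

    bracket₁₀ : bracket 1 x 0 y ≋ p 1 a ⊠ p 0 b ⊞ p 0 a ⊠ p 1 b
    bracket₁₀ = 𝕊.trans (𝕊.sym (bracket-kernel 1 x 0 y)) (𝕊.trans
      (Θ₂-cong (λ u v → solve 4 (λ u v c d → (u :+ v) :^ 1 :* (u :- v) :^ 0 :* (c :* d)
          := u :^ 1 :* c :* (v :^ 0 :* d) :+ u :^ 0 :* c :* (v :^ 1 :* d))
        (fromℤ u) (fromℤ v) (char a u) (char b v)))
      (𝕊.trans (Θ₂-+ (term 1 0 a b) (term 0 1 a b)) (𝕊.+-cong (U 1 0) (U 0 1))))

    bracket₂₀ : bracket 2 x 0 y ≋ p 2 a ⊠ p 0 b ⊞ p 1 a ⊠ p 1 b ⊞ (p 1 a ⊠ p 1 b ⊞ p 0 a ⊠ p 2 b)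
    bracket₂₀ = 𝕊.trans (𝕊.sym (bracket-kernel 2 x 0 y)) (𝕊.trans
      (Θ₂-cong (λ u v → solve 4 (λ u v c d → (u :+ v) :^ 2 :* (u :- v) :^ 0 :* (c :* d)
          := u :^ 2 :* c :* (v :^ 0 :* d) :+ u :^ 1 :* c :* (v :^ 1 :* d)
             :+ (u :^ 1 :* c :* (v :^ 1 :* d) :+ u :^ 0 :* c :* (v :^ 2 :* d)))
        (fromℤ u) (fromℤ v) (char a u) (char b v)))
      (𝕊.trans (Θ₂-+ (λ u v → term 2 0 a b u v + term 1 1 a b u v) (λ u v → term 1 1 a b u v + term 0 2 a b u v))
        (𝕊.+-cong (𝕊.trans (Θ₂-+ (term 2 0 a b) (term 1 1 a b)) (𝕊.+-cong (U 2 0) (U 1 1)))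
                  (𝕊.trans (Θ₂-+ (term 1 1 a b) (term 0 2 a b)) (𝕊.+-cong (U 1 1) (U 0 2))))))

    bracket₀₂ : bracket 0 x 2 y ≋ p 2 a ⊠ p 0 b ⊞ p 0 a ⊠ p 2 b ⊞ ⊟ (p 1 a ⊠ p 1 b ⊞ p 1 a ⊠ p 1 b)
    bracket₀₂ = 𝕊.trans (𝕊.sym (bracket-kernel 0 x 2 y)) (𝕊.trans
      (Θ₂-cong (λ u v → solve 4 (λ u v c d → (u :+ v) :^ 0 :* (u :- v) :^ 2 :* (c :* d)
          := u :^ 2 :* c :* (v :^ 0 :* d) :+ u :^ 0 :* c :* (v :^ 2 :* d)
             :- (u :^ 1 :* c :* (v :^ 1 :* d) :+ u :^ 1 :* c :* (v :^ 1 :* d)))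
        (fromℤ u) (fromℤ v) (char a u) (char b v)))
      (𝕊.trans (Θ₂-+ (λ u v → term 2 0 a b u v + term 0 2 a b u v) (λ u v → - (term 1 1 a b u v + term 1 1 a b u v)))
        (𝕊.+-cong (𝕊.trans (Θ₂-+ (term 2 0 a b) (term 0 2 a b)) (𝕊.+-cong (U 2 0) (U 0 2)))
          (𝕊.trans (Θ₂-neg (λ u v → term 1 1 a b u v + term 1 1 a b u v))
            (𝕊.-‿cong (𝕊.trans (Θ₂-+ (term 1 1 a b) (term 1 1 a b)) (𝕊.+-cong (U 1 1) (U 1 1))))))))

    bracket₁₂ : bracket 1 x 2 y ≋ p 3 a ⊠ p 0 b ⊞ p 0 a ⊠ p 3 b ⊞ ⊟ (p 2 a ⊠ p 1 b ⊞ p 1 a ⊠ p 2 b)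
    bracket₁₂ = 𝕊.trans (𝕊.sym (bracket-kernel 1 x 2 y)) (𝕊.trans
      (Θ₂-cong (λ u v → solve 4 (λ u v c d → (u :+ v) :^ 1 :* (u :- v) :^ 2 :* (c :* d)
          := u :^ 3 :* c :* (v :^ 0 :* d) :+ u :^ 0 :* c :* (v :^ 3 :* d)
             :- (u :^ 2 :* c :* (v :^ 1 :* d) :+ u :^ 1 :* c :* (v :^ 2 :* d)))
        (fromℤ u) (fromℤ v) (char a u) (char b v)))
      (𝕊.trans (Θ₂-+ (λ u v → term 3 0 a b u v + term 0 3 a b u v) (λ u v → - (term 2 1 a b u v + term 1 2 a b u v)))
        (𝕊.+-cong (𝕊.trans (Θ₂-+ (term 3 0 a b) (term 0 3 a b)) (𝕊.+-cong (U 3 0) (U 0 3)))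
          (𝕊.trans (Θ₂-neg (λ u v → term 2 1 a b u v + term 1 2 a b u v))
            (𝕊.-‿cong (𝕊.trans (Θ₂-+ (term 2 1 a b) (term 1 2 a b)) (𝕊.+-cong (U 2 1) (U 1 2))))))))

  p-cong : ∀ i {a b} → a ≡ b → p i a ≋ p i b
  p-cong i ≡.refl = 𝕊.refl

  p₀-odd : ∀ a → p 0 (ℤ.- a) ≋ ⊟ p 0 a
  p₀-odd a = 𝕊.trans (Θ-cong (λ u → *-congˡ (zpow-cong (solveℤ 2 (λ a u → ⁻ a ⊗ u ≔ a ⊗ (⁻ u)) a u)))) (Θ-reflect (weighted 0 a))

  p₁-even : ∀ a → p 1 (ℤ.- a) ≋ p 1 a
  p₁-even a = 𝕊.trans (Θ-cong (λ u → trans (*-cong (flip u) (zpow-cong (solveℤ 2 (λ a u → ⁻ a ⊗ u ≔ a ⊗ (⁻ u)) a u))) refl))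
    (𝕊.trans (Θ-reflect (λ u → fromℤ (ℤ.- u) ^ 1 * char a u))
    (𝕊.trans (𝕊.-‿cong (Θ-neg)) (RingP.-‿involutive (p 1 a))))
    where
    import Algebra.Properties.Ring as RingProperties
    module RingP = RingProperties 𝕊.ring
    flip : ∀ u → fromℤ u ^ 1 ≈ fromℤ (ℤ.- (ℤ.- u)) ^ 1
    flip u = reflexive (≡.cong (λ v → fromℤ v ^ 1) (≡.sym (ℤP.neg-involutive u)))
    Θ-neg : Θ (λ u → fromℤ (ℤ.- u) ^ 1 * char a u) ≋ ⊟ p 1 a
    Θ-neg = 𝕊.trans (Θ-cong (λ u → trans (*-congʳ (^-cong 1 (fromℤ-neg u))) (solve 2 (λ x c → (:- x) :^ 1 :* c := :- (x :^ 1 :* c)) (fromℤ u) (char a u))))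
      (RingP.+-inverseˡ-unique _ _ (𝕊.trans (𝕊.sym (lat-+ trs _ _)) (lat-0 λ n → solve 3 (λ s x c → s :* (:- (x :^ 1 :* c)) :+ s :* (x :^ 1 :* c) := :0)
        (sg n) (fromℤ (odd n)) (char a (odd n)))))
      where
      lat-0 : ∀ {c} → (∀ n → c n ≈ 0#) → lat trs c ≋ 𝟘
      lat-0 z N = FiniteSums.sumℤ-0 R (2 ℕ.+ N) (λ n → trans (pick-cong (trs n) N (z n)) (pick-0 (trs n) N))

  p₀-0 : p 0 (+ 0) ≋ 𝟘
  p₀-0 = Θ-even (weighted 0 (+ 0)) (λ u → refl)

  p₂-0 : p 2 (+ 0) ≋ 𝟘
  p₂-0 = Θ-even (weighted 2 (+ 0)) (λ u → *-congʳ (trans (^-cong 2 (fromℤ-neg u)) (solve 1 (λ x → (:- x) :^ 2 := x :^ 2) (fromℤ u))))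

  -- Since (2n + 1)² = 8 n(n + 1)/2 + 1, two Euler derivatives in ξ^a act as 8 q d/dq + 1. The
  -- summand 1 stands for the factor q^(1/8) that is left out of θ₁.
  heat : ∀ i a → p (2 ℕ.+ i) a ≋ C (fromℤ (+ 8)) ⊠ D (p i a) ⊞ p i a
  heat i a N = sym (begin
    (C (fromℤ (+ 8)) ⊠ D (p i a)) N + p i a N
      ≈⟨ +-congʳ (C-⊠ (fromℤ (+ 8)) (D (p i a)) N) ⟩
    fromℤ (+ 8) * (fromℕ N * p i a N) + p i a N
      ≈⟨ trans (+-congʳ (trans (sym (*-assoc _ _ _)) (sym (sumℤ-*ˡ (2 ℕ.+ N) (fromℤ (+ 8) * fromℕ N) f)))) (sym (sumℤ-+ (2 ℕ.+ N) _ f)) ⟩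
    sumℤ (2 ℕ.+ N) (λ n → fromℤ (+ 8) * fromℕ N * f n + f n)
      ≈⟨ sumℤ-cong (2 ℕ.+ N) (λ n → at n) ⟩
    p (2 ℕ.+ i) a N ∎)
    where
    open FiniteSums R
    f : ℤ → Carrier
    f n = pick (trs n) N (sg n * weighted i a (odd n))
    weight : ∀ n → fromℤ (+ 8) * fromℕ (trs n) + 1# ≈ fromℤ (odd n) ^ 2
    weight n = begin
      fromℤ (+ 8) * fromℤ (+ trs n) + fromℤ (+ 1)
        ≈⟨ trans (+-congʳ (sym (fromℤ-* (+ 8) (+ trs n)))) (sym (fromℤ-+ (+ 8 ℤ.* + trs n) (+ 1))) ⟩
      fromℤ (+ 8 ℤ.* + trs n ℤ.+ + 1)
        ≈⟨ reflexive (≡.cong fromℤ (≡.trans (solveℤ 1 (λ t → ₈ ⊗ t ⊹ ₁ ≔ ₄ ⊗ (t ⊹ t) ⊹ ₁) (+ trs n))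
             (≡.trans (≡.cong (λ k → + 4 ℤ.* k ℤ.+ + 1) (trs-double n)) (solveℤ 1 (λ n → ₄ ⊗ (n ⊗ (n ⊹ ₁)) ⊹ ₁ ≔ (n ⊹ n ⊹ ₁) ⊗ (n ⊹ n ⊹ ₁)) n)))) ⟩
      fromℤ (odd n ℤ.* odd n)      ≈⟨ fromℤ-* (odd n) (odd n) ⟩
      fromℤ (odd n) * fromℤ (odd n) ≈⟨ *-congˡ (sym (*-identityʳ _)) ⟩
      fromℤ (odd n) ^ 2            ∎
      where
      open Solver ℤP.+-*-commutativeRing using (Expr) renaming (:c to con)
      ₈ ₄ : ∀ {n} → Expr n
      ₈ = con (+ 8)
      ₄ = con (+ 4)
    -- Where `pick` does not vanish, the index N of the coefficient is the exponent e.
    hit : ∀ e → fromℤ (+ 8) * fromℕ N * pick e N 1# ≈ fromℤ (+ 8) * fromℕ e * pick e N 1#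
    hit e = trans (*-assoc _ _ _) (trans (*-congˡ (go e N)) (sym (*-assoc _ _ _)))
      where
      go : ∀ e N → fromℕ N * pick e N 1# ≈ fromℕ e * pick e N 1#
      go zero    zero    = refl
      go zero    (suc N) = trans (zeroʳ _) (sym (zeroʳ _))
      go (suc e) zero    = trans (zeroʳ _) (sym (zeroʳ _))
      go (suc e) (suc N) = trans (*-congʳ (Solver.fromℕ-suc R N)) (trans (distribʳ _ _ _)
        (trans (+-congˡ (go e N)) (trans (sym (distribʳ _ _ _)) (*-congʳ (sym (Solver.fromℕ-suc R e))))))
    unpick : ∀ e c → pick e N c ≈ pick e N 1# * c
    unpick e c = trans (pick-cong e N (sym (*-identityʳ c))) (trans (pick-* e N c 1#) (*-comm _ _))
    at : ∀ n → fromℤ (+ 8) * fromℕ N * f n + f n ≈ pick (trs n) N (sg n * weighted (2 ℕ.+ i) a (odd n))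
    at n = begin
      fromℤ (+ 8) * fromℕ N * f n + f n
        ≈⟨ +-cong (*-congˡ (unpick (trs n) _)) (unpick (trs n) _) ⟩
      fromℤ (+ 8) * fromℕ N * (I * c) + I * c
        ≈⟨ solve 3 (λ k i c → k :* (i :* c) :+ i :* c := (k :* i :+ i) :* c) (fromℤ (+ 8) * fromℕ N) I c ⟩
      (fromℤ (+ 8) * fromℕ N * I + I) * c
        ≈⟨ *-congʳ (trans (+-congʳ (hit (trs n))) (trans (+-congˡ (sym (*-identityˡ I))) (trans (sym (distribʳ _ _ _)) (*-congʳ (weight n))))) ⟩
      fromℤ (odd n) ^ 2 * I * c
        ≈⟨ solve 5 (λ x i s w z → x :^ 2 :* i :* (s :* (w :* z)) := i :* (s :* (x :* (x :* w) :* z)))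
             (fromℤ (odd n)) I (sg n) (fromℤ (odd n) ^ i) (char a (odd n)) ⟩
      I * (sg n * weighted (2 ℕ.+ i) a (odd n))
        ≈⟨ sym (unpick (trs n) _) ⟩
      pick (trs n) N (sg n * weighted (2 ℕ.+ i) a (odd n)) ∎
      where
      I c : Carrier
      I = pick (trs n) N 1#
      c = sg n * weighted i a (odd n)

  module _ (n : ℤ) (period : zpow n ≈ 1#) where
    p-periodic : ∀ i a → p i (a ℤ.+ n) ≋ p i a
    p-periodic i a = Θ-cong λ u → *-congˡ {x = fromℤ u ^ i} (begin
      zpow ((a ℤ.+ n) ℤ.* u)              ≈⟨ zpow-cong (solveℤ 3 (λ a n u → (a ⊹ n) ⊗ u ≔ a ⊗ u ⊹ n ⊗ u) a n u) ⟩
      zpow (a ℤ.* u ℤ.+ n ℤ.* u)          ≈⟨ zpow-+ (a ℤ.* u) (n ℤ.* u) ⟩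
      zpow (a ℤ.* u) * zpow (n ℤ.* u)     ≈⟨ trans (*-congˡ (mult u)) (*-identityʳ _) ⟩
      zpow (a ℤ.* u)                      ∎)
      where
      multⁿ : ∀ k → zpow (n ℤ.* + k) ≈ 1#
      multⁿ zero    = zpow-cong (ℤP.*-zeroʳ n)
      multⁿ (suc k) = trans (zpow-cong (solveℤ 2 (λ n k → n ⊗ (₁ ⊹ k) ≔ n ⊹ n ⊗ k) n (+ k)))
        (trans (zpow-+ n (n ℤ.* + k)) (trans (*-cong period (multⁿ k)) (*-identityˡ 1#)))
      mult : ∀ u → zpow (n ℤ.* u) ≈ 1#
      mult (+ k) = multⁿ k
      mult -[1+ k ] = begin
        zpow (n ℤ.* -[1+ k ])                                   ≈⟨ sym (*-identityʳ _) ⟩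
        zpow (n ℤ.* -[1+ k ]) * 1#                              ≈⟨ *-congˡ (sym (multⁿ (suc k))) ⟩
        zpow (n ℤ.* -[1+ k ]) * zpow (n ℤ.* + suc k)            ≈⟨ sym (zpow-+ (n ℤ.* -[1+ k ]) (n ℤ.* + suc k)) ⟩
        zpow (n ℤ.* -[1+ k ] ℤ.+ n ℤ.* + suc k)                 ≈⟨ zpow-cong (solveℤ 2 (λ n k → n ⊗ (⁻ (₁ ⊹ k)) ⊹ n ⊗ (₁ ⊹ k) ≔ n ⊝ n) n (+ k)) ⟩
        zpow (n ℤ.- n)                                          ≈⟨ zpow-cong (ℤP.+-inverseʳ n) ⟩
        1# ∎

-- Coloured partitions into distinct parts

-- Coloured integers are numbered by v in increasing order, and `level v`, the quotient of v by the
-- number of colours, is the integer value. The interface serves one colour, for the triple product,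
-- and fifteen colours.
record Levels : Set where
  field
    colours      : ℕ
    level        : ℕ → ℕ
    level-zero   : ∀ v → v < colours → level v ≡ 0
    level-suc    : ∀ v → level (v ℕ.+ colours) ≡ suc (level v)

  level-block : ∀ j v → level (v ℕ.+ j ℕ.* colours) ≡ j ℕ.+ level v
  level-block zero    v = ≡.cong level (ℕP.+-identityʳ v)
  level-block (suc j) v = ≡.trans
    (≡.cong level (≡.trans (≡.cong (v ℕ.+_) (ℕP.+-comm colours (j ℕ.* colours))) (≡.sym (ℕP.+-assoc v _ colours))))
    (≡.trans (level-suc (v ℕ.+ j ℕ.* colours)) (≡.cong suc (level-block j v)))

module Coloured (R : CommutativeRing 0ℓ 0ℓ) (L : Levels) where
  open Levels L renaming (colours to k)
  open CommutativeRing R hiding (zero)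
  open Solver R using (_^_; ^-cong; fromℤ)
  open FiniteSums R
  open Series R
  open Lattice R
  private
    module 𝕊 = CommutativeRing ring𝕊
    module Σ𝕊 = FiniteSums ring𝕊
    module 𝕊𝕊 = Series ring𝕊
  open Solver ring𝕊 using () renaming (_^_ to _^ˢ_; ^-cong to ^ˢ-cong)
  open Solver ring𝕊 using (solve; _:+_; _:*_; _:-_; :-_; _:^_; _:=_; :0; :1; :c)

  -- A M ℓ is the generating function by weight of the strictly decreasing
  -- sequences of length ℓ with entries v < M, where v has weight level v.
  A : ℕ → ℕ → Ser
  A zero    zero    = 𝟙
  A zero    (suc ℓ) = 𝟘
  A (suc M) zero    = A M zero
  A (suc M) (suc ℓ) = A M (suc ℓ) ⊞ sh (level M) (A M ℓ)

  A-0 : ∀ M → A M 0 ≋ 𝟙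
  A-0 zero    = 𝕊.refl
  A-0 (suc M) = A-0 M

  sh-𝟘 : ∀ j {a} → a ≋ 𝟘 → sh j a ≋ 𝟘
  sh-𝟘 zero    e n       = e n
  sh-𝟘 (suc j) e zero    = refl
  sh-𝟘 (suc j) e (suc n) = sh-𝟘 j e n

  A-long : ∀ M ℓ → M < ℓ → A M ℓ ≋ 𝟘
  A-long zero    (suc ℓ) p       = 𝕊.refl
  A-long (suc M) (suc ℓ) (s≤s p) = 𝕊.trans (𝕊.+-cong (A-long M (suc ℓ) (ℕP.m≤n⇒m≤1+n p)) (sh-𝟘 (level M) (A-long M ℓ p))) (𝕊.+-identityˡ 𝟘)

  -- At most k of the distinct entries have level zero, and every other one weighs at least 1.
  A-O : ∀ M ℓ → A M ℓ ∈O ℓ ∸ k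
  A-O zero    zero    i p = ⊥-elim (ℕP.n≮0 (≡.subst (i <_) (ℕP.0∸n≡0 k) p))
    where open import Data.Empty using (⊥-elim)
  A-O zero    (suc ℓ) i p = refl
  A-O (suc M) zero    = A-O M zero
  A-O (suc M) (suc ℓ) with M ℕ.<? k
  ... | no M≮k = O-⊞ {A M (suc ℓ)} (A-O M (suc ℓ)) (O-mono {sh (level M) (A M ℓ)} lem (O-sh (level M) (A-O M ℓ)))
    where
    pos : 1 ≤ level M
    pos = ≡.subst (1 ≤_) (≡.trans (≡.sym (level-suc (M ∸ k))) (≡.cong level (ℕP.m∸n+n≡m (ℕP.≮⇒≥ M≮k)))) (s≤s z≤n)
    lem : suc ℓ ∸ k ≤ level M ℕ.+ (ℓ ∸ k)
    lem = ℕP.≤-trans (ℕP.≤-trans (sub ℓ k) (ℕP.≤-refl)) (ℕP.+-monoˡ-≤ (ℓ ∸ k) pos)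
      where
      sub : ∀ ℓ k → suc ℓ ∸ k ≤ suc (ℓ ∸ k)
      sub ℓ zero          = ℕP.≤-refl
      sub zero (suc k)    = ℕP.≤-trans (ℕP.≤-reflexive (ℕP.0∸n≡0 k)) z≤n
      sub (suc ℓ) (suc k) = sub ℓ k
  ... | yes M<k with ℓ ℕ.≤? M
  ...   | yes ℓ≤M = λ i p → ⊥-elim (ℕP.n≮0 (≡.subst (i <_) (ℕP.m≤n⇒m∸n≡0 (ℕP.≤-trans (s≤s ℓ≤M) M<k)) p))
    where open import Data.Empty using (⊥-elim)
  ...   | no ℓ≰M = O-⊞ {A M (suc ℓ)} (A-O M (suc ℓ)) (λ i p → sh-𝟘 (level M) (A-long M ℓ (ℕP.≰⇒> ℓ≰M)) i)

  A-stable : ∀ r w ℓ i → i ≤ w → A (r ℕ.+ suc w ℕ.* k) ℓ i ≈ A (suc w ℕ.* k) ℓ i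
  A-stable zero    w ℓ       i p = refl
  A-stable (suc r) w zero    i p = A-stable r w zero i p
  A-stable (suc r) w (suc ℓ) i p = trans (+-cong (A-stable r w (suc ℓ) i p)
    (O-sh (level (r ℕ.+ suc w ℕ.* k)) {N = 0} (λ _ ()) i
      (ℕP.≤-trans (s≤s p) (ℕP.≤-trans (ℕP.≤-trans (ℕP.m≤m+n (suc w) (level r)) (ℕP.≤-reflexive (≡.sym (level-block (suc w) r)))) (ℕP.m≤m+n _ 0)))))
    (+-identityʳ _)

  A∞ : ℕ → Ser
  A∞ ℓ n = A (suc n ℕ.* k) ℓ n

  A∞-at : ∀ r w ℓ i → i ≤ w → A (r ℕ.+ suc w ℕ.* k) ℓ i ≈ A∞ ℓ i
  A∞-at r w ℓ i i≤w = trans (A-stable r w ℓ i i≤w) (trans (reflexive (≡.cong (λ M → A M ℓ i) split)) (A-stable ((w ∸ i) ℕ.* k) i ℓ i ℕP.≤-refl))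
    where
    split : suc w ℕ.* k ≡ (w ∸ i) ℕ.* k ℕ.+ suc i ℕ.* k
    split = ≡.trans (≡.cong (ℕ._* k) (≡.sym (≡.trans (ℕP.+-suc (w ∸ i) i) (≡.cong suc (ℕP.m∸n+n≡m i≤w))))) (ℕP.*-distribʳ-+ k (w ∸ i) (suc i))

  A∞-O : ∀ ℓ → A∞ ℓ ∈O ℓ ∸ k
  A∞-O ℓ i p = A-O (suc i ℕ.* k) ℓ i p

  A∞-0 : A∞ 0 ≋ 𝟙
  A∞-0 n = A-0 (suc n ℕ.* k) n

  -- The substitution z ↦ qz on the coefficients of z^ℓ: each of the ℓ entries rises by one level.
  δ : (ℕ → Ser) → ℕ → Ser
  δ a ℓ = q^ ℓ ⊠ a ℓ

  -- P_{M+k}(z) = P_k(z) P_M(qz) for P_M(z) = Σ A M ℓ z^ℓ.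
  A-recurrence : ∀ M ℓ → A (M ℕ.+ k) ℓ ≋ Σ𝕊.sum (suc k) (λ i → A k i ⊠ 𝕊𝕊.sh i (δ (A M)) ℓ)
  A-recurrence zero ℓ = 𝕊.sym (go (suc k) (A k) ℓ (λ i p → A-long k i p))
    where
    head : ∀ ℓ → δ (A 0) (suc ℓ) ≋ 𝟘
    head ℓ = 𝕊.zeroʳ (q^ (suc ℓ))
    go : ∀ K (b : ℕ → Ser) ℓ → (∀ i → K ≤ i → b i ≋ 𝟘) → Σ𝕊.sum K (λ i → b i ⊠ 𝕊𝕊.sh i (δ (A 0)) ℓ) ≋ b ℓ
    go zero    b ℓ z = 𝕊.sym (z ℓ z≤n)
    go (suc K) b zero z = 𝕊.trans (𝕊.+-cong (𝕊.trans (𝕊.*-congˡ (𝕊.*-identityˡ 𝟙)) (𝕊.*-identityʳ _)) (Σ𝕊.sum-0 K (λ i _ → 𝕊.zeroʳ _))) (𝕊.+-identityʳ _)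
    go (suc K) b (suc ℓ) z = 𝕊.trans (𝕊.+-cong (𝕊.trans (𝕊.*-congˡ (head ℓ)) (𝕊.zeroʳ _)) (go K (λ i → b (suc i)) ℓ (λ i p → z (suc i) (s≤s p)))) (𝕊.+-identityˡ _)
  A-recurrence (suc M) zero = 𝕊.trans (A-recurrence M zero) (Σ𝕊.sum-cong (suc k) (λ i → 𝕊.*-congˡ {x = A k i} (same i)))
    where
    same : ∀ i → 𝕊𝕊.sh i (δ (A M)) zero ≋ 𝕊𝕊.sh i (δ (A (suc M))) zero
    same zero    = 𝕊.refl
    same (suc i) = 𝕊.refl
  A-recurrence (suc M) (suc ℓ) = 𝕊.trans (𝕊.+-cong (A-recurrence M (suc ℓ))
      (𝕊.trans (sh-cong (level (M ℕ.+ k)) (A-recurrence M ℓ)) (𝕊.trans (𝕊.sym (q^-⊠ (level (M ℕ.+ k)) _)) (𝕊.sym (Σ𝕊.sum-*ˡ (suc k) (q^ (level (M ℕ.+ k))) (λ i → A k i ⊠ 𝕊𝕊.sh i (δ (A M)) ℓ))))))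
    (𝕊.trans (𝕊.sym (Σ𝕊.sum-+ (suc k) (λ i → A k i ⊠ 𝕊𝕊.sh i (δ (A M)) (suc ℓ)) (λ i → q^ (level (M ℕ.+ k)) ⊠ (A k i ⊠ 𝕊𝕊.sh i (δ (A M)) ℓ))))
    (Σ𝕊.sum-cong (suc k) (λ i → 𝕊.trans
      (solve 4 (λ a x q y → a :* x :+ q :* (a :* y) := a :* (x :+ q :* y)) (A k i) (𝕊𝕊.sh i (δ (A M)) (suc ℓ)) (q^ (level (M ℕ.+ k))) (𝕊𝕊.sh i (δ (A M)) ℓ))
      (𝕊.*-congˡ {x = A k i} (step i ℓ)))))
    where
    Q : Ser
    Q = q^ (level (M ℕ.+ k))
    Q≋ : Q ≋ q^ 1 ⊠ q^ (level M)
    Q≋ = 𝕊.trans (𝕊.reflexive (≡.cong q^ (level-suc M))) (q^-+ 1 (level M))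
    base : ∀ ℓ → δ (A M) (suc ℓ) ⊞ Q ⊠ δ (A M) ℓ ≋ δ (A (suc M)) (suc ℓ)
    base ℓ = 𝕊.trans (𝕊.+-congˡ (𝕊.*-congʳ Q≋)) (𝕊.trans (𝕊.+-cong (𝕊.*-congʳ (q^-+ 1 ℓ)) 𝕊.refl)
      (𝕊.trans (solve 5 (λ q x a l b → q :* x :* a :+ q :* l :* (x :* b) := q :* x :* (a :+ l :* b)) (q^ 1) (q^ ℓ) (A M (suc ℓ)) (q^ (level M)) (A M ℓ))
      (𝕊.*-cong (𝕊.sym (q^-+ 1 ℓ)) (𝕊.+-congˡ (q^-⊠ (level M) (A M ℓ))))))
    step : ∀ i ℓ → 𝕊𝕊.sh i (δ (A M)) (suc ℓ) ⊞ Q ⊠ 𝕊𝕊.sh i (δ (A M)) ℓ ≋ 𝕊𝕊.sh i (δ (A (suc M))) (suc ℓ)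
    step zero          ℓ       = base ℓ
    step (suc zero)    zero    = 𝕊.trans (𝕊.+-congˡ (𝕊.zeroʳ Q)) (𝕊.+-identityʳ _)
    step (suc (suc i)) zero    = 𝕊.trans (𝕊.+-congˡ (𝕊.zeroʳ Q)) (𝕊.+-identityʳ _)
    step (suc i)       (suc ℓ) = step i ℓ

  coeff-sum : ∀ n (f : ℕ → Ser) N → Σ𝕊.sum n f N ≈ sum n (λ i → f i N)
  coeff-sum zero    f N = refl
  coeff-sum (suc n) f N = +-congˡ (coeff-sum n (λ i → f (suc i)) N)

  b : ℕ → Ser
  b = A k

  A∞-recurrence : ∀ ℓ → A∞ ℓ ≋ Σ𝕊.sum (suc k) (λ i → b i ⊠ 𝕊𝕊.sh i (δ A∞) ℓ)
  A∞-recurrence ℓ n = trans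
    (trans (sym (A∞-at k n ℓ n ℕP.≤-refl)) (reflexive (≡.cong (λ M → A M ℓ n) (ℕP.+-comm k (suc n ℕ.* k)))))
    (trans (A-recurrence (suc n ℕ.* k) ℓ n) (trans (coeff-sum (suc k) (λ i → b i ⊠ 𝕊𝕊.sh i (δ (A (suc n ℕ.* k))) ℓ) n)
    (trans (sum-cong (suc k) (λ i → ⊠-cong≤ n {a = b i} (λ _ _ → refl) (λ j j≤n → at i ℓ j j≤n)))
    (sym (coeff-sum (suc k) (λ i → b i ⊠ 𝕊𝕊.sh i (δ A∞) ℓ) n)))))
    where
    at : ∀ i ℓ j → j ≤ n → 𝕊𝕊.sh i (δ (A (suc n ℕ.* k))) ℓ j ≈ 𝕊𝕊.sh i (δ A∞) ℓ j
    at zero    ℓ       j p = ⊠-cong≤ j {a = q^ ℓ} (λ _ _ → refl) (λ i i≤j → A∞-at 0 n ℓ i (ℕP.≤-trans i≤j p))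
    at (suc i) zero    j p = refl
    at (suc i) (suc ℓ) j p = at i ℓ j p

  -- The coefficient of z^s in the product of (1 + z q^j)^k (1 + q^(j+1)/z)^k over j ≥ 0. At s = 0
  -- both rows have the same length m and q^m counts the columns, so `Cs 0` is the generating
  -- function of the Frobenius partitions.
  Cs : ℕ → Ser
  Cs s = Σ∞ 0 (λ m → A∞ (m ℕ.+ s) ⊠ δ A∞ m)

  δ-O : ∀ a m → δ a m ∈O m
  δ-O a m = O-q^ m (a m)

  summable : ∀ (f : ℕ → Ser) → (∀ m → f m ∈O m) → Summable 0 f
  summable f o l n p = o l n (≡.subst (_< l) (ℕP.+-identityʳ n) p)

  Σ𝕊-Σ∞ : ∀ n (f : ℕ → ℕ → Ser) → Σ∞ 0 (λ m → Σ𝕊.sum n (λ i → f i m)) ≋ Σ𝕊.sum n (λ i → Σ∞ 0 (f i))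
  Σ𝕊-Σ∞ n f N = trans (sum-cong (suc (N ℕ.+ 0)) (λ m → coeff-sum n (λ i → f i m) N))
    (trans (sum-swap (suc (N ℕ.+ 0)) n (λ m i → f i m N)) (sym (coeff-sum n (λ i → Σ∞ 0 (f i)) N)))

  module _ (palindromic : ∀ i j → i ℕ.+ j ≡ k → b i ≋ b j) where

    reverse : ∀ n (f : ℕ → Ser) → Σ𝕊.sum (suc n) f ≋ Σ𝕊.sum (suc n) (λ i → f (n ∸ i))
    reverse zero    f = 𝕊.refl
    reverse (suc n) f = 𝕊.trans (Σ𝕊.sum-last (suc n) f) (𝕊.trans (𝕊.+-comm _ _) (𝕊.+-congˡ (reverse n f)))

    private
      common : ℕ → ℕ → ℕ → Ser
      common s i m = b i ⊠ (q^ (i ℕ.+ m ℕ.+ s) ⊠ A∞ (i ℕ.+ m ℕ.+ s) ⊠ δ A∞ m)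

    C-lhs : ∀ s → Cs (s ℕ.+ k) ≋ Σ𝕊.sum (suc k) (λ i → Σ∞ 0 (common s i))
    C-lhs s = 𝕊.trans (Σ∞-cong 0 (λ m → 𝕊.trans (𝕊.*-congʳ (𝕊.trans (A∞-recurrence (m ℕ.+ (s ℕ.+ k))) (reverse k (λ i → b i ⊠ 𝕊𝕊.sh i (δ A∞) (m ℕ.+ (s ℕ.+ k))))))
        (𝕊.trans (𝕊.sym (Σ𝕊.sum-*ʳ (suc k) (δ A∞ m) (λ i → b (k ∸ i) ⊠ 𝕊𝕊.sh (k ∸ i) (δ A∞) (m ℕ.+ (s ℕ.+ k)))))
        (Σ𝕊.sum-cong< (suc k) (λ i i<k → entry m i (ℕP.≤-pred i<k))))))
      (Σ𝕊-Σ∞ (suc k) (common s))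
      where
      entry : ∀ m i → i ≤ k → b (k ∸ i) ⊠ 𝕊𝕊.sh (k ∸ i) (δ A∞) (m ℕ.+ (s ℕ.+ k)) ⊠ δ A∞ m ≋ common s i m
      entry m i i≤k = 𝕊.trans (𝕊.*-congʳ (𝕊.*-cong (palindromic (k ∸ i) i (ℕP.m∸n+n≡m i≤k)) (𝕊.reflexive
        (≡.trans (≡.cong (𝕊𝕊.sh (k ∸ i) (δ A∞)) index) (𝕊𝕊.sh-at (k ∸ i) (δ A∞) (i ℕ.+ m ℕ.+ s))))))
        (𝕊.*-assoc (b i) _ _)
        where
        index : m ℕ.+ (s ℕ.+ k) ≡ (k ∸ i) ℕ.+ (i ℕ.+ m ℕ.+ s)
        index = ≡.trans (≡.trans (≡.sym (ℕP.+-assoc m s k)) (ℕP.+-comm (m ℕ.+ s) k))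
          (≡.trans (≡.cong (ℕ._+ (m ℕ.+ s)) (≡.sym (ℕP.m∸n+n≡m i≤k))) (≡.trans (ℕP.+-assoc (k ∸ i) i (m ℕ.+ s)) (≡.cong ((k ∸ i) ℕ.+_) (≡.sym (ℕP.+-assoc i m s)))))

    C-rhs : ∀ s → q^ s ⊠ Cs s ≋ Σ𝕊.sum (suc k) (λ i → Σ∞ 0 (common s i))
    C-rhs s = 𝕊.trans (𝕊.*-comm (q^ s) (Cs s)) (𝕊.trans (Σ∞-⊠ 0 (λ m → A∞ (m ℕ.+ s) ⊠ δ A∞ m) (q^ s) (summable (λ m → A∞ (m ℕ.+ s) ⊠ δ A∞ m) (λ m → O-⊠ʳ (A∞ (m ℕ.+ s)) (δ-O A∞ m))))
      (𝕊.trans (Σ∞-cong 0 (λ m → 𝕊.trans (𝕊.*-congʳ (𝕊.*-congˡ (𝕊.*-congˡ (A∞-recurrence m))))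
          (𝕊.trans (solve 4 (λ a q x t → a :* (q :* x) :* t := a :* q :* t :* x) (A∞ (m ℕ.+ s)) (q^ m) (Σ𝕊.sum (suc k) (λ i → b i ⊠ 𝕊𝕊.sh i (δ A∞) m)) (q^ s))
            (𝕊.sym (Σ𝕊.sum-*ˡ (suc k) (pre m) (λ i → b i ⊠ 𝕊𝕊.sh i (δ A∞) m))))))
      (𝕊.trans (Σ𝕊-Σ∞ (suc k) g) (Σ𝕊.sum-cong (suc k) shifted))))
      where
      pre : ℕ → Ser
      pre m = A∞ (m ℕ.+ s) ⊠ q^ m ⊠ q^ s
      g : ℕ → ℕ → Ser
      g i m = pre m ⊠ (b i ⊠ 𝕊𝕊.sh i (δ A∞) m)
      vanish : ∀ i m → m < i → 𝕊𝕊.sh i (δ A∞) m ≋ 𝟘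
      vanish (suc i) zero    p       = 𝕊.refl
      vanish (suc i) (suc m) (s≤s p) = vanish i m p
      shifted : ∀ i → Σ∞ 0 (g i) ≋ Σ∞ 0 (common s i)
      shifted i = 𝕊.trans
        (Σ∞-shift 0 (g i) (summable (g i) (λ m → O-⊠ˡ (b i ⊠ 𝕊𝕊.sh i (δ A∞) m) (O-cong (𝕊.trans (𝕊.*-congˡ (𝕊.*-comm (q^ s) _)) (solve 3 (λ q a t → q :* (a :* t) := a :* q :* t) (q^ m) (A∞ (m ℕ.+ s)) (q^ s))) (O-q^ m (q^ s ⊠ A∞ (m ℕ.+ s))))))
          i (λ m m<i → 𝕊.trans (𝕊.*-congˡ (𝕊.trans (𝕊.*-congˡ (vanish i m m<i)) (𝕊.zeroʳ _))) (𝕊.zeroʳ _)))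
        (Σ∞-cong 0 (λ m → 𝕊.trans (𝕊.*-congˡ {x = pre (i ℕ.+ m)} (𝕊.*-congˡ {x = b i} (𝕊.reflexive (𝕊𝕊.sh-at i (δ A∞) m))))
          (𝕊.trans (solve 5 (λ a q t b x → a :* q :* t :* (b :* x) := b :* (q :* t :* a :* x)) (A∞ (i ℕ.+ m ℕ.+ s)) (q^ (i ℕ.+ m)) (q^ s) (b i) (δ A∞ m))
            (𝕊.*-congˡ {x = b i} (𝕊.*-congʳ (𝕊.*-congʳ (𝕊.sym (q^-+ (i ℕ.+ m) s))))))))

    -- The functional equation G(qz) = z^(-k) G(z) of the product, read off in coefficients.
    -- Splitting the factor of level zero off the first row on one side, and off the second row on
    -- the other, gives the same double sum `common`, since the binomial factors are palindromic.
    C-shift : ∀ s → Cs (s ℕ.+ k) ≋ q^ s ⊠ Cs s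
    C-shift s = 𝕊.trans (C-lhs s) (𝕊.sym (C-rhs s))

-- Products over the levels and their Laurent expansion in z.

module Products (R : CommutativeRing 0ℓ 0ℓ) where
  open CommutativeRing R hiding (zero)
  open Series R
  private module 𝕊 = CommutativeRing ring𝕊
  open Solver ring𝕊 using (solve; _:+_; _:*_; _:-_; :-_; _:=_; :0; :1)

  F : ℕ → Ser → Ser
  F zero    Z = 𝟙
  F (suc j) Z = F j Z ⊠ (𝟙 ⊞ Z ⊠ q^ j)

  F-stable : ∀ Z → Stable (λ j → F (suc j) Z)
  F-stable Z = Stable-Π (λ j → F (suc j) Z) (λ _ → Z)
    (λ M → solve 3 (λ f z q → f :* (:1 :+ z :* q) := f :+ f :* (q :* z)) (F (suc M) Z) Z (q^ (suc M)))

module Evaluation (R : CommutativeRing 0ℓ 0ℓ) (L : Levels) where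
  open Levels L renaming (colours to k)
  open CommutativeRing R hiding (zero)
  open Solver R using (_^_; ^-cong; fromℤ)
  open FiniteSums R
  open Series R
  open Lattice R
  open Coloured R L
  open Products R
  open SetoidReasoning setoid
  private
    module 𝕊 = CommutativeRing ring𝕊
    module Σ𝕊 = FiniteSums ring𝕊
  open Solver ring𝕊 using () renaming (_^_ to _^ˢ_; ^-cong to ^ˢ-cong)
  open Solver ring𝕊 using (solve; _:+_; _:*_; _:-_; :-_; _:^_; _:=_; :0; :1; :c)

  P : ℕ → Ser → Ser
  P zero    Z = 𝟙
  P (suc M) Z = P M Z ⊠ (𝟙 ⊞ Z ⊠ q^ (level M))

  P-sum : ∀ M Z B → M < B → P M Z ≋ Σ𝕊.sum B (λ ℓ → Z ^ˢ ℓ ⊠ A M ℓ)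
  P-sum zero    Z (suc B) p = 𝕊.sym (𝕊.trans (𝕊.+-cong (𝕊.*-identityˡ 𝟙) (Σ𝕊.sum-0 B (λ ℓ _ → 𝕊.zeroʳ _))) (𝕊.+-identityʳ 𝟙))
  P-sum (suc M) Z (suc B) (s≤s p) = 𝕊.sym (𝕊.trans
    (𝕊.+-congˡ (𝕊.trans (Σ𝕊.sum-cong B (λ ℓ → 𝕊.trans (𝕊.distribˡ (Z ^ˢ suc ℓ) (A M (suc ℓ)) (sh (level M) (A M ℓ)))
        (𝕊.+-congˡ (𝕊.trans (𝕊.*-congˡ (𝕊.sym (q^-⊠ (level M) (A M ℓ))))
          (solve 4 (λ z y q a → z :* y :* (q :* a) := z :* q :* (y :* a)) Z (Z ^ˢ ℓ) (q^ (level M)) (A M ℓ))))))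
      (𝕊.trans (Σ𝕊.sum-+ B (λ ℓ → Z ^ˢ suc ℓ ⊠ A M (suc ℓ)) (λ ℓ → Z ⊠ q^ (level M) ⊠ (Z ^ˢ ℓ ⊠ A M ℓ)))
        (𝕊.+-congˡ (Σ𝕊.sum-*ˡ B (Z ⊠ q^ (level M)) (λ ℓ → Z ^ˢ ℓ ⊠ A M ℓ))))))
    (𝕊.trans (𝕊.sym (𝕊.+-assoc _ _ _)) (𝕊.trans
      (𝕊.+-cong (𝕊.sym (P-sum M Z (suc B) (ℕP.m≤n⇒m≤1+n p))) (𝕊.*-congˡ (𝕊.sym (P-sum M Z B p))))
      (solve 2 (λ f x → f :+ x :* f := f :* (:1 :+ x)) (P M Z) (Z ⊠ q^ (level M))))))

  P-block : ∀ j Z → P (j ℕ.* k) Z ≋ F j Z ^ˢ k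
  P-block zero    Z = ones k
    where
    ones : ∀ n → 𝟙 ≋ 𝟙 ^ˢ n
    ones zero    = 𝕊.refl
    ones (suc n) = 𝕊.trans (ones n) (𝕊.sym (𝕊.*-identityˡ _))
  P-block (suc j) Z = 𝕊.trans (go k ℕP.≤-refl) (𝕊.trans (𝕊.*-congʳ (P-block j Z)) (𝕊.sym (pow-* k)))
    where
    X : Ser
    X = 𝟙 ⊞ Z ⊠ q^ j
    go : ∀ r → r ≤ k → P (r ℕ.+ j ℕ.* k) Z ≋ P (j ℕ.* k) Z ⊠ X ^ˢ r
    go zero    p = 𝕊.sym (𝕊.*-identityʳ _)
    go (suc r) p = 𝕊.trans (𝕊.*-cong (go r (ℕP.≤-trans (ℕP.n≤1+n r) p)) (𝕊.+-congˡ (𝕊.*-congˡ (𝕊.reflexive (≡.cong q^ lv)))))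
      (solve 3 (λ f y x → f :* y :* x := f :* (x :* y)) (P (j ℕ.* k) Z) (X ^ˢ r) X)
      where
      lv : level (r ℕ.+ j ℕ.* k) ≡ j
      lv = ≡.trans (level-block j r) (≡.trans (≡.cong (j ℕ.+_) (level-zero r p)) (ℕP.+-identityʳ j))
    pow-* : ∀ n → (F j Z ⊠ X) ^ˢ n ≋ F j Z ^ˢ n ⊠ X ^ˢ n
    pow-* zero    = 𝕊.sym (𝕊.*-identityˡ 𝟙)
    pow-* (suc n) = 𝕊.trans (𝕊.*-congˡ (pow-* n)) (solve 4 (λ a b c d → a :* b :* (c :* d) := a :* c :* (b :* d)) (F j Z) X (F j Z ^ˢ n) (X ^ˢ n))

  G : Ser → Ser
  G Z = Σ∞ k (λ ℓ → Z ^ˢ ℓ ⊠ A∞ ℓ)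

  far : ∀ {N l} → N ℕ.+ k < l → N < l ∸ k
  far {N} {l} p = ℕP.≤-trans (ℕP.≤-reflexive (≡.sym (ℕP.m+n∸n≡m (suc N) k))) (ℕP.∸-monoˡ-≤ k p)

  G-summable : ∀ Z → Summable k (λ ℓ → Z ^ˢ ℓ ⊠ A∞ ℓ)
  G-summable Z l n p = O-⊠ʳ (Z ^ˢ l) (A∞-O l) n (far p)

  G-product : ∀ Z → G Z ≋ Lim (λ j → F (suc j) Z ^ˢ k)
  G-product Z N = begin
    G Z N
      ≈⟨ Σ∞-upto k _ (G-summable Z) N B (s≤s (ℕP.m≤n+m (N ℕ.+ k) (suc N ℕ.* k))) ⟩
    sum B (λ ℓ → (Z ^ˢ ℓ ⊠ A∞ ℓ) N)
      ≈⟨ sum-cong B (λ ℓ → ⊠-cong≤ N {a = Z ^ˢ ℓ} (λ _ _ → refl) (λ i i≤N → sym (A∞-at 0 N ℓ i i≤N))) ⟩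
    sum B (λ ℓ → (Z ^ˢ ℓ ⊠ A (suc N ℕ.* k) ℓ) N)
      ≈⟨ sym (coeff-sum B (λ ℓ → Z ^ˢ ℓ ⊠ A (suc N ℕ.* k) ℓ) N) ⟩
    Σ𝕊.sum B (λ ℓ → Z ^ˢ ℓ ⊠ A (suc N ℕ.* k) ℓ) N
      ≈⟨ sym (P-sum (suc N ℕ.* k) Z B (s≤s (ℕP.m≤m+n _ _)) N) ⟩
    P (suc N ℕ.* k) Z N
      ≈⟨ P-block (suc N) Z N ⟩
    (F (suc N) Z ^ˢ k) N ∎
    where
    B : ℕ
    B = suc (suc N ℕ.* k ℕ.+ (N ℕ.+ k))

  Aℤ δℤ : ℤ → Ser
  Aℤ (+ n)    = A∞ n
  Aℤ -[1+ n ] = 𝟘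
  δℤ (+ n)    = δ A∞ n
  δℤ -[1+ n ] = 𝟘

  -- For negative index the value is dictated by the symmetry z ↦ q/z, which exchanges the rows: the
  -- coefficient of z^(-s) is q^s times that of z^s.
  Cℤ : ℤ → Ser
  Cℤ (+ s)    = Cs s
  Cℤ -[1+ s ] = q^ (suc s) ⊠ Cs (suc s)

  C-O : ∀ s → Cs s ∈O s ∸ k
  C-O s N p = sum-0 (suc (N ℕ.+ 0)) (λ m _ → O-⊠ˡ (δ A∞ m) (O-mono (ℕP.∸-monoˡ-≤ k (ℕP.m≤n+m s m)) (A∞-O (m ℕ.+ s))) N p)

  Cℤ-supp : ∀ N → Supp (suc (N ℕ.+ k)) (λ s → Cℤ s N)
  Cℤ-supp N (+ s)    p = C-O s N (far p)
  Cℤ-supp N -[1+ s ] p = O-q^ (suc s) (Cs (suc s)) N (ℕP.≤-trans (s≤s (ℕP.m≤m+n N k)) (ℕP.m≤n⇒m≤1+n p))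

  Aℤ-⊖ : ∀ m s → m < s → Aℤ (m ℤ.⊖ s) ≋ 𝟘
  Aℤ-⊖ zero    (suc s) p       = 𝕊.refl
  Aℤ-⊖ (suc m) (suc s) (s≤s p) = 𝕊.trans (𝕊.reflexive (≡.cong Aℤ (ℤP.[1+m]⊖[1+n]≡m⊖n m s))) (Aℤ-⊖ m s p)

  Cℤ-sum : ∀ s → Σ∞ 0 (λ m → Aℤ (s ℤ.+ + m) ⊠ δ A∞ m) ≋ Cℤ s
  Cℤ-sum (+ s)    = Σ∞-cong 0 (λ m → 𝕊.*-congʳ {x = δ A∞ m} (𝕊.reflexive (≡.cong A∞ (ℕP.+-comm s m))))
  Cℤ-sum -[1+ s ] = 𝕊.trans
    (Σ∞-shift 0 (λ m → Aℤ (m ℤ.⊖ suc s) ⊠ δ A∞ m) (summable _ (λ m → O-⊠ʳ (Aℤ (m ℤ.⊖ suc s)) (δ-O A∞ m))) (suc s)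
      (λ m p → 𝕊.trans (𝕊.*-congʳ (Aℤ-⊖ m (suc s) p)) (𝕊.zeroˡ _)))
    (𝕊.trans (Σ∞-cong 0 (λ m → 𝕊.trans (𝕊.*-cong (𝕊.reflexive (≡.cong Aℤ (index m))) (𝕊.trans (𝕊.*-cong (q^-+ (suc s) m) (𝕊.reflexive (≡.cong A∞ (ℕP.+-comm (suc s) m)))) 𝕊.refl))
        (solve 4 (λ a t q b → a :* (t :* q :* b) := b :* (q :* a) :* t) (A∞ m) (q^ (suc s)) (q^ m) (A∞ (m ℕ.+ suc s)))))
    (𝕊.trans (𝕊.sym (Σ∞-⊠ 0 (λ m → A∞ (m ℕ.+ suc s) ⊠ δ A∞ m) (q^ (suc s)) (summable _ (λ m → O-⊠ʳ (A∞ (m ℕ.+ suc s)) (δ-O A∞ m)))))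
      (𝕊.*-comm _ (q^ (suc s)))))
    where
    index : ∀ m → (suc s ℕ.+ m) ℤ.⊖ suc s ≡ + m
    index m = ≡.trans (ℤP.⊖-≥ (ℕP.m≤m+n (suc s) m)) (≡.cong +_ (ℕP.m+n∸m≡n (suc s) m))

  module _ (z : Unit R) where
    open Unit z renaming (unit to x; inverse to y; unit-inverse to xy)
    open Power x y xy

    C-pow : ∀ c n → C c ^ˢ n ≋ C (c ^ n)
    C-pow c zero    = 𝕊.sym C-1
    C-pow c (suc n) = 𝕊.trans (𝕊.*-congˡ (C-pow c n)) (𝕊.sym (C-* c (c ^ n)))

    zpow-neg : ∀ n → zpow (ℤ.- + n) ≈ y ^ n
    zpow-neg zero    = refl
    zpow-neg (suc n) = refl

    G-at : ∀ N i B → i ≤ N → suc (N ℕ.+ k) ≤ B → G (C x) i ≈ sumℤ B (λ l → zpow l * Aℤ l i)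
    G-at N i B i≤N p = trans (Σ∞-upto k _ (G-summable (C x)) i B (ℕP.≤-trans (s≤s (ℕP.+-monoˡ-≤ k i≤N)) p))
      (trans (sum-cong B (λ l → trans (⊠-cong (C-pow x l) (λ _ → refl) i) (C-⊠ (x ^ l) (A∞ l) i)))
      (sym (sumℤ-nonneg B _ (λ n → zeroʳ _))))

    G'-at : ∀ N i B → i ≤ N → suc (N ℕ.+ k) ≤ B → G (C y ⊠ q^ 1) i ≈ sumℤ B (λ m → zpow (ℤ.- m) * δℤ m i)
    G'-at N i B i≤N p = trans (Σ∞-upto k _ (G-summable (C y ⊠ q^ 1)) i B (ℕP.≤-trans (s≤s (ℕP.+-monoˡ-≤ k i≤N)) p))
      (trans (sum-cong B (λ m → trans (step m i) (*-congʳ (sym (zpow-neg m)))))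
      (sym (sumℤ-nonneg B _ (λ n → zeroʳ _))))
      where
      q-pow : ∀ m → (C y ⊠ q^ 1) ^ˢ m ≋ C (y ^ m) ⊠ q^ m
      q-pow zero    = 𝕊.sym (𝕊.trans (𝕊.*-congʳ C-1) (𝕊.*-identityˡ 𝟙))
      q-pow (suc m) = 𝕊.trans (𝕊.*-congˡ (q-pow m)) (𝕊.trans (solve 4 (λ a b c d → a :* b :* (c :* d) := a :* c :* (b :* d)) (C y) (q^ 1) (C (y ^ m)) (q^ m))
        (𝕊.*-cong (𝕊.sym (C-* y (y ^ m))) (𝕊.sym (q^-+ 1 m))))
      step : ∀ m → (C y ⊠ q^ 1) ^ˢ m ⊠ A∞ m ≋ λ i → y ^ m * δ A∞ m i
      step m = 𝕊.trans (𝕊.*-congʳ (q-pow m)) (𝕊.trans (𝕊.*-assoc (C (y ^ m)) (q^ m) (A∞ m)) (C-⊠ (y ^ m) (δ A∞ m)))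

    -- The Laurent expansion in z of G(z) G(q/z).
    laurent : ∀ N B → suc (N ℕ.+ k) ≤ B → (G (C x) ⊠ G (C y ⊠ q^ 1)) N ≈ sumℤ B (λ s → zpow s * Cℤ s N)
    laurent N B' B₀≤B' = begin
      (G (C x) ⊠ G (C y ⊠ q^ 1)) N
        ≈⟨ ⊠-coeff (G (C x)) (G (C y ⊠ q^ 1)) N ⟩
      sum (suc N) (λ i → G (C x) i * G (C y ⊠ q^ 1) (N ∸ i))
        ≈⟨ sum-cong< (suc N) (λ i p → trans (*-cong (G-at N i B (ℕP.≤-pred p) ℕP.≤-refl) (G'-at N (N ∸ i) B (ℕP.m∸n≤m N i) ℕP.≤-refl))
             (trans (sym (sumℤ-*ʳ B (sumℤ B (λ m → zpow (ℤ.- m) * δℤ m (N ∸ i))) (λ l → zpow l * Aℤ l i)))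
               (sumℤ-cong B (λ l → sym (sumℤ-*ˡ B (zpow l * Aℤ l i) (λ m → zpow (ℤ.- m) * δℤ m (N ∸ i))))))) ⟩
      sum (suc N) (λ i → sumℤ B (λ l → sumℤ B (λ m → f l m i)))
        ≈⟨ sum-sumℤ (suc N) B (λ i l → sumℤ B (λ m → f l m i)) ⟩
      sumℤ B (λ l → sum (suc N) (λ i → sumℤ B (λ m → f l m i)))
        ≈⟨ sumℤ-cong B (λ l → sum-sumℤ (suc N) B (λ i m → f l m i)) ⟩
      sum2 B (λ l m → sum (suc N) (λ i → f l m i))
        ≈⟨ sum2-cong B collect ⟩
      sum2 B g
        ≈⟨ sum2-shear g supp-g ℕP.≤-refl ⟩
      sum2 K (λ s m → g (s ℤ.+ m) m)
        ≈⟨ sumℤ-cong K inner ⟩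
      sumℤ K (λ s → zpow s * Cℤ s N)
        ≈⟨ sumℤ-unique (λ s → zpow s * Cℤ s N) (supp-C K B≤K) (supp-C B' B₀≤B') ⟩
      sumℤ B' (λ s → zpow s * Cℤ s N) ∎
      where
      B K : ℕ
      B = suc (N ℕ.+ k)
      K = suc (suc (B ℕ.+ B))
      B≤K : B ≤ K
      B≤K = ℕP.≤-trans (ℕP.m≤m+n B B) (ℕP.≤-trans (ℕP.n≤1+n _) (ℕP.n≤1+n _))
      f : ℤ → ℤ → ℕ → Carrier
      f l m i = zpow l * Aℤ l i * (zpow (ℤ.- m) * δℤ m (N ∸ i))
      g : ℤ → ℤ → Carrier
      g l m = zpow (l ℤ.- m) * (Aℤ l ⊠ δℤ m) N
      collect : ∀ l m → sum (suc N) (λ i → f l m i) ≈ g l m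
      collect l m = trans (sum-cong (suc N) (λ i → Solver.solve R 4 (λ a b c d → a R* b R* (c R* d) R= a R* c R* (b R* d)) (zpow l) (Aℤ l i) (zpow (ℤ.- m)) (δℤ m (N ∸ i))))
        (trans (sum-*ˡ (suc N) (zpow l * zpow (ℤ.- m)) (λ i → Aℤ l i * δℤ m (N ∸ i)))
          (*-cong (sym (zpow-+ l (ℤ.- m))) (sym (⊠-coeff (Aℤ l) (δℤ m) N))))
        where open Solver R using () renaming (_:*_ to _R*_; _:=_ to _R=_)
      supp-g : Supp2 B g
      supp-g l m p = trans (*-congˡ (zero-at l m p)) (zeroʳ _)
        where
        zero-at : ∀ l m → B ≤ sz l ⊎ B ≤ sz m → (Aℤ l ⊠ δℤ m) N ≈ 0#
        zero-at -[1+ l ] m        _        = 𝕊.zeroˡ (δℤ m) N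
        zero-at (+ l)    -[1+ m ] _        = 𝕊.zeroʳ (A∞ l) N
        zero-at (+ l)    (+ m)    (inj₁ p) = O-⊠ˡ (δ A∞ m) (A∞-O l) N (far p)
        zero-at (+ l)    (+ m)    (inj₂ p) = O-⊠ʳ (A∞ l) (δ-O A∞ m) N (ℕP.≤-trans (s≤s (ℕP.m≤m+n N k)) p)
      supp-C : ∀ K → B ≤ K → Supp K (λ s → zpow s * Cℤ s N)
      supp-C K p s q = trans (*-congˡ (Cℤ-supp N s (ℕP.≤-trans p q))) (zeroʳ _)
      inner : ∀ s → sumℤ K (λ m → g (s ℤ.+ m) m) ≈ zpow s * Cℤ s N
      inner s = begin
        sumℤ K (λ m → zpow (s ℤ.+ m ℤ.- m) * (Aℤ (s ℤ.+ m) ⊠ δℤ m) N)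
          ≈⟨ sumℤ-cong K (λ m → *-congʳ (zpow-cong (solveℤ 2 (λ s m → s ⊹ m ⊝ m ≔ s) s m))) ⟩
        sumℤ K (λ m → zpow s * (Aℤ (s ℤ.+ m) ⊠ δℤ m) N)
          ≈⟨ sumℤ-*ˡ K (zpow s) (λ m → (Aℤ (s ℤ.+ m) ⊠ δℤ m) N) ⟩
        zpow s * sumℤ K (λ m → (Aℤ (s ℤ.+ m) ⊠ δℤ m) N)
          ≈⟨ *-congˡ (sumℤ-nonneg K _ (λ n → 𝕊.zeroʳ (Aℤ (s ℤ.+ -[1+ n ])) N)) ⟩
        zpow s * sum K (λ m → (Aℤ (s ℤ.+ + m) ⊠ δ A∞ m) N)
          ≈⟨ *-congˡ (sym (Σ∞-upto 0 (λ m → Aℤ (s ℤ.+ + m) ⊠ δ A∞ m) (summable _ (λ m → O-⊠ʳ (Aℤ (s ℤ.+ + m)) (δ-O A∞ m))) N K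
               (ℕP.≤-trans (s≤s (ℕP.+-monoʳ-≤ N z≤n)) B≤K))) ⟩
        zpow s * Σ∞ 0 (λ m → Aℤ (s ℤ.+ + m) ⊠ δ A∞ m) N
          ≈⟨ *-congˡ (Cℤ-sum s N) ⟩
        zpow s * Cℤ s N ∎
        where open Solver ℤP.+-*-commutativeRing using () renaming (solve to solveℤ; _:+_ to _⊹_; _:-_ to _⊝_; _:=_ to _≔_)

-- The Jacobi triple product

oneColour : Levels
oneColour = record
  { colours    = 1
  ; level      = λ v → v
  ; level-zero = λ { zero _ → ≡.refl ; (suc v) (s≤s ()) }
  ; level-suc  = λ v → ℕP.+-comm v 1
  }

module TripleProduct (R : CommutativeRing 0ℓ 0ℓ) where
  open IntegerSolver
  open CommutativeRing R hiding (zero)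
  open Solver R using (_^_; ^-cong; fromℤ)
  open FiniteSums R
  open Series R
  open Lattice R
  open Products R
  open Coloured R oneColour
  open Evaluation R oneColour
  open SetoidReasoning setoid
  private
    module 𝕊 = CommutativeRing ring𝕊
    module Σ𝕊 = FiniteSums ring𝕊
  open Solver ring𝕊 using (solve; _:+_; _:*_; _:-_; :-_; _:^_; _:=_; :0; :1; :c)

  -- Π (1 + Z q^i) over 1 ≤ i ≤ j.
  F⁺ : ℕ → Ser → Ser
  F⁺ j Z = F j (Z ⊠ q^ 1)

  e : ℕ → Ser
  e j = F⁺ j (⊟ 𝟙)

  𝓔 : Ser
  𝓔 = Lim e

  F⁺-suc : ∀ Z M → F⁺ (suc M) Z ≋ F⁺ M Z ⊠ (𝟙 ⊞ Z ⊠ q^ (suc M))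
  F⁺-suc Z M = 𝕊.*-congˡ (𝕊.+-congˡ (𝕊.trans (𝕊.*-assoc Z (q^ 1) (q^ M)) (𝕊.*-congˡ (𝕊.sym (q^-+ 1 M)))))

  F⁺-stable : ∀ Z → Stable (λ M → F⁺ M Z)
  F⁺-stable Z = Stable-Π (λ M → F⁺ M Z) (λ _ → Z) (λ M → 𝕊.trans (F⁺-suc Z M)
    (solve 3 (λ f z q → f :* (:1 :+ z :* q) := f :+ f :* (q :* z)) (F⁺ M Z) Z (q^ (suc M))))

  F-head : ∀ j Z → F (suc j) Z ≋ (𝟙 ⊞ Z) ⊠ F⁺ j Z
  F-head zero    Z = solve 1 (λ z → :1 :* (:1 :+ z :* :1) := (:1 :+ z) :* :1) Z
  F-head (suc j) Z = 𝕊.trans (𝕊.*-congʳ (F-head j Z)) (𝕊.trans (𝕊.*-assoc (𝟙 ⊞ Z) (F⁺ j Z) _) (𝕊.*-congˡ (𝕊.sym (F⁺-suc Z j))))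

  -- The number s(s - 1)/2, the least weight of s distinct entries in one colour.
  t : ℕ → ℕ
  t zero    = 0
  t (suc s) = t s ℕ.+ s

  t-T : ∀ m → t (suc m) ≡ tri m
  t-T zero    = ≡.refl
  t-T (suc m) = ≡.trans (≡.cong (ℕ._+ suc m) (t-T m)) (ℕP.+-comm (tri m) (suc m))

  b-one : b 1 ≋ 𝟙
  b-one = 𝕊.+-identityˡ 𝟙

  palindromic : ∀ i j → i ℕ.+ j ≡ 1 → b i ≋ b j
  palindromic zero          (suc zero) _ = 𝕊.sym b-one
  palindromic (suc zero)    zero       _ = b-one
  palindromic (suc zero)    (suc j)    ()
  palindromic (suc (suc i)) j          ()

  A∞-step : ∀ ℓ → A∞ (suc ℓ) ≋ q^ (suc ℓ) ⊠ A∞ (suc ℓ) ⊞ q^ ℓ ⊠ A∞ ℓ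
  A∞-step ℓ = 𝕊.trans (A∞-recurrence (suc ℓ)) (𝕊.+-cong (𝕊.*-identityˡ _)
    (𝕊.trans (𝕊.+-identityʳ _) (𝕊.trans (𝕊.*-congʳ b-one) (𝕊.*-identityˡ _))))

  e-suc : ∀ s → e (suc s) ≋ e s ⊠ (𝟙 ⊞ ⊟ q^ (suc s))
  e-suc s = 𝕊.trans (F⁺-suc (⊟ 𝟙) s) (solve 2 (λ f q → f :* (:1 :+ (:- :1) :* q) := f :* (:1 :- q)) (e s) (q^ (suc s)))

  e-A∞ : ∀ s → e s ⊠ A∞ s ≋ q^ (t s)
  e-A∞ zero    = 𝕊.trans (𝕊.*-identityˡ _) A∞-0
  e-A∞ (suc s) = 𝕊.trans (𝕊.*-congʳ (e-suc s)) (𝕊.trans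
    (solve 3 (λ f q a → f :* (:1 :- q) :* a := f :* (a :- q :* a)) (e s) (q^ (suc s)) (A∞ (suc s)))
    (𝕊.trans (𝕊.*-congˡ (𝕊.trans (𝕊.+-congʳ (A∞-step s))
        (solve 2 (λ x y → x :+ y :- x := y) (q^ (suc s) ⊠ A∞ (suc s)) (q^ s ⊠ A∞ s))))
    (𝕊.trans (solve 3 (λ f q a → f :* (q :* a) := f :* a :* q) (e s) (q^ s) (A∞ s))
    (𝕊.trans (𝕊.*-congʳ (e-A∞ s)) (𝕊.sym (q^-+ (t s) s))))))

  A∞-order : ∀ s → A∞ s ∈O t s
  A∞-order zero i ()
  A∞-order (suc s) = go
    where
    Y-O : q^ s ⊠ A∞ s ∈O t s ℕ.+ s
    Y-O = O-cong (𝕊.sym (q^-⊠ s (A∞ s))) (O-mono (ℕP.≤-reflexive (ℕP.+-comm (t s) s)) (O-sh s (A∞-order s)))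
    shifted : ∀ k X i → (∀ j → j < i → X j ≈ 0#) → sh (suc k) X i ≈ 0#
    shifted k       X zero    z = refl
    shifted zero    X (suc i) z = z i ℕP.≤-refl
    shifted (suc k) X (suc i) z = shifted k X i (λ j p → z j (ℕP.m≤n⇒m≤1+n p))
    -- The unknown series occurs on the right of `A∞-step` as well, but multiplied by a positive
    -- power of q, so induction on the coefficient applies.
    upto : ∀ n i → i < n → i < t s ℕ.+ s → A∞ (suc s) i ≈ 0#
    upto (suc n) i (s≤s i≤n) p = trans (A∞-step s i) (trans (+-cong
      (trans (q^-⊠ (suc s) (A∞ (suc s)) i) (shifted s (A∞ (suc s)) i (λ j j<i → upto n j (ℕP.≤-trans j<i i≤n) (ℕP.<-trans j<i p))))
      (Y-O i p)) (+-identityˡ 0#))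
    go : A∞ (suc s) ∈O t s ℕ.+ s
    go i p = upto (suc i) i ℕP.≤-refl p

  Cs-t : ∀ s → Cs s ≋ q^ (t s) ⊠ Cs 0
  Cs-t zero    = 𝕊.sym (𝕊.*-identityˡ _)
  Cs-t (suc s) = 𝕊.trans (𝕊.reflexive (≡.cong Cs (ℕP.+-comm 1 s))) (𝕊.trans (C-shift palindromic s)
    (𝕊.trans (𝕊.*-congˡ (Cs-t s)) (𝕊.trans (solve 3 (λ a b c → a :* (b :* c) := b :* a :* c) (q^ s) (q^ (t s)) (Cs 0))
      (𝕊.*-congʳ (𝕊.sym (q^-+ (t s) s))))))

  t-mono : ∀ m s → t (suc s) ≤ t (suc m ℕ.+ s)
  t-mono zero    s = ℕP.≤-refl
  t-mono (suc m) s = ℕP.≤-trans (t-mono m s) (ℕP.m≤m+n _ _)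

  Cs-head : ∀ s → Σ∞ 0 (λ m → A∞ (suc m ℕ.+ s) ⊠ δ A∞ (suc m)) ∈O t s ℕ.+ s
  Cs-head s N p = sum-0 (suc (N ℕ.+ 0)) (λ m _ → O-⊠ˡ (δ A∞ (suc m)) (O-mono (t-mono m s) (A∞-order (suc m ℕ.+ s))) N p)

  -- This fixes the constant of the triple product. By `Cs-t` the coefficient of z^s is q^(t s)
  -- `Cs 0`; by definition it is `A∞ s`, which is q^(t s) after multiplication by `e s`, plus terms
  -- of order at least t s + s. Comparing, `e s` times `Cs 0` is 1 + O(q^s), and s tends to
  -- infinity.
  euler-coeff : ∀ s n → n < s → (e s ⊠ Cs 0) n ≈ 𝟙 n
  euler-coeff s n n<s = begin
    (e s ⊠ Cs 0) n                          ≡⟨ ≡.sym (sh-at (t s) (e s ⊠ Cs 0) n) ⟩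
    sh (t s) (e s ⊠ Cs 0) (t s ℕ.+ n)       ≈⟨ main (t s ℕ.+ n) ⟩
    (q^ (t s) ⊞ X) (t s ℕ.+ n)              ≈⟨ trans (+-congˡ (X-O (t s ℕ.+ n) (ℕP.+-monoʳ-< (t s) n<s))) (+-identityʳ _) ⟩
    q^ (t s) (t s ℕ.+ n)                    ≡⟨ sh-at (t s) 𝟙 n ⟩
    𝟙 n                                     ∎
    where
    X : Ser
    X = e s ⊠ Σ∞ 0 (λ m → A∞ (suc m ℕ.+ s) ⊠ δ A∞ (suc m))
    X-O : X ∈O t s ℕ.+ s
    X-O = O-⊠ʳ (e s) (Cs-head s)
    main : sh (t s) (e s ⊠ Cs 0) ≋ q^ (t s) ⊞ X
    main = 𝕊.trans (𝕊.sym (q^-⊠ (t s) (e s ⊠ Cs 0))) (𝕊.trans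
      (solve 3 (λ q e c → q :* (e :* c) := e :* (q :* c)) (q^ (t s)) (e s) (Cs 0))
      (𝕊.trans (𝕊.*-congˡ (𝕊.trans (𝕊.sym (Cs-t s)) (Σ∞-suc 0 (λ m → A∞ (m ℕ.+ s) ⊠ δ A∞ m) (summable _ (λ m → O-⊠ʳ (A∞ (m ℕ.+ s)) (δ-O A∞ m))))))
      (𝕊.trans (𝕊.distribˡ (e s) _ _) (𝕊.+-congʳ (𝕊.trans (𝕊.*-congˡ (𝕊.trans (𝕊.*-congˡ (𝕊.trans (𝕊.*-identityˡ _) A∞-0)) (𝕊.*-identityʳ _))) (e-A∞ s))))))

  𝓔-Cs : 𝓔 ⊠ Cs 0 ≋ 𝟙
  𝓔-Cs n = trans (⊠-cong≤ n {a = 𝓔} (λ i i≤n → sym (Lim-at e (F⁺-stable (⊟ 𝟙)) (suc n) i (ℕP.m≤n⇒m≤1+n i≤n))) (λ _ _ → refl))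
    (euler-coeff (suc n) n ℕP.≤-refl)

  tt : ℤ → ℕ
  tt (+ s)    = t s
  tt -[1+ s ] = suc s ℕ.+ t (suc s)

  Cℤ-tt : ∀ s → Cℤ s ≋ q^ (tt s) ⊠ Cs 0
  Cℤ-tt (+ s)    = Cs-t s
  Cℤ-tt -[1+ s ] = 𝕊.trans (𝕊.*-congˡ (Cs-t (suc s))) (𝕊.trans (𝕊.sym (𝕊.*-assoc _ _ _)) (𝕊.*-congʳ (𝕊.sym (q^-+ (suc s) (t (suc s))))))

  tt-trs : ∀ n → tt (n ℤ.+ + 1) ≡ trs n
  tt-trs (+ n)          = ≡.trans (≡.cong t (ℕP.+-comm n 1)) (t-T n)
  tt-trs -[1+ zero ]    = ≡.refl
  tt-trs -[1+ suc n ]   = ≡.cong (suc n ℕ.+_) (t-T n)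

  lat-shifted : ∀ e c a N → Proper e → (lat e c ⊠ a) N ≈ sumℤ (2 ℕ.+ N) (λ n → c n * (q^ (e n) ⊠ a) N)
  lat-shifted e c a N pr = begin
    (lat e c ⊠ a) N
      ≈⟨ ⊠-coeff (lat e c) a N ⟩
    sum (suc N) (λ i → lat e c i * a (N ∸ i))
      ≈⟨ sum-cong< (suc N) (λ i p → trans (*-congʳ (sym (sumℤ-extend (λ n → pick (e n) i (c n)) (lat-supp {e} pr c i) (s≤s (s≤s (ℕP.≤-pred p))))))
           (sym (sumℤ-*ʳ (2 ℕ.+ N) (a (N ∸ i)) (λ n → pick (e n) i (c n))))) ⟩
    sum (suc N) (λ i → sumℤ (2 ℕ.+ N) (λ n → pick (e n) i (c n) * a (N ∸ i)))
      ≈⟨ sum-sumℤ (suc N) (2 ℕ.+ N) (λ i n → pick (e n) i (c n) * a (N ∸ i)) ⟩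
    sumℤ (2 ℕ.+ N) (λ n → sum (suc N) (λ i → pick (e n) i (c n) * a (N ∸ i)))
      ≈⟨ sumℤ-cong (2 ℕ.+ N) (λ n → trans (sum-cong (suc N) (λ i → trans (*-congʳ {x = a (N ∸ i)} (picked (e n) i (c n))) (*-assoc _ _ _)))
           (trans (sum-*ˡ (suc N) (c n) (λ i → q^ (e n) i * a (N ∸ i))) (*-congˡ (sym (⊠-coeff (q^ (e n)) a N))))) ⟩
    sumℤ (2 ℕ.+ N) (λ n → c n * (q^ (e n) ⊠ a) N) ∎
    where
    picked : ∀ e i c → pick e i c ≈ c * q^ e i
    picked zero    zero    c = sym (*-identityʳ c)
    picked zero    (suc i) c = sym (zeroʳ c)
    picked (suc e) zero    c = sym (zeroʳ c)
    picked (suc e) (suc i) c = picked e i c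

  module _ (w : Unit R) where
    open Unit w renaming (unit to x; inverse to y; unit-inverse to xy)
    open Power x y xy

    -- The substitution z = - w² produces the signs of θ₁ and, after division by w, the odd powers
    -- w^(2n + 1).
    w² : Unit R
    w² = record
      { unit = - (x * x)
      ; inverse = - (y * y)
      ; unit-inverse = trans (Solver.solve R 2 (λ x y → (R- (x R* x)) R* (R- (y R* y)) R= x R* y R* (x R* y)) x y)
          (trans (*-cong xy xy) (*-identityˡ 1#)) }
      where open Solver R using () renaming (_:*_ to _R*_; _:=_ to _R=_; :-_ to R-_)

    open Power (Unit.unit w²) (Unit.inverse w²) (Unit.unit-inverse w²) using () renaming (zpow to zpow²)

    zpow²-zpow : ∀ s → zpow² s ≈ sgn s * zpow (s ℤ.+ s)
    zpow²-zpow (+ n)    = go x n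
      where
      go : ∀ x n → (- (x * x)) ^ n ≈ (- 1#) ^ n * x ^ (n ℕ.+ n)
      go x zero    = sym (*-identityˡ 1#)
      go x (suc n) = trans (*-congˡ (go x n)) (trans
        (Solver.solve R 3 (λ x s y → (R- (x R* x)) R* (s R* y) R= (R- R1) R* s R* (x R* (x R* y))) x ((- 1#) ^ n) (x ^ (n ℕ.+ n)))
        (*-congˡ (reflexive (≡.cong (λ k → x ^ suc k) (≡.sym (ℕP.+-suc n n))))))
        where open Solver R using () renaming (_:*_ to _R*_; _:=_ to _R=_; :-_ to R-_; :1 to R1)
    zpow²-zpow -[1+ n ] = trans (go (suc n)) (*-congˡ (reflexive (≡.cong (λ k → y ^ suc k) (ℕP.+-suc n n))))
      where
      open Solver R using () renaming (_:*_ to _R*_; _:=_ to _R=_; :-_ to R-_; :1 to R1)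
      go : ∀ n → (- (y * y)) ^ n ≈ (- 1#) ^ n * y ^ (n ℕ.+ n)
      go zero    = sym (*-identityˡ 1#)
      go (suc n) = trans (*-congˡ (go n)) (trans
        (Solver.solve R 3 (λ x s y → (R- (x R* x)) R* (s R* y) R= (R- R1) R* s R* (x R* (x R* y))) y ((- 1#) ^ n) (y ^ (n ℕ.+ n)))
        (*-congˡ (reflexive (≡.cong (λ k → y ^ suc k) (≡.sym (ℕP.+-suc n n))))))

    theta : Ser
    theta = Θ zpow

    GG : Ser
    GG = G (C (- (x * x))) ⊠ G (C (- (y * y)) ⊠ q^ 1)

    theta-Cs : C y ⊠ GG ≋ theta ⊠ Cs 0
    theta-Cs N = begin
      (C y ⊠ GG) N
        ≈⟨ trans (C-⊠ y GG N) (*-congˡ (laurent w² N B ℕP.≤-refl)) ⟩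
      y * sumℤ B (λ s → zpow² s * Cℤ s N)
        ≈⟨ sym (sumℤ-*ˡ B y (λ s → zpow² s * Cℤ s N)) ⟩
      sumℤ B g
        ≈⟨ sym (sumℤ-shift g (+ 1) supp-g (Supp-cong (λ n → sym (shifted n)) supp-c)) ⟩
      sumℤ (2 ℕ.+ N) (λ n → g (n ℤ.+ + 1))
        ≈⟨ sumℤ-cong (2 ℕ.+ N) shifted ⟩
      sumℤ (2 ℕ.+ N) (λ n → sg n * zpow (odd n) * (q^ (trs n) ⊠ Cs 0) N)
        ≈⟨ sym (lat-shifted trs (λ n → sg n * zpow (odd n)) (Cs 0) N proper-trs) ⟩
      (theta ⊠ Cs 0) N ∎
      where
      B : ℕ
      B = suc (N ℕ.+ 1)
      g : ℤ → Carrier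
      g s = y * (zpow² s * Cℤ s N)
      supp-g : Supp B g
      supp-g s p = trans (*-congˡ (trans (*-congˡ (Cℤ-supp N s p)) (zeroʳ _))) (zeroʳ _)
      supp-c : Supp (2 ℕ.+ N) (λ n → sg n * zpow (odd n) * (q^ (trs n) ⊠ Cs 0) N)
      supp-c n p = trans (*-congˡ (O-q^ (trs n) (Cs 0) N (ℕP.≤-pred (ℕP.≤-trans p (proper-trs n))))) (zeroʳ _)
      shifted : ∀ n → g (n ℤ.+ + 1) ≈ sg n * zpow (odd n) * (q^ (trs n) ⊠ Cs 0) N
      shifted n = begin
        y * (zpow² (n ℤ.+ + 1) * Cℤ (n ℤ.+ + 1) N)
          ≈⟨ *-congˡ (*-cong (zpow²-zpow (n ℤ.+ + 1)) (trans (Cℤ-tt (n ℤ.+ + 1) N) (reflexive (≡.cong (λ k → (q^ k ⊠ Cs 0) N) (tt-trs n))))) ⟩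
        y * (sg n * zpow (n ℤ.+ + 1 ℤ.+ (n ℤ.+ + 1)) * (q^ (trs n) ⊠ Cs 0) N)
          ≈⟨ Solver.solve R 4 (λ y s z c → y R* (s R* z R* c) R= s R* (y R* z) R* c) y (sg n) (zpow (n ℤ.+ + 1 ℤ.+ (n ℤ.+ + 1))) ((q^ (trs n) ⊠ Cs 0) N) ⟩
        sg n * (y * zpow (n ℤ.+ + 1 ℤ.+ (n ℤ.+ + 1))) * (q^ (trs n) ⊠ Cs 0) N
          ≈⟨ *-congʳ (*-congˡ (trans (sym (zpow-pred (n ℤ.+ + 1 ℤ.+ (n ℤ.+ + 1)))) (zpow-cong (solveℤ 1 (λ n → (⁻ ₁) ⊹ (n ⊹ ₁ ⊹ (n ⊹ ₁)) ≔ n ⊹ n ⊹ ₁) n)))) ⟩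
        sg n * zpow (odd n) * (q^ (trs n) ⊠ Cs 0) N ∎
        where open Solver R using () renaming (_:*_ to _R*_; _:=_ to _R=_)

    theta-GG : theta ≋ 𝓔 ⊠ (C y ⊠ GG)
    theta-GG = 𝕊.trans (𝕊.sym (𝕊.*-identityʳ theta)) (𝕊.trans (𝕊.*-congˡ (𝕊.sym 𝓔-Cs))
      (𝕊.trans (solve 3 (λ a e c → a :* (e :* c) := e :* (a :* c)) theta 𝓔 (Cs 0)) (𝕊.*-congˡ (𝕊.sym theta-Cs))))

    Π₁ Π₂ : ℕ → Ser
    Π₁ j = F⁺ j (C (- (x * x)))
    Π₂ j = F⁺ j (C (- (y * y)))

    GG-product : C y ⊠ GG ≋ (C y ⊞ ⊟ C x) ⊠ (Lim Π₁ ⊠ Lim Π₂)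
    GG-product = 𝕊.trans (𝕊.*-congˡ (𝕊.*-cong first second)) (𝕊.trans
      (solve 4 (λ y z a b → y :* ((:1 :+ z) :* a :* b) := (y :+ y :* z) :* (a :* b)) (C y) (C (- (x * x))) (Lim Π₁) (Lim Π₂))
      (𝕊.*-congʳ (𝕊.+-congˡ (𝕊.trans (𝕊.sym (C-* y (- (x * x)))) (𝕊.trans (C-cong (trans
        (Solver.solve R 2 (λ x y → y R* (R- (x R* x)) R= R- (x R* (x R* y))) x y)
        (-‿cong (trans (*-congˡ xy) (*-identityʳ x))))) (C-neg x))))))
      where
      open Solver R using () renaming (_:*_ to _R*_; _:=_ to _R=_; :-_ to R-_)
      first : G (C (- (x * x))) ≋ (𝟙 ⊞ C (- (x * x))) ⊠ Lim Π₁
      first = 𝕊.trans (G-product (C (- (x * x)))) (𝕊.trans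
        (Lim-cong (λ j → 𝕊.trans (𝕊.*-identityʳ _) (F-head j (C (- (x * x))))))
        (Lim-⊠ (λ _ → 𝟙 ⊞ C (- (x * x))) Π₁ (Stable-const _) (F⁺-stable (C (- (x * x))))))
      second : G (C (- (y * y)) ⊠ q^ 1) ≋ Lim Π₂
      second = 𝕊.trans (G-product (C (- (y * y)) ⊠ q^ 1)) (𝕊.trans
        (Lim-cong (λ j → 𝕊.*-identityʳ _)) (λ n → F⁺-stable (C (- (y * y))) n n ℕP.≤-refl))

    -- Jacobi's triple product. The factor 1 - w² of level zero, together with 1/w from the
    -- normalisation, becomes 1/w - w.
    theta-product : theta ≋ (C y ⊞ ⊟ C x) ⊠ Lim (λ j → e j ⊠ (Π₁ j ⊠ Π₂ j))
    theta-product = 𝕊.trans theta-GG (𝕊.trans (𝕊.*-congˡ GG-product) (𝕊.trans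
      (solve 3 (λ e c p → e :* (c :* p) := c :* (e :* p)) 𝓔 (C y ⊞ ⊟ C x) (Lim Π₁ ⊠ Lim Π₂))
      (𝕊.*-congˡ (𝕊.trans (𝕊.*-congˡ (𝕊.sym (Lim-⊠ Π₁ Π₂ (F⁺-stable _) (F⁺-stable _))))
        (𝕊.sym (Lim-⊠ e (λ j → Π₁ j ⊠ Π₂ j) (F⁺-stable _) (Stable-⊠ Π₁ Π₂ (F⁺-stable _) (F⁺-stable _))))))))

-- R[t] / (t² - a t - b).
module QuadraticExtension (R : CommutativeRing 0ℓ 0ℓ) (a b : CommutativeRing.Carrier R) where
  open CommutativeRing R hiding (zero)
  open Solver R using (solve; _:+_; _:*_; _:-_; :-_; _:=_; :0; :1)

  quadratic : CommutativeRing 0ℓ 0ℓ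
  quadratic = record
    { Carrier = Carrier × Carrier
    ; _≈_ = λ x y → proj₁ x ≈ proj₁ y × proj₂ x ≈ proj₂ y
    ; _+_ = λ x y → proj₁ x + proj₁ y , proj₂ x + proj₂ y
    ; _*_ = λ x y → proj₁ x * proj₁ y + b * (proj₂ x * proj₂ y) ,
                    proj₁ x * proj₂ y + proj₂ x * proj₁ y + a * (proj₂ x * proj₂ y)
    ; -_ = λ x → - proj₁ x , - proj₂ x
    ; 0# = 0# , 0#
    ; 1# = 1# , 0#
    ; isCommutativeRing = record
      { isRing = record
        { +-isAbelianGroup = record
          { isGroup = record
            { isMonoid = record
              { isSemigroup = record
                { isMagma = record
                  { isEquivalence = record
                    { refl = refl , refl
                    ; sym = λ e → sym (proj₁ e) , sym (proj₂ e)
                    ; trans = λ e f → trans (proj₁ e) (proj₁ f) , trans (proj₂ e) (proj₂ f) }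
                  ; ∙-cong = λ e f → +-cong (proj₁ e) (proj₁ f) , +-cong (proj₂ e) (proj₂ f) }
                ; assoc = λ x y z → +-assoc _ _ _ , +-assoc _ _ _ }
              ; identity = (λ x → +-identityˡ _ , +-identityˡ _) , (λ x → +-identityʳ _ , +-identityʳ _) }
            ; inverse = (λ x → -‿inverseˡ _ , -‿inverseˡ _) , (λ x → -‿inverseʳ _ , -‿inverseʳ _)
            ; ⁻¹-cong = λ e → -‿cong (proj₁ e) , -‿cong (proj₂ e) }
          ; comm = λ x y → +-comm _ _ , +-comm _ _ }
        ; *-cong = λ e f → +-cong (*-cong (proj₁ e) (proj₁ f)) (*-congˡ (*-cong (proj₂ e) (proj₂ f)))
                         , +-cong (+-cong (*-cong (proj₁ e) (proj₂ f)) (*-cong (proj₂ e) (proj₁ f))) (*-congˡ (*-cong (proj₂ e) (proj₂ f)))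
        ; *-assoc = λ x y z →
            solve 8 (λ a b x u y v z w → (x :* y :+ b :* (u :* v)) :* z :+ b :* ((x :* v :+ u :* y :+ a :* (u :* v)) :* w)
              := x :* (y :* z :+ b :* (v :* w)) :+ b :* (u :* (y :* w :+ v :* z :+ a :* (v :* w))))
              a b (proj₁ x) (proj₂ x) (proj₁ y) (proj₂ y) (proj₁ z) (proj₂ z) ,
            solve 8 (λ a b x u y v z w → (x :* y :+ b :* (u :* v)) :* w :+ (x :* v :+ u :* y :+ a :* (u :* v)) :* z :+ a :* ((x :* v :+ u :* y :+ a :* (u :* v)) :* w)
              := x :* (y :* w :+ v :* z :+ a :* (v :* w)) :+ u :* (y :* z :+ b :* (v :* w)) :+ a :* (u :* (y :* w :+ v :* z :+ a :* (v :* w))))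
              a b (proj₁ x) (proj₂ x) (proj₁ y) (proj₂ y) (proj₁ z) (proj₂ z)
        ; *-identity = (λ x → solve 3 (λ b x u → :1 :* x :+ b :* (:0 :* u) := x) b (proj₁ x) (proj₂ x) ,
                              solve 3 (λ a x u → :1 :* u :+ :0 :* x :+ a :* (:0 :* u) := u) a (proj₁ x) (proj₂ x)) ,
                       (λ x → solve 3 (λ b x u → x :* :1 :+ b :* (u :* :0) := x) b (proj₁ x) (proj₂ x) ,
                              solve 3 (λ a x u → x :* :0 :+ u :* :1 :+ a :* (u :* :0) := u) a (proj₁ x) (proj₂ x))
        ; distrib = (λ x y z →
            solve 7 (λ b x u y v z w → x :* (y :+ z) :+ b :* (u :* (v :+ w)) := x :* y :+ b :* (u :* v) :+ (x :* z :+ b :* (u :* w)))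
              b (proj₁ x) (proj₂ x) (proj₁ y) (proj₂ y) (proj₁ z) (proj₂ z) ,
            solve 7 (λ a x u y v z w → x :* (v :+ w) :+ u :* (y :+ z) :+ a :* (u :* (v :+ w)) := x :* v :+ u :* y :+ a :* (u :* v) :+ (x :* w :+ u :* z :+ a :* (u :* w)))
              a (proj₁ x) (proj₂ x) (proj₁ y) (proj₂ y) (proj₁ z) (proj₂ z)) ,
          (λ x y z →
            solve 7 (λ b x u y v z w → (y :+ z) :* x :+ b :* ((v :+ w) :* u) := y :* x :+ b :* (v :* u) :+ (z :* x :+ b :* (w :* u)))
              b (proj₁ x) (proj₂ x) (proj₁ y) (proj₂ y) (proj₁ z) (proj₂ z) ,
            solve 7 (λ a x u y v z w → (y :+ z) :* u :+ (v :+ w) :* x :+ a :* ((v :+ w) :* u) := y :* u :+ v :* x :+ a :* (v :* u) :+ (z :* u :+ w :* x :+ a :* (w :* u)))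
              a (proj₁ x) (proj₂ x) (proj₁ y) (proj₂ y) (proj₁ z) (proj₂ z)) }
      ; *-comm = λ x y →
          solve 5 (λ b x u y v → x :* y :+ b :* (u :* v) := y :* x :+ b :* (v :* u)) b (proj₁ x) (proj₂ x) (proj₁ y) (proj₂ y) ,
          solve 5 (λ a x u y v → x :* v :+ u :* y :+ a :* (u :* v) := y :* u :+ v :* x :+ a :* (v :* u)) a (proj₁ x) (proj₂ x) (proj₁ y) (proj₂ y) } }

-- Ring homomorphisms

record Hom (R S : CommutativeRing 0ℓ 0ℓ) : Set where
  private
    module R = CommutativeRing R
    module S = CommutativeRing S
  field
    φ      : R.Carrier → S.Carrier
    φ-cong : ∀ {x y} → x R.≈ y → φ x S.≈ φ y
    φ-+    : ∀ x y → φ (x R.+ y) S.≈ φ x S.+ φ y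
    φ-*    : ∀ x y → φ (x R.* y) S.≈ φ x S.* φ y
    φ-neg  : ∀ x → φ (R.- x) S.≈ S.- φ x
    φ-0    : φ R.0# S.≈ S.0#
    φ-1    : φ R.1# S.≈ S.1#

  φ-fromℕ : ∀ n → φ (Solver.fromℕ R n) S.≈ Solver.fromℕ S n
  φ-fromℕ zero          = φ-0
  φ-fromℕ (suc zero)    = φ-1
  φ-fromℕ (suc (suc n)) = S.trans (φ-+ R.1# (Solver.fromℕ R (suc n))) (S.+-cong φ-1 (φ-fromℕ (suc n)))

  φ-fromℤ : ∀ z → φ (Solver.fromℤ R z) S.≈ Solver.fromℤ S z
  φ-fromℤ (+ n)    = φ-fromℕ n
  φ-fromℤ -[1+ n ] = S.trans (φ-neg _) (S.-‿cong (φ-fromℕ (suc n)))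

  φ-^ : ∀ x n → φ (Solver._^_ R x n) S.≈ Solver._^_ S (φ x) n
  φ-^ x zero    = φ-1
  φ-^ x (suc n) = S.trans (φ-* x _) (S.*-congˡ (φ-^ x n))

embed : ∀ (R : CommutativeRing 0ℓ 0ℓ) a b → Hom R (QuadraticExtension.quadratic R a b)
embed R a b = record
  { φ      = λ x → x , 0#
  ; φ-cong = λ e → e , refl
  ; φ-+    = λ x y → refl , sym (+-identityˡ 0#)
  ; φ-*    = λ x y → solve 3 (λ b x y → x :* y := x :* y :+ b :* (:0 :* :0)) b x y
                   , solve 3 (λ a x y → :0 := x :* :0 :+ :0 :* y :+ a :* (:0 :* :0)) a x y
  ; φ-neg  = λ x → refl , solve 0 (:0 := :- :0)
  ; φ-0    = refl , refl
  ; φ-1    = refl , refl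
  }
  where
  open CommutativeRing R
  open Solver R using (solve; _:+_; _:*_; :-_; _:=_; :0)

compose : ∀ {R S T} → Hom S T → Hom R S → Hom R T
compose {R} {S} {T} g f = record
  { φ      = λ x → G.φ (F.φ x)
  ; φ-cong = λ e → G.φ-cong (F.φ-cong e)
  ; φ-+    = λ x y → T.trans (G.φ-cong (F.φ-+ x y)) (G.φ-+ _ _)
  ; φ-*    = λ x y → T.trans (G.φ-cong (F.φ-* x y)) (G.φ-* _ _)
  ; φ-neg  = λ x → T.trans (G.φ-cong (F.φ-neg x)) (G.φ-neg _)
  ; φ-0    = T.trans (G.φ-cong F.φ-0) G.φ-0
  ; φ-1    = T.trans (G.φ-cong F.φ-1) G.φ-1
  }
  where
  module F = Hom f
  module G = Hom g
  module T = CommutativeRing T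

module MapSeries {R S : CommutativeRing 0ℓ 0ℓ} (h : Hom R S) where
  open Hom h
  private
    module R = CommutativeRing R
    module S = CommutativeRing S
    module ΣR = FiniteSums R
    module ΣS = FiniteSums S
    module A = Series R
    module B = Series S
    module LA = Lattice R
    module LB = Lattice S
    module 𝔹 = CommutativeRing B.ring𝕊

  Φ : A.Ser → B.Ser
  Φ a n = φ (a n)

  Φ-cong : ∀ {a b} → a A.≋ b → Φ a B.≋ Φ b
  Φ-cong e n = φ-cong (e n)

  Φ-⊞ : ∀ a b → Φ (a A.⊞ b) B.≋ Φ a B.⊞ Φ b
  Φ-⊞ a b n = φ-+ (a n) (b n)

  Φ-⊠ : ∀ a b → Φ (a A.⊠ b) B.≋ Φ a B.⊠ Φ b
  Φ-⊠ a b zero    = φ-* _ _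
  Φ-⊠ a b (suc n) = S.trans (φ-+ _ _) (S.+-cong (φ-* _ _) (Φ-⊠ (A.tail a) b n))

  Φ-𝟙 : Φ A.𝟙 B.≋ B.𝟙
  Φ-𝟙 zero    = φ-1
  Φ-𝟙 (suc n) = φ-0

  Φ-sh : ∀ k a → Φ (A.sh k a) B.≋ B.sh k (Φ a)
  Φ-sh zero    a n       = S.refl
  Φ-sh (suc k) a zero    = φ-0
  Φ-sh (suc k) a (suc n) = Φ-sh k a n

  Φ-q^ : ∀ k → Φ (A.q^ k) B.≋ B.q^ k
  Φ-q^ k = 𝔹.trans (Φ-sh k A.𝟙) (B.sh-cong k Φ-𝟙)

  hom-series : Hom A.ring𝕊 B.ring𝕊
  hom-series = record
    { φ = Φ ; φ-cong = Φ-cong ; φ-+ = Φ-⊞ ; φ-* = Φ-⊠ ; φ-neg = λ a n → φ-neg (a n) ; φ-0 = λ n → φ-0 ; φ-1 = Φ-𝟙 }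

  Φ-D : ∀ a → Φ (A.D a) B.≋ B.D (Φ a)
  Φ-D a n = S.trans (φ-* _ _) (S.*-congʳ (φ-fromℕ n))

  φ-sum : ∀ n f → φ (ΣR.sum n f) S.≈ ΣS.sum n (λ i → φ (f i))
  φ-sum zero    f = φ-0
  φ-sum (suc n) f = S.trans (φ-+ _ _) (S.+-congˡ (φ-sum n _))

  φ-sgn : ∀ i → φ (LA.sgn i) S.≈ LB.sgn i
  φ-sgn i = go i
    where
    goⁿ : ∀ n → φ (Solver._^_ R (R.- R.1#) n) S.≈ Solver._^_ S (S.- S.1#) n
    goⁿ n = S.trans (φ-^ _ n) (Solver.^-cong S n (S.trans (φ-neg _) (S.-‿cong φ-1)))
    go : ∀ i → φ (LA.sgn i) S.≈ LB.sgn i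
    go (+ n)    = goⁿ n
    go -[1+ n ] = goⁿ (suc n)

  module _ (L : Levels) where
    open Levels L
    private
      module CA = Coloured R L
      module CB = Coloured S L
      module EA = Evaluation R L
      module EB = Evaluation S L

    Φ-A : ∀ M ℓ → Φ (CA.A M ℓ) B.≋ CB.A M ℓ
    Φ-A zero    zero    = Φ-𝟙
    Φ-A zero    (suc ℓ) = λ n → φ-0
    Φ-A (suc M) zero    = Φ-A M zero
    Φ-A (suc M) (suc ℓ) = 𝔹.trans (Φ-⊞ (CA.A M (suc ℓ)) (A.sh (level M) (CA.A M ℓ))) (𝔹.+-cong (Φ-A M (suc ℓ))
      (𝔹.trans (Φ-sh (level M) (CA.A M ℓ)) (B.sh-cong (level M) (Φ-A M ℓ))))

    Φ-A∞ : ∀ ℓ → Φ (CA.A∞ ℓ) B.≋ CB.A∞ ℓ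
    Φ-A∞ ℓ n = Φ-A (suc n ℕ.* colours) ℓ n

    Φ-Cs : ∀ s → Φ (CA.Cs s) B.≋ CB.Cs s
    Φ-Cs s n = S.trans (φ-sum (suc (n ℕ.+ 0)) (λ m → (CA.A∞ (m ℕ.+ s) A.⊠ CA.δ CA.A∞ m) n)) (ΣS.sum-cong (suc (n ℕ.+ 0)) (λ m → term m n))
      where
      term : ∀ m → Φ (CA.A∞ (m ℕ.+ s) A.⊠ CA.δ CA.A∞ m) B.≋ CB.A∞ (m ℕ.+ s) B.⊠ CB.δ CB.A∞ m
      term m = 𝔹.trans (Φ-⊠ (CA.A∞ (m ℕ.+ s)) (CA.δ CA.A∞ m)) (𝔹.*-cong (Φ-A∞ (m ℕ.+ s))
        (𝔹.trans (Φ-⊠ (A.q^ m) (CA.A∞ m)) (𝔹.*-cong (Φ-q^ m) (Φ-A∞ m))))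

    Φ-Cℤ : ∀ s → Φ (EA.Cℤ s) B.≋ EB.Cℤ s
    Φ-Cℤ (+ s)    = Φ-Cs s
    Φ-Cℤ -[1+ s ] = 𝔹.trans (Φ-⊠ (A.q^ (suc s)) (CA.Cs (suc s))) (𝔹.*-cong (Φ-q^ (suc s)) (Φ-Cs (suc s)))

-- Dual numbers and the Euler derivative in z.

module Dual (R : CommutativeRing 0ℓ 0ℓ) where
  open CommutativeRing R hiding (zero)
  open Solver R using (_^_; ^-cong; fromℤ; fromℕ; fromℤ-+; fromℕ-suc; solve; _:+_; _:*_; _:-_; :-_; _:=_; :0; :1)

  Rε : CommutativeRing 0ℓ 0ℓ
  Rε = QuadraticExtension.quadratic R 0# 0#

  private
    module ε = CommutativeRing Rε
    module A = Series R
    module B = Series Rε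
    module ΣA = FiniteSums R
    module ΣB = FiniteSums Rε
    module LA = Lattice R
    module LB = Lattice Rε
    module 𝔸 = CommutativeRing A.ring𝕊
    module 𝔹 = CommutativeRing B.ring𝕊

  lift : Hom R Rε
  lift = embed R 0# 0#

  π₁ π₂ : B.Ser → A.Ser
  π₁ a n = proj₁ (a n)
  π₂ a n = proj₂ (a n)

  π₁-⊠ : ∀ a b → π₁ (a B.⊠ b) A.≋ π₁ a A.⊠ π₁ b
  π₁-⊠ a b zero    = trans (+-congˡ (zeroˡ _)) (+-identityʳ _)
  π₁-⊠ a b (suc n) = +-cong (trans (+-congˡ (zeroˡ _)) (+-identityʳ _)) (π₁-⊠ (B.tail a) b n)

  π₂-⊠ : ∀ a b → π₂ (a B.⊠ b) A.≋ π₁ a A.⊠ π₂ b A.⊞ π₂ a A.⊠ π₁ b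
  π₂-⊠ a b zero    = trans (+-congˡ (zeroˡ _)) (+-identityʳ _)
  π₂-⊠ a b (suc n) = trans (+-cong (trans (+-congˡ (zeroˡ _)) (+-identityʳ _)) (π₂-⊠ (B.tail a) b n))
    (Solver.+-interchange R _ _ _ _)

  open Solver A.ring𝕊 using () renaming (_^_ to _^ᴬ_)
  open Solver B.ring𝕊 using () renaming (_^_ to _^ᴮ_)

  π₁-^ : ∀ a n → π₁ (a ^ᴮ n) A.≋ π₁ a ^ᴬ n
  π₁-^ a zero    = λ { zero → refl ; (suc n) → refl }
  π₁-^ a (suc n) = 𝔸.trans (π₁-⊠ a (a ^ᴮ n)) (𝔸.*-congˡ (π₁-^ a n))

  π₂-^ : ∀ a n → π₂ (a ^ᴮ suc n) A.≋ Solver.fromℕ A.ring𝕊 (suc n) A.⊠ (π₁ a ^ᴬ n A.⊠ π₂ a)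
  π₂-^ a zero = 𝔸.trans (π₂-⊠ a B.𝟙) (𝔸.trans (𝔸.+-cong (𝔸.trans (𝔸.*-congˡ (λ { zero → refl ; (suc n) → refl })) (𝔸.zeroʳ (π₁ a)))
      (𝔸.trans (𝔸.*-congˡ (λ { zero → refl ; (suc n) → refl })) (𝔸.*-identityʳ (π₂ a))))
    (𝔸.trans (𝔸.+-identityˡ _) (𝔸.sym (𝔸.trans (𝔸.*-identityˡ _) (𝔸.*-identityˡ _)))))
  π₂-^ a (suc n) = 𝔸.trans (π₂-⊠ a (a ^ᴮ suc n)) (𝔸.trans (𝔸.+-cong (𝔸.*-congˡ (π₂-^ a n)) (𝔸.*-congˡ (π₁-^ a (suc n))))
    (𝔸.trans (Solver.solve A.ring𝕊 4 (λ x k y z → x ·* (k ·* (y ·* z)) ·+ z ·* (x ·* y) ·= (·1 ·+ k) ·* (x ·* y ·* z)) (π₁ a) (Solver.fromℕ A.ring𝕊 (suc n)) (π₁ a ^ᴬ n) (π₂ a))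
      (𝔸.*-congʳ (𝔸.sym (Solver.fromℕ-suc A.ring𝕊 (suc n))))))
    where open Solver A.ring𝕊 using () renaming (_:*_ to _·*_; _:+_ to _·+_; _:=_ to _·=_; :1 to ·1)

  opaque
    unfolding FiniteSums.sumℤ
    private
      π₁-sum : ∀ n f → proj₁ (ΣB.sum n f) ≈ ΣA.sum n (λ i → proj₁ (f i))
      π₁-sum zero    f = refl
      π₁-sum (suc n) f = +-congˡ (π₁-sum n _)
      π₂-sum : ∀ n f → proj₂ (ΣB.sum n f) ≈ ΣA.sum n (λ i → proj₂ (f i))
      π₂-sum zero    f = refl
      π₂-sum (suc n) f = +-congˡ (π₂-sum n _)
    π₁-sumℤ : ∀ B f → proj₁ (ΣB.sumℤ B f) ≈ ΣA.sumℤ B (λ i → proj₁ (f i))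
    π₁-sumℤ B f = +-cong (π₁-sum B _) (π₁-sum B _)
    π₂-sumℤ : ∀ B f → proj₂ (ΣB.sumℤ B f) ≈ ΣA.sumℤ B (λ i → proj₂ (f i))
    π₂-sumℤ B f = +-cong (π₂-sum B _) (π₂-sum B _)

  π-pick : ∀ e N c → proj₁ (LB.pick e N c) ≈ LA.pick e N (proj₁ c) × proj₂ (LB.pick e N c) ≈ LA.pick e N (proj₂ c)
  π-pick e N c with e ℕ.≡ᵇ N
  ... | true  = refl , refl
  ... | false = refl , refl

  π₁-lat : ∀ e c → π₁ (LB.lat e c) A.≋ LA.lat e (λ n → proj₁ (c n))
  π₁-lat e c N = trans (π₁-sumℤ (2 ℕ.+ N) _) (ΣA.sumℤ-cong (2 ℕ.+ N) (λ n → proj₁ (π-pick (e n) N (c n))))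

  π₂-lat : ∀ e c → π₂ (LB.lat e c) A.≋ LA.lat e (λ n → proj₂ (c n))
  π₂-lat e c N = trans (π₂-sumℤ (2 ℕ.+ N) _) (ΣA.sumℤ-cong (2 ℕ.+ N) (λ n → proj₂ (π-pick (e n) N (c n))))

  -- This is w (1 + ε); since w^i (1 + ε)^i = w^i (1 + iε), the ε-part of an expression in it is its
  -- derivative under w d/dw.
  perturb : Unit R → Unit Rε
  perturb w = record
    { unit = x , x
    ; inverse = y , - y
    ; unit-inverse = trans (solve 2 (λ x y → x :* y :+ :0 :* (x :* :- y) := x :* y) x y) xy
                   , solve 2 (λ x y → x :* (:- y) :+ x :* y :+ :0 :* (x :* :- y) := :0) x y }
    where open Unit w renaming (unit to x; inverse to y; unit-inverse to xy)

  module _ (w : Unit R) where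
    open Unit w renaming (unit to x; inverse to y; unit-inverse to xy)
    open LA.Power x y xy
    private
      module Pε = LB.Power (Unit.unit (perturb w)) (Unit.inverse (perturb w)) (Unit.unit-inverse (perturb w))

    zpow-ε : ∀ i → Pε.zpow i ε.≈ (zpow i , fromℤ i * zpow i)
    zpow-ε (+ n) = go n
      where
      go : ∀ n → Pε.zpow (+ n) ε.≈ (zpow (+ n) , fromℕ n * zpow (+ n))
      go zero    = refl , sym (zeroˡ 1#)
      go (suc n) = ε.trans (ε.*-congˡ {x , x} (go n))
        ( solve 3 (λ x z m → x :* z :+ :0 :* (x :* (m :* z)) := x :* z) x (x ^ n) (fromℕ n)
        , trans (solve 3 (λ x z m → x :* (m :* z) :+ x :* z :+ :0 :* (x :* (m :* z)) := (:1 :+ m) :* (x :* z)) x (x ^ n) (fromℕ n))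
            (*-congʳ (sym (fromℕ-suc n))))
    zpow-ε -[1+ n ] = go n
      where
      go : ∀ n → Pε.zpow -[1+ n ] ε.≈ (zpow -[1+ n ] , fromℤ -[1+ n ] * zpow -[1+ n ])
      go zero    = solve 1 (λ y → y :* :1 :+ :0 :* (:- y :* :0) := y :* :1) y
                 , solve 1 (λ y → y :* :0 :+ :- y :* :1 :+ :0 :* (:- y :* :0) := :- :1 :* (y :* :1)) y
      go (suc n) = ε.trans (ε.*-congˡ {y , - y} (go n))
        ( solve 3 (λ y z m → y :* z :+ :0 :* (:- y :* (m :* z)) := y :* z) y (y ^ suc n) (- fromℕ (suc n))
        , solve 3 (λ y z m → y :* (:- m :* z) :+ :- y :* z :+ :0 :* (:- y :* (:- m :* z)) := :- (:1 :+ m) :* (y :* z)) y (y ^ suc n) (fromℕ (suc n)))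

-- The product for fifteen colours.

fifteenColours : Levels
fifteenColours = record
  { colours    = 15
  ; level      = λ v → v ℕ./ 15
  ; level-zero = λ v → m<n⇒m/n≡0
  ; level-suc  = λ v → ≡.trans (m/n≡1+[m∸n]/n (ℕP.m≤n+m 15 v)) (≡.cong (λ u → suc (u ℕ./ 15)) (ℕP.m+n∸n≡m v 15))
  }

bin : ℕ → ℕ → ℕ
bin zero    zero    = 1
bin zero    (suc ℓ) = 0
bin (suc M) zero    = bin M zero
bin (suc M) (suc ℓ) = bin M (suc ℓ) ℕ.+ bin M ℓ

bin-symmetric : ∀ i → i ≤ 15 → bin 15 i ≡ bin 15 (15 ∸ i)
bin-symmetric 0 _ = ≡.refl
bin-symmetric 1 _ = ≡.refl
bin-symmetric 2 _ = ≡.refl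
bin-symmetric 3 _ = ≡.refl
bin-symmetric 4 _ = ≡.refl
bin-symmetric 5 _ = ≡.refl
bin-symmetric 6 _ = ≡.refl
bin-symmetric 7 _ = ≡.refl
bin-symmetric 8 _ = ≡.refl
bin-symmetric 9 _ = ≡.refl
bin-symmetric 10 _ = ≡.refl
bin-symmetric 11 _ = ≡.refl
bin-symmetric 12 _ = ≡.refl
bin-symmetric 13 _ = ≡.refl
bin-symmetric 14 _ = ≡.refl
bin-symmetric 15 _ = ≡.refl
bin-symmetric (suc (suc (suc (suc (suc (suc (suc (suc (suc (suc (suc (suc (suc (suc (suc (suc i))))))))))))))))
  (s≤s (s≤s (s≤s (s≤s (s≤s (s≤s (s≤s (s≤s (s≤s (s≤s (s≤s (s≤s (s≤s (s≤s (s≤s ())))))))))))))))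

-- The substitution q ↦ q^m.

module Spread (R : CommutativeRing 0ℓ 0ℓ) (m' : ℕ) where
  open CommutativeRing R hiding (zero)
  open FiniteSums R
  open Series R
  open Lattice R
  private module 𝕊 = CommutativeRing ring𝕊

  -- spread c a is q^c a(q^m).
  spread : ℕ → Ser → Ser
  spread zero    a zero    = a 0
  spread (suc c) a zero    = 0#
  spread zero    a (suc n) = spread m' (tail a) n
  spread (suc c) a (suc n) = spread c a n

  spread-cong≤ : ∀ n c {a b} → (∀ i → i ≤ n → a i ≈ b i) → spread c a n ≈ spread c b n
  spread-cong≤ zero    zero    e = e 0 z≤n
  spread-cong≤ zero    (suc c) e = refl
  spread-cong≤ (suc n) zero    e = spread-cong≤ n m' (λ i p → e (suc i) (s≤s p))
  spread-cong≤ (suc n) (suc c) e = spread-cong≤ n c (λ i p → e i (ℕP.m≤n⇒m≤1+n p))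

  spread-0 : ∀ n c → spread c 𝟘 n ≈ 0#
  spread-0 zero    zero    = refl
  spread-0 zero    (suc c) = refl
  spread-0 (suc n) zero    = spread-0 n m'
  spread-0 (suc n) (suc c) = spread-0 n c

  spread-+ : ∀ n c a b → spread c (a ⊞ b) n ≈ spread c a n + spread c b n
  spread-+ zero    zero    a b = refl
  spread-+ zero    (suc c) a b = sym (+-identityˡ 0#)
  spread-+ (suc n) zero    a b = spread-+ n m' (tail a) (tail b)
  spread-+ (suc n) (suc c) a b = spread-+ n c a b

  spread-* : ∀ n c k a → spread c (λ i → k * a i) n ≈ k * spread c a n
  spread-* zero    zero    k a = refl
  spread-* zero    (suc c) k a = sym (zeroʳ k)
  spread-* (suc n) zero    k a = spread-* n m' k (tail a)
  spread-* (suc n) (suc c) k a = spread-* n c k a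

  spread-⊠′ : ∀ n c a b → spread c (a ⊠ b) n ≈ (spread c a ⊠ spread 0 b) n
  spread-⊠′ zero    zero    a b = refl
  spread-⊠′ zero    (suc c) a b = sym (zeroˡ _)
  spread-⊠′ (suc n) zero    a b = trans (spread-+ n m' (λ i → a 0 * tail b i) (tail a ⊠ b))
    (+-cong (spread-* n m' (a 0) (tail b)) (spread-⊠′ n m' (tail a) b))
  spread-⊠′ (suc n) (suc c) a b = trans (spread-⊠′ n c a b) (sym (trans (+-congʳ (zeroˡ _)) (+-identityˡ _)))

  dilation : Ser → Ser
  dilation = spread 0

  dilation-cong : ∀ {a b} → a ≋ b → dilation a ≋ dilation b
  dilation-cong e n = spread-cong≤ n 0 (λ i _ → e i)

  dilation-⊠ : ∀ a b → dilation (a ⊠ b) ≋ dilation a ⊠ dilation b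
  dilation-⊠ a b n = spread-⊠′ n 0 a b

  spread-pick : ∀ n c e x → spread c (λ i → pick e i x) n ≈ pick (c ℕ.+ e ℕ.* suc m') n x
  spread-pick zero    zero    zero    x = refl
  spread-pick zero    zero    (suc e) x = refl
  spread-pick zero    (suc c) e       x = refl
  spread-pick (suc n) zero    zero    x = spread-0 n m'
  spread-pick (suc n) zero    (suc e) x = spread-pick n m' e x
  spread-pick (suc n) (suc c) e       x = spread-pick n c e x

  spread-sum : ∀ n c k (f : ℕ → Ser) → spread c (λ i → sum k (λ j → f j i)) n ≈ sum k (λ j → spread c (f j) n)
  spread-sum n c zero    f = spread-0 n c
  spread-sum n c (suc k) f = trans (spread-+ n c (f 0) (λ i → sum k (λ j → f (suc j) i))) (+-congˡ (spread-sum n c k (λ j → f (suc j))))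

  opaque
    unfolding sumℤ
    spread-sumℤ : ∀ n c B (f : ℤ → Ser) → spread c (λ i → sumℤ B (λ j → f j i)) n ≈ sumℤ B (λ j → spread c (f j) n)
    spread-sumℤ n c B f = trans (spread-+ n c (λ i → sum B (λ j → f (+ j) i)) (λ i → sum B (λ j → f -[1+ j ] i)))
      (+-cong (spread-sum n c B (λ j → f (+ j))) (spread-sum n c B (λ j → f -[1+ j ])))

  dilation-lat : ∀ e c → Proper e → dilation (lat e c) ≋ lat (λ n → e n ℕ.* suc m') c
  dilation-lat e c pr n = trans
    (spread-cong≤ n 0 (λ i i≤n → sym (sumℤ-extend (λ z → pick (e z) i (c z)) (lat-supp {e} pr c i) (s≤s (s≤s i≤n)))))
    (trans (spread-sumℤ n 0 (2 ℕ.+ n) (λ z i → pick (e z) i (c z)))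
      (sumℤ-cong (2 ℕ.+ n) (λ z → spread-pick n 0 (e z) (c z))))

  dilation-𝟙 : dilation 𝟙 ≋ 𝟙
  dilation-𝟙 zero    = refl
  dilation-𝟙 (suc n) = spread-0 n m'

  dilation-⊞ : ∀ a b → dilation (a ⊞ b) ≋ dilation a ⊞ dilation b
  dilation-⊞ a b n = spread-+ n 0 a b

  dilation-C : ∀ c → dilation (C c) ≋ C c
  dilation-C c zero    = refl
  dilation-C c (suc n) = spread-0 n m'

  dilation-q^ : ∀ k → dilation (q^ k) ≋ q^ (k ℕ.* suc m')
  dilation-q^ zero    = dilation-𝟙
  dilation-q^ (suc k) = 𝕊.trans shift (𝕊.trans (q^-cong (suc m')) (𝕊.sym (q^-+ (suc m') (k ℕ.* suc m'))))
    where
    q^-cong : ∀ j → sh j (dilation (q^ k)) ≋ q^ j ⊠ q^ (k ℕ.* suc m')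
    q^-cong j = 𝕊.trans (sh-cong j (dilation-q^ k)) (𝕊.sym (q^-⊠ j _))
    up : ∀ c a → spread c a ≋ sh c (spread 0 a)
    up zero    a n       = refl
    up (suc c) a zero    = refl
    up (suc c) a (suc n) = up c a n
    shift : dilation (q^ (suc k)) ≋ sh (suc m') (dilation (q^ k))
    shift zero    = refl
    shift (suc n) = up m' (q^ k) n

module FifteenColours (R : CommutativeRing 0ℓ 0ℓ) where
  open CommutativeRing R hiding (zero)
  open Solver R using (_^_; ^-cong; fromℤ; fromℕ; fromℕ-+)
  open Series R
  open Products R
  open Coloured R fifteenColours
  open Evaluation R fifteenColours
  open TripleProduct R using (𝓔; F⁺-stable)
  private
    module 𝕊 = CommutativeRing ring𝕊
    module J = TripleProduct R
    module E₁ = Evaluation R oneColour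
  open Solver ring𝕊 using (solve; _:+_; _:*_; _:-_; :-_; _:=_; :0; :1) renaming (_^_ to _^ˢ_; ^-cong to ^ˢ-cong)

  -- The first fifteen entries have level zero, so only the number of choices counts. The symmetry
  -- of binomial coefficients then supplies the hypothesis of `C-shift`.
  A-bin : ∀ M ℓ → M ≤ 15 → A M ℓ ≋ C (fromℕ (bin M ℓ))
  A-bin zero    zero    p = 𝕊.sym C-1
  A-bin zero    (suc ℓ) p = 𝕊.sym C-0
  A-bin (suc M) zero    p = A-bin M zero (ℕP.≤-trans (ℕP.n≤1+n M) p)
  A-bin (suc M) (suc ℓ) p = 𝕊.trans
    (𝕊.+-cong (A-bin M (suc ℓ) M≤15) (𝕊.trans (𝕊.reflexive (≡.cong (λ j → sh j (A M ℓ)) (m<n⇒m/n≡0 p))) (A-bin M ℓ M≤15)))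
    (𝕊.trans (𝕊.sym (C-+ _ _)) (C-cong (sym (fromℕ-+ (bin M (suc ℓ)) (bin M ℓ)))))
    where
    M≤15 : M ≤ 15
    M≤15 = ℕP.≤-trans (ℕP.n≤1+n M) p

  palindromic : ∀ i j → i ℕ.+ j ≡ 15 → b i ≋ b j
  palindromic i j e = 𝕊.trans (A-bin 15 i ℕP.≤-refl) (𝕊.trans
    (C-cong (reflexive (≡.cong fromℕ (≡.trans (bin-symmetric i (ℕP.≤-trans (ℕP.m≤m+n i j) (ℕP.≤-reflexive e)))
      (≡.cong (bin 15) (≡.trans (≡.cong (_∸ i) (≡.sym e)) (ℕP.m+n∸m≡n i j)))))))
    (𝕊.sym (A-bin 15 j ℕP.≤-refl)))

  Lim-^ : ∀ (f : ℕ → Ser) n → Stable f → Lim (λ j → f j ^ˢ n) ≋ Lim f ^ˢ n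
  Lim-^ f zero    s = 𝕊.refl
  Lim-^ f (suc n) s = 𝕊.trans (Lim-⊠ f (λ j → f j ^ˢ n) s (stable n)) (𝕊.*-congˡ (Lim-^ f n s))
    where
    stable : ∀ n → Stable (λ j → f j ^ˢ n)
    stable zero    = Stable-const 𝟙
    stable (suc n) = Stable-⊠ f (λ j → f j ^ˢ n) s (stable n)

  G-power : ∀ Z → G Z ≋ E₁.G Z ^ˢ 15
  G-power Z = 𝕊.trans (G-product Z) (𝕊.trans (Lim-^ (λ j → F (suc j) Z) 15 (F-stable Z))
    (^ˢ-cong 15 (𝕊.sym (𝕊.trans (E₁.G-product Z) (Lim-cong (λ j → 𝕊.*-identityʳ _))))))

  *-^ : ∀ a b n → (a ⊠ b) ^ˢ n ≋ a ^ˢ n ⊠ b ^ˢ n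
  *-^ a b zero    = 𝕊.sym (𝕊.*-identityˡ 𝟙)
  *-^ a b (suc n) = 𝕊.trans (𝕊.*-congˡ (*-^ a b n)) (solve 4 (λ a b c d → a :* b :* (c :* d) := a :* c :* (b :* d)) a b (a ^ˢ n) (b ^ˢ n))

  -- Iterating `C-shift` adds the exponents 0, 15, ..., 15 (j - 1). The coefficients with index
  -- divisible by 15 are therefore those of a theta series in q^15.
  Cs-block : ∀ j → Cs (j ℕ.* 15) ≋ q^ (J.t j ℕ.* 15) ⊠ Cs 0
  Cs-block zero    = 𝕊.sym (𝕊.*-identityˡ _)
  Cs-block (suc j) = 𝕊.trans (𝕊.reflexive (≡.cong Cs (ℕP.+-comm 15 (j ℕ.* 15)))) (𝕊.trans (C-shift palindromic (j ℕ.* 15))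
    (𝕊.trans (𝕊.*-congˡ (Cs-block j)) (𝕊.trans (𝕊.sym (𝕊.*-assoc _ _ _)) (𝕊.*-congʳ (𝕊.trans (𝕊.sym (q^-+ (j ℕ.* 15) (J.t j ℕ.* 15)))
      (𝕊.reflexive (≡.cong q^ (≡.trans (≡.sym (ℕP.*-distribʳ-+ 15 j (J.t j))) (≡.cong (ℕ._* 15) (ℕP.+-comm j (J.t j)))))))))))

  Cℤ-block : ∀ j → Cℤ (j ℤ.* + 15) ≋ q^ (J.tt j ℕ.* 15) ⊠ Cs 0
  Cℤ-block (+ j)    = 𝕊.trans (𝕊.reflexive (≡.cong Cℤ (≡.sym (ℤP.pos-* j 15)))) (Cs-block j)
  Cℤ-block -[1+ j ] = 𝕊.trans (𝕊.*-congˡ {x = q^ (suc j ℕ.* 15)} (Cs-block (suc j))) (𝕊.trans (𝕊.sym (𝕊.*-assoc _ _ _)) (𝕊.*-congʳ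
    (𝕊.trans (𝕊.sym (q^-+ (suc j ℕ.* 15) (J.t (suc j) ℕ.* 15))) (𝕊.reflexive (≡.cong q^ (≡.sym (ℕP.*-distribʳ-+ 15 (suc j) (J.t (suc j)))))))))

  module _ (w : Unit R) where
    open Unit w renaming (unit to x; inverse to y; unit-inverse to xy)
    open Lattice R
    open FiniteSums R
    open Power x y xy
    open SetoidReasoning setoid

    GG : Ser
    GG = G (C (- (x * x))) ⊠ G (C (- (y * y)) ⊠ q^ 1)

    theta-power : J.theta w ^ˢ 15 ≋ 𝓔 ^ˢ 15 ⊠ (C (y ^ 15) ⊠ GG)
    theta-power = 𝕊.trans (^ˢ-cong 15 (J.theta-GG w)) (𝕊.trans (*-^ 𝓔 (C y ⊠ J.GG w) 15) (𝕊.*-congˡ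
      (𝕊.trans (*-^ (C y) (J.GG w) 15) (𝕊.*-cong (E₁.C-pow w′ y 15) (𝕊.trans (*-^ _ _ 15) (𝕊.*-cong (𝕊.sym (G-power _)) (𝕊.sym (G-power _))))))))
      where
      w′ : Unit R
      w′ = w

    expansion : ∀ N B → suc (N ℕ.+ 15) ≤ B →
                (C (y ^ 15) ⊠ GG) N ≈ sumℤ B (λ s → zpow (s ℤ.+ s ℤ.- + 15) * (sgn s * Cℤ s N))
    expansion N B p = begin
      (C (y ^ 15) ⊠ GG) N
        ≈⟨ trans (C-⊠ (y ^ 15) GG N) (*-congˡ (laurent (J.w² w) N B p)) ⟩
      y ^ 15 * sumℤ B (λ s → Z.zpow s * Cℤ s N)
        ≈⟨ sym (sumℤ-*ˡ B (y ^ 15) _) ⟩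
      sumℤ B (λ s → y ^ 15 * (Z.zpow s * Cℤ s N))
        ≈⟨ sumℤ-cong B (λ s → trans (*-congˡ (*-congʳ (J.zpow²-zpow w s)))
             (trans (Solver.solve R 4 (λ y s z c → y R* (s R* z R* c) R= z R* y R* (s R* c)) (y ^ 15) (sgn s) (zpow (s ℤ.+ s)) (Cℤ s N))
               (*-congʳ (sym (zpow-+ (s ℤ.+ s) -[1+ 14 ]))))) ⟩
      sumℤ B (λ s → zpow (s ℤ.+ s ℤ.- + 15) * (sgn s * Cℤ s N)) ∎
      where
      module Z = Power (Unit.unit (J.w² w)) (Unit.inverse (J.w² w)) (Unit.unit-inverse (J.w² w))
      open Solver R using () renaming (_:*_ to _R*_; _:=_ to _R=_)

module MapProducts {R S : CommutativeRing 0ℓ 0ℓ} (h : Hom R S) where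
  open MapSeries h
  private
    module A = Series R
    module B = Series S
    module PA = Products R
    module PB = Products S
    module JA = TripleProduct R
    module JB = TripleProduct S
    module 𝔸 = CommutativeRing A.ring𝕊
    module 𝔹 = CommutativeRing B.ring𝕊

  Φ-F : ∀ j Z → Φ (PA.F j Z) B.≋ PB.F j (Φ Z)
  Φ-F zero    Z = Φ-𝟙
  Φ-F (suc j) Z = 𝔹.trans (Φ-⊠ (PA.F j Z) _) (𝔹.*-cong (Φ-F j Z)
    (𝔹.trans (Φ-⊞ A.𝟙 _) (𝔹.+-cong Φ-𝟙 (𝔹.trans (Φ-⊠ Z _) (𝔹.*-congˡ (Φ-q^ j))))))

  F-cong : ∀ j {Z Z'} → Z B.≋ Z' → PB.F j Z B.≋ PB.F j Z'
  F-cong zero    e = 𝔹.refl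
  F-cong (suc j) e = 𝔹.*-cong (F-cong j e) (𝔹.+-congˡ (𝔹.*-congʳ e))

  Φ-F⁺ : ∀ j Z → Φ (JA.F⁺ j Z) B.≋ JB.F⁺ j (Φ Z)
  Φ-F⁺ j Z = 𝔹.trans (Φ-F j _) (F-cong j (𝔹.trans (Φ-⊠ Z _) (𝔹.*-congˡ (Φ-q^ 1))))

  F⁺-cong : ∀ j {Z Z'} → Z B.≋ Z' → JB.F⁺ j Z B.≋ JB.F⁺ j Z'
  F⁺-cong j e = F-cong j (𝔹.*-congʳ e)

  Φ-𝓔 : Φ JA.𝓔 B.≋ JB.𝓔
  Φ-𝓔 n = 𝔹.trans (Φ-F⁺ n (A.⊟ A.𝟙)) (F⁺-cong n (𝔹.trans (λ n → Hom.φ-neg h _) (𝔹.-‿cong Φ-𝟙))) n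

module DualTheta (R : CommutativeRing 0ℓ 0ℓ) where
  open CommutativeRing R hiding (zero)
  open Solver R using (_^_; ^-cong; fromℤ; fromℕ; solve; _:+_; _:*_; _:-_; :-_; _:=_; :0; :1)
  open Series R
  open Dual R
  private
    module 𝕊 = CommutativeRing ring𝕊
    module Lε = Lattice Rε
    module Bε = Series Rε
    module 𝔹 = CommutativeRing Bε.ring𝕊
    module Jε = TripleProduct Rε
    module J = TripleProduct R
  open Lattice R
  open MapSeries lift
  open MapProducts lift

  sgn-ε : ∀ i → proj₁ (Lε.sgn i) ≈ sgn i × proj₂ (Lε.sgn i) ≈ 0#
  sgn-ε i = sym (proj₁ (φ-sgn i)) , sym (proj₂ (φ-sgn i))

  module _ (w : Unit R) where
    open Unit w renaming (unit to x; inverse to y; unit-inverse to xy)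
    open Power x y xy
    private module Pε = Lε.Power (Unit.unit (perturb w)) (Unit.inverse (perturb w)) (Unit.unit-inverse (perturb w))

    π₁-theta : π₁ (Jε.theta (perturb w)) ≋ Θ zpow
    π₁-theta = 𝕊.trans (π₁-lat trs (λ n → CommutativeRing._*_ Rε (Lε.sg n) (Pε.zpow (odd n)))) (lat-cong {trs} (λ _ → ≡.refl) (λ n → trans
      (+-cong (*-cong (proj₁ (sgn-ε (n ℤ.+ + 1))) (proj₁ (zpow-ε w (odd n)))) (zeroˡ _)) (+-identityʳ _)))

    π₂-theta : π₂ (Jε.theta (perturb w)) ≋ Θ (λ u → fromℤ u * zpow u)
    π₂-theta = 𝕊.trans (π₂-lat trs (λ n → CommutativeRing._*_ Rε (Lε.sg n) (Pε.zpow (odd n)))) (lat-cong {trs} (λ _ → ≡.refl) (λ n → trans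
      (+-cong (+-cong (*-cong (proj₁ (sgn-ε (n ℤ.+ + 1))) (proj₂ (zpow-ε w (odd n)))) (trans (*-congʳ (proj₂ (sgn-ε (n ℤ.+ + 1)))) (zeroˡ _))) (zeroˡ _))
      (trans (+-identityʳ _) (+-identityʳ _))))

  one : Unit R
  one = record { unit = 1# ; inverse = 1# ; unit-inverse = *-identityˡ 1# }

  -- Jacobi's identity, by differentiating the triple product at z = 1.
  theta′-one : Θ (λ u → fromℤ u * Power.zpow 1# 1# (*-identityˡ 1#) u) ≋ Solver.fromℤ ring𝕊 -[1+ 1 ] ⊠ (J.𝓔 ⊠ (J.𝓔 ⊠ J.𝓔))
  theta′-one = 𝕊.trans (𝕊.sym (π₂-theta one)) (𝕊.trans (λ n → proj₂ (Jε.theta-product (perturb one) n))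
    (𝕊.trans (π₂-⊠ front (Bε.Lim prod)) (𝕊.trans (𝕊.+-cong (𝕊.trans (𝕊.*-congʳ front₁) (𝕊.zeroˡ _)) (𝕊.*-cong front₂ lim₁)) (𝕊.+-identityˡ _))))
    where
    front : Bε.Ser
    front = Bε.C (1# , - 1#) Bε.⊞ Bε.⊟ Bε.C (1# , 1#)
    prod : ℕ → Bε.Ser
    prod j = Jε.e j Bε.⊠ (Jε.Π₁ (perturb one) j Bε.⊠ Jε.Π₂ (perturb one) j)
    front₁ : π₁ front ≋ 𝟘
    front₁ zero    = -‿inverseʳ 1#
    front₁ (suc n) = -‿inverseʳ 0#
    front₂ : π₂ front ≋ Solver.fromℤ ring𝕊 -[1+ 1 ]
    front₂ zero    = solve 0 (:- :1 :- :1 := :- (:1 :+ :1))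
    front₂ (suc n) = solve 0 (:0 :- :0 := :- (:0 :+ :0))
    open Products R
    open Products Rε using () renaming (F to Fε)
    F-π₁ : ∀ j Z Z' → π₁ Z ≋ Z' → π₁ (Fε j Z) ≋ F j Z'
    F-π₁ zero    Z Z' e = λ { zero → refl ; (suc n) → refl }
    F-π₁ (suc j) Z Z' e = 𝕊.trans (π₁-⊠ (Fε j Z) _) (𝕊.*-cong (F-π₁ j Z Z' e) (𝕊.+-cong (λ { zero → refl ; (suc n) → refl })
      (𝕊.trans (π₁-⊠ Z (Bε.q^ j)) (𝕊.*-cong e (λ n → sym (proj₁ (Φ-q^ j n)))))))
    F⁺-π₁ : ∀ j Z Z' → π₁ Z ≋ Z' → π₁ (Jε.F⁺ j Z) ≋ J.F⁺ j Z'
    F⁺-π₁ j Z Z' e = F-π₁ j _ _ (𝕊.trans (π₁-⊠ Z (Bε.q^ 1)) (𝕊.*-cong e (λ n → sym (proj₁ (Φ-q^ 1 n)))))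
    neg₁ : π₁ (Bε.C (CommutativeRing.-_ Rε (CommutativeRing._*_ Rε (1# , 1#) (1# , 1#)))) ≋ ⊟ 𝟙
    neg₁ zero    = solve 0 (:- (:1 :* :1 :+ :0 :* (:1 :* :1)) := :- :1)
    neg₁ (suc n) = solve 0 (:0 := :- :0)
    neg₂ : π₁ (Bε.C (CommutativeRing.-_ Rε (CommutativeRing._*_ Rε (1# , - 1#) (1# , - 1#)))) ≋ ⊟ 𝟙
    neg₂ zero    = solve 0 (:- (:1 :* :1 :+ :0 :* (:- :1 :* :- :1)) := :- :1)
    neg₂ (suc n) = solve 0 (:0 := :- :0)
    lim₁ : π₁ (Bε.Lim prod) ≋ J.𝓔 ⊠ (J.𝓔 ⊠ J.𝓔)
    lim₁ = 𝕊.trans {j = Lim (λ j → J.e j ⊠ (J.e j ⊠ J.e j))}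
      (λ n → 𝕊.trans (π₁-⊠ (Jε.e n) _) (𝕊.*-cong (F⁺-π₁ n (Bε.⊟ Bε.𝟙) (⊟ 𝟙) (λ { zero → refl ; (suc n) → refl }))
        (𝕊.trans (π₁-⊠ (Jε.Π₁ (perturb one) n) _) (𝕊.*-cong (F⁺-π₁ n _ (⊟ 𝟙) neg₁) (F⁺-π₁ n _ (⊟ 𝟙) neg₂)))) n)
      (𝕊.trans (Lim-⊠ J.e (λ j → J.e j ⊠ J.e j) st (Stable-⊠ J.e J.e st st)) (𝕊.*-congˡ (Lim-⊠ J.e J.e st st)))
      where
      st : Stable J.e
      st = J.F⁺-stable (⊟ 𝟙)

-- The average over the fifteenth roots of unity.

module RootSum (R : CommutativeRing 0ℓ 0ℓ) (ξ : Unit R)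
  (period : CommutativeRing._≈_ R (Solver._^_ R (Unit.unit ξ) 15) (CommutativeRing.1# R))
  (orthogonal : ∀ r → 1 ≤ r → r < 15 → CommutativeRing._≈_ R
    (FiniteSums.sum R 15 (λ a → Solver._^_ R (Solver._^_ R (Unit.unit ξ) (r ℕ.+ r)) a)) (CommutativeRing.0# R))
  where
  open IntegerSolver
  open CommutativeRing R hiding (zero)
  open Solver R using (_^_; ^-cong; fromℤ; fromℕ; fromℤ-*; solve; _:+_; _:*_; _:-_; :-_; _:=_; :0; :1)
  open FiniteSums R
  open Series R
  open Lattice R
  open ThetaValues R ξ using (p)
  open Dual R
  open DualTheta R
  open Spread R 14
  open SetoidReasoning setoid
  open Power (Unit.unit ξ) (Unit.inverse ξ) (Unit.unit-inverse ξ)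
  private
    module 𝕊 = CommutativeRing ring𝕊
    module Σ𝕊 = FiniteSums ring𝕊
    module Bε = Series Rε
    module 𝔹 = CommutativeRing Bε.ring𝕊
    module ε = CommutativeRing Rε
    module Lε = Lattice Rε
    module Jε = TripleProduct Rε
    module J = TripleProduct R
    module Fε = FifteenColours Rε
    module F₁₅ = FifteenColours R
    module C₁₅ = Coloured R fifteenColours
    module E₁₅ = Evaluation R fifteenColours
    module Eε = Evaluation Rε fifteenColours
    x y : Carrier
    x = Unit.unit ξ
    y = Unit.inverse ξ
  open Solver ring𝕊 using () renaming (_^_ to _^ˢ_; ^-cong to ^ˢ-cong)
  open MapSeries lift
  open MapProducts lift

  root : ℕ → Unit R
  root a = record { unit = x ^ a ; inverse = y ^ a ; unit-inverse = inv a }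
    where
    inv : ∀ a → x ^ a * y ^ a ≈ 1#
    inv zero    = *-identityˡ 1#
    inv (suc a) = trans (solve 4 (λ x a y b → x :* a :* (y :* b) := x :* y :* (a :* b)) x (x ^ a) y (y ^ a))
      (trans (*-cong (Unit.unit-inverse ξ) (inv a)) (*-identityˡ 1#))

  module Root (a : ℕ) = Power (Unit.unit (root a)) (Unit.inverse (root a)) (Unit.unit-inverse (root a))

  root-zpow : ∀ a u → Root.zpow a u ≈ zpow (+ a ℤ.* u)
  root-zpow a (+ n) = go n
    where
    go : ∀ n → (x ^ a) ^ n ≈ zpow (+ a ℤ.* + n)
    go zero    = zpow-cong (≡.sym (ℤP.*-zeroʳ (+ a)))
    go (suc n) = trans (*-congˡ (go n)) (trans (sym (zpow-+ (+ a) (+ a ℤ.* + n)))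
      (zpow-cong (solveℤ 2 (λ a n → a ⊹ a ⊗ n ≔ a ⊗ (₁ ⊹ n)) (+ a) (+ n))))
  root-zpow a -[1+ n ] = go n
    where
    neg : ∀ a → y ^ a ≈ zpow (ℤ.- + a)
    neg zero    = refl
    neg (suc a) = refl
    go : ∀ n → (y ^ a) ^ suc n ≈ zpow (+ a ℤ.* -[1+ n ])
    go zero    = trans (*-identityʳ _) (trans (neg a) (zpow-cong (solveℤ 1 (λ a → ⁻ a ≔ a ⊗ (⁻ ₁)) (+ a))))
    go (suc n) = trans (*-cong (neg a) (go n)) (trans (sym (zpow-+ (ℤ.- + a) (+ a ℤ.* -[1+ n ])))
      (zpow-cong (solveℤ 2 (λ a n → (⁻ a) ⊹ a ⊗ (⁻ (₁ ⊹ n)) ≔ a ⊗ (⁻ (₁ ⊹ (₁ ⊹ n)))) (+ a) (+ n))))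

  θ : ℕ → Bε.Ser
  θ a = Jε.theta (perturb (root a))

  π₁-θ : ∀ a → π₁ (θ a) ≋ p 0 (+ a)
  π₁-θ a = 𝕊.trans (π₁-theta (root a)) (Θ-cong (λ u → trans (root-zpow a u) (sym (*-identityˡ _))))

  π₂-θ : ∀ a → π₂ (θ a) ≋ p 1 (+ a)
  π₂-θ a = 𝕊.trans (π₂-theta (root a)) (Θ-cong (λ u → *-cong {fromℤ u} {fromℤ u ^ 1} (sym (*-identityʳ _)) (root-zpow a u)))

  p₁-0 : p 1 (+ 0) ≋ Solver.fromℤ ring𝕊 -[1+ 1 ] ⊠ (J.𝓔 ⊠ (J.𝓔 ⊠ J.𝓔))
  p₁-0 = 𝕊.trans (Θ-cong (λ u → *-cong {fromℤ u ^ 1} {fromℤ u} (*-identityʳ _) (trans (sym (root-zpow 0 u)) (Power-1 u)))) theta′-one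
    where
    Power-1 : ∀ u → Root.zpow 0 u ≈ Power.zpow 1# 1# (*-identityˡ 1#) u
    Power-1 (+ n)    = refl
    Power-1 -[1+ n ] = refl

  X : ℕ → Bε.Ser
  X a = Bε.C (Solver._^_ Rε (Unit.inverse (perturb (root a))) 15) Bε.⊠ Fε.GG (perturb (root a))

  -- The ε-part of the fifteenth power of the triple product. The Euler product is the image of a
  -- series without ε-part, so only the factor depending on z is differentiated.
  power-derivative : ∀ a → Solver.fromℕ ring𝕊 15 ⊠ (p 0 (+ a) ^ˢ 14 ⊠ p 1 (+ a)) ≋ J.𝓔 ^ˢ 15 ⊠ π₂ (X a)
  power-derivative a = 𝕊.trans (𝕊.*-congˡ (𝕊.*-cong (^ˢ-cong 14 (𝕊.sym (π₁-θ a))) (𝕊.sym (π₂-θ a))))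
    (𝕊.trans (𝕊.sym (π₂-^ (θ a) 14)) (𝕊.trans (λ n → proj₂ (Fε.theta-power (perturb (root a)) n))
    (𝕊.trans (π₂-⊠ (Jε.𝓔 ^ᴮ 15) (X a)) (𝕊.trans (𝕊.+-cong (𝕊.*-congʳ (𝕊.trans (π₁-^ Jε.𝓔 15) (^ˢ-cong 15 (λ n → sym (proj₁ (Φ-𝓔 n))))))
        (𝕊.trans (𝕊.*-congʳ (𝕊.trans (π₂-^ Jε.𝓔 14) (𝕊.trans (𝕊.*-congˡ (𝕊.trans (𝕊.*-congˡ (λ n → sym (proj₂ (Φ-𝓔 n)))) (𝕊.zeroʳ _))) (𝕊.zeroʳ _)))) (𝕊.zeroˡ _)))
      (𝕊.+-identityʳ _)))))
    where open Solver Bε.ring𝕊 using () renaming (_^_ to _^ᴮ_)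

  weight : ℤ → ℤ
  weight s = s ℤ.+ s ℤ.- + 15

  summand : ℕ → ℤ → Carrier
  summand N s = sgn s * E₁₅.Cℤ s N

  π₂-X : ∀ a N B → suc (N ℕ.+ 15) ≤ B → π₂ (X a) N ≈ sumℤ B (λ s → fromℤ (weight s) * summand N s * zpow (+ a ℤ.* weight s))
  π₂-X a N B p = trans (proj₂ (Fε.expansion (perturb (root a)) N B p)) (trans (π₂-sumℤ B _) (sumℤ-cong B term))
    where
    module Pε = Lε.Power (Unit.unit (perturb (root a))) (Unit.inverse (perturb (root a))) (Unit.unit-inverse (perturb (root a)))
    scalar : ∀ s → (Lε.sgn s ε.* Eε.Cℤ s N) ε.≈ (summand N s , 0#)
    scalar s = ε.trans (ε.*-cong (ε.sym (φ-sgn s)) (ε.sym (Φ-Cℤ fifteenColours s N))) (ε.sym (Hom.φ-* lift (sgn s) (E₁₅.Cℤ s N)))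
    term : ∀ s → proj₂ (Pε.zpow (weight s) ε.* (Lε.sgn s ε.* Eε.Cℤ s N)) ≈ fromℤ (weight s) * summand N s * zpow (+ a ℤ.* weight s)
    term s = trans (proj₂ (ε.*-cong (zpow-ε (root a) (weight s)) (scalar s)))
      (trans (solve 3 (λ z k c → z :* :0 :+ k :* z :* c :+ :0 :* (k :* z :* :0) := k :* c :* z) (Root.zpow a (weight s)) (fromℤ (weight s)) (summand N s))
        (*-congˡ (root-zpow a (weight s))))

  zpow-period : ∀ k u → zpow (k ℤ.* + 15 ℤ.+ u) ≈ zpow u
  zpow-period k u = trans (zpow-+ (k ℤ.* + 15) u) (trans (*-congʳ (ones k)) (*-identityˡ _))
    where
    onesⁿ : ∀ k → zpow (+ k ℤ.* + 15) ≈ 1#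
    onesⁿ zero    = refl
    onesⁿ (suc k) = trans (zpow-cong (solveℤ 1 (λ k → (₁ ⊹ k) ⊗ cℤ (+ 15) ≔ cℤ (+ 15) ⊹ k ⊗ cℤ (+ 15)) (+ k)))
      (trans (zpow-+ (+ 15) (+ k ℤ.* + 15)) (trans (*-cong period (onesⁿ k)) (*-identityˡ 1#)))
    ones : ∀ k → zpow (k ℤ.* + 15) ≈ 1#
    ones (+ k) = onesⁿ k
    ones -[1+ k ] = trans (sym (*-identityʳ _)) (trans (*-congˡ (sym (onesⁿ (suc k)))) (trans (sym (zpow-+ (-[1+ k ] ℤ.* + 15) (+ suc k ℤ.* + 15)))
      (zpow-cong (solveℤ 1 (λ k → (⁻ (₁ ⊹ k)) ⊗ cℤ (+ 15) ⊹ (₁ ⊹ k) ⊗ cℤ (+ 15) ≔ cℤ (+ 0)) (+ k)))))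

  character-sum : ℤ → Carrier
  character-sum s = sum 15 (λ a → zpow (+ a ℤ.* weight s))

  character-sum-residue : ∀ j r → character-sum (j ℤ.* + 15 ℤ.+ + r) ≈ sum 15 (λ a → (x ^ (r ℕ.+ r)) ^ a)
  character-sum-residue j r = sum-cong 15 λ a → trans
    (zpow-cong (solveℤ 3 (λ a j r → a ⊗ ((j ⊗ cℤ (+ 15) ⊹ r) ⊹ (j ⊗ cℤ (+ 15) ⊹ r) ⊝ cℤ (+ 15)) ≔ (a ⊗ (j ⊹ j ⊝ ₁)) ⊗ cℤ (+ 15) ⊹ a ⊗ (r ⊹ r)) (+ a) j (+ r)))
    (trans (zpow-period (+ a ℤ.* (j ℤ.+ j ℤ.- + 1)) (+ a ℤ.* (+ r ℤ.+ + r)))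
    (trans (zpow-cong (ℤP.*-comm (+ a) (+ (r ℕ.+ r)))) (sym (root-zpow (r ℕ.+ r) (+ a)))))

  sgn-15 : ∀ j → sgn (j ℤ.* + 15) ≈ sgn j
  sgn-15 j = trans (sgn-cong (solveℤ 1 (λ j → j ⊗ cℤ (+ 15) ≔ (j ⊗ cℤ (+ 7) ⊹ j ⊗ cℤ (+ 7)) ⊹ j) j))
    (trans (sgn-+ (j ℤ.* + 7 ℤ.+ j ℤ.* + 7) j) (trans (*-congʳ (sgn-sq (j ℤ.* + 7))) (*-identityˡ _)))

  proper-15 : Proper (λ n → trs n ℕ.* 15)
  proper-15 n = ℕP.≤-trans (proper-trs n) (s≤s (ℕP.m≤m*n (trs n) 15))

  p₁-0-dilated : dilation (p 1 (+ 0)) ≋ lat (λ n → trs n ℕ.* 15) (λ n → sg n * fromℤ (odd n))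
  p₁-0-dilated = 𝕊.trans (dilation-lat trs _ proper-trs) (lat-cong {λ n → trs n ℕ.* 15} (λ _ → ≡.refl)
    (λ n → *-congˡ (trans (*-identityʳ _) (*-identityʳ _))))

  -- Orthogonality leaves only s = 15j, where (-1)^s C_s = (-1)^j q^(15 j(j-1)/2) C_0 and the weight
  -- 2s - 15 is 15 (2j - 1): the terms of Jacobi's series in q^15. In 225 = 15 · 15 one factor comes
  -- from this weight and the other from the number of roots.
  root-sum : ∀ N → sum 15 (λ a → π₂ (X a) N) ≈ (C (fromℤ (+ 225)) ⊠ (dilation (p 1 (+ 0)) ⊠ C₁₅.Cs 0)) N
  root-sum N = begin
    sum 15 (λ a → π₂ (X a) N)
      ≈⟨ sum-cong 15 (λ a → π₂-X a N (M ℕ.* 15) big) ⟩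
    sum 15 (λ a → sumℤ (M ℕ.* 15) (λ s → c s * zpow (+ a ℤ.* weight s)))
      ≈⟨ sum-sumℤ 15 (M ℕ.* 15) (λ a s → c s * zpow (+ a ℤ.* weight s)) ⟩
    sumℤ (M ℕ.* 15) (λ s → sum 15 (λ a → c s * zpow (+ a ℤ.* weight s)))
      ≈⟨ sumℤ-cong (M ℕ.* 15) (λ s → sum-*ˡ 15 (c s) (λ a → zpow (+ a ℤ.* weight s))) ⟩
    sumℤ (M ℕ.* 15) (λ s → c s * character-sum s)
      ≈⟨ sumℤ-residues M 15 (λ s → c s * character-sum s) ⟩
    sum 15 (λ r → sumℤ M (λ j → c (j ℤ.* + 15 ℤ.+ + r) * character-sum (j ℤ.* + 15 ℤ.+ + r)))
      ≈⟨ trans (+-congˡ (sum-0 14 (λ r r<14 → sumℤ-0 M (λ j → trans (*-congˡ {x = c (j ℤ.* + 15 ℤ.+ + suc r)} (trans (character-sum-residue j (suc r)) (orthogonal (suc r) (s≤s z≤n) (s≤s r<14)))) (zeroʳ _))))) (+-identityʳ _) ⟩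
    sumℤ M (λ j → c (j ℤ.* + 15 ℤ.+ + 0) * character-sum (j ℤ.* + 15 ℤ.+ + 0))
      ≈⟨ sumℤ-cong M reduce ⟩
    sumℤ M (λ j → fromℤ (+ 225) * g j)
      ≈⟨ sumℤ-*ˡ M (fromℤ (+ 225)) g ⟩
    fromℤ (+ 225) * sumℤ M g
      ≈⟨ *-congˡ (trans (sym (sumℤ-shift g (+ 1) supp-g (Supp-cong (λ n → sym (shifted n)) supp-c))) (sumℤ-cong M shifted)) ⟩
    fromℤ (+ 225) * sumℤ M (λ n → sg n * fromℤ (odd n) * (q^ (trs n ℕ.* 15) ⊠ C₁₅.Cs 0) N)
      ≈⟨ *-congˡ (sym (J.lat-shifted (λ n → trs n ℕ.* 15) (λ n → sg n * fromℤ (odd n)) (C₁₅.Cs 0) N proper-15)) ⟩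
    fromℤ (+ 225) * (lat (λ n → trs n ℕ.* 15) (λ n → sg n * fromℤ (odd n)) ⊠ C₁₅.Cs 0) N
      ≈⟨ *-congˡ (⊠-cong (𝕊.sym p₁-0-dilated) (λ _ → refl) N) ⟩
    fromℤ (+ 225) * (dilation (p 1 (+ 0)) ⊠ C₁₅.Cs 0) N
      ≈⟨ sym (C-⊠ (fromℤ (+ 225)) _ N) ⟩
    (C (fromℤ (+ 225)) ⊠ (dilation (p 1 (+ 0)) ⊠ C₁₅.Cs 0)) N ∎
    where
    M : ℕ
    M = 2 ℕ.+ N
    big : suc (N ℕ.+ 15) ≤ M ℕ.* 15
    big = ℕP.≤-trans (ℕP.≤-reflexive (≡.cong suc (ℕP.+-comm N 15))) (s≤s (ℕP.+-monoʳ-≤ 15 (ℕP.≤-trans (ℕP.m≤m*n N 15) (ℕP.m≤n+m (N ℕ.* 15) 14))))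
    c : ℤ → Carrier
    c s = fromℤ (weight s) * summand N s
    g : ℤ → Carrier
    g j = fromℤ (j ℤ.+ j ℤ.- + 1) * (sgn j * (q^ (J.tt j ℕ.* 15) ⊠ C₁₅.Cs 0) N)
    reduce : ∀ j → c (j ℤ.* + 15 ℤ.+ + 0) * character-sum (j ℤ.* + 15 ℤ.+ + 0) ≈ fromℤ (+ 225) * g j
    reduce j = trans (*-cong (*-cong (trans
        (reflexive (≡.cong fromℤ (solveℤ 1 (λ j → (j ⊗ cℤ (+ 15) ⊹ cℤ (+ 0)) ⊹ (j ⊗ cℤ (+ 15) ⊹ cℤ (+ 0)) ⊝ cℤ (+ 15) ≔ cℤ (+ 15) ⊗ (j ⊹ j ⊝ ₁)) j)))
        (fromℤ-* (+ 15) (j ℤ.+ j ℤ.- + 1)))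
        (trans (reflexive (≡.cong (summand N) (ℤP.+-identityʳ (j ℤ.* + 15)))) (*-cong (sgn-15 j) (F₁₅.Cℤ-block j N))))
      (trans (character-sum-residue j 0) (trans (sum-cong 15 ones) (solve 0
        (:1 :+ (:1 :+ (:1 :+ (:1 :+ (:1 :+ (:1 :+ (:1 :+ (:1 :+ (:1 :+ (:1 :+ (:1 :+ (:1 :+ (:1 :+ (:1 :+ (:1 :+ :0)))))))))))))) := cr (+ 15))))))
      (solve 2 (λ k c → cr (+ 15) :* k :* c :* cr (+ 15) := cr (+ 225) :* (k :* c)) (fromℤ (j ℤ.+ j ℤ.- + 1)) (sgn j * (q^ (J.tt j ℕ.* 15) ⊠ C₁₅.Cs 0) N))
      where
      open Solver R using () renaming (:c to cr)
      ones : ∀ a → 1# ^ a ≈ 1#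
      ones zero    = refl
      ones (suc a) = trans (*-identityˡ _) (ones a)
    supp-g : Supp M g
    supp-g j p = trans (*-congˡ (trans (*-congˡ (O-q^ (J.tt j ℕ.* 15) (C₁₅.Cs 0) N
        (ℕP.≤-trans (ℕP.≤-pred (ℕP.≤-trans p (proper-tt j))) (ℕP.m≤m*n (J.tt j) 15)))) (zeroʳ _))) (zeroʳ _)
      where
      proper-tt : Proper J.tt
      proper-tt (+ zero)  = z≤n
      proper-tt (+ suc s) = s≤s (≡.subst (s ≤_) (≡.sym (J.t-T s)) (n≤T s))
      proper-tt -[1+ s ]  = ℕP.≤-trans (ℕP.n≤1+n s) (ℕP.m≤n⇒m≤1+n (ℕP.m≤m+n (suc s) _))
    supp-c : Supp M (λ n → sg n * fromℤ (odd n) * (q^ (trs n ℕ.* 15) ⊠ C₁₅.Cs 0) N)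
    supp-c n p = trans (*-congˡ (O-q^ (trs n ℕ.* 15) (C₁₅.Cs 0) N (ℕP.≤-pred (ℕP.≤-trans p (proper-15 n))))) (zeroʳ _)
    shifted : ∀ n → g (n ℤ.+ + 1) ≈ sg n * fromℤ (odd n) * (q^ (trs n ℕ.* 15) ⊠ C₁₅.Cs 0) N
    shifted n = trans (*-cong (reflexive (≡.cong fromℤ (solveℤ 1 (λ n → (n ⊹ ₁) ⊹ (n ⊹ ₁) ⊝ ₁ ≔ n ⊹ n ⊹ ₁) n)))
        (*-congˡ (reflexive (≡.cong (λ k → (q^ (k ℕ.* 15) ⊠ C₁₅.Cs 0) N) (J.tt-trs n)))))
      (solve 3 (λ k s c → k :* (s :* c) := s :* k :* c) (fromℤ (odd n)) (sg n) ((q^ (trs n ℕ.* 15) ⊠ C₁₅.Cs 0) N))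

  𝓔₁₅ : Ser
  𝓔₁₅ = dilation J.𝓔

  theta-sum : Σ𝕊.sum 15 (λ a → Solver.fromℕ ring𝕊 15 ⊠ (p 0 (+ a) ^ˢ 14 ⊠ p 1 (+ a)))
            ≋ J.𝓔 ^ˢ 15 ⊠ (Solver.fromℤ ring𝕊 -[1+ 449 ] ⊠ (𝓔₁₅ ⊠ (𝓔₁₅ ⊠ 𝓔₁₅)) ⊠ C₁₅.Cs 0)
  theta-sum = 𝕊.trans (Σ𝕊.sum-cong 15 power-derivative) (𝕊.trans (Σ𝕊.sum-*ˡ 15 (J.𝓔 ^ˢ 15) (λ a → π₂ (X a)))
    (𝕊.*-congˡ (𝕊.trans (λ N → trans (C₁₅.coeff-sum 15 (λ a → π₂ (X a)) N) (root-sum N))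
      (𝕊.trans (𝕊.*-congˡ (𝕊.*-congʳ dilated)) (𝕊.trans (𝕊.*-congʳ (𝕊.sym (fromℤ-C (+ 225))))
        (Solver.solve ring𝕊 2 (λ e c → cs (+ 225) ·* (cs -[1+ 1 ] ·* e ·* c) ·= cs -[1+ 449 ] ·* e ·* c) (𝓔₁₅ ⊠ (𝓔₁₅ ⊠ 𝓔₁₅)) (C₁₅.Cs 0)))))))
    where
    open Solver ring𝕊 using () renaming (_:*_ to _·*_; _:=_ to _·=_; :c to cs)
    dilated : dilation (p 1 (+ 0)) ≋ Solver.fromℤ ring𝕊 -[1+ 1 ] ⊠ (𝓔₁₅ ⊠ (𝓔₁₅ ⊠ 𝓔₁₅))
    dilated = 𝕊.trans (dilation-cong p₁-0) (𝕊.trans (dilation-⊠ _ _) (𝕊.*-cong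
      (𝕊.trans (dilation-cong (fromℤ-C -[1+ 1 ])) (𝕊.trans (dilation-C _) (𝕊.sym (fromℤ-C -[1+ 1 ]))))
      (𝕊.trans (dilation-⊠ _ _) (𝕊.*-congˡ (dilation-⊠ _ _)))))

-- Fifteenth roots of unity

Φ₁₅ : (S : CommutativeRing 0ℓ 0ℓ) → CommutativeRing.Carrier S → CommutativeRing.Carrier S
Φ₁₅ S z = z ^ 8 + - z ^ 7 + z ^ 5 + - z ^ 4 + z ^ 3 + - z + 1#
  where
  open CommutativeRing S
  open Solver S using (_^_)

module FifteenthRoot (S : CommutativeRing 0ℓ 0ℓ) (z : CommutativeRing.Carrier S)
  (Φ : CommutativeRing._≈_ S (Φ₁₅ S z) (CommutativeRing.0# S)) where
  open CommutativeRing S hiding (zero)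
  open Solver S using (Expr; _^_; ^-cong; fromℤ; fromℕ; solve; _:+_; _:*_; _:-_; :-_; _:=_; :0; :1; :c; _:^_)
  open FiniteSums S using (sum; sum-cong)

  -- Reduction modulo a vanishing r. The quotient h is supplied explicitly each time, so congruences
  -- modulo the cyclotomic polynomial or its multiples become plain polynomial identities.
  mod : ∀ {a b h r} → r ≈ 0# → a ≈ b + r * h → a ≈ b
  mod {b = b} {h} r≈0 e = trans e (trans (+-congˡ (trans (*-congʳ r≈0) (zeroˡ h))) (+-identityʳ b))

  private
    :Φ : ∀ {n} → Expr n → Expr n
    :Φ z = z :^ 8 :- z :^ 7 :+ z :^ 5 :- z :^ 4 :+ z :^ 3 :- z :+ :1

  z¹⁵ : z ^ 15 ≈ 1#
  z¹⁵ = mod Φ (solve 1 (λ z → z :^ 15 := :1 :+ :Φ z :* (z :^ 7 :+ z :^ 6 :+ z :^ 5 :- z :^ 2 :- z :- :1)) z)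

  cubic : 1# + z ^ 5 + z ^ 10 ≈ 0#
  cubic = mod Φ (solve 1 (λ z → :1 :+ z :^ 5 :+ z :^ 10 := :0 :+ :Φ z :* (:1 :+ z :+ z :^ 2)) z)

  quintic : 1# + z ^ 3 + z ^ 6 + z ^ 9 + z ^ 12 ≈ 0#
  quintic = mod Φ (solve 1 (λ z → :1 :+ z :^ 3 :+ z :^ 6 :+ z :^ 9 :+ z :^ 12 := :0 :+ :Φ z :* (:1 :+ z :+ z :^ 2 :+ z :^ 3 :+ z :^ 4)) z)

  ^-+ : ∀ m n → z ^ (m ℕ.+ n) ≈ z ^ m * z ^ n
  ^-+ zero    n = sym (*-identityˡ _)
  ^-+ (suc m) n = trans (*-congˡ (^-+ m n)) (sym (*-assoc _ _ _))

  ^-* : ∀ m n → (z ^ m) ^ n ≈ z ^ (m ℕ.* n)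
  ^-* m zero    = trans refl (reflexive (≡.cong (z ^_) (≡.sym (ℕP.*-zeroʳ m))))
  ^-* m (suc n) = trans (*-congˡ (^-* m n)) (trans (sym (^-+ m (m ℕ.* n))) (reflexive (≡.cong (z ^_) (≡.sym (ℕP.*-suc m n)))))

  ones : ∀ n → 1# ^ n ≈ 1#
  ones zero    = refl
  ones (suc n) = trans (*-identityˡ _) (ones n)

  reduce : ∀ k d → z ^ (15 ℕ.* k ℕ.+ d) ≈ z ^ d
  reduce k d = trans (^-+ (15 ℕ.* k) d) (trans (*-congʳ (trans (sym (^-* 15 k)) (trans (^-cong k z¹⁵) (ones k)))) (*-identityˡ _))

  -- The constants evaluated here and in the next two statements are the leading coefficients of the
  -- theta products P₅, P₃P₆ and P₁P₂P₄P₇: square roots of -3 and 5, and 1.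
  kappa₅ : (z ^ 10 + - z ^ 5) ^ 2 ≈ fromℤ -[1+ 2 ]
  kappa₅ = mod cubic (solve 1 (λ z → (z :^ 10 :- z :^ 5) :^ 2 := :c -[1+ 2 ] :+ (:1 :+ z :^ 5 :+ z :^ 10) :* (z :^ 10 :- :c (+ 3) :* z :^ 5 :+ :c (+ 3))) z)

  kappa₃₆ : ((z ^ 12 + - z ^ 3) * (z ^ 9 + - z ^ 6)) ^ 2 ≈ fromℤ (+ 5)
  kappa₃₆ = mod quintic (solve 1 (λ z → ((z :^ 12 :- z :^ 3) :* (z :^ 9 :- z :^ 6)) :^ 2 := :c (+ 5) :+ (:1 :+ z :^ 3 :+ z :^ 6 :+ z :^ 9 :+ z :^ 12)
    :* (:c -[1+ 4 ] :+ :c (+ 5) :* z :^ 3 :- :c (+ 5) :* z :^ 15 :+ :c (+ 6) :* z :^ 18 :- :c (+ 3) :* z :^ 21 :+ :c (+ 3) :* z :^ 24 :- :c (+ 3) :* z :^ 27 :+ z :^ 30)) z)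

  kappa₁₂₄₇ : (z ^ 14 + - z) * (z ^ 13 + - z ^ 2) * (z ^ 11 + - z ^ 4) * (z ^ 8 + - z ^ 7) ≈ 1#
  kappa₁₂₄₇ = mod Φ (solve 1 (λ z → (z :^ 14 :- z) :* (z :^ 13 :- z :^ 2) :* (z :^ 11 :- z :^ 4) :* (z :^ 8 :- z :^ 7) := :1 :+ :Φ z
    :* (:- :1 :- z :- z :^ 2 :+ z :^ 5 :+ z :^ 6 :+ z :^ 7 :+ z :^ 14 :- z :^ 15 :- z :^ 16 :- :c (+ 2) :* z :^ 17 :- z :^ 19 :+ z :^ 20 :+ :c (+ 2) :* z :^ 22 :+ z :^ 24
        :- z :^ 25 :+ z :^ 26 :- z :^ 27 :+ z :^ 28 :+ z :^ 30 :- z :^ 31 :- z :^ 33 :- z :^ 35 :+ z :^ 38)) z)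

  -- z^3 + z^-3 and z^6 + z^-6 are the two roots of h² + h - 1.
  golden : (z ^ 6 + z ^ 9) ^ 2 ≈ 1# + - (z ^ 6 + z ^ 9)
  golden = mod quintic (solve 1 (λ z → (z :^ 6 :+ z :^ 9) :^ 2 := :1 :- (z :^ 6 :+ z :^ 9) :+ (:1 :+ z :^ 3 :+ z :^ 6 :+ z :^ 9 :+ z :^ 12) :* (:- :1 :+ z :^ 3 :+ z :^ 6)) z)

  golden₃ : (z ^ 12 + - z ^ 3) ^ 2 ≈ z ^ 6 + z ^ 9 + - fromℤ (+ 2)
  golden₃ = mod quintic (solve 1 (λ z → (z :^ 12 :- z :^ 3) :^ 2 := z :^ 6 :+ z :^ 9 :- :c (+ 2) :+ (:1 :+ z :^ 3 :+ z :^ 6 :+ z :^ 9 :+ z :^ 12)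
    :* (:c (+ 2) :- :c (+ 2) :* z :^ 3 :- z :^ 9 :+ z :^ 12)) z)

  golden₆ : (z ^ 9 + - z ^ 6) ^ 2 ≈ fromℤ -[1+ 2 ] + - (z ^ 6 + z ^ 9)
  golden₆ = mod quintic (solve 1 (λ z → (z :^ 9 :- z :^ 6) :^ 2 := :c -[1+ 2 ] :- (z :^ 6 :+ z :^ 9) :+ (:1 :+ z :^ 3 :+ z :^ 6 :+ z :^ 9 :+ z :^ 12)
    :* (:c (+ 3) :- :c (+ 3) :* z :^ 3 :+ z :^ 6)) z)

  golden₃₆ : (z ^ 12 + - z ^ 3) * (z ^ 9 + - z ^ 6) ≈ 1# + fromℤ (+ 2) * (z ^ 6 + z ^ 9)
  golden₃₆ = mod quintic (solve 1 (λ z → (z :^ 12 :- z :^ 3) :* (z :^ 9 :- z :^ 6) := :1 :+ :c (+ 2) :* (z :^ 6 :+ z :^ 9) :+ (:1 :+ z :^ 3 :+ z :^ 6 :+ z :^ 9 :+ z :^ 12)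
    :* (:- :1 :+ z :^ 3 :- :c (+ 2) :* z :^ 6 :+ z :^ 9)) z)

  cube-product : ∀ u x → (1# + - (u * x)) * (1# + - (u * z ^ 5 * x)) * (1# + - (u * z ^ 10 * x)) ≈ 1# + - (u ^ 3 * x ^ 3)
  cube-product u x = mod cubic (solve 3 (λ z u x → (:1 :- u :* x) :* (:1 :- u :* z :^ 5 :* x) :* (:1 :- u :* z :^ 10 :* x)
    := :1 :- u :^ 3 :* x :^ 3 :+ (:1 :+ z :^ 5 :+ z :^ 10) :* (:- (u :* x) :+ z :^ 5 :* (u :* x) :^ 2 :+ (:1 :- z :^ 5) :* (u :* x) :^ 3)) z u x)

  fifth-product : ∀ x → (1# + - x) * (1# + - (z ^ 3 * x)) * (1# + - (z ^ 6 * x)) * (1# + - (z ^ 9 * x)) * (1# + - (z ^ 12 * x)) ≈ 1# + - x ^ 5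
  fifth-product x = mod quintic (solve 2 (λ z x → (:1 :- x) :* (:1 :- z :^ 3 :* x) :* (:1 :- z :^ 6 :* x) :* (:1 :- z :^ 9 :* x) :* (:1 :- z :^ 12 :* x)
    := :1 :- x :^ 5 :+ (:1 :+ z :^ 3 :+ z :^ 6 :+ z :^ 9 :+ z :^ 12)
      :* (:- x :+ (z :^ 3 :+ z :^ 9) :* x :^ 2 :- (z :^ 9 :+ z :^ 15) :* x :^ 3 :+ z :^ 18 :* x :^ 4 :+ (:1 :- z :^ 3 :+ z :^ 15 :- z :^ 18) :* x :^ 5)) z x)

  private
    L : ℕ → Carrier → Carrier
    L k x = 1# + - (z ^ k * x)

  -- The orbits of multiplication by z^5 on z, z^2, z^3, z^4.
  orbit : ∀ k x → L k x * L (k ℕ.+ 5) x * L (k ℕ.+ 10) x ≈ 1# + - (z ^ (3 ℕ.* k) * x ^ 3)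
  orbit k x = trans (*-cong (*-congˡ (+-congˡ (-‿cong (*-congʳ (^-+ k 5))))) (+-congˡ (-‿cong (*-congʳ (^-+ k 10)))))
    (trans (cube-product (z ^ k) x) (+-congˡ (-‿cong (*-congʳ (trans (^-* k 3) (reflexive (≡.cong (z ^_) (ℕP.*-comm k 3))))))))

  -- The factor 1 - x^5 is split into five linear ones. All fifteen are then regrouped along cosets
  -- of the cube roots of unity, which leaves the five factors of 1 - x^15 in x^3.
  primitive-product : ∀ x → L 1 x * L 2 x * L 4 x * L 7 x * L 8 x * L 11 x * L 13 x * L 14 x * (1# + - x ^ 5) * (1# + - x ^ 3) ≈ (1# + - x) * (1# + - x ^ 15)
  primitive-product x = trans (*-congʳ (*-congˡ (sym (fifth-product x)))) (trans
    (solve 14 (λ a b c d e f g h o t s n w y →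
        a :* b :* c :* d :* e :* f :* g :* h :* (o :* t :* s :* n :* w) :* y
        := o :* (y :* (a :* s :* f) :* (b :* d :* w) :* (c :* n :* h) :* (t :* e :* g)))
      (L 1 x) (L 2 x) (L 4 x) (L 7 x) (L 8 x) (L 11 x) (L 13 x) (L 14 x) (1# + - x) (L 3 x) (L 6 x) (L 9 x) (L 12 x) (1# + - x ^ 3))
    (*-congˡ (trans (*-cong (*-cong (*-cong (*-congˡ (orbit 1 x)) (orbit 2 x)) (orbit 4 x)) (orbit 3 x))
      (trans (solve 5 (λ o a b c d → o :* a :* b :* c :* d := o :* a :* b :* d :* c) (1# + - x ^ 3) (L 3 (x ^ 3)) (L 6 (x ^ 3)) (L 12 (x ^ 3)) (L 9 (x ^ 3)))
      (trans (fifth-product (x ^ 3)) (+-congˡ (-‿cong (solve 1 (λ x → (x :^ 3) :^ 5 := x :^ 15) x))))))))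

  module Orthogonality (cancel : ∀ n x → fromℕ (suc n) * x ≈ 0# → x ≈ 0#) where

    geometric : ∀ x n → (x + - 1#) * sum n (x ^_) ≈ x ^ n + - 1#
    geometric x zero    = solve 1 (λ x → (x :- :1) :* :0 := :1 :- :1) x
    geometric x (suc n) = trans (*-congˡ (+-congˡ (FiniteSums.sum-*ˡ S n x (x ^_))))
      (trans (solve 2 (λ x s → (x :- :1) :* (:1 :+ x :* s) := x :- :1 :+ x :* ((x :- :1) :* s)) x (sum n (x ^_)))
      (trans (+-congˡ (*-congˡ (geometric x n))) (solve 2 (λ x y → x :- :1 :+ x :* (y :- :1) := x :* y :- :1) x (x ^ n))))

    kill : ∀ x s n → (x + - 1#) * s ≈ 0# → (x ^ n + - 1#) * s ≈ 0#
    kill x s zero    e = solve 1 (λ s → (:1 :- :1) :* s := :0) s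
    kill x s (suc n) e = trans (solve 3 (λ x y s → (x :* y :- :1) :* s := x :* ((y :- :1) :* s) :+ (x :- :1) :* s) x (x ^ n) s)
      (trans (+-cong (trans (*-congˡ (kill x s n e)) (zeroʳ x)) e) (+-identityˡ 0#))

    -- For the geometric sum s, (z^m - 1) s = z^(15m) - 1 = 0. The exponent n is chosen with mn
    -- congruent to d = gcd(m, 15) modulo 15, so (z^d - 1) s = 0 as well; and modulo the cyclotomic
    -- relations z^d - 1 divides 1, 5 or 3 for d = 1, 3, 5.
    by : ∀ m n k d → m ℕ.* n ≡ 15 ℕ.* k ℕ.+ d → (∀ s → (z ^ d + - 1#) * s ≈ 0# → s ≈ 0#) → sum 15 (λ a → (z ^ m) ^ a) ≈ 0#
    by m n k d e c = c _ (trans (*-congʳ (+-congʳ (sym (trans (^-* m n) (trans (reflexive (≡.cong (z ^_) e)) (reduce k d))))))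
      (kill (z ^ m) _ n (trans (geometric (z ^ m) 15) (trans (+-congʳ (trans (^-* m 15) (trans (reflexive (≡.cong (z ^_)
        (≡.trans (ℕP.*-comm m 15) (≡.sym (ℕP.+-identityʳ (15 ℕ.* m)))))) (reduce m 0)))) (-‿inverseʳ 1#)))))

    cancel₁ : ∀ s → (z ^ 1 + - 1#) * s ≈ 0# → s ≈ 0#
    cancel₁ s e = trans (mod Φ (solve 2 (λ z s → s := :- ((z :^ 1 :- :1) :* s :* (z :^ 7 :+ z :^ 4 :+ z :^ 2 :+ z)) :+ :Φ z :* s) z s))
      (trans (-‿cong (trans (*-congʳ e) (zeroˡ _))) (solve 0 (:- :0 := :0)))

    cancel₃ : ∀ s → (z ^ 3 + - 1#) * s ≈ 0# → s ≈ 0#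
    cancel₃ s e = cancel 4 s (trans (mod quintic (solve 2 (λ z s → :c (+ 5) :* s := :- ((z :^ 3 :- :1) :* s :* (z :^ 9 :+ :c (+ 2) :* z :^ 6 :+ :c (+ 3) :* z :^ 3 :+ :c (+ 4)))
        :+ (:1 :+ z :^ 3 :+ z :^ 6 :+ z :^ 9 :+ z :^ 12) :* s) z s))
      (trans (-‿cong (trans (*-congʳ e) (zeroˡ _))) (solve 0 (:- :0 := :0))))

    cancel₅ : ∀ s → (z ^ 5 + - 1#) * s ≈ 0# → s ≈ 0#
    cancel₅ s e = cancel 2 s (trans (mod cubic (solve 2 (λ z s → :c (+ 3) :* s := :- ((z :^ 5 :- :1) :* s :* (z :^ 5 :+ :c (+ 2))) :+ (:1 :+ z :^ 5 :+ z :^ 10) :* s) z s))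
      (trans (-‿cong (trans (*-congʳ e) (zeroˡ _))) (solve 0 (:- :0 := :0))))

    orthogonal : ∀ r → 1 ≤ r → r < 15 → sum 15 (λ a → (z ^ (r ℕ.+ r)) ^ a) ≈ 0#
    orthogonal 1  _ _ = by 2 8 1 1 ≡.refl cancel₁
    orthogonal 2  _ _ = by 4 4 1 1 ≡.refl cancel₁
    orthogonal 3  _ _ = by 6 3 1 3 ≡.refl cancel₃
    orthogonal 4  _ _ = by 8 2 1 1 ≡.refl cancel₁
    orthogonal 5  _ _ = by 10 2 1 5 ≡.refl cancel₅
    orthogonal 6  _ _ = by 12 4 3 3 ≡.refl cancel₃
    orthogonal 7  _ _ = by 14 14 13 1 ≡.refl cancel₁
    orthogonal 8  _ _ = by 16 1 1 1 ≡.refl cancel₁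
    orthogonal 9  _ _ = by 18 1 1 3 ≡.refl cancel₃
    orthogonal 10 _ _ = by 20 1 1 5 ≡.refl cancel₅
    orthogonal 11 _ _ = by 22 13 19 1 ≡.refl cancel₁
    orthogonal 12 _ _ = by 24 2 3 3 ≡.refl cancel₃
    orthogonal 13 _ _ = by 26 11 19 1 ≡.refl cancel₁
    orthogonal 14 _ _ = by 28 7 13 1 ≡.refl cancel₁
    orthogonal (suc (suc (suc (suc (suc (suc (suc (suc (suc (suc (suc (suc (suc (suc (suc r))))))))))))))) _
      (s≤s (s≤s (s≤s (s≤s (s≤s (s≤s (s≤s (s≤s (s≤s (s≤s (s≤s (s≤s (s≤s (s≤s (s≤s ())))))))))))))))

-- Infinite products of power series.

module InfiniteProducts (R : CommutativeRing 0ℓ 0ℓ) where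
  open CommutativeRing R hiding (zero)
  open Series R
  private module 𝕊 = CommutativeRing ring𝕊
  open Solver ring𝕊 using (_^_; solve; _:+_; _:*_; _:-_; :-_; _:=_; :0; :1; :c; _:^_)

  Π : (ℕ → Ser) → ℕ → Ser
  Π f zero    = 𝟙
  Π f (suc j) = Π f j ⊠ f j

  Π-cong : ∀ {f g} → (∀ i → f i ≋ g i) → ∀ j → Π f j ≋ Π g j
  Π-cong e zero    = 𝕊.refl
  Π-cong e (suc j) = 𝕊.*-cong (Π-cong e j) (e j)

  Π-⊠ : ∀ f g j → Π (λ i → f i ⊠ g i) j ≋ Π f j ⊠ Π g j
  Π-⊠ f g zero    = 𝕊.sym (𝕊.*-identityˡ 𝟙)
  Π-⊠ f g (suc j) = 𝕊.trans (𝕊.*-congʳ (Π-⊠ f g j)) (solve 4 (λ a b c d → a :* b :* (c :* d) := a :* c :* (b :* d)) (Π f j) (Π g j) (f j) (g j))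

  -- Factors 1 + O(q^(i+1)).
  Convergent : (ℕ → Ser) → Set
  Convergent f = ∀ i → (f i ⊞ ⊟ 𝟙) ∈O suc i

  Π-stable : ∀ f → Convergent f → Stable (Π f)
  Π-stable f c M n n≤M = trans (𝕊.trans split (𝕊.refl) n) (trans (+-congˡ (O-⊠ʳ (Π f M) (c M) n (s≤s n≤M))) (+-identityʳ _))
    where
    split : Π f M ⊠ f M ≋ Π f M ⊞ Π f M ⊠ (f M ⊞ ⊟ 𝟙)
    split = solve 2 (λ p f → p :* f := p :+ p :* (f :- :1)) (Π f M) (f M)

  convergent-⊠ : ∀ f g → Convergent f → Convergent g → Convergent (λ i → f i ⊠ g i)
  convergent-⊠ f g c d i = O-cong (solve 2 (λ f g → (f :- :1) :* g :+ (g :- :1) := f :* g :- :1) (f i) (g i))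
    (O-⊞ {(f i ⊞ ⊟ 𝟙) ⊠ g i} (O-⊠ˡ (g i) (c i)) (d i))

  ∏ : (ℕ → Ser) → Ser
  ∏ f = Lim (Π f)

  ∏-⊠ : ∀ f g → Convergent f → Convergent g → ∏ (λ i → f i ⊠ g i) ≋ ∏ f ⊠ ∏ g
  ∏-⊠ f g c d = 𝕊.trans (Lim-cong (Π-⊠ f g)) (Lim-⊠ (Π f) (Π g) (Π-stable f c) (Π-stable g d))

  ∏-cong : ∀ {f g} → (∀ i → f i ≋ g i) → ∏ f ≋ ∏ g
  ∏-cong e = Lim-cong (Π-cong e)

  Q : ℕ → Ser
  Q i = q^ (suc i)

  linear : Ser → ℕ → Ser
  linear Z i = 𝟙 ⊞ Z ⊠ Q i

  module J = TripleProduct R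

  F⁺-Π : ∀ j Z → J.F⁺ j Z ≋ Π (linear Z) j
  F⁺-Π zero    Z = 𝕊.refl
  F⁺-Π (suc j) Z = 𝕊.trans (J.F⁺-suc Z j) (𝕊.*-congʳ (F⁺-Π j Z))

  euler : ℕ → ℕ → Ser
  euler m i = 𝟙 ⊞ ⊟ q^ (m ℕ.* suc i)

  𝐄 : ℕ → Ser
  𝐄 m = ∏ (euler m)

  euler-convergent : ∀ m → Convergent (euler (suc m))
  euler-convergent m i = O-cong (𝕊.trans (𝕊.*-congˡ (𝕊.refl {⊟ q^ (m ℕ.* suc i)})) (𝕊.trans
      (solve 2 (λ a b → a :* :- b := :1 :- a :* b :- :1) (q^ (suc i)) (q^ (m ℕ.* suc i)))
      (𝕊.+-congʳ (𝕊.+-congˡ (𝕊.-‿cong (𝕊.sym (q^-+ (suc i) (m ℕ.* suc i))))))))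
    (O-q^ (suc i) (⊟ q^ (m ℕ.* suc i)))

  Q-pow : ∀ m i → Q i ^ m ≋ q^ (m ℕ.* suc i)
  Q-pow zero    i = 𝕊.refl
  Q-pow (suc m) i = 𝕊.trans (𝕊.*-congˡ (Q-pow m i)) (𝕊.sym (q^-+ (suc i) (m ℕ.* suc i)))

  euler-Q : ∀ m i → euler m i ≋ 𝟙 ⊞ ⊟ (Q i ^ m)
  euler-Q m i = 𝕊.+-congˡ (𝕊.-‿cong (𝕊.sym (Q-pow m i)))

  𝓔≋𝐄 : J.𝓔 ≋ 𝐄 1
  𝓔≋𝐄 = Lim-cong (λ j → 𝕊.trans (F⁺-Π j (⊟ 𝟙)) (Π-cong (λ i → 𝕊.sym (𝕊.trans (euler-Q 1 i)
    (solve 1 (λ q → :1 :- q :^ 1 := :1 :+ (:- :1) :* q) (Q i)))) j))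

  private module Sp = Spread R 14

  dilation-𝓔 : Sp.dilation J.𝓔 ≋ 𝐄 15
  dilation-𝓔 n = trans (Sp.spread-cong≤ n 0 (λ i i≤n → trans (sym (Lim-at J.e (J.F⁺-stable (⊟ 𝟙)) n i i≤n)) (F⁺-Π n (⊟ 𝟙) i))) (go n n)
    where
    go : ∀ j → Sp.dilation (Π (linear (⊟ 𝟙)) j) ≋ Π (euler 15) j
    go zero    = Sp.dilation-𝟙
    go (suc j) = 𝕊.trans (Sp.dilation-⊠ (Π (linear (⊟ 𝟙)) j) _) (𝕊.*-cong (go j) step)
      where
      minus-one : Sp.dilation (⊟ 𝟙) ≋ ⊟ 𝟙
      minus-one = 𝕊.trans (Sp.dilation-cong (𝕊.sym C₋₁)) (𝕊.trans (Sp.dilation-C (- 1#)) C₋₁)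
        where
        C₋₁ : C (- 1#) ≋ ⊟ 𝟙
        C₋₁ = 𝕊.trans (C-neg 1#) (𝕊.-‿cong C-1)
      term : Sp.dilation (⊟ 𝟙 ⊠ Q j) ≋ ⊟ q^ (15 ℕ.* suc j)
      term = 𝕊.trans (Sp.dilation-⊠ (⊟ 𝟙) (Q j)) (𝕊.trans (𝕊.*-cong minus-one (Sp.dilation-q^ (suc j)))
        (𝕊.trans (solve 1 (λ a → (:- :1) :* a := :- a) (q^ (suc j ℕ.* 15))) (𝕊.-‿cong (𝕊.reflexive (≡.cong q^ (ℕP.*-comm (suc j) 15))))))
      step : Sp.dilation (linear (⊟ 𝟙) j) ≋ euler 15 j
      step = 𝕊.trans (Sp.dilation-⊞ 𝟙 (⊟ 𝟙 ⊠ Q j)) (𝕊.+-cong Sp.dilation-𝟙 term)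

-- Theta values at fifteenth roots of unity as products.

module FifteenthTheta (R : CommutativeRing 0ℓ 0ℓ) (ζ : CommutativeRing.Carrier R)
  (Φ : CommutativeRing._≈_ R (Φ₁₅ R ζ) (CommutativeRing.0# R))
  (cancel : ∀ n x → CommutativeRing._≈_ R (CommutativeRing._*_ R (Solver.fromℕ R (suc n)) x) (CommutativeRing.0# R) →
            CommutativeRing._≈_ R x (CommutativeRing.0# R)) where
  open CommutativeRing R hiding (zero)
  open Series R
  open InfiniteProducts R
  private
    module 𝕊 = CommutativeRing ring𝕊
    module Rt = FifteenthRoot R ζ Φ
  open Solver R using () renaming (_^_ to _^ᴿ_)
  open Solver ring𝕊 using (Expr; _^_; ^-cong; fromℤ; solve; _:+_; _:*_; _:-_; :-_; _:=_; :0; :1; :c; _:^_)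

  ξ : Unit R
  ξ = record { unit = ζ ; inverse = ζ ^ᴿ 14 ; unit-inverse = Rt.z¹⁵ }

  open RootSum R ξ Rt.z¹⁵ (Rt.Orthogonality.orthogonal cancel) public
  open ThetaValues R ξ public

  z : Ser
  z = C ζ

  C-^ : ∀ n → C (ζ ^ᴿ n) ≋ z ^ n
  C-^ zero    = C-1
  C-^ (suc n) = 𝕊.trans (C-* ζ (ζ ^ᴿ n)) (𝕊.*-congˡ (C-^ n))

  Φ𝕊 : Φ₁₅ ring𝕊 z ≋ 𝟘
  Φ𝕊 = 𝕊.trans (𝕊.sym (𝕊.trans (plus _ _) (𝕊.+-cong (𝕊.trans (plus _ _) (𝕊.+-cong (𝕊.trans (plus _ _) (𝕊.+-cong (𝕊.trans (plus _ _)
      (𝕊.+-cong (𝕊.trans (plus _ _) (𝕊.+-cong (𝕊.trans (plus _ _) (𝕊.+-cong (C-^ 8) (minus (C-^ 7)))) (C-^ 5))) (minus (C-^ 4)))) (C-^ 3))) (minus 𝕊.refl))) C-1)))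
    (𝕊.trans (C-cong Φ) C-0)
    where
    plus : ∀ a b → C (a + b) ≋ C a ⊞ C b
    plus = C-+
    minus : ∀ {a b} → C a ≋ b → C (- a) ≋ ⊟ b
    minus e = 𝕊.trans (C-neg _) (𝕊.-‿cong e)

  module Zt = FifteenthRoot ring𝕊 z Φ𝕊

  inverse-power : ∀ a b k → 14 ℕ.* a ≡ 15 ℕ.* k ℕ.+ b → (ζ ^ᴿ 14) ^ᴿ a ≈ ζ ^ᴿ b
  inverse-power a b k e = trans (Rt.^-* 14 a) (trans (reflexive (≡.cong (ζ ^ᴿ_) e)) (Rt.reduce k b))

  factor : ℕ → ℕ → ℕ → Ser
  factor m n i = (𝟙 ⊞ ⊟ Q i) ⊠ ((𝟙 ⊞ ⊟ (z ^ m ⊠ Q i)) ⊠ (𝟙 ⊞ ⊟ (z ^ n ⊠ Q i)))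

  factor-convergent : ∀ m n → Convergent (factor m n)
  factor-convergent m n = convergent-⊠ (λ i → 𝟙 ⊞ ⊟ Q i) (λ i → (𝟙 ⊞ ⊟ (z ^ m ⊠ Q i)) ⊠ (𝟙 ⊞ ⊟ (z ^ n ⊠ Q i))) one
    (convergent-⊠ (λ i → 𝟙 ⊞ ⊟ (z ^ m ⊠ Q i)) (λ i → 𝟙 ⊞ ⊟ (z ^ n ⊠ Q i)) (lin m) (lin n))
    where
    one : Convergent (λ i → 𝟙 ⊞ ⊟ Q i)
    one i = O-cong (solve 1 (λ q → q :* :- :1 := :1 :- q :- :1) (Q i)) (O-q^ (suc i) (⊟ 𝟙))
    lin : ∀ m → Convergent (λ i → 𝟙 ⊞ ⊟ (z ^ m ⊠ Q i))
    lin m i = O-cong (solve 2 (λ z q → q :* :- z := :1 :- z :* q :- :1) (z ^ m) (Q i)) (O-q^ (suc i) (⊟ (z ^ m)))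

  -- Here b and n are the residues of -a and -2a modulo 15, with quotients recorded by k and l, so
  -- that inverse powers of the root are written with natural exponents.
  product-formula : ∀ a b k n l → 14 ℕ.* a ≡ 15 ℕ.* k ℕ.+ b → 14 ℕ.* (a ℕ.+ a) ≡ 15 ℕ.* l ℕ.+ n →
                    p 0 (+ a) ≋ (z ^ b ⊞ ⊟ (z ^ a)) ⊠ ∏ (factor (a ℕ.+ a) n)
  product-formula a b k n l e f = 𝕊.trans (Θ-cong (λ u → trans (*-identityˡ _) (sym (root-zpow a u)))) (𝕊.trans (J.theta-product (root a))
    (𝕊.*-cong (𝕊.+-cong (𝕊.trans (C-cong (inverse-power a b k e)) (C-^ b)) (𝕊.-‿cong (C-^ a)))
      (Lim-cong (λ j → 𝕊.trans (𝕊.*-cong (F⁺-Π j (⊟ 𝟙)) (𝕊.*-cong (F⁺-Π j _) (F⁺-Π j _)))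
        (𝕊.sym (𝕊.trans (Π-cong split j) (𝕊.trans (Π-⊠ (linear (⊟ 𝟙)) _ j) (𝕊.*-congˡ (Π-⊠ (linear X′) (linear Y′) j)))))))))
    where
    open Lattice R using (Θ-cong)
    X′ Y′ : Ser
    X′ = C (- (ζ ^ᴿ a * ζ ^ᴿ a))
    Y′ = C (- ((ζ ^ᴿ 14) ^ᴿ a * (ζ ^ᴿ 14) ^ᴿ a))
    X≋ : X′ ≋ ⊟ (z ^ (a ℕ.+ a))
    X≋ = 𝕊.trans (C-neg _) (𝕊.-‿cong (𝕊.trans (C-cong (sym (Rt.^-+ a a))) (C-^ (a ℕ.+ a))))
    Y≋ : Y′ ≋ ⊟ (z ^ n)
    Y≋ = 𝕊.trans (C-neg _) (𝕊.-‿cong (𝕊.trans (C-cong (trans (trans (*-cong (Rt.^-* 14 a) (Rt.^-* 14 a)) (sym (Rt.^-+ (14 ℕ.* a) (14 ℕ.* a))))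
      (trans (reflexive (≡.cong (ζ ^ᴿ_) (≡.trans (≡.sym (ℕP.*-distribˡ-+ 14 a a)) f))) (Rt.reduce l n)))) (C-^ n)))
    split : ∀ i → factor (a ℕ.+ a) n i ≋ linear (⊟ 𝟙) i ⊠ (linear X′ i ⊠ linear Y′ i)
    split i = 𝕊.trans (solve 3 (λ q x y → (:1 :- q) :* ((:1 :- x :* q) :* (:1 :- y :* q)) := (:1 :+ (:- :1) :* q) :* ((:1 :+ (:- x) :* q) :* (:1 :+ (:- y) :* q))) (Q i) (z ^ (a ℕ.+ a)) (z ^ n))
      (𝕊.*-congˡ (𝕊.*-cong (𝕊.+-congˡ (𝕊.*-congʳ (𝕊.sym X≋))) (𝕊.+-congˡ (𝕊.*-congʳ (𝕊.sym Y≋)))))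

  P : ℕ → Ser
  P a = p 0 (+ a)

  κ : ℕ → ℕ → Ser
  κ b a = z ^ b ⊞ ⊟ (z ^ a)

  P₅ : P 5 ≋ κ 10 5 ⊠ 𝐄 3
  P₅ = 𝕊.trans (product-formula 5 10 4 5 9 ≡.refl ≡.refl) (𝕊.*-congˡ (∏-cong (λ i → 𝕊.trans
    (𝕊.trans (solve 3 (λ q x y → (:1 :- q) :* ((:1 :- x :* q) :* (:1 :- y :* q)) := (:1 :- :1 :* q) :* (:1 :- :1 :* y :* q) :* (:1 :- :1 :* x :* q)) (Q i) (z ^ 10) (z ^ 5))
      (Zt.cube-product 𝟙 (Q i)))
    (𝕊.trans (solve 1 (λ q → :1 :- :1 :^ 3 :* q :^ 3 := :1 :- q :^ 3) (Q i)) (𝕊.sym (euler-Q 3 i))))))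

  P₃P₆ : P 3 ⊠ P 6 ≋ κ 12 3 ⊠ κ 9 6 ⊠ (𝐄 1 ⊠ 𝐄 5)
  P₃P₆ = 𝕊.trans (𝕊.*-cong (product-formula 3 12 2 9 5 ≡.refl ≡.refl) (product-formula 6 9 5 3 11 ≡.refl ≡.refl))
    (𝕊.trans (solve 4 (λ a b c d → a :* b :* (c :* d) := a :* c :* (b :* d)) (κ 12 3) (∏ (factor 6 9)) (κ 9 6) (∏ (factor 12 3)))
    (𝕊.*-congˡ (𝕊.trans (𝕊.sym (∏-⊠ (factor 6 9) (factor 12 3) (factor-convergent 6 9) (factor-convergent 12 3)))
      (𝕊.trans (∏-cong pointwise) (∏-⊠ (euler 1) (euler 5) (euler-convergent 0) (euler-convergent 4))))))
    where
    pointwise : ∀ i → factor 6 9 i ⊠ factor 12 3 i ≋ euler 1 i ⊠ euler 5 i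
    pointwise i = 𝕊.trans (solve 5 (λ q a b c d → (:1 :- q) :* ((:1 :- a :* q) :* (:1 :- b :* q)) :* ((:1 :- q) :* ((:1 :- c :* q) :* (:1 :- d :* q)))
        := (:1 :- q :^ 1) :* ((:1 :- q) :* (:1 :- d :* q) :* (:1 :- a :* q) :* (:1 :- b :* q) :* (:1 :- c :* q))) (Q i) (z ^ 6) (z ^ 9) (z ^ 12) (z ^ 3))
      (𝕊.*-cong (𝕊.sym (euler-Q 1 i)) (𝕊.trans (Zt.fifth-product (Q i)) (𝕊.sym (euler-Q 5 i))))

  -- The exponents 2a and -2a for a = 1, 2, 4, 7 run through the residues prime to 15. Multiplying
  -- by the products in q^3 and q^5 makes `primitive-product` applicable factor by factor.
  P₁P₂P₄P₇ : P 1 ⊠ P 2 ⊠ P 4 ⊠ P 7 ⊠ (𝐄 3 ⊠ 𝐄 5) ≋ 𝐄 15 ⊠ 𝐄 1 ^ 5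
  P₁P₂P₄P₇ = 𝕊.trans (𝕊.*-congʳ (𝕊.*-cong (𝕊.*-cong (𝕊.*-cong (product-formula 1 14 0 13 1 ≡.refl ≡.refl) (product-formula 2 13 1 11 3 ≡.refl ≡.refl))
      (product-formula 4 11 3 7 7 ≡.refl ≡.refl)) (product-formula 7 8 6 1 13 ≡.refl ≡.refl)))
    (𝕊.trans (solve 10 (λ a A b B c C d D E F → a :* A :* (b :* B) :* (c :* C) :* (d :* D) :* (E :* F) := a :* b :* c :* d :* (A :* B :* (C :* D) :* (E :* F)))
      (κ 14 1) ∏₁ (κ 13 2) ∏₂ (κ 11 4) ∏₄ (κ 8 7) ∏₇ (𝐄 3) (𝐄 5))
    (𝕊.trans (𝕊.*-cong constants (𝕊.trans (𝕊.sym collect) (𝕊.trans (∏-cong pointwise) expand))) (𝕊.*-identityˡ _)))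
    where
    f₁ f₂ f₄ f₇ : ℕ → Ser
    f₁ = factor 2 13
    f₂ = factor 4 11
    f₄ = factor 8 7
    f₇ = factor 14 1
    ∏₁ ∏₂ ∏₄ ∏₇ : Ser
    ∏₁ = ∏ f₁
    ∏₂ = ∏ f₂
    ∏₄ = ∏ f₄
    ∏₇ = ∏ f₇
    constants : κ 14 1 ⊠ κ 13 2 ⊠ κ 11 4 ⊠ κ 8 7 ≋ 𝟙
    constants = 𝕊.trans (solve 1 (λ z → (z :^ 14 :- z :^ 1) :* (z :^ 13 :- z :^ 2) :* (z :^ 11 :- z :^ 4) :* (z :^ 8 :- z :^ 7)
      := (z :^ 14 :- z) :* (z :^ 13 :- z :^ 2) :* (z :^ 11 :- z :^ 4) :* (z :^ 8 :- z :^ 7)) z) Zt.kappa₁₂₄₇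
    c₁₂ : Convergent (λ i → f₁ i ⊠ f₂ i)
    c₁₂ = convergent-⊠ f₁ f₂ (factor-convergent 2 13) (factor-convergent 4 11)
    c₄₇ : Convergent (λ i → f₄ i ⊠ f₇ i)
    c₄₇ = convergent-⊠ f₄ f₇ (factor-convergent 8 7) (factor-convergent 14 1)
    c₃₅ : Convergent (λ i → euler 3 i ⊠ euler 5 i)
    c₃₅ = convergent-⊠ (euler 3) (euler 5) (euler-convergent 2) (euler-convergent 4)
    all : ℕ → Ser
    all i = f₁ i ⊠ f₂ i ⊠ (f₄ i ⊠ f₇ i) ⊠ (euler 3 i ⊠ euler 5 i)
    collect : ∏ all ≋ ∏₁ ⊠ ∏₂ ⊠ (∏₄ ⊠ ∏₇) ⊠ (𝐄 3 ⊠ 𝐄 5)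
    collect = 𝕊.trans (∏-⊠ (λ i → f₁ i ⊠ f₂ i ⊠ (f₄ i ⊠ f₇ i)) (λ i → euler 3 i ⊠ euler 5 i) (convergent-⊠ _ (λ i → f₄ i ⊠ f₇ i) c₁₂ c₄₇) c₃₅)
      (𝕊.*-cong (𝕊.trans (∏-⊠ (λ i → f₁ i ⊠ f₂ i) (λ i → f₄ i ⊠ f₇ i) c₁₂ c₄₇)
        (𝕊.*-cong (∏-⊠ f₁ f₂ (factor-convergent 2 13) (factor-convergent 4 11)) (∏-⊠ f₄ f₇ (factor-convergent 8 7) (factor-convergent 14 1))))
        (∏-⊠ (euler 3) (euler 5) (euler-convergent 2) (euler-convergent 4)))
    pow : ℕ → ℕ → Ser
    pow n i = euler 1 i ^ n
    pow-convergent : ∀ n → Convergent (pow n)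
    pow-convergent zero    i j p = -‿inverseʳ (𝟙 j)
    pow-convergent (suc n) = convergent-⊠ (euler 1) (pow n) (euler-convergent 0) (pow-convergent n)
    ∏-pow : ∀ n → ∏ (pow n) ≋ 𝐄 1 ^ n
    ∏-pow zero    = Lim-cong {λ j → Π (pow 0) j} {λ _ → 𝟙} ones
      where
      ones : ∀ j → Π (pow 0) j ≋ 𝟙
      ones zero    = 𝕊.refl
      ones (suc j) = 𝕊.trans (𝕊.*-identityʳ _) (ones j)
    ∏-pow (suc n) = 𝕊.trans (∏-⊠ (euler 1) (pow n) (euler-convergent 0) (pow-convergent n)) (𝕊.*-congˡ (∏-pow n))
    expand : ∏ (λ i → euler 15 i ⊠ pow 5 i) ≋ 𝐄 15 ⊠ 𝐄 1 ^ 5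
    expand = 𝕊.trans (∏-⊠ (euler 15) (pow 5) (euler-convergent 14) (pow-convergent 5)) (𝕊.*-congˡ (∏-pow 5))
    L : ℕ → ℕ → Ser
    L k i = 𝟙 ⊞ ⊟ (z ^ k ⊠ Q i)
    pointwise : ∀ i → all i ≋ euler 15 i ⊠ pow 5 i
    pointwise i = 𝕊.trans (𝕊.*-congˡ (𝕊.*-cong (euler-Q 3 i) (euler-Q 5 i))) (𝕊.trans
      (solve 11 (λ e a b c d f g h k t u → e :* (b :* g) :* (e :* (c :* f)) :* (e :* (h :* d) :* (e :* (k :* a))) :* (t :* u)
        := e :^ 4 :* (a :* b :* c :* d :* h :* f :* g :* k :* u :* t))
        (𝟙 ⊞ ⊟ Q i) (L 1 i) (L 2 i) (L 4 i) (L 7 i) (L 11 i) (L 13 i) (L 8 i) (L 14 i) (𝟙 ⊞ ⊟ (Q i ^ 3)) (𝟙 ⊞ ⊟ (Q i ^ 5)))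
      (𝕊.trans (𝕊.*-congˡ (Zt.primitive-product (Q i))) (𝕊.trans
        (solve 2 (λ q u → (:1 :- q) :^ 4 :* ((:1 :- q) :* u) := u :* (:1 :- q :^ 1) :^ 5) (Q i) (𝟙 ⊞ ⊟ (Q i ^ 15)))
        (𝕊.*-cong (𝕊.sym (euler-Q 15 i)) (^-cong 5 (𝕊.sym (euler-Q 1 i)))))))

-- The odd and even functions on ℤ / 15 with given values at 1, …, 7; the odd one vanishes at 0.
module Values (S : CommutativeRing 0ℓ 0ℓ) where
  open CommutativeRing S hiding (zero)

  odd-table even-table : (ℕ → Carrier) → ℕ → Carrier
  odd-table P 0  = 0#
  odd-table P 8  = - P 7
  odd-table P 9  = - P 6
  odd-table P 10 = - P 5
  odd-table P 11 = - P 4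
  odd-table P 12 = - P 3
  odd-table P 13 = - P 2
  odd-table P 14 = - P 1
  odd-table P r  = P r
  even-table P 8  = P 7
  even-table P 9  = P 6
  even-table P 10 = P 5
  even-table P 11 = P 4
  even-table P 12 = P 3
  even-table P 13 = P 2
  even-table P 14 = P 1
  even-table P r  = P r

  -- At a numeral these compute to an entry of the table with its sign, so a relation instantiated
  -- at given integers is by evaluation a relation between the values at 1, ..., 7.
  odd-value even-value : (ℕ → Carrier) → ℤ → Carrier
  odd-value P i  = odd-table P (i %ℕ 15)
  even-value P i = even-table P (i %ℕ 15)

-- Relations between theta values

module PluckerRelation (S : CommutativeRing 0ℓ 0ℓ) where
  open CommutativeRing S hiding (zero)
  open Solver S using (solve; _:+_; _:*_; _:-_; _:=_; :0)

  -- Four vectors (oᵢ, eᵢ) lie in a plane, and their minors satisfy the Plücker relation. With theta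
  -- products for the minors this is Weierstrass's three-term relation; when a vector is replaced by
  -- a derivative of another one, it relates derivatives.
  plücker : ∀ o₁ e₁ o₂ e₂ o₃ e₃ o₄ e₄ →
    (o₁ * e₂ + - (e₁ * o₂)) * (o₃ * e₄ + - (e₃ * o₄)) + - ((o₁ * e₃ + - (e₁ * o₃)) * (o₂ * e₄ + - (e₂ * o₄)))
    + (o₁ * e₄ + - (e₁ * o₄)) * (o₂ * e₃ + - (e₂ * o₃)) ≈ 0#
  plücker = solve 8 (λ o₁ e₁ o₂ e₂ o₃ e₃ o₄ e₄ →
    (o₁ :* e₂ :- e₁ :* o₂) :* (o₃ :* e₄ :- e₃ :* o₄) :- (o₁ :* e₃ :- e₁ :* o₃) :* (o₂ :* e₄ :- e₂ :* o₄)
    :+ (o₁ :* e₄ :- e₁ :* o₄) :* (o₂ :* e₃ :- e₂ :* o₃) := :0)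

  subst-plücker : ∀ {a b c d e f a′ b′ c′ d′ e′ f′} → a ≈ a′ → b ≈ b′ → c ≈ c′ → d ≈ d′ → e ≈ e′ → f ≈ f′ →
    a * b + - (c * d) + e * f ≈ 0# → a′ * b′ + - (c′ * d′) + e′ * f′ ≈ 0#
  subst-plücker a b c d e f h = trans (sym (+-cong (+-cong (*-cong a b) (-‿cong (*-cong c d))) (*-cong e f))) h

module ThetaRelations (R : CommutativeRing 0ℓ 0ℓ) (ζ : CommutativeRing.Carrier R)
  (Φ : CommutativeRing._≈_ R (Φ₁₅ R ζ) (CommutativeRing.0# R))
  (cancel : ∀ n x → CommutativeRing._≈_ R (CommutativeRing._*_ R (Solver.fromℕ R (suc n)) x) (CommutativeRing.0# R) →
            CommutativeRing._≈_ R x (CommutativeRing.0# R)) where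
  open CommutativeRing R hiding (zero)
  open Series R
  open FifteenthTheta R ζ Φ cancel
  open PluckerRelation ring𝕊
  open Values ring𝕊
  open Solver ring𝕊 using (fromℤ; fromℕ; solve; _:+_; _:*_; _:-_; :-_; _:=_; :0; :1; :c)
  private
    module 𝕊 = CommutativeRing ring𝕊
    module J = TripleProduct R

  P′ : ℕ → Ser
  P′ a = p 1 (+ a)

  v v′ : ℤ → Ser
  v  = odd-value P
  v′ = even-value P′

  period-15 : ∀ i a k → p i (a ℤ.+ k ℤ.* + 15) ≋ p i a
  period-15 i a k = p-periodic (k ℤ.* + 15) (trans (reflexive (≡.cong zpow (≡.sym (ℤP.+-identityʳ (k ℤ.* + 15))))) (zpow-period k (+ 0))) i a
    where open Lattice.Power R (Unit.unit ξ) (Unit.inverse ξ) (Unit.unit-inverse ξ)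

  p-residue : ∀ i a → p i a ≋ p i (+ (a %ℕ 15))
  p-residue i a = 𝕊.trans (p-cong i (a≡a%ℕn+[a/ℕn]*n a 15)) (period-15 i (+ (a %ℕ 15)) (a /ℕ 15))

  private
    neg₀ : ∀ a → p 0 (ℤ.- + a ℤ.+ + 1 ℤ.* + 15) ≋ ⊟ P a
    neg₀ a = 𝕊.trans (period-15 0 (ℤ.- + a) (+ 1)) (p₀-odd (+ a))
    neg₁ : ∀ a → p 1 (ℤ.- + a ℤ.+ + 1 ℤ.* + 15) ≋ P′ a
    neg₁ a = 𝕊.trans (period-15 1 (ℤ.- + a) (+ 1)) (p₁-even (+ a))

    table₀ : ∀ r → r < 15 → p 0 (+ r) ≋ odd-table P r
    table₀ 0 _ = p₀-0
    table₀ 1 _ = 𝕊.refl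
    table₀ 2 _ = 𝕊.refl
    table₀ 3 _ = 𝕊.refl
    table₀ 4 _ = 𝕊.refl
    table₀ 5 _ = 𝕊.refl
    table₀ 6 _ = 𝕊.refl
    table₀ 7 _ = 𝕊.refl
    table₀ 8 _ = neg₀ 7
    table₀ 9 _ = neg₀ 6
    table₀ 10 _ = neg₀ 5
    table₀ 11 _ = neg₀ 4
    table₀ 12 _ = neg₀ 3
    table₀ 13 _ = neg₀ 2
    table₀ 14 _ = neg₀ 1
    table₀ (suc (suc (suc (suc (suc (suc (suc (suc (suc (suc (suc (suc (suc (suc (suc r)))))))))))))))
      (s≤s (s≤s (s≤s (s≤s (s≤s (s≤s (s≤s (s≤s (s≤s (s≤s (s≤s (s≤s (s≤s (s≤s (s≤s ())))))))))))))))

    table₁ : ∀ r → r < 15 → p 1 (+ r) ≋ even-table P′ r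
    table₁ 0 _ = 𝕊.refl
    table₁ 1 _ = 𝕊.refl
    table₁ 2 _ = 𝕊.refl
    table₁ 3 _ = 𝕊.refl
    table₁ 4 _ = 𝕊.refl
    table₁ 5 _ = 𝕊.refl
    table₁ 6 _ = 𝕊.refl
    table₁ 7 _ = 𝕊.refl
    table₁ 8 _ = neg₁ 7
    table₁ 9 _ = neg₁ 6
    table₁ 10 _ = neg₁ 5
    table₁ 11 _ = neg₁ 4
    table₁ 12 _ = neg₁ 3
    table₁ 13 _ = neg₁ 2
    table₁ 14 _ = neg₁ 1
    table₁ (suc (suc (suc (suc (suc (suc (suc (suc (suc (suc (suc (suc (suc (suc (suc r)))))))))))))))
      (s≤s (s≤s (s≤s (s≤s (s≤s (s≤s (s≤s (s≤s (s≤s (s≤s (s≤s (s≤s (s≤s (s≤s (s≤s ())))))))))))))))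

  p₀-value : ∀ a → p 0 a ≋ v a
  p₀-value a = 𝕊.trans (p-residue 0 a) (table₀ (a %ℕ 15) (n%ℕd<d a 15))

  p₁-value : ∀ a → p 1 a ≋ v′ a
  p₁-value a = 𝕊.trans (p-residue 1 a) (table₁ (a %ℕ 15) (n%ℕd<d a 15))

  κ₁ : Ser
  κ₁ = p 1 (+ 0)

  private
    B₀₀ : ∀ x y → bracket 0 x 0 y ≋ v (x ℤ.+ y) ⊠ v (x ℤ.- y)
    B₀₀ x y = 𝕊.trans (bracket₀₀ x y) (𝕊.*-cong (p₀-value (x ℤ.+ y)) (p₀-value (x ℤ.- y)))
    B₁₀ : ∀ x y → bracket 1 x 0 y ≋ v′ (x ℤ.+ y) ⊠ v (x ℤ.- y) ⊞ v (x ℤ.+ y) ⊠ v′ (x ℤ.- y)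
    B₁₀ x y = 𝕊.trans (bracket₁₀ x y) (𝕊.+-cong (𝕊.*-cong (p₁-value (x ℤ.+ y)) (p₀-value (x ℤ.- y))) (𝕊.*-cong (p₀-value (x ℤ.+ y)) (p₁-value (x ℤ.- y))))
    diag : ∀ i x → p i (x ℤ.- x) ≋ p i (+ 0)
    diag i x = p-cong i (ℤP.+-inverseʳ x)
    B₁₀-diag : ∀ x → bracket 1 x 0 x ≋ v (x ℤ.+ x) ⊠ κ₁
    B₁₀-diag x = 𝕊.trans (bracket₁₀ x x) (𝕊.trans (𝕊.+-cong (𝕊.trans (𝕊.*-congˡ (𝕊.trans (diag 0 x) p₀-0)) (𝕊.zeroʳ _))
      (𝕊.*-cong (p₀-value (x ℤ.+ x)) (diag 1 x))) (𝕊.+-identityˡ _))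
    second : ∀ a → p 2 a ≋ fromℤ (+ 8) ⊠ D (v a) ⊞ v a
    second a = 𝕊.trans (heat 0 a) (𝕊.+-cong (𝕊.*-cong (𝕊.sym (fromℤ-C (+ 8))) (D-cong (p₀-value a))) (p₀-value a))
    third : p 3 (+ 0) ≋ fromℤ (+ 8) ⊠ D κ₁ ⊞ κ₁
    third = 𝕊.trans (heat 1 (+ 0)) (𝕊.+-congʳ (𝕊.*-congʳ (𝕊.sym (fromℤ-C (+ 8)))))
    B₂₀-swap : ∀ x y → bracket 0 y 2 x ≋ ⊟ (bracket 2 x 0 y)
    B₂₀-swap x y = solve 4 (λ a b c d → a :* d :- b :* c := :- (c :* b :- d :* a)) (O 0 y) (E 0 y) (O 2 x) (E 2 x)

  three-term : ∀ x y z w →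
    v (x ℤ.+ y) ⊠ v (x ℤ.- y) ⊠ (v (z ℤ.+ w) ⊠ v (z ℤ.- w)) ⊞ ⊟ (v (x ℤ.+ z) ⊠ v (x ℤ.- z) ⊠ (v (y ℤ.+ w) ⊠ v (y ℤ.- w)))
    ⊞ v (x ℤ.+ w) ⊠ v (x ℤ.- w) ⊠ (v (y ℤ.+ z) ⊠ v (y ℤ.- z)) ≋ 𝟘
  three-term x y z w = subst-plücker (B₀₀ x y) (B₀₀ z w) (B₀₀ x z) (B₀₀ y w) (B₀₀ x w) (B₀₀ y z)
    (plücker (O 0 x) (E 0 x) (O 0 y) (E 0 y) (O 0 z) (E 0 z) (O 0 w) (E 0 w))

  -- The confluent case with vectors x′, x, y, z: the minor of x′ and x is the theta value at 2x
  -- times the derivative at 0. Divided by the theta products, it evaluates λ(x + y) + λ(x - y) -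
  -- λ(x + z) - λ(x - z) as a monomial, for the logarithmic derivative λ.
  addition : ∀ x y z →
    v (x ℤ.+ x) ⊠ κ₁ ⊠ (v (y ℤ.+ z) ⊠ v (y ℤ.- z))
    ⊞ ⊟ ((v′ (x ℤ.+ y) ⊠ v (x ℤ.- y) ⊞ v (x ℤ.+ y) ⊠ v′ (x ℤ.- y)) ⊠ (v (x ℤ.+ z) ⊠ v (x ℤ.- z)))
    ⊞ (v′ (x ℤ.+ z) ⊠ v (x ℤ.- z) ⊞ v (x ℤ.+ z) ⊠ v′ (x ℤ.- z)) ⊠ (v (x ℤ.+ y) ⊠ v (x ℤ.- y)) ≋ 𝟘
  addition x y z = subst-plücker (B₁₀-diag x) (B₀₀ y z) (B₁₀ x y) (B₀₀ x z) (B₁₀ x z) (B₀₀ x y)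
    (plücker (O 1 x) (E 1 x) (O 0 x) (E 0 x) (O 0 y) (E 0 y) (O 0 z) (E 0 z))

  -- From the coincidence of three of the four arguments, with the second derivatives
  -- eliminated by the heat equation.
  derivative : ∀ x y → let a = v (x ℤ.+ y) ; b = v (x ℤ.- y) ; c = v (x ℤ.+ x)
                           a′ = v′ (x ℤ.+ y) ; b′ = v′ (x ℤ.- y) ; c′ = v′ (x ℤ.+ x) in
    κ₁ ⊠ (fromℤ (+ 4) ⊠ (D a ⊠ b ⊠ c ⊞ a ⊠ D b ⊠ c ⊞ a ⊠ b ⊠ D c) ⊞ a ⊠ b ⊠ c ⊞ (a′ ⊠ b′ ⊠ c ⊞ ⊟ (c′ ⊠ (a′ ⊠ b ⊞ a ⊠ b′)))) ⊠ fromℤ (+ 2)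
    ≋ fromℤ (+ 8) ⊠ D κ₁ ⊠ (a ⊠ b ⊠ c)
  derivative x y = 𝕊.trans (solve 11 (λ a b c a′ b′ c′ Da Db Dc k Dk →
      k :* (:c (+ 4) :* (Da :* b :* c :+ a :* Db :* c :+ a :* b :* Dc) :+ a :* b :* c :+ (a′ :* b′ :* c :- c′ :* (a′ :* b :+ a :* b′))) :* :c (+ 2)
      := :c (+ 8) :* Dk :* (a :* b :* c)
         :- (c :* k :* (:- ((:c (+ 8) :* Da :+ a) :* b :+ a′ :* b′ :+ (a′ :* b′ :+ a :* (:c (+ 8) :* Db :+ b))))
          :- (a′ :* b :+ a :* b′) :* (:- (c′ :* k :+ c′ :* k))
          :+ (c :* (:c (+ 8) :* Dk :+ k) :- (:c (+ 8) :* Dc :+ c) :* k) :* (a :* b)))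
      (v (x ℤ.+ y)) (v (x ℤ.- y)) (v (x ℤ.+ x)) (v′ (x ℤ.+ y)) (v′ (x ℤ.- y)) (v′ (x ℤ.+ x)) (D (v (x ℤ.+ y))) (D (v (x ℤ.- y))) (D (v (x ℤ.+ x))) κ₁ (D κ₁))
    (𝕊.trans (𝕊.+-congˡ (𝕊.-‿cong relation)) (𝕊.trans (𝕊.+-congˡ (solve 0 (:- :0 := :0))) (𝕊.+-identityʳ _)))
    where
    relation = subst-plücker (B₁₀-diag x)
      (𝕊.trans (B₂₀-swap x y) (𝕊.-‿cong (𝕊.trans (bracket₂₀ x y) (𝕊.+-cong
        (𝕊.+-cong (𝕊.*-cong (second (x ℤ.+ y)) (p₀-value (x ℤ.- y))) (𝕊.*-cong (p₁-value (x ℤ.+ y)) (p₁-value (x ℤ.- y))))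
        (𝕊.+-cong (𝕊.*-cong (p₁-value (x ℤ.+ y)) (p₁-value (x ℤ.- y))) (𝕊.*-cong (p₀-value (x ℤ.+ y)) (second (x ℤ.- y))))))))
      (B₁₀ x y)
      (𝕊.trans (bracket₀₂ x x) (𝕊.trans (𝕊.+-cong (𝕊.trans (𝕊.+-cong (𝕊.trans (𝕊.*-congˡ (𝕊.trans (diag 0 x) p₀-0)) (𝕊.zeroʳ _))
          (𝕊.trans (𝕊.*-congˡ (𝕊.trans (diag 2 x) p₂-0)) (𝕊.zeroʳ _))) (𝕊.+-identityˡ 𝟘))
          (𝕊.-‿cong (𝕊.+-cong (𝕊.*-cong (p₁-value (x ℤ.+ x)) (diag 1 x)) (𝕊.*-cong (p₁-value (x ℤ.+ x)) (diag 1 x))))) (𝕊.+-identityˡ _)))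
      (𝕊.trans (bracket₁₂ x x) (𝕊.+-cong
        (𝕊.trans (𝕊.+-cong (𝕊.trans (𝕊.*-congˡ (𝕊.trans (diag 0 x) p₀-0)) (𝕊.zeroʳ _)) (𝕊.*-cong (p₀-value (x ℤ.+ x)) (𝕊.trans (diag 3 x) third))) (𝕊.+-identityˡ _))
        (𝕊.-‿cong (𝕊.trans (𝕊.+-cong (𝕊.*-cong (second (x ℤ.+ x)) (diag 1 x)) (𝕊.trans (𝕊.*-congˡ (𝕊.trans (diag 2 x) p₂-0)) (𝕊.zeroʳ _))) (𝕊.+-identityʳ _)))))
      (B₀₀ x y)
      (plücker (O 1 x) (E 1 x) (O 0 x) (E 0 x) (O 0 y) (E 0 y) (O 2 x) (E 2 x))

-- Normal forms X^-m (A(X) + B(X) Y) for expressions in X, X⁻¹ and Y modulo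
-- Y + Y⁻¹ = X + X⁻¹ + 1.
module Curve (S : CommutativeRing 0ℓ 0ℓ) (X X⁻¹ Y : CommutativeRing.Carrier S)
  (XX⁻¹ : CommutativeRing._≈_ S (CommutativeRing._*_ S X X⁻¹) (CommutativeRing.1# S))
  (curve : CommutativeRing._≈_ S (CommutativeRing._*_ S Y Y)
    (CommutativeRing._+_ S (CommutativeRing._*_ S (CommutativeRing._+_ S (CommutativeRing._+_ S X X⁻¹) (CommutativeRing.1# S)) Y)
      (CommutativeRing.-_ S (CommutativeRing.1# S)))) where
  open CommutativeRing S hiding (zero)
  open Solver S
  open SetoidReasoning setoid

  record Normal : Set where
    constructor nf
    field
      shift : ℕ
      part₀ part₁ : List ℤ

  value : List ℤ → Carrier
  value A = ev {1} A (X ∷ [])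

  val : Normal → Carrier
  val (nf m A B) = X⁻¹ ^ m * (value A + value B * Y)

  up : ℕ → List ℤ → List ℤ
  up zero    A = A
  up (suc k) A = + 0 ∷ up k A

  value-up : ∀ k A → value (up k A) ≈ X ^ k * value A
  value-up zero    A = sym (*-identityˡ _)
  value-up (suc k) A = trans (+-identityˡ _) (trans (*-congˡ (value-up k A)) (sym (*-assoc _ _ _)))

  ^-+ : ∀ x m n → x ^ (m ℕ.+ n) ≈ x ^ m * x ^ n
  ^-+ x zero    n = sym (*-identityˡ _)
  ^-+ x (suc m) n = trans (*-congˡ (^-+ x m n)) (sym (*-assoc _ _ _))

  cancel-pow : ∀ k → X⁻¹ ^ k * X ^ k ≈ 1#
  cancel-pow zero    = *-identityˡ 1#
  cancel-pow (suc k) = trans (solve 4 (λ a b c d → a :* b :* (c :* d) := c :* a :* (b :* d)) X⁻¹ (X⁻¹ ^ k) X (X ^ k))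
    (trans (*-cong XX⁻¹ (cancel-pow k)) (*-identityˡ 1#))

  value-+ : ∀ A B → value (add {1} A B) ≈ value A + value B
  value-+ A B = ev-add {1} A B (X ∷ [])

  value-* : ∀ A B → value (mul {1} A B) ≈ value A * value B
  value-* A B = ev-mul {1} A B (X ∷ [])

  value-neg : ∀ A → value (neg {1} A) ≈ - value A
  value-neg A = ev-neg {1} A (X ∷ [])

  rescale : ∀ m k A B → X⁻¹ ^ (m ℕ.+ k) * (value (up k A) + value (up k B) * Y) ≈ val (nf m A B)
  rescale m k A B = begin
    X⁻¹ ^ (m ℕ.+ k) * (value (up k A) + value (up k B) * Y)
      ≈⟨ *-cong (^-+ X⁻¹ m k) (+-cong (value-up k A) (*-congʳ (value-up k B))) ⟩
    X⁻¹ ^ m * X⁻¹ ^ k * (X ^ k * value A + X ^ k * value B * Y)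
      ≈⟨ solve 6 (λ i j x a b y → i :* j :* (x :* a :+ x :* b :* y) := j :* x :* (i :* (a :+ b :* y))) (X⁻¹ ^ m) (X⁻¹ ^ k) (X ^ k) (value A) (value B) Y ⟩
    X⁻¹ ^ k * X ^ k * val (nf m A B)
      ≈⟨ trans (*-congʳ (cancel-pow k)) (*-identityˡ _) ⟩
    val (nf m A B) ∎

  -- Multiplied by X, the equation of the curve reads X Y² = (1 + X + X²) Y - X, so a product of two
  -- parts with Y costs one factor X⁻¹. The clauses for an empty Y-part avoid this cost and keep the
  -- lists short.
  _+ₙ_ _*ₙ_ : Normal → Normal → Normal
  nf m A B +ₙ nf n C D = nf (m ℕ.+ (n ∸ m)) (add {1} (up (n ∸ m) A) (up (m ∸ n) C)) (add {1} (up (n ∸ m) B) (up (m ∸ n) D))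
  nf m A [] *ₙ nf n C D = nf (m ℕ.+ n) (mul {1} A C) (mul {1} A D)
  nf m A (b ∷ B) *ₙ nf n C [] = nf (m ℕ.+ n) (mul {1} A C) (mul {1} (b ∷ B) C)
  nf m A (b ∷ B) *ₙ nf n C (d ∷ D) = nf (m ℕ.+ n ℕ.+ 1)
    (+ 0 ∷ add {1} (mul {1} A C) (neg {1} BD))
    (add {1} (+ 0 ∷ add {1} (mul {1} A (d ∷ D)) (mul {1} (b ∷ B) C)) (mul {1} (+ 1 ∷ + 1 ∷ + 1 ∷ []) BD))
    where
    BD : List ℤ
    BD = mul {1} (b ∷ B) (d ∷ D)

  negₙ : Normal → Normal
  negₙ (nf m A B) = nf m (neg {1} A) (neg {1} B)

  maximum : ∀ m n → m ℕ.+ (n ∸ m) ≡ n ℕ.+ (m ∸ n)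
  maximum zero    n       = ≡.sym (≡.trans (≡.cong (n ℕ.+_) (ℕP.0∸n≡0 n)) (ℕP.+-identityʳ n))
  maximum (suc m) zero    = ≡.cong suc (ℕP.+-identityʳ m)
  maximum (suc m) (suc n) = ≡.cong suc (maximum m n)

  val-+ : ∀ a b → val (a +ₙ b) ≈ val a + val b
  val-+ (nf m A B) (nf n C D) = begin
    X⁻¹ ^ (m ℕ.+ (n ∸ m)) * (value (add {1} (up (n ∸ m) A) (up (m ∸ n) C)) + value (add {1} (up (n ∸ m) B) (up (m ∸ n) D)) * Y)
      ≈⟨ *-congˡ (+-cong (value-+ (up (n ∸ m) A) (up (m ∸ n) C)) (*-congʳ (value-+ (up (n ∸ m) B) (up (m ∸ n) D)))) ⟩
    X⁻¹ ^ (m ℕ.+ (n ∸ m)) * (value (up (n ∸ m) A) + value (up (m ∸ n) C) + (value (up (n ∸ m) B) + value (up (m ∸ n) D)) * Y)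
      ≈⟨ solve 6 (λ i a b c d y → i :* (a :+ b :+ (c :+ d) :* y) := i :* (a :+ c :* y) :+ i :* (b :+ d :* y))
           (X⁻¹ ^ (m ℕ.+ (n ∸ m))) (value (up (n ∸ m) A)) (value (up (m ∸ n) C)) (value (up (n ∸ m) B)) (value (up (m ∸ n) D)) Y ⟩
    X⁻¹ ^ (m ℕ.+ (n ∸ m)) * (value (up (n ∸ m) A) + value (up (n ∸ m) B) * Y) + X⁻¹ ^ (m ℕ.+ (n ∸ m)) * (value (up (m ∸ n) C) + value (up (m ∸ n) D) * Y)
      ≈⟨ +-cong (rescale m (n ∸ m) A B) (trans (*-congʳ (reflexive (≡.cong (X⁻¹ ^_) (maximum m n)))) (rescale n (m ∸ n) C D)) ⟩
    val (nf m A B) + val (nf n C D) ∎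

  val-* : ∀ a b → val (a *ₙ b) ≈ val a * val b
  val-* (nf m A []) (nf n C D) = trans (*-cong (^-+ X⁻¹ m n) (+-cong (value-* A C) (*-congʳ (value-* A D))))
    (solve 6 (λ i j a c d y → i :* j :* (a :* c :+ a :* d :* y) := i :* (a :+ :0 :* y) :* (j :* (c :+ d :* y))) (X⁻¹ ^ m) (X⁻¹ ^ n) (value A) (value C) (value D) Y)
  val-* (nf m A B@(_ ∷ _)) (nf n C []) = trans (*-cong (^-+ X⁻¹ m n) (+-cong (value-* A C) (*-congʳ (value-* B C))))
    (solve 6 (λ i j a b c y → i :* j :* (a :* c :+ b :* c :* y) := i :* (a :+ b :* y) :* (j :* (c :+ :0 :* y))) (X⁻¹ ^ m) (X⁻¹ ^ n) (value A) (value B) (value C) Y)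
  val-* (nf m A B@(_ ∷ _)) (nf n C D@(_ ∷ _)) = begin
    X⁻¹ ^ (m ℕ.+ n ℕ.+ 1) * (value (+ 0 ∷ P₀) + value (add {1} (+ 0 ∷ P₁) P₂) * Y)
      ≈⟨ *-cong (trans (^-+ X⁻¹ (m ℕ.+ n) 1) (*-congʳ (^-+ X⁻¹ m n)))
           (+-cong (trans (+-identityˡ _) (*-congˡ (trans (value-+ (mul {1} A C) (neg {1} BD)) (+-cong (value-* A C) (trans (value-neg BD) (-‿cong (value-* B D)))))))
             (*-congʳ (trans (value-+ (+ 0 ∷ P₁) P₂) (+-cong
               (trans (+-identityˡ _) (*-congˡ (trans (value-+ (mul {1} A D) (mul {1} B C)) (+-cong (value-* A D) (value-* B C)))))
               (trans (value-* (+ 1 ∷ + 1 ∷ + 1 ∷ []) BD) (*-congˡ (value-* B D))))))) ⟩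
    X⁻¹ ^ m * X⁻¹ ^ n * (X⁻¹ * 1#) * (X * (value A * value C + - (value B * value D)) +
      (X * (value A * value D + value B * value C) + (1# + X * (1# + X * (1# + X * 0#))) * (value B * value D)) * Y)
      ≈⟨ solve 9 (λ i j z x a b c d y → i :* j :* (z :* :1) :* (x :* (a :* c :- b :* d) :+ (x :* (a :* d :+ b :* c) :+ (:1 :+ x :* (:1 :+ x :* (:1 :+ x :* :0))) :* (b :* d)) :* y)
           := i :* j :* (x :* z :* (a :* c :- b :* d :+ (a :* d :+ b :* c :+ (x :+ :1) :* (b :* d)) :* y) :+ z :* (b :* d) :* y))
           (X⁻¹ ^ m) (X⁻¹ ^ n) X⁻¹ X (value A) (value B) (value C) (value D) Y ⟩
    X⁻¹ ^ m * X⁻¹ ^ n * (X * X⁻¹ * (value A * value C + - (value B * value D) + (value A * value D + value B * value C + (X + 1#) * (value B * value D)) * Y) + X⁻¹ * (value B * value D) * Y)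
      ≈⟨ *-congˡ (+-congʳ (*-congʳ XX⁻¹)) ⟩
    X⁻¹ ^ m * X⁻¹ ^ n * (1# * (value A * value C + - (value B * value D) + (value A * value D + value B * value C + (X + 1#) * (value B * value D)) * Y) + X⁻¹ * (value B * value D) * Y)
      ≈⟨ solve 9 (λ i j z x a b c d y → i :* j :* (:1 :* (a :* c :- b :* d :+ (a :* d :+ b :* c :+ (x :+ :1) :* (b :* d)) :* y) :+ z :* (b :* d) :* y)
           := i :* j :* (a :* c :+ (a :* d :+ b :* c) :* y :+ b :* d :* ((x :+ z :+ :1) :* y :- :1)))
           (X⁻¹ ^ m) (X⁻¹ ^ n) X⁻¹ X (value A) (value B) (value C) (value D) Y ⟩
    X⁻¹ ^ m * X⁻¹ ^ n * (value A * value C + (value A * value D + value B * value C) * Y + value B * value D * ((X + X⁻¹ + 1#) * Y + - 1#))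
      ≈⟨ *-congˡ (+-congˡ (*-congˡ (sym curve))) ⟩
    X⁻¹ ^ m * X⁻¹ ^ n * (value A * value C + (value A * value D + value B * value C) * Y + value B * value D * (Y * Y))
      ≈⟨ solve 7 (λ i j a b c d y → i :* j :* (a :* c :+ (a :* d :+ b :* c) :* y :+ b :* d :* (y :* y)) := i :* (a :+ b :* y) :* (j :* (c :+ d :* y)))
           (X⁻¹ ^ m) (X⁻¹ ^ n) (value A) (value B) (value C) (value D) Y ⟩
    val (nf m A B) * val (nf n C D) ∎
    where
    BD P₀ P₁ P₂ : List ℤ
    BD = mul {1} B D
    P₀ = add {1} (mul {1} A C) (neg {1} BD)
    P₁ = add {1} (mul {1} A D) (mul {1} B C)
    P₂ = mul {1} (+ 1 ∷ + 1 ∷ + 1 ∷ []) BD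

  val-neg : ∀ a → val (negₙ a) ≈ - val a
  val-neg (nf m A B) = trans (*-congˡ (+-cong (value-neg A) (*-congʳ (value-neg B))))
    (solve 4 (λ i a b y → i :* (:- a :+ (:- b) :* y) := :- (i :* (a :+ b :* y))) (X⁻¹ ^ m) (value A) (value B) Y)

  powₙ : Normal → ℕ → Normal
  powₙ a zero    = nf 0 (+ 1 ∷ []) []
  powₙ a (suc k) = a *ₙ powₙ a k

  constant : ℤ → Normal
  constant c = nf 0 (c ∷ []) []

  normal : Expr 3 → Normal
  normal (:v zero)             = nf 0 (+ 0 ∷ + 1 ∷ []) []
  normal (:v (suc zero))       = nf 1 (+ 1 ∷ []) []
  normal (:v (suc (suc zero))) = nf 0 [] (+ 1 ∷ [])
  normal (:c c)   = constant c
  normal :0       = constant (+ 0)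
  normal :1       = constant (+ 1)
  normal (a :+ b) = normal a +ₙ normal b
  normal (a :* b) = normal a *ₙ normal b
  normal (a :- b) = normal a +ₙ negₙ (normal b)
  normal (:- a)   = negₙ (normal a)
  normal (a :^ k) = powₙ (normal a) k

  ⟪_⟫ : Expr 3 → Carrier
  ⟪ e ⟫ = ⟦ e ⟧ (X ∷ X⁻¹ ∷ Y ∷ [])

  val-constant : ∀ c → val (constant c) ≈ fromℤ c
  val-constant c = solve 3 (λ c x y → :1 :* (c :+ x :* :0 :+ :0 :* y) := c) (fromℤ c) X Y

  val-pow : ∀ a k → val (powₙ a k) ≈ val a ^ k
  val-pow a zero    = val-constant (+ 1)
  val-pow a (suc k) = trans (val-* a (powₙ a k)) (*-congˡ (val-pow a k))

  normal-sound : ∀ e → val (normal e) ≈ ⟪ e ⟫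
  normal-sound (:v zero)             = solve 2 (λ x y → :1 :* (:0 :+ x :* (:1 :+ x :* :0) :+ :0 :* y) := x) X Y
  normal-sound (:v (suc zero))       = solve 3 (λ x z y → z :* :1 :* (:1 :+ x :* :0 :+ :0 :* y) := z) X X⁻¹ Y
  normal-sound (:v (suc (suc zero))) = solve 2 (λ x y → :1 :* (:0 :+ (:1 :+ x :* :0) :* y) := y) X Y
  normal-sound (:c c)   = val-constant c
  normal-sound :0       = val-constant (+ 0)
  normal-sound :1       = val-constant (+ 1)
  normal-sound (a :+ b) = trans (val-+ (normal a) (normal b)) (+-cong (normal-sound a) (normal-sound b))
  normal-sound (a :* b) = trans (val-* (normal a) (normal b)) (*-cong (normal-sound a) (normal-sound b))
  normal-sound (a :- b) = trans (val-+ (normal a) (negₙ (normal b))) (+-cong (normal-sound a) (trans (val-neg (normal b)) (-‿cong (normal-sound b))))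
  normal-sound (:- a)   = trans (val-neg (normal a)) (-‿cong (normal-sound a))
  normal-sound (a :^ k) = trans (val-pow (normal a) k) (^-cong k (normal-sound a))

  vanishes : Normal → Bool
  vanishes (nf m A B) = isZero {1} A ∧ isZero {1} B

  on-curve : ∀ a b → vanishes (normal (a :- b)) ≡ true → ⟪ a ⟫ ≈ ⟪ b ⟫
  on-curve a b e = -≈0⇒≈ (trans (sym (normal-sound (a :- b))) (zero-val (normal (a :- b)) e))
    where
    zero-val : ∀ n → vanishes n ≡ true → val n ≈ 0#
    zero-val (nf m A B) e = trans (*-congˡ (trans (+-cong (isZero-sound {1} A (X ∷ []) (proj₁ (∧-true e)))
      (*-congʳ (isZero-sound {1} B (X ∷ []) (proj₂ (∧-true {isZero {1} A} e))))) (trans (+-identityˡ _) (zeroˡ Y)))) (zeroʳ _)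

-- Monomials with integer exponents.

module Monomials (S : CommutativeRing 0ℓ 0ℓ) where
  open CommutativeRing S hiding (zero)
  open Solver S using (solve; _:*_; _:=_; _^_; ^-cong)
  open Lattice S using (module Power)

  power : Unit S → ℤ → Carrier
  power u = Power.zpow (Unit.unit u) (Unit.inverse u) (Unit.unit-inverse u)

  mono : ∀ {n} → Vec (Unit S) n → Vec ℤ n → Carrier
  mono []       []       = 1#
  mono (u ∷ us) (k ∷ ks) = power u k * mono us ks

  infixl 6 _⊹_
  infixl 7 _⊗_
  _⊹_ : ∀ {n} → Vec ℤ n → Vec ℤ n → Vec ℤ n
  _⊹_ = Vec.zipWith ℤ._+_

  _⊗_ : ∀ {n} → ℤ → Vec ℤ n → Vec ℤ n
  k ⊗ v = Vec.map (k ℤ.*_) v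

  mono-+ : ∀ {n} (us : Vec (Unit S) n) v w → mono us (v ⊹ w) ≈ mono us v * mono us w
  mono-+ []       []       []       = sym (*-identityˡ 1#)
  mono-+ (u ∷ us) (k ∷ v) (l ∷ w) = trans
    (*-cong (Power.zpow-+ (Unit.unit u) (Unit.inverse u) (Unit.unit-inverse u) k l) (mono-+ us v w))
    (solve 4 (λ a b c d → a :* b :* (c :* d) := a :* c :* (b :* d)) (power u k) (power u l) (mono us v) (mono us w))

  mono-0 : ∀ {n} (us : Vec (Unit S) n) v → mono us (+ 0 ⊗ v) ≈ 1#
  mono-0 []       []      = refl
  mono-0 (u ∷ us) (k ∷ v) = trans (*-congˡ (mono-0 us v)) (*-identityˡ 1#)

  mono-inverse : ∀ {n} (us : Vec (Unit S) n) v → mono us v * mono us (-[1+ 0 ] ⊗ v) ≈ 1#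
  mono-inverse us v = trans (sym (mono-+ us v (-[1+ 0 ] ⊗ v))) (trans (reflexive (≡.cong (mono us) (zero-sum v))) (mono-0 us v))
    where
    zero-sum : ∀ {n} (v : Vec ℤ n) → v ⊹ (-[1+ 0 ] ⊗ v) ≡ + 0 ⊗ v
    zero-sum []      = ≡.refl
    zero-sum (k ∷ v) = ≡.cong₂ _∷_ (≡.trans (≡.cong (λ j → k ℤ.+ j) (ℤP.-1*i≡-i k)) (ℤP.+-inverseʳ k)) (zero-sum v)

  mono-unit : ∀ {n} (us : Vec (Unit S) n) → Vec ℤ n → Unit S
  mono-unit us v = record { unit = mono us v ; inverse = mono us (-[1+ 0 ] ⊗ v) ; unit-inverse = mono-inverse us v }

  combination : ∀ {m n} → Vec (Vec ℤ n) m → Vec ℤ m → Vec ℤ n → Vec ℤ n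
  combination []       []       o = o
  combination (b ∷ bs) (k ∷ ks) o = k ⊗ b ⊹ combination bs ks o

  power-mono : ∀ {n} (us : Vec (Unit S) n) b k → power (mono-unit us b) k ≈ mono us (k ⊗ b)
  power-mono us b (+ n)    = go n
    where
    go : ∀ n → mono us b ^ n ≈ mono us (+ n ⊗ b)
    go zero    = sym (mono-0 us b)
    go (suc n) = trans (*-congˡ (go n)) (trans (sym (mono-+ us b (+ n ⊗ b))) (reflexive (≡.cong (mono us) (step b))))
      where
      step : ∀ {m} (b : Vec ℤ m) → b ⊹ (+ n ⊗ b) ≡ + suc n ⊗ b
      step []      = ≡.refl
      step (k ∷ b) = ≡.cong₂ _∷_ (≡.sym (ℤP.suc-* (+ n) k)) (step b)
  power-mono us b -[1+ n ] = go n
    where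
    go : ∀ n → mono us (-[1+ 0 ] ⊗ b) ^ suc n ≈ mono us (-[1+ n ] ⊗ b)
    go zero    = *-identityʳ _
    go (suc n) = trans (*-congˡ (go n)) (trans (sym (mono-+ us (-[1+ 0 ] ⊗ b) (-[1+ n ] ⊗ b))) (reflexive (≡.cong (mono us) (step b))))
      where
      step : ∀ {m} (b : Vec ℤ m) → (-[1+ 0 ] ⊗ b) ⊹ (-[1+ n ] ⊗ b) ≡ -[1+ suc n ] ⊗ b
      step []      = ≡.refl
      step (k ∷ b) = ≡.cong₂ _∷_ (≡.sym (ℤP.*-distribʳ-+ k -[1+ 0 ] -[1+ n ])) (step b)

  -- Rewriting a monomial through other monomials is thereby linear algebra on exponent vectors:
  -- each use needs one closed equation between integer vectors, settled by evaluation.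
  mono-mono : ∀ {m n} (us : Vec (Unit S) n) (bs : Vec (Vec ℤ n) m) ks o →
              mono (Vec.map (mono-unit us) bs) ks * mono us o ≈ mono us (combination bs ks o)
  mono-mono us []       []       o = *-identityˡ _
  mono-mono us (b ∷ bs) (k ∷ ks) o = trans (*-assoc _ _ _) (trans (*-cong (power-mono us b k) (mono-mono us bs ks o)) (sym (mono-+ us (k ⊗ b) _)))

v⃗ : (a b c d e f g : ℕ) → Vec ℤ 7
v⃗ a b c d e f g = + a ∷ + b ∷ + c ∷ + d ∷ + e ∷ + f ∷ + g ∷ []

infixl 6 _⊘_
_⊘_ : Vec ℤ 7 → Vec ℤ 7 → Vec ℤ 7
_⊘_ = Vec.zipWith ℤ._-_

-- The function field of X_1(15)

-- An abstract ring with a derivation stands between the series and the algebra. The computations on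
-- the curve rest on these data and relations alone, and no power series is unfolded during
-- evaluation.
record ThetaFunctions (S : CommutativeRing 0ℓ 0ℓ) : Set where
  open CommutativeRing S hiding (zero)
  open Solver S using (fromℕ; fromℤ; _^_)
  open Values S
  field
    cancel : ∀ n {x y} → fromℕ (suc n) * x ≈ fromℕ (suc n) * y → x ≈ y
    D : Carrier → Carrier
    D-cong : ∀ {x y} → x ≈ y → D x ≈ D y
    D-+ : ∀ x y → D (x + y) ≈ D x + D y
    D-* : ∀ x y → D (x * y) ≈ D x * y + x * D y
    D-fromℤ : ∀ k → D (fromℤ k) ≈ 0#
    P P′ P⁻¹ : ℕ → Carrier
    P-inverse : ∀ r → r < 7 → P (suc r) * P⁻¹ (suc r) ≈ 1#
    e e⁻¹ κ : Carrier
    e-inverse : e * e⁻¹ ≈ 1#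
    κ-e : κ ≈ fromℤ -[1+ 1 ] * e ^ 3

  v v′ : ℤ → Carrier
  v  = odd-value P
  v′ = even-value P′

record ThetaSystem (S : CommutativeRing 0ℓ 0ℓ) : Set where
  open CommutativeRing S hiding (zero)
  open Solver S using (fromℤ)
  field
    functions : ThetaFunctions S
  open ThetaFunctions functions public
  field
    three-term : ∀ x y z w →
      v (x ℤ.+ y) * v (x ℤ.- y) * (v (z ℤ.+ w) * v (z ℤ.- w)) + - (v (x ℤ.+ z) * v (x ℤ.- z) * (v (y ℤ.+ w) * v (y ℤ.- w)))
      + v (x ℤ.+ w) * v (x ℤ.- w) * (v (y ℤ.+ z) * v (y ℤ.- z)) ≈ 0#
    addition : ∀ x y z →
      v (x ℤ.+ x) * κ * (v (y ℤ.+ z) * v (y ℤ.- z))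
      + - ((v′ (x ℤ.+ y) * v (x ℤ.- y) + v (x ℤ.+ y) * v′ (x ℤ.- y)) * (v (x ℤ.+ z) * v (x ℤ.- z)))
      + (v′ (x ℤ.+ z) * v (x ℤ.- z) + v (x ℤ.+ z) * v′ (x ℤ.- z)) * (v (x ℤ.+ y) * v (x ℤ.- y)) ≈ 0#
    derivative : ∀ x y → let a = v (x ℤ.+ y) ; b = v (x ℤ.- y) ; c = v (x ℤ.+ x)
                             a′ = v′ (x ℤ.+ y) ; b′ = v′ (x ℤ.- y) ; c′ = v′ (x ℤ.+ x) in
      κ * (fromℤ (+ 4) * (D a * b * c + a * D b * c + a * b * D c) + a * b * c + (a′ * b′ * c + - (c′ * (a′ * b + a * b′)))) * fromℤ (+ 2)
      ≈ fromℤ (+ 8) * D κ * (a * b * c)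

module Parametrisation (S : CommutativeRing 0ℓ 0ℓ) (T : ThetaSystem S) where
  open CommutativeRing S hiding (zero)
  open ThetaSystem T public
  open Values S
  open Solver S
  open Monomials S

  mon : ∀ {n} (a₁ a₂ a₃ a₄ a₅ a₆ a₇ : Expr n) (k₁ k₂ k₃ k₄ k₅ k₆ k₇ : ℕ) → Expr n
  mon a₁ a₂ a₃ a₄ a₅ a₆ a₇ k₁ k₂ k₃ k₄ k₅ k₆ k₇ = a₁ :^ k₁ :* (a₂ :^ k₂ :* (a₃ :^ k₃ :* (a₄ :^ k₄ :* (a₅ :^ k₅ :* (a₆ :^ k₆ :* (a₇ :^ k₇ :* :1))))))

  infixr 5 _⊕_
  _⊕_ : ∀ {a b} → a ≈ 0# → b ≈ 0# → a + b ≈ 0#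
  p ⊕ q = trans (+-cong p q) (+-identityˡ 0#)

  -- Membership certificates: the first argument, found by `solve`, states that the two sides differ
  -- by a combination of terms c (l - r), and `times` shows each of these to vanish. The cofactors c
  -- are read off from the identity by unification.
  by : ∀ {a b z} → a ≈ b + z → z ≈ 0# → a ≈ b
  by p q = trans p (trans (+-congˡ q) (+-identityʳ _))

  times : ∀ c {l r} → l ≈ r → c * (l + - r) ≈ 0#
  times c p = trans (*-congˡ (trans (+-congʳ p) (-‿inverseʳ _))) (zeroʳ c)

  times₀ : ∀ c {l} → l ≈ 0# → c * l ≈ 0#
  times₀ c p = trans (*-congˡ p) (zeroʳ c)

  divide : ∀ {u w x y} → u * w ≈ 1# → x * u ≈ y * u → x ≈ y
  divide {u} {w} {x} {y} i p = trans (by (solve 3 (λ x u w → x := x :* u :* w :+ (:- x) :* (u :* w :- :1)) x u w) (times (- x) i))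
    (trans (*-congʳ p) (sym (by (solve 3 (λ x u w → x := x :* u :* w :+ (:- x) :* (u :* w :- :1)) y u w) (times (- y) i))))

  D-neg : ∀ x → D (- x) ≈ - D x
  D-neg x = trans (D-cong (solve 1 (λ x → :- x := :c -[1+ 0 ] :* x) x)) (trans (D-* (fromℤ -[1+ 0 ]) x)
    (trans (+-congʳ (trans (*-congʳ (D-fromℤ -[1+ 0 ])) (zeroˡ x))) (solve 1 (λ x → :0 :+ :c -[1+ 0 ] :* x := :- x) (D x))))

  -- Logarithmic derivatives in w and in q.
  lam d : ℕ → Carrier
  lam r = P′ r * P⁻¹ r
  d r = D (P r) * P⁻¹ r

  de : Carrier
  de = D e * e⁻¹

  P′-lam : ∀ r → r < 7 → P′ (suc r) ≈ lam (suc r) * P (suc r)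
  P′-lam r p = by (solve 3 (λ x y z → x := x :* y :* z :+ (:- x) :* (z :* y :- :1)) (P′ (suc r)) (P⁻¹ (suc r)) (P (suc r))) (times (- P′ (suc r)) (P-inverse r p))

  DP-d : ∀ r → r < 7 → D (P (suc r)) ≈ d (suc r) * P (suc r)
  DP-d r p = by (solve 3 (λ x y z → x := x :* y :* z :+ (:- x) :* (z :* y :- :1)) (D (P (suc r))) (P⁻¹ (suc r)) (P (suc r))) (times (- D (P (suc r))) (P-inverse r p))

  De-de : D e ≈ de * e
  De-de = by (solve 3 (λ x y z → x := x :* y :* z :+ (:- x) :* (z :* y :- :1)) (D e) e⁻¹ e) (times (- D e) e-inverse)

  record Point (p p′ ℓ δ : Carrier) : Set where
    constructor point
    field
      inv : Carrier
      inverse : p * inv ≈ 1#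
      prime : p′ ≈ ℓ * p
      deriv : D p ≈ δ * p

  positive : ∀ r → r < 7 → Point (P (suc r)) (P′ (suc r)) (lam (suc r)) (d (suc r))
  positive r p = point (P⁻¹ (suc r)) (P-inverse r p) (P′-lam r p) (DP-d r p)

  -- The theta value is odd and its first derivative even, so λ changes sign with the argument while
  -- the logarithmic q-derivative does not.
  negative : ∀ r → r < 7 → Point (- P (suc r)) (P′ (suc r)) (- lam (suc r)) (d (suc r))
  negative r p = point (- P⁻¹ (suc r)) (trans (solve 2 (λ x y → :- x :* :- y := x :* y) _ _) (P-inverse r p))
    (trans (P′-lam r p) (solve 2 (λ x y → x :* y := :- x :* :- y) _ _))
    (trans (D-neg _) (trans (-‿cong (DP-d r p)) (solve 2 (λ x y → :- (x :* y) := x :* :- y) _ _)))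

  Dκ : D κ ≈ fromℤ -[1+ 5 ] * e ^ 3 * de
  Dκ = trans (D-cong κ-e) (trans (D-* _ _) (trans (+-cong (trans (*-congʳ (D-fromℤ -[1+ 1 ])) (zeroˡ _))
      (*-congˡ (trans (D-* e (e * (e * 1#))) (+-congˡ (*-congˡ (trans (D-* e (e * 1#)) (+-congˡ (*-congˡ (D-* e 1#)))))))))
    (by (solve 4 (λ e De de z → :0 :+ :c -[1+ 1 ] :* (De :* (e :* (e :* :1)) :+ e :* (De :* (e :* :1) :+ e :* (De :* :1 :+ e :* z)))
        := :c -[1+ 5 ] :* e :^ 3 :* de :+ (:c -[1+ 5 ] :* e :^ 2 :* (De :- de :* e) :+ :c -[1+ 1 ] :* e :^ 3 :* z)) e (D e) de (D 1#))
      (times _ De-de ⊕ times₀ _ (D-fromℤ (+ 1))))))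

  -- The relation `derivative` at y = 0, divided by 2 κ a² c. As κ = -2 e³, the logarithmic
  -- q-derivative of κ is 3 `de`, and 4 · 3 = 12.
  log-derivative : ∀ {a a′ ℓa da c c′ ℓc dc} → Point a a′ ℓa da → Point c c′ ℓc dc →
    κ * (fromℤ (+ 4) * (D a * a * c + a * D a * c + a * a * D c) + a * a * c + (a′ * a′ * c + - (c′ * (a′ * a + a * a′)))) * fromℤ (+ 2)
      ≈ fromℤ (+ 8) * D κ * (a * a * c) →
    fromℤ (+ 4) * (fromℤ (+ 2) * da + dc) + 1# + ℓa * ℓa + - (fromℤ (+ 2) * ℓc * ℓa) ≈ fromℤ (+ 12) * de
  log-derivative {a} {a′} {ℓa} {da} {c} {c′} {ℓc} {dc} (point ā aā pa da≈) (point c̄ cc̄ pc dc≈) h =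
    cancel 3 (divide {u = e ^ 3 * (a * a * c)} {w = e⁻¹ ^ 3 * (ā * ā * c̄)} unit
      (by (solve 14 (λ e a c ℓa da ℓc dc de κ Dκ a′ c′ Da Dc →
          :c (+ 4) :* (:c (+ 4) :* (:c (+ 2) :* da :+ dc) :+ :1 :+ ℓa :* ℓa :- :c (+ 2) :* ℓc :* ℓa) :* (e :^ 3 :* (a :* a :* c))
          := :c (+ 4) :* (:c (+ 12) :* de) :* (e :^ 3 :* (a :* a :* c))
             :+ ((:- :1) :* (κ :* (:c (+ 4) :* (Da :* a :* c :+ a :* Da :* c :+ a :* a :* Dc) :+ a :* a :* c :+ (a′ :* a′ :* c :- c′ :* (a′ :* a :+ a :* a′))) :* :c (+ 2)
                  :- :c (+ 8) :* Dκ :* (a :* a :* c))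
             :+ (:c (+ 2) :* (:c (+ 4) :* (Da :* a :* c :+ a :* Da :* c :+ a :* a :* Dc) :+ a :* a :* c :+ (a′ :* a′ :* c :- c′ :* (a′ :* a :+ a :* a′)))) :* (κ :- :c -[1+ 1 ] :* e :^ 3)
             :+ (:- :c (+ 8) :* (a :* a :* c)) :* (Dκ :- :c -[1+ 5 ] :* e :^ 3 :* de)
             :+ (:c -[1+ 3 ] :* e :^ 3 :* :c (+ 8) :* a :* c) :* (Da :- da :* a)
             :+ (:c -[1+ 3 ] :* e :^ 3 :* :c (+ 4) :* a :* a) :* (Dc :- dc :* c)
             :+ (:c -[1+ 3 ] :* e :^ 3 :* (c :* (a′ :+ ℓa :* a) :- :c (+ 2) :* c′ :* a)) :* (a′ :- ℓa :* a)
             :+ (:c -[1+ 3 ] :* e :^ 3 :* (:- :c (+ 2) :* a :* ℓa :* a)) :* (c′ :- ℓc :* c)))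
          e a c ℓa da ℓc dc de κ (D κ) a′ c′ (D a) (D c))
        (plus₇ (times _ h) (times _ κ-e) (times _ Dκ) (times _ da≈) (times _ dc≈) (times _ pa) (times _ pc))))
    where
    plus₇ : ∀ {a b c d e f g} → a ≈ 0# → b ≈ 0# → c ≈ 0# → d ≈ 0# → e ≈ 0# → f ≈ 0# → g ≈ 0# → a + b + c + d + e + f + g ≈ 0#
    plus₇ a b c d e f g = (((((a ⊕ b) ⊕ c) ⊕ d) ⊕ e) ⊕ f) ⊕ g
    unit : e ^ 3 * (a * a * c) * (e⁻¹ ^ 3 * (ā * ā * c̄)) ≈ 1#
    unit = trans (solve 6 (λ e i a b c d → e :^ 3 :* (a :* a :* c) :* (i :^ 3 :* (b :* b :* d)) := (e :* i) :^ 3 :* ((a :* b) :* (a :* b) :* (c :* d))) e e⁻¹ a ā c c̄)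
      (trans (*-cong (^-cong 3 e-inverse) (*-cong (*-cong aā aā) cc̄)) (solve 0 (:1 :^ 3 :* (:1 :* :1 :* :1) := :1)))

  -- The relation `addition` with each first derivative replaced by λ times the value and κ by -2
  -- e³; only the combination of four λ's and two monomials are left.
  addition-law : ∀ {a a′ ℓa da b b′ ℓb db c c′ ℓc dc x x′ ℓx dx} C F → Point a a′ ℓa da → Point b b′ ℓb db → Point c c′ ℓc dc → Point x x′ ℓx dx →
    C * κ * F + - ((a′ * b + a * b′) * (c * x)) + (c′ * x + c * x′) * (a * b) ≈ 0# →
    (ℓa + ℓb + - ℓc + - ℓx) * (a * b * (c * x)) ≈ fromℤ -[1+ 1 ] * e ^ 3 * (C * F)
  addition-law {a} {a′} {ℓa} {_} {b} {b′} {ℓb} {_} {c} {c′} {ℓc} {_} {x} {x′} {ℓx} C F (point _ _ pa _) (point _ _ pb _) (point _ _ pc _) (point _ _ px _) h =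
    by (solve 16 (λ a a′ ℓa b b′ ℓb c c′ ℓc x x′ ℓx C F κ e →
        (ℓa :+ ℓb :- ℓc :- ℓx) :* (a :* b :* (c :* x)) := :c -[1+ 1 ] :* e :^ 3 :* (C :* F)
        :+ ((:- :1) :* (C :* κ :* F :- (a′ :* b :+ a :* b′) :* (c :* x) :+ (c′ :* x :+ c :* x′) :* (a :* b))
        :+ (C :* F) :* (κ :- :c -[1+ 1 ] :* e :^ 3)
        :+ (:- (b :* c :* x)) :* (a′ :- ℓa :* a) :+ (:- (a :* c :* x)) :* (b′ :- ℓb :* b)
        :+ (x :* a :* b) :* (c′ :- ℓc :* c) :+ (c :* a :* b) :* (x′ :- ℓx :* x)))
        a a′ ℓa b b′ ℓb c c′ ℓc x x′ ℓx C F κ e)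
      (((((times₀ _ h ⊕ times _ κ-e) ⊕ times _ pa) ⊕ times _ pb) ⊕ times _ pc) ⊕ times _ px)

  below : ∀ r {k} → r < suc (r ℕ.+ k)
  below zero    = s≤s z≤n
  below (suc r) = s≤s (below r)

  p₁ = positive 0 (below 0)
  p₂ = positive 1 (below 1)
  p₃ = positive 2 (below 2)
  p₄ = positive 3 (below 3)
  p₅ = positive 4 (below 4)
  p₆ = positive 5 (below 5)
  p₇ = positive 6 (below 6)
  n₁ = negative 0 (below 0)
  n₂ = negative 1 (below 1)
  n₃ = negative 2 (below 2)
  n₄ = negative 3 (below 3)
  n₅ = negative 4 (below 4)
  n₆ = negative 5 (below 5)
  n₇ = negative 6 (below 6)

  -- The second point is 2r modulo 15. From r = 4 on it is the negative of a value in the table: 8,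
  -- 10, 12, 14 are -7, -5, -3, -1.
  log₁ = log-derivative p₁ p₂ (derivative (+ 1) (+ 0))
  log₂ = log-derivative p₂ p₄ (derivative (+ 2) (+ 0))
  log₃ = log-derivative p₃ p₆ (derivative (+ 3) (+ 0))
  log₄ = log-derivative p₄ n₇ (derivative (+ 4) (+ 0))
  log₅ = log-derivative p₅ n₅ (derivative (+ 5) (+ 0))
  log₆ = log-derivative p₆ n₃ (derivative (+ 6) (+ 0))
  log₇ = log-derivative p₇ n₁ (derivative (+ 7) (+ 0))

  u : ∀ r → r < 7 → Unit S
  u r p = record { unit = P (suc r) ; inverse = P⁻¹ (suc r) ; unit-inverse = P-inverse r p }

  units : Vec (Unit S) 7
  units = u 0 (below 0) ∷ u 1 (below 1) ∷ u 2 (below 2) ∷ u 3 (below 3) ∷ u 4 (below 4) ∷ u 5 (below 5) ∷ u 6 (below 6) ∷ []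

  M : Vec ℤ 7 → Carrier
  M = mono units

  M-* : ∀ u w {z} → u ⊹ w ≡ z → M u * M w ≈ M z
  M-* u w e = trans (sym (mono-+ units u w)) (reflexive (≡.cong M e))

  M-divide : ∀ {x y} u w z → z ⊹ u ≡ w → x * M u ≈ y * M w → x ≈ y * M z
  M-divide {x} {y} u w z e p = divide (mono-inverse units u) (trans p (trans (*-congˡ (sym (M-* z u e))) (sym (*-assoc _ _ _))))

  -- Exponent vectors of quotients of theta values. The vectors after `ref` have degree zero and
  -- belong to X, Y, Y - X, 1 + X, Y - 1 and 1/X + XY. Together with `ref`, which has degree -1,
  -- they express every monomial needed later.
  0⃗ ref x⃗ y⃗ yx⃗ 1x⃗ y1⃗ t⃗ : Vec ℤ 7
  0⃗  = v⃗ 0 0 0 0 0 0 0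
  ref = (v⃗ 0 1 0 0 0 0 0 ⊘ v⃗ 0 0 1 0 1 0 0)
  x⃗   = (v⃗ 1 0 0 0 0 0 0 ⊘ v⃗ 0 0 0 1 0 0 0)
  y⃗   = (v⃗ 0 1 0 0 0 0 0 ⊘ v⃗ 0 0 0 0 0 0 1)
  yx⃗  = (v⃗ 1 0 1 0 0 0 0 ⊘ v⃗ 0 0 0 0 0 1 1)
  1x⃗  = (v⃗ 1 0 0 0 1 1 0 ⊘ v⃗ 0 1 1 0 0 0 1)
  y1⃗  = (v⃗ 0 1 1 0 1 0 0 ⊘ v⃗ 1 0 0 1 0 1 0)
  t⃗   = (v⃗ 0 0 1 0 0 2 0 ⊘ v⃗ 1 0 0 1 0 0 1)

  X X⁻¹ Y Y⁻¹ : Carrier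
  X   = M x⃗
  X⁻¹ = M (-[1+ 0 ] ⊗ x⃗)
  Y   = M y⃗
  Y⁻¹ = M (-[1+ 0 ] ⊗ y⃗)

  -- Divides a three-term relation of degree four by a monomial, which makes it a relation between
  -- functions of degree zero.
  shift : ∀ x y z w {x′ y′ z′} → x ⊹ w ≡ x′ → y ⊹ w ≡ y′ → z ⊹ w ≡ z′ → M x ≈ M y + M z → M x′ ≈ M y′ + M z′
  shift x y z w p q r h = trans (sym (M-* x w p)) (trans (*-congʳ h) (trans (distribʳ _ _ _) (+-cong (M-* y w q) (M-* z w r))))

  W₁ : M 1x⃗ ≈ M 0⃗ + M x⃗
  W₁ = shift (v⃗ 1 0 0 1 1 1 0) (v⃗ 0 1 1 1 0 0 1) (v⃗ 1 1 1 0 0 0 1) (0⃗ ⊘ v⃗ 0 1 1 1 0 0 1) ≡.refl ≡.refl ≡.refl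
    (by (solve 7 (λ a₁ a₂ a₃ a₄ a₅ a₆ a₇ → mon a₁ a₂ a₃ a₄ a₅ a₆ a₇ 1 0 0 1 1 1 0 := mon a₁ a₂ a₃ a₄ a₅ a₆ a₇ 0 1 1 1 0 0 1 :+ mon a₁ a₂ a₃ a₄ a₅ a₆ a₇ 1 1 1 0 0 0 1
        :+ :1 :* (((:- a₇) :* a₂ :* (a₃ :* a₁)) :- (a₇ :* a₃ :* (a₄ :* a₂)) :+ (a₆ :* a₄ :* (a₅ :* a₁)))) (P 1) (P 2) (P 3) (P 4) (P 5) (P 6) (P 7)) (times₀ _ (three-term (+ 5) (+ 3) (+ 2) (+ 1))))

  W₂ : M y⃗ ≈ M yx⃗ + M x⃗
  W₂ = shift (v⃗ 0 1 0 1 1 1 0) (v⃗ 1 0 1 1 1 0 0) (v⃗ 1 0 0 0 1 1 1) (0⃗ ⊘ v⃗ 0 0 0 1 1 1 1) ≡.refl ≡.refl ≡.refl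
    (by (solve 7 (λ a₁ a₂ a₃ a₄ a₅ a₆ a₇ → mon a₁ a₂ a₃ a₄ a₅ a₆ a₇ 0 1 0 1 1 1 0 := mon a₁ a₂ a₃ a₄ a₅ a₆ a₇ 1 0 1 1 1 0 0 :+ mon a₁ a₂ a₃ a₄ a₅ a₆ a₇ 1 0 0 0 1 1 1
        :+ :1 :* (((:- a₄) :* a₁ :* (a₅ :* a₃)) :- ((:- a₅) :* a₂ :* (a₆ :* a₄)) :+ (a₇ :* a₅ :* ((:- a₆) :* a₁)))) (P 1) (P 2) (P 3) (P 4) (P 5) (P 6) (P 7)) (times₀ _ (three-term (+ 6) (+ 5) (+ 4) (+ 1))))

  W₃ : M (x⃗ ⊹ y⃗) ≈ M 0⃗ + M (v⃗ 0 1 0 0 0 1 0 ⊘ v⃗ 0 0 1 1 0 0 0)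
  W₃ = shift (v⃗ 1 1 1 0 1 0 0) (v⃗ 0 0 1 1 1 0 1) (v⃗ 0 1 0 0 1 1 1) (0⃗ ⊘ v⃗ 0 0 1 1 1 0 1) ≡.refl ≡.refl ≡.refl
    (by (solve 7 (λ a₁ a₂ a₃ a₄ a₅ a₆ a₇ → mon a₁ a₂ a₃ a₄ a₅ a₆ a₇ 1 1 1 0 1 0 0 := mon a₁ a₂ a₃ a₄ a₅ a₆ a₇ 0 0 1 1 1 0 1 :+ mon a₁ a₂ a₃ a₄ a₅ a₆ a₇ 0 1 0 0 1 1 1
        :+ (:- :1) :* (((:- a₅) :* a₂ :* (a₃ :* a₁)) :- ((:- a₇) :* a₄ :* (a₅ :* a₃)) :+ (a₇ :* a₅ :* (a₆ :* a₂)))) (P 1) (P 2) (P 3) (P 4) (P 5) (P 6) (P 7)) (times₀ _ (three-term (+ 6) (+ 4) (+ 2) (+ 1))))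

  W₄ : M y⃗ ≈ M 0⃗ + M y1⃗
  W₄ = shift (v⃗ 1 1 0 1 0 1 0) (v⃗ 1 0 0 1 0 1 1) (v⃗ 0 1 1 0 1 0 1) (0⃗ ⊘ v⃗ 1 0 0 1 0 1 1) ≡.refl ≡.refl ≡.refl
    (by (solve 7 (λ a₁ a₂ a₃ a₄ a₅ a₆ a₇ → mon a₁ a₂ a₃ a₄ a₅ a₆ a₇ 1 1 0 1 0 1 0 := mon a₁ a₂ a₃ a₄ a₅ a₆ a₇ 1 0 0 1 0 1 1 :+ mon a₁ a₂ a₃ a₄ a₅ a₆ a₇ 0 1 1 0 1 0 1
        :+ :1 :* (((:- a₄) :* (:- a₁) :* (a₆ :* a₂)) :- ((:- a₆) :* a₁ :* ((:- a₇) :* a₄)) :+ (a₇ :* a₃ :* ((:- a₅) :* a₂)))) (P 1) (P 2) (P 3) (P 4) (P 5) (P 6) (P 7)) (times₀ _ (three-term (+ 5) (+ 6) (+ 4) (+ 2))))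

  W₅ : M t⃗ ≈ M 0⃗ + M (v⃗ 0 2 0 0 1 0 0 ⊘ v⃗ 2 0 0 1 0 0 0)
  W₅ = shift (v⃗ 1 0 1 0 0 2 0) (v⃗ 2 0 0 1 0 0 1) (v⃗ 0 2 0 0 1 0 1) (0⃗ ⊘ v⃗ 2 0 0 1 0 0 1) ≡.refl ≡.refl ≡.refl
    (by (solve 7 (λ a₁ a₂ a₃ a₄ a₅ a₆ a₇ → mon a₁ a₂ a₃ a₄ a₅ a₆ a₇ 1 0 1 0 0 2 0 := mon a₁ a₂ a₃ a₄ a₅ a₆ a₇ 2 0 0 1 0 0 1 :+ mon a₁ a₂ a₃ a₄ a₅ a₆ a₇ 0 2 0 0 1 0 1
        :+ :1 :* (((:- a₄) :* a₁ :* (a₇ :* a₁)) :- ((:- a₅) :* a₂ :* ((:- a₇) :* a₂)) :+ ((:- a₆) :* a₃ :* ((:- a₆) :* a₁)))) (P 1) (P 2) (P 3) (P 4) (P 5) (P 6) (P 7)) (times₀ _ (three-term (+ 6) (+ 5) (+ 4) (+ 3))))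

  M-0 : M 0⃗ ≈ 1#
  M-0 = mono-0 units x⃗

  XX⁻¹ : X * X⁻¹ ≈ 1#
  XX⁻¹ = mono-inverse units x⃗

  1+X : 1# + X ≈ M 1x⃗
  1+X = trans (+-congʳ (sym M-0)) (sym W₁)

  Y-X : Y + - X ≈ M yx⃗
  Y-X = by (solve 3 (λ x y m → y :- x := m :+ :1 :* (y :- (m :+ x))) X Y (M yx⃗)) (times _ W₂)

  Y-1 : Y + - 1# ≈ M y1⃗
  Y-1 = by (solve 3 (λ y o m → y :- :1 := m :+ (:1 :* (y :- (o :+ m)) :+ :1 :* (o :- :1))) Y (M 0⃗) (M y1⃗)) (times _ W₄ ⊕ times _ M-0)

  -- By `W₃` and `W₂` the functions XY - 1 and Y - X are monomials, and their product is the
  -- monomial XY. So (XY - 1)(Y - X) = XY, and division by X gives the equation.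
  curve : Y * Y ≈ (X + X⁻¹ + 1#) * Y + - 1#
  curve = by (solve 7 (λ x i y o m n p → y :* y := (x :+ i :+ :1) :* y :- :1
      :+ ((i :* n) :* (p :- (o :+ m)) :+ i :* (m :* n :- p) :+ (i :* n) :* (o :- :1) :+ (i :- i :* n) :* (p :- x :* y)
        :+ (:- i :* (x :* y :- :1)) :* (n :- (y :- x)) :+ (:- (y :* (y :- x) :- y :+ :1)) :* (x :* i :- :1)))
      X X⁻¹ Y (M 0⃗) (M (v⃗ 0 1 0 0 0 1 0 ⊘ v⃗ 0 0 1 1 0 0 0)) (M yx⃗) (M (x⃗ ⊹ y⃗)))
    (((((times _ W₃ ⊕ times _ (M-* (v⃗ 0 1 0 0 0 1 0 ⊘ v⃗ 0 0 1 1 0 0 0) yx⃗ ≡.refl)) ⊕ times _ M-0) ⊕ times _ (sym (M-* x⃗ y⃗ ≡.refl))) ⊕ times _ (sym Y-X)) ⊕ times _ XX⁻¹)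

  open Curve S X X⁻¹ Y XX⁻¹ curve using (⟪_⟫; on-curve)

  -- The inverse of Y is read off from Y + 1/Y = X + 1/X + 1, and `ŷx⁻` inverts Y - X on the curve.
  -- The functions 1 + X, Y - 1 and `t̂` enter `uexpr` with natural exponents only.
  x̂ x̂⁻ ŷ ŷ⁻ ŷx ŷx⁻ t̂ : Expr 3
  x̂   = :v zero
  x̂⁻  = :v (suc zero)
  ŷ   = :v (suc (suc zero))
  ŷ⁻  = x̂ :+ x̂⁻ :+ :1 :- ŷ
  ŷx  = ŷ :- x̂
  ŷx⁻ = ŷ :* x̂⁻ :- x̂⁻ :- x̂⁻ :^ 2
  t̂   = x̂⁻ :+ x̂ :* ŷ

  inverse-unique : ∀ {u i j} → u * i ≈ 1# → u * j ≈ 1# → i ≈ j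
  inverse-unique {u} {i} {j} p q = divide {u} {i} p (trans (*-comm i u) (trans p (trans (sym q) (*-comm u j))))

  Y⁻¹-expr : ⟪ ŷ⁻ ⟫ ≈ Y⁻¹
  Y⁻¹-expr = inverse-unique (on-curve (ŷ :* ŷ⁻) :1 ≡.refl) (mono-inverse units y⃗)

  YX⁻¹-expr : ⟪ ŷx⁻ ⟫ ≈ M (-[1+ 0 ] ⊗ yx⃗)
  YX⁻¹-expr = inverse-unique (on-curve (ŷx :* ŷx⁻) :1 ≡.refl) (trans (*-congʳ Y-X) (mono-inverse units yx⃗))

  T-expr : ⟪ t̂ ⟫ ≈ M t⃗
  T-expr = trans (on-curve t̂ (:1 :+ ŷ :* ŷx⁻ :* (ŷ :- :1)) ≡.refl) (trans (+-congˡ (*-cong (*-congˡ YX⁻¹-expr) Y-1))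
    (by (solve 6 (λ o m t y i z → :1 :+ y :* i :* z := t :+ ((:- :1) :* (t :- (o :+ m)) :+ (:- :1) :* (o :- :1) :+ :1 :* (y :* i :* z :- m)))
        (M 0⃗) (M (v⃗ 0 2 0 0 1 0 0 ⊘ v⃗ 2 0 0 1 0 0 0)) (M t⃗) Y (M (-[1+ 0 ] ⊗ yx⃗)) (M y1⃗))
      ((times _ W₅ ⊕ times _ M-0) ⊕ times _ (trans (*-congʳ (M-* y⃗ (-[1+ 0 ] ⊗ yx⃗) ≡.refl)) (M-* (y⃗ ⊹ (-[1+ 0 ] ⊗ yx⃗)) y1⃗ ≡.refl)))))

  basis : Vec (Vec ℤ 7) 6
  basis = x⃗ ∷ y⃗ ∷ yx⃗ ∷ 1x⃗ ∷ y1⃗ ∷ t⃗ ∷ []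

  pexpr : Expr 3 → Expr 3 → ℤ → Expr 3
  pexpr a a⁻ (+ n)    = a :^ n
  pexpr a a⁻ -[1+ n ] = a⁻ :^ suc n

  uexpr : ℤ → ℤ → ℤ → ℕ → ℕ → ℕ → Expr 3
  uexpr a b c d f g = pexpr x̂ x̂⁻ a :* (pexpr ŷ ŷ⁻ b :* (pexpr ŷx ŷx⁻ c :* ((:1 :+ x̂) :^ d :* ((ŷ :- :1) :^ f :* (t̂ :^ g :* :1)))))

  pexpr-sound : ∀ {a a⁻} (u : Unit S) → ⟪ a ⟫ ≈ Unit.unit u → ⟪ a⁻ ⟫ ≈ Unit.inverse u → ∀ k → ⟪ pexpr a a⁻ k ⟫ ≈ power u k
  pexpr-sound u p q (+ n)    = ^-cong n p
  pexpr-sound u p q -[1+ n ] = ^-cong (suc n) q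

  uexpr-sound : ∀ a b c d f g → ⟪ uexpr a b c d f g ⟫ ≈ mono (Vec.map (mono-unit units) basis) (a ∷ b ∷ c ∷ + d ∷ + f ∷ + g ∷ [])
  uexpr-sound a b c d f g = *-cong (pexpr-sound {x̂} {x̂⁻} (mono-unit units x⃗) refl refl a) (*-cong (pexpr-sound {ŷ} {ŷ⁻} (mono-unit units y⃗) refl Y⁻¹-expr b)
    (*-cong (pexpr-sound {ŷx} {ŷx⁻} (mono-unit units yx⃗) Y-X YX⁻¹-expr c) (*-cong (^-cong d 1+X) (*-cong (^-cong f Y-1) (*-cong (^-cong g T-expr) refl)))))

  M-expr : ∀ a b c d f g o w → combination basis (a ∷ b ∷ c ∷ + d ∷ + f ∷ + g ∷ []) o ≡ w → M w ≈ ⟪ uexpr a b c d f g ⟫ * M o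
  M-expr a b c d f g o w e = trans (reflexive (≡.cong M (≡.sym e))) (trans (sym (mono-mono units basis (a ∷ b ∷ c ∷ + d ∷ + f ∷ + g ∷ []) o)) (*-congʳ (sym (uexpr-sound a b c d f g))))

  -- The form whose powers carry the weight: e³ has weight 3/2 and the quotient `ref` of theta
  -- values has weight -1/2, so ε has weight one.
  ε : Carrier
  ε = e ^ 3 * M ref

  private
    l₁ l₂ l₃ l₄ l₅ l₆ l₇ a₁ a₂ a₃ a₄ a₅ a₆ a₇ ê : Expr 15
    l₁ = :v (# 0)
    l₂ = :v (# 1)
    l₃ = :v (# 2)
    l₄ = :v (# 3)
    l₅ = :v (# 4)
    l₆ = :v (# 5)
    l₇ = :v (# 6)
    a₁ = :v (# 7)
    a₂ = :v (# 8)
    a₃ = :v (# 9)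
    a₄ = :v (# 10)
    a₅ = :v (# 11)
    a₆ = :v (# 12)
    a₇ = :v (# 13)
    ê = :v (# 14)

    μ : (k₁ k₂ k₃ k₄ k₅ k₆ k₇ : ℕ) → Expr 15
    μ = mon a₁ a₂ a₃ a₄ a₅ a₆ a₇

    values : Vec Carrier 15
    values = lam 1 ∷ lam 2 ∷ lam 3 ∷ lam 4 ∷ lam 5 ∷ lam 6 ∷ lam 7 ∷ P 1 ∷ P 2 ∷ P 3 ∷ P 4 ∷ P 5 ∷ P 6 ∷ P 7 ∷ e ∷ []

    product : ∀ a b → isZero (norm (a :- b)) ≡ true → ⟦ a ⟧ values ≈ ⟦ b ⟧ values
    product a b p = prove a b p values

  quotient : ∀ {ℓ E} u z w → w ⊹ u ≡ z → M w ≈ E * M ref → ℓ * M u ≈ fromℤ -[1+ 1 ] * e ^ 3 * M z → ℓ ≈ fromℤ -[1+ 1 ] * (ε * E)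
  quotient {ℓ} {E} u z w p q h = trans (M-divide u z w p h) (trans (*-congˡ q)
    (solve 3 (λ e m k → :c -[1+ 1 ] :* e :^ 3 :* (k :* m) := :c -[1+ 1 ] :* (e :^ 3 :* m :* k)) e (M ref) E))

  quotient⁻ : ∀ {ℓ E} u z w → w ⊹ u ≡ z → M w ≈ E * M ref → ℓ * M u ≈ fromℤ (+ 2) * e ^ 3 * M z → ℓ ≈ fromℤ -[1+ 1 ] * (ε * - E)
  quotient⁻ {ℓ} {E} u z w p q h = trans (M-divide u z w p h) (trans (*-congˡ q)
    (solve 3 (λ e m k → :c (+ 2) :* e :^ 3 :* (k :* m) := :c -[1+ 1 ] :* (e :^ 3 :* m :* (:- k))) e (M ref) E))

  -- Seven instances of `addition` follow, chosen to determine the seven values λ. Each right side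
  -- is, up to sign, -2 ε times a Laurent monomial in X and Y.
  A₁ : Expr 3
  A₁ = uexpr -[1+ 1 ] (+ 0) (+ 0) 0 0 0
  Λ₁ : fromℤ (+ 2) * lam 1 + lam 3 + - lam 5 ≈ fromℤ -[1+ 1 ] * (ε * ⟪ A₁ ⟫)
  Λ₁ = quotient (v⃗ 2 0 1 0 1 0 0) (v⃗ 0 1 0 2 0 0 0) (v⃗ 0 1 0 2 0 0 0 ⊘ v⃗ 2 0 1 0 1 0 0) ≡.refl (M-expr -[1+ 1 ] (+ 0) (+ 0) 0 0 0 ref (v⃗ 0 1 0 2 0 0 0 ⊘ v⃗ 2 0 1 0 1 0 0) ≡.refl)
    (by (product ((:c (+ 2) :* l₁ :+ l₃ :- l₅) :* μ 2 0 1 0 1 0 0) (:c (-[1+ 1 ]) :* ê :^ 3 :* μ 0 1 0 2 0 0 0 :+ (:- :1) :* (((l₁ :+ l₁ :- l₅ :- (:- l₃)) :* (a₁ :* a₁ :* (a₅ :* (:- a₃)))) :- (:c -[1+ 1 ] :* ê :^ 3 :* (a₂ :* (a₄ :* (:- a₄)))))) ≡.refl) (times _ (addition-law (P 2) ((P 4) * (- P 4)) p₁ p₁ p₅ n₃ (addition (+ 1) (+ 0) (+ 4)))))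

  A₂ : Expr 3
  A₂ = uexpr -[1+ 0 ] -[1+ 0 ] (+ 0) 0 0 0
  Λ₂ : lam 1 + lam 3 + lam 5 + lam 6 ≈ fromℤ -[1+ 1 ] * (ε * ⟪ A₂ ⟫)
  Λ₂ = quotient (v⃗ 1 0 1 0 1 1 0) (v⃗ 0 0 0 1 0 1 1) (v⃗ 0 0 0 1 0 0 1 ⊘ v⃗ 1 0 1 0 1 0 0) ≡.refl (M-expr -[1+ 0 ] -[1+ 0 ] (+ 0) 0 0 0 ref (v⃗ 0 0 0 1 0 0 1 ⊘ v⃗ 1 0 1 0 1 0 0) ≡.refl)
    (by (product ((l₁ :+ l₃ :+ l₅ :+ l₆) :* μ 1 0 1 0 1 1 0) (:c (-[1+ 1 ]) :* ê :^ 3 :* μ 0 0 0 1 0 1 1 :+ (:1) :* (((l₁ :+ l₃ :- (:- l₆) :- (:- l₅)) :* (a₁ :* a₃ :* ((:- a₆) :* (:- a₅)))) :- (:c -[1+ 1 ] :* ê :^ 3 :* (a₄ :* (a₆ :* a₇))))) ≡.refl) (times _ (addition-law (P 4) ((P 6) * (P 7)) p₁ p₃ n₆ n₅ (addition (+ 2) -[1+ 0 ] (+ 7)))))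

  A₃ : Expr 3
  A₃ = :- (uexpr -[1+ 0 ] (+ 0) (+ 0) 0 0 0)
  Λ₃ : lam 1 + - lam 3 + - lam 5 + lam 7 ≈ fromℤ -[1+ 1 ] * (ε * ⟪ A₃ ⟫)
  Λ₃ = quotient⁻ (v⃗ 1 0 1 0 1 0 1) (v⃗ 0 1 0 1 0 0 1) (v⃗ 0 1 0 1 0 0 0 ⊘ v⃗ 1 0 1 0 1 0 0) ≡.refl (M-expr -[1+ 0 ] (+ 0) (+ 0) 0 0 0 ref (v⃗ 0 1 0 1 0 0 0 ⊘ v⃗ 1 0 1 0 1 0 0) ≡.refl)
    (by (product ((l₁ :- l₃ :- l₅ :+ l₇) :* μ 1 0 1 0 1 0 1) (:c (+ 2) :* ê :^ 3 :* μ 0 1 0 1 0 0 1 :+ (:1) :* (((l₁ :+ l₇ :- l₃ :- l₅) :* (a₁ :* a₇ :* (a₃ :* a₅))) :- (:c -[1+ 1 ] :* ê :^ 3 :* ((:- a₇) :* ((:- a₄) :* (:- a₂)))))) ≡.refl) (times _ (addition-law (- P 7) ((- P 4) * (- P 2)) p₁ p₇ p₃ p₅ (addition (+ 4) -[1+ 2 ] -[1+ 0 ]))))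

  A₄ : Expr 3
  A₄ = uexpr (+ 0) -[1+ 1 ] (+ 0) 0 0 0
  Λ₄ : lam 2 + lam 3 + fromℤ (+ 2) * lam 5 ≈ fromℤ -[1+ 1 ] * (ε * ⟪ A₄ ⟫)
  Λ₄ = quotient (v⃗ 0 1 1 0 2 0 0) (v⃗ 0 0 0 0 1 0 2) (v⃗ 0 0 0 0 0 0 2 ⊘ v⃗ 0 1 1 0 1 0 0) ≡.refl (M-expr (+ 0) -[1+ 1 ] (+ 0) 0 0 0 ref (v⃗ 0 0 0 0 0 0 2 ⊘ v⃗ 0 1 1 0 1 0 0) ≡.refl)
    (by (product ((l₂ :+ l₃ :+ :c (+ 2) :* l₅) :* μ 0 1 1 0 2 0 0) (:c (-[1+ 1 ]) :* ê :^ 3 :* μ 0 0 0 0 1 0 2 :+ (:1) :* (((l₂ :+ l₃ :- (:- l₅) :- (:- l₅)) :* (a₂ :* a₃ :* ((:- a₅) :* (:- a₅)))) :- (:c -[1+ 1 ] :* ê :^ 3 :* (a₅ :* (a₇ :* a₇))))) ≡.refl) (times _ (addition-law (P 5) ((P 7) * (P 7)) p₂ p₃ n₅ n₅ (addition -[1+ 4 ] (+ 7) (+ 0)))))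

  A₅ : Expr 3
  A₅ = uexpr (+ 1) -[1+ 0 ] (+ 0) 0 0 0
  Λ₅ : lam 2 + - lam 3 + - lam 4 + lam 5 ≈ fromℤ -[1+ 1 ] * (ε * ⟪ A₅ ⟫)
  Λ₅ = quotient (v⃗ 0 1 1 1 1 0 0) (v⃗ 1 1 0 0 0 0 1) (v⃗ 1 0 0 0 0 0 1 ⊘ v⃗ 0 0 1 1 1 0 0) ≡.refl (M-expr (+ 1) -[1+ 0 ] (+ 0) 0 0 0 ref (v⃗ 1 0 0 0 0 0 1 ⊘ v⃗ 0 0 1 1 1 0 0) ≡.refl)
    (by (product ((l₂ :- l₃ :- l₄ :+ l₅) :* μ 0 1 1 1 1 0 0) (:c (-[1+ 1 ]) :* ê :^ 3 :* μ 1 1 0 0 0 0 1 :+ (:1) :* (((l₂ :+ l₅ :- l₃ :- l₄) :* (a₂ :* a₅ :* (a₃ :* a₄))) :- (:c -[1+ 1 ] :* ê :^ 3 :* (a₇ :* ((:- a₂) :* (:- a₁)))))) ≡.refl) (times _ (addition-law (P 7) ((- P 2) * (- P 1)) p₂ p₅ p₃ p₄ (addition -[1+ 3 ] (+ 6) (+ 7)))))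

  A₆ : Expr 3
  A₆ = :- (uexpr (+ 2) -[1+ 0 ] (+ 0) 0 0 0)
  Λ₆ : lam 3 + - (fromℤ (+ 2) * lam 4) + lam 5 ≈ fromℤ -[1+ 1 ] * (ε * ⟪ A₆ ⟫)
  Λ₆ = quotient⁻ (v⃗ 0 0 1 2 1 0 0) (v⃗ 2 0 0 0 0 0 1) (v⃗ 2 0 0 0 0 0 1 ⊘ v⃗ 0 0 1 2 1 0 0) ≡.refl (M-expr (+ 2) -[1+ 0 ] (+ 0) 0 0 0 ref (v⃗ 2 0 0 0 0 0 1 ⊘ v⃗ 0 0 1 2 1 0 0) ≡.refl)
    (by (product ((l₃ :- :c (+ 2) :* l₄ :+ l₅) :* μ 0 0 1 2 1 0 0) (:c (+ 2) :* ê :^ 3 :* μ 2 0 0 0 0 0 1 :+ (:1) :* (((l₃ :+ l₅ :- l₄ :- l₄) :* (a₃ :* a₅ :* (a₄ :* a₄))) :- (:c -[1+ 1 ] :* ê :^ 3 :* ((:- a₇) :* ((:- a₁) :* (:- a₁)))))) ≡.refl) (times _ (addition-law (- P 7) ((- P 1) * (- P 1)) p₃ p₅ p₄ p₄ (addition (+ 4) -[1+ 0 ] (+ 0)))))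

  A₇ : Expr 3
  A₇ = :- (uexpr (+ 1) (+ 0) (+ 0) 0 0 0)
  Λ₇ : lam 3 + - lam 4 + - lam 5 + lam 6 ≈ fromℤ -[1+ 1 ] * (ε * ⟪ A₇ ⟫)
  Λ₇ = quotient⁻ (v⃗ 0 0 1 1 1 1 0) (v⃗ 1 1 0 0 0 1 0) (v⃗ 1 1 0 0 0 0 0 ⊘ v⃗ 0 0 1 1 1 0 0) ≡.refl (M-expr (+ 1) (+ 0) (+ 0) 0 0 0 ref (v⃗ 1 1 0 0 0 0 0 ⊘ v⃗ 0 0 1 1 1 0 0) ≡.refl)
    (by (product ((l₃ :- l₄ :- l₅ :+ l₆) :* μ 0 0 1 1 1 1 0) (:c (+ 2) :* ê :^ 3 :* μ 1 1 0 0 0 1 0 :+ (:1) :* (((l₃ :+ l₆ :- l₄ :- l₅) :* (a₃ :* a₆ :* (a₄ :* a₅))) :- (:c -[1+ 1 ] :* ê :^ 3 :* ((:- a₆) :* ((:- a₂) :* (:- a₁)))))) ≡.refl) (times _ (addition-law (- P 6) ((- P 2) * (- P 1)) p₃ p₆ p₄ p₅ (addition -[1+ 2 ] (+ 6) (+ 7)))))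

  private
    ε̂ k₁ k₂ k₃ k₄ k₅ k₆ k₇ r₁ r₂ r₃ r₄ r₅ r₆ r₇ : Expr 15
    ε̂ = :v (# 7)
    k₁ = :v (# 8)
    k₂ = :v (# 9)
    k₃ = :v (# 10)
    k₄ = :v (# 11)
    k₅ = :v (# 12)
    k₆ = :v (# 13)
    k₇ = :v (# 14)
    r₁ = :c (+ 2) :* l₁ :+ l₃ :- l₅ :- :c -[1+ 1 ] :* (ε̂ :* k₁)
    r₂ = l₁ :+ l₃ :+ l₅ :+ l₆ :- :c -[1+ 1 ] :* (ε̂ :* k₂)
    r₃ = l₁ :- l₃ :- l₅ :+ l₇ :- :c -[1+ 1 ] :* (ε̂ :* k₃)
    r₄ = l₂ :+ l₃ :+ :c (+ 2) :* l₅ :- :c -[1+ 1 ] :* (ε̂ :* k₄)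
    r₅ = l₂ :- l₃ :- l₄ :+ l₅ :- :c -[1+ 1 ] :* (ε̂ :* k₅)
    r₆ = l₃ :- :c (+ 2) :* l₄ :+ l₅ :- :c -[1+ 1 ] :* (ε̂ :* k₆)
    r₇ = l₃ :- l₄ :- l₅ :+ l₆ :- :c -[1+ 1 ] :* (ε̂ :* k₇)

    env : Vec Carrier 15
    env = lam 1 ∷ lam 2 ∷ lam 3 ∷ lam 4 ∷ lam 5 ∷ lam 6 ∷ lam 7 ∷ ε ∷ ⟪ A₁ ⟫ ∷ ⟪ A₂ ⟫ ∷ ⟪ A₃ ⟫ ∷ ⟪ A₄ ⟫ ∷ ⟪ A₅ ⟫ ∷ ⟪ A₆ ⟫ ∷ ⟪ A₇ ⟫ ∷ []

    linear : ∀ a b → isZero (norm (a :- b)) ≡ true → ⟦ a ⟧ env ≈ ⟦ b ⟧ env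
    linear a b p = prove a b p env

  -- The coefficients are a row of 30 times the inverse matrix of the linear system given by the
  -- Λ's. Since every right side contains -2 ε, a factor 2 cancels and 15 λ = - ε L remains; the
  -- other L's arise in the same way.
  L₁ : Expr 3
  L₁ = :c (+ 11) :* A₁ :+ :c (+ 8) :* A₂ :- :c (+ 6) :* A₄ :+ :c (+ 6) :* A₅ :+ A₆ :- :c (+ 8) :* A₇
  λ₁ : fromℤ (+ 15) * lam 1 ≈ - (ε * ⟪ L₁ ⟫)
  λ₁ = cancel 1 (by (linear (:c (+ 2) :* (:c (+ 15) :* l₁)) (:c (+ 2) :* (:- (ε̂ :* (:c (+ 11) :* k₁ :+ :c (+ 8) :* k₂ :- :c (+ 6) :* k₄ :+ :c (+ 6) :* k₅ :+ k₆ :- :c (+ 8) :* k₇))) :+ (:c (+ 11) :* r₁ :+ (:c (+ 8) :* r₂ :+ (:c (-[1+ 5 ]) :* r₄ :+ (:c (+ 6) :* r₅ :+ (:c (+ 1) :* r₆ :+ (:c (-[1+ 7 ]) :* r₇))))))) ≡.refl) (times _ Λ₁ ⊕ times _ Λ₂ ⊕ times _ Λ₄ ⊕ times _ Λ₅ ⊕ times _ Λ₆ ⊕ times _ Λ₇))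

  L₂ : Expr 3
  L₂ = :c (+ 7) :* A₁ :- :c (+ 14) :* A₂ :+ :c (+ 18) :* A₄ :+ :c (+ 12) :* A₅ :- :c (+ 13) :* A₆ :+ :c (+ 14) :* A₇
  λ₂ : fromℤ (+ 15) * lam 2 ≈ - (ε * ⟪ L₂ ⟫)
  λ₂ = cancel 1 (by (linear (:c (+ 2) :* (:c (+ 15) :* l₂)) (:c (+ 2) :* (:- (ε̂ :* (:c (+ 7) :* k₁ :- :c (+ 14) :* k₂ :+ :c (+ 18) :* k₄ :+ :c (+ 12) :* k₅ :- :c (+ 13) :* k₆ :+ :c (+ 14) :* k₇))) :+ (:c (+ 7) :* r₁ :+ (:c (-[1+ 13 ]) :* r₂ :+ (:c (+ 18) :* r₄ :+ (:c (+ 12) :* r₅ :+ (:c (-[1+ 12 ]) :* r₆ :+ (:c (+ 14) :* r₇))))))) ≡.refl) (times _ Λ₁ ⊕ times _ Λ₂ ⊕ times _ Λ₄ ⊕ times _ Λ₅ ⊕ times _ Λ₆ ⊕ times _ Λ₇))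

  L₃ : Expr 3
  L₃ = :c (+ 3) :* A₁ :- :c (+ 6) :* A₂ :+ :c (+ 12) :* A₄ :- :c (+ 12) :* A₅ :+ :c (+ 3) :* A₆ :+ :c (+ 6) :* A₇
  λ₃ : fromℤ (+ 15) * lam 3 ≈ - (ε * ⟪ L₃ ⟫)
  λ₃ = cancel 1 (by (linear (:c (+ 2) :* (:c (+ 15) :* l₃)) (:c (+ 2) :* (:- (ε̂ :* (:c (+ 3) :* k₁ :- :c (+ 6) :* k₂ :+ :c (+ 12) :* k₄ :- :c (+ 12) :* k₅ :+ :c (+ 3) :* k₆ :+ :c (+ 6) :* k₇))) :+ (:c (+ 3) :* r₁ :+ (:c (-[1+ 5 ]) :* r₂ :+ (:c (+ 12) :* r₄ :+ (:c (-[1+ 11 ]) :* r₅ :+ (:c (+ 3) :* r₆ :+ (:c (+ 6) :* r₇))))))) ≡.refl) (times _ Λ₁ ⊕ times _ Λ₂ ⊕ times _ Λ₄ ⊕ times _ Λ₅ ⊕ times _ Λ₆ ⊕ times _ Λ₇))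

  L₄ : Expr 3
  L₄ = :- A₁ :+ :c (+ 2) :* A₂ :+ :c (+ 6) :* A₄ :- :c (+ 6) :* A₅ :- :c (+ 11) :* A₆ :- :c (+ 2) :* A₇
  λ₄ : fromℤ (+ 15) * lam 4 ≈ - (ε * ⟪ L₄ ⟫)
  λ₄ = cancel 1 (by (linear (:c (+ 2) :* (:c (+ 15) :* l₄)) (:c (+ 2) :* (:- (ε̂ :* (:- k₁ :+ :c (+ 2) :* k₂ :+ :c (+ 6) :* k₄ :- :c (+ 6) :* k₅ :- :c (+ 11) :* k₆ :- :c (+ 2) :* k₇))) :+ (:c (-[1+ 0 ]) :* r₁ :+ (:c (+ 2) :* r₂ :+ (:c (+ 6) :* r₄ :+ (:c (-[1+ 5 ]) :* r₅ :+ (:c (-[1+ 10 ]) :* r₆ :+ (:c (-[1+ 1 ]) :* r₇))))))) ≡.refl) (times _ Λ₁ ⊕ times _ Λ₂ ⊕ times _ Λ₄ ⊕ times _ Λ₅ ⊕ times _ Λ₆ ⊕ times _ Λ₇))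

  L₅ : Expr 3
  L₅ = :- :c (+ 5) :* A₁ :+ :c (+ 10) :* A₂ :+ :c (+ 5) :* A₆ :- :c (+ 10) :* A₇
  λ₅ : fromℤ (+ 15) * lam 5 ≈ - (ε * ⟪ L₅ ⟫)
  λ₅ = cancel 1 (by (linear (:c (+ 2) :* (:c (+ 15) :* l₅)) (:c (+ 2) :* (:- (ε̂ :* (:- :c (+ 5) :* k₁ :+ :c (+ 10) :* k₂ :+ :c (+ 5) :* k₆ :- :c (+ 10) :* k₇))) :+ (:c (-[1+ 4 ]) :* r₁ :+ (:c (+ 10) :* r₂ :+ (:c (+ 5) :* r₆ :+ (:c (-[1+ 9 ]) :* r₇))))) ≡.refl) (times _ Λ₁ ⊕ times _ Λ₂ ⊕ times _ Λ₆ ⊕ times _ Λ₇))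

  L₆ : Expr 3
  L₆ = :- :c (+ 9) :* A₁ :+ :c (+ 18) :* A₂ :- :c (+ 6) :* A₄ :+ :c (+ 6) :* A₅ :- :c (+ 9) :* A₆ :+ :c (+ 12) :* A₇
  λ₆ : fromℤ (+ 15) * lam 6 ≈ - (ε * ⟪ L₆ ⟫)
  λ₆ = cancel 1 (by (linear (:c (+ 2) :* (:c (+ 15) :* l₆)) (:c (+ 2) :* (:- (ε̂ :* (:- :c (+ 9) :* k₁ :+ :c (+ 18) :* k₂ :- :c (+ 6) :* k₄ :+ :c (+ 6) :* k₅ :- :c (+ 9) :* k₆ :+ :c (+ 12) :* k₇))) :+ (:c (-[1+ 8 ]) :* r₁ :+ (:c (+ 18) :* r₂ :+ (:c (-[1+ 5 ]) :* r₄ :+ (:c (+ 6) :* r₅ :+ (:c (-[1+ 8 ]) :* r₆ :+ (:c (+ 12) :* r₇))))))) ≡.refl) (times _ Λ₁ ⊕ times _ Λ₂ ⊕ times _ Λ₄ ⊕ times _ Λ₅ ⊕ times _ Λ₆ ⊕ times _ Λ₇))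

  L₇ : Expr 3
  L₇ = :- :c (+ 13) :* A₁ :- :c (+ 4) :* A₂ :+ :c (+ 30) :* A₃ :+ :c (+ 18) :* A₄ :- :c (+ 18) :* A₅ :+ :c (+ 7) :* A₆ :+ :c (+ 4) :* A₇
  λ₇ : fromℤ (+ 15) * lam 7 ≈ - (ε * ⟪ L₇ ⟫)
  λ₇ = cancel 1 (by (linear (:c (+ 2) :* (:c (+ 15) :* l₇)) (:c (+ 2) :* (:- (ε̂ :* (:- :c (+ 13) :* k₁ :- :c (+ 4) :* k₂ :+ :c (+ 30) :* k₃ :+ :c (+ 18) :* k₄ :- :c (+ 18) :* k₅ :+ :c (+ 7) :* k₆ :+ :c (+ 4) :* k₇))) :+ (:c (-[1+ 12 ]) :* r₁ :+ (:c (-[1+ 3 ]) :* r₂ :+ (:c (+ 30) :* r₃ :+ (:c (+ 18) :* r₄ :+ (:c (-[1+ 17 ]) :* r₅ :+ (:c (+ 7) :* r₆ :+ (:c (+ 4) :* r₇)))))))) ≡.refl) (times _ Λ₁ ⊕ times _ Λ₂ ⊕ times _ Λ₃ ⊕ times _ Λ₄ ⊕ times _ Λ₅ ⊕ times _ Λ₆ ⊕ times _ Λ₇))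

  D-1 : D 1# ≈ 0#
  D-1 = D-fromℤ (+ 1)

  D-inverse : ∀ {u w δ} → u * w ≈ 1# → D u ≈ δ * u → D w ≈ - δ * w
  D-inverse {u} {w} {δ} i p = by (solve 6 (λ u w δ Du Dw D1 → Dw := :- δ :* w :+ ((:- Dw) :* (u :* w :- :1) :+ (w :* ((Du :* w :+ u :* Dw :- D1) :+ (D1 :+ (:- w) :* (Du :- δ :* u))) :+ (:- δ :* w) :* (u :* w :- :1)))) u w δ (D u) (D w) (D 1#))
    (times _ i ⊕ (times₀ _ (trans (+-congʳ (-‿inverseʳ′ (trans (sym (D-* u w)) (D-cong i)))) (trans (+-identityˡ _) (trans (+-congʳ D-1) (trans (+-identityˡ _) (times (- w) p))))) ⊕ times _ i))
    where
    -‿inverseʳ′ : ∀ {x y} → x ≈ y → x + - y ≈ 0#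
    -‿inverseʳ′ p = trans (+-congʳ p) (-‿inverseʳ _)

  D-pow : ∀ {u δ} → D u ≈ δ * u → ∀ n → D (u ^ n) ≈ fromℕ n * δ * u ^ n
  D-pow {u} {δ} p zero    = trans D-1 (solve 1 (λ δ → :0 := :0 :* δ :* :1) δ)
  D-pow {u} {δ} p (suc n) = trans (D-* u (u ^ n)) (trans (+-cong (*-congʳ p) (*-congˡ (D-pow p n)))
    (trans (solve 4 (λ u δ n x → δ :* u :* x :+ u :* (n :* δ :* x) := (:1 :+ n) :* δ :* (u :* x)) u δ (fromℕ n) (u ^ n)) (*-congʳ (*-congʳ (sym (fromℕ-suc n))))))

  D-power : ∀ (u : Unit S) {δ} → D (Unit.unit u) ≈ δ * Unit.unit u → ∀ k → D (power u k) ≈ fromℤ k * δ * power u k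
  D-power u p (+ n)    = D-pow p n
  D-power u p -[1+ n ] = trans (D-pow (D-inverse (Unit.unit-inverse u) p) (suc n)) (*-congʳ (solve 2 (λ n δ → n :* :- δ := :- n :* δ) (fromℕ (suc n)) _))

  dlog : Vec ℤ 7 → Carrier
  dlog (a ∷ b ∷ c ∷ f ∷ g ∷ h ∷ k ∷ []) = fromℤ a * d 1 + (fromℤ b * d 2 + (fromℤ c * d 3 + (fromℤ f * d 4 + (fromℤ g * d 5 + (fromℤ h * d 6 + fromℤ k * d 7)))))

  D-M : ∀ w → D (M w) ≈ dlog w * M w
  D-M (a ∷ b ∷ c ∷ f ∷ g ∷ h ∷ k ∷ []) = step (D-power (u 0 (below 0)) (DP-d 0 (below 0)) a) (step (D-power (u 1 (below 1)) (DP-d 1 (below 1)) b) (step (D-power (u 2 (below 2)) (DP-d 2 (below 2)) c)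
    (step (D-power (u 3 (below 3)) (DP-d 3 (below 3)) f) (step (D-power (u 4 (below 4)) (DP-d 4 (below 4)) g) (step (D-power (u 5 (below 5)) (DP-d 5 (below 5)) h)
    (trans (D-* _ 1#) (trans (+-cong (*-congʳ (D-power (u 6 (below 6)) (DP-d 6 (below 6)) k)) (*-congˡ D-1)) (solve 2 (λ δ x → δ :* x :* :1 :+ x :* :0 := δ :* (x :* :1)) _ _))))))))
    where
    step : ∀ {x y δ δ′} → D x ≈ δ * x → D y ≈ δ′ * y → D (x * y) ≈ (δ + δ′) * (x * y)
    step {x} {y} {δ} {δ′} p q = trans (D-* x y) (trans (+-cong (*-congʳ p) (*-congˡ q)) (solve 4 (λ x y δ δ′ → δ :* x :* y :+ x :* (δ′ :* y) := (δ :+ δ′) :* (x :* y)) x y δ δ′))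

  t⁺ t⁻ : Vec ℤ 7
  t⁺ = (v⃗ 0 0 0 0 0 5 0 ⊘ v⃗ 0 0 5 0 0 0 0)
  t⁻ = (v⃗ 0 0 5 0 0 0 0 ⊘ v⃗ 0 0 0 0 0 5 0)

  -- With t = (P 6 / P 3)^5, Ramanujan's identity for t - 1/t + 11 reads rr = - q. The differential
  -- equation D rr = rr determines rr up to a constant factor.
  R rr : Carrier
  R = M t⁺ + fromℤ (+ 11) + - M t⁻
  rr = e ^ 12 * M (0⃗ ⊘ v⃗ 0 0 6 0 0 6 0) * R

  -- All arguments are multiples of 3, so only P₃ and P₆ occur: this is the theory of fifth roots of
  -- unity inside that of fifteenth roots.
  λ₃₆ : fromℤ (+ 3) * lam 3 + lam 6 ≈ fromℤ (+ 2) * e ^ 3 * M (v⃗ 0 0 0 0 0 2 0 ⊘ v⃗ 0 0 3 0 0 0 0)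
  λ₃₆ = M-divide (v⃗ 0 0 3 0 0 1 0) (v⃗ 0 0 0 0 0 3 0) (v⃗ 0 0 0 0 0 2 0 ⊘ v⃗ 0 0 3 0 0 0 0) ≡.refl
    (by (product ((:c (+ 3) :* l₃ :+ l₆) :* μ 0 0 3 0 0 1 0) (:c (+ 2) :* ê :^ 3 :* μ 0 0 0 0 0 3 0
        :+ :1 :* ((l₃ :+ l₃ :- (:- l₆) :- (:- l₃)) :* (a₃ :* a₃ :* ((:- a₆) :* (:- a₃))) :- :c -[1+ 1 ] :* ê :^ 3 :* (a₆ :* (a₆ :* (:- a₆))))) ≡.refl)
      (times _ (addition-law (P 6) (P 6 * - P 6) p₃ p₃ n₆ n₃ (addition (+ 3) (+ 0) (+ 6)))))

  λ₆₃ : fromℤ (+ 3) * lam 6 + - lam 3 ≈ fromℤ (+ 2) * e ^ 3 * M (v⃗ 0 0 2 0 0 0 0 ⊘ v⃗ 0 0 0 0 0 3 0)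
  λ₆₃ = M-divide (v⃗ 0 0 1 0 0 3 0) (v⃗ 0 0 3 0 0 0 0) (v⃗ 0 0 2 0 0 0 0 ⊘ v⃗ 0 0 0 0 0 3 0) ≡.refl
    (by (product ((:c (+ 3) :* l₆ :- l₃) :* μ 0 0 1 0 0 3 0) (:c (+ 2) :* ê :^ 3 :* μ 0 0 3 0 0 0 0
        :+ (:- :1) :* ((l₆ :+ l₆ :- (:- l₆) :- l₃) :* (a₆ :* a₆ :* ((:- a₆) :* a₃)) :- :c -[1+ 1 ] :* ê :^ 3 :* ((:- a₃) :* (a₃ :* (:- a₃))))) ≡.refl)
      (times _ (addition-law (- P 3) (P 3 * - P 3) p₆ p₆ n₆ p₃ (addition (+ 6) (+ 0) (+ 3)))))

  -- The relations `log₃` and `log₆` eliminate the q-derivatives of P₃ and P₆, and then `de`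
  -- cancels. What is left is quadratic in λ₃ and λ₆ and vanishes by their expressions in `five₃`
  -- and `five₆`. The factor 100 = 4 · 25 clears the 4 of the logarithmic relations and the squares
  -- of 5 λ.
  D-rr : D rr ≈ rr
  D-rr = trans (D-* (e ^ 12 * M m⃗) R) (trans (+-cong (*-congʳ (trans (D-* (e ^ 12) (M m⃗)) (+-cong (*-congʳ (D-pow De-de 12)) (*-congˡ (D-M m⃗)))))
      (*-congˡ (trans (D-+ _ _) (+-cong (trans (D-+ _ _) (+-cong (D-M t⁺) (D-fromℤ (+ 11)))) (trans (D-neg _) (-‿cong (D-M t⁻)))))))
    (cancel 99 (by (solve 14 (λ E m t s d₁ d₂ d₃ d₄ d₅ d₆ d₇ de l₃ l₆ →
        :c (+ 100) :* ((:c (+ 12) :* de :* E :* m :+ E :* ((:c (+ 0) :* d₁ :+ (:c (+ 0) :* d₂ :+ (:c (-[1+ 5 ]) :* d₃ :+ (:c (+ 0) :* d₄ :+ (:c (+ 0) :* d₅ :+ (:c (-[1+ 5 ]) :* d₆ :+ (:c (+ 0) :* d₇))))))) :* m)) :* (t :+ :c (+ 11) :- s) :+ E :* m :* ((:c (+ 0) :* d₁ :+ (:c (+ 0) :* d₂ :+ (:c (-[1+ 4 ]) :* d₃ :+ (:c (+ 0) :* d₄ :+ (:c (+ 0) :* d₅ :+ (:c (+ 5) :* d₆ :+ (:c (+ 0) :* d₇))))))) :* t :+ :0 :- (:c (+ 0) :* d₁ :+ (:c (+ 0) :* d₂ :+ (:c (+ 5) :* d₃ :+ (:c (+ 0) :*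 d₄ :+ (:c (+ 0) :* d₅ :+ (:c (-[1+ 4 ]) :* d₆ :+ (:c (+ 0) :* d₇))))))) :* s))
        := :c (+ 100) :* (E :* m :* (t :+ :c (+ 11) :- s))
           :+ ((E :* m :* :c (+ 25) :* (:- :c (+ 2) :* (t :+ :c (+ 11) :- s) :- :c (+ 5) :* (t :+ s))) :* (:c (+ 4) :* (:c (+ 2) :* d₃ :+ d₆) :+ :1 :+ l₃ :* l₃ :- :c (+ 2) :* l₆ :* l₃ :- :c (+ 12) :* de)
           :+ ((E :* m :* :c (+ 25) :* (:- :c (+ 2) :* (t :+ :c (+ 11) :- s) :+ :c (+ 5) :* (t :+ s))) :* (:c (+ 4) :* (:c (+ 2) :* d₆ :+ d₃) :+ :1 :+ l₆ :* l₆ :- :c (+ 2) :* (:- l₃) :* l₆ :- :c (+ 12) :* de)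
           :+ (E :* m) :* (:c (+ 2) :* ((:c (+ 5) :* l₃) :^ 2 :+ (:c (+ 5) :* l₆) :^ 2) :* (t :+ :c (+ 11) :- s)
                :- :c (+ 5) :* ((:c (+ 5) :* l₆) :^ 2 :+ :c (+ 4) :* (:c (+ 5) :* l₃) :* (:c (+ 5) :* l₆) :- (:c (+ 5) :* l₃) :^ 2) :* (t :+ s)))))
        (e ^ 12) (M m⃗) (M t⁺) (M t⁻) (d 1) (d 2) (d 3) (d 4) (d 5) (d 6) (d 7) de (lam 3) (lam 6))
      (times _ log₃ ⊕ (times _ log₆ ⊕ times₀ _ quadratic)))))
    where
    m⃗ b⃗ : Vec ℤ 7
    m⃗ = (0⃗ ⊘ v⃗ 0 0 6 0 0 6 0)
    b⃗ = (v⃗ 0 0 2 0 0 0 0 ⊘ v⃗ 0 0 0 0 0 3 0)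
    tt : M t⁺ * M t⁻ ≈ 1#
    tt = trans (M-* t⁺ t⁻ ≡.refl) M-0
    five₃ : fromℤ (+ 5) * lam 3 ≈ e ^ 3 * (fromℤ (+ 3) * (M b⃗ * M t⁺) + - M b⃗)
    five₃ = cancel 1 (by (solve 6 (λ l₃ l₆ e a b p → :c (+ 2) :* (:c (+ 5) :* l₃) := :c (+ 2) :* (e :^ 3 :* (:c (+ 3) :* p :- b))
      :+ (:c (+ 3) :* (:c (+ 3) :* l₃ :+ l₆ :- :c (+ 2) :* e :^ 3 :* a) :+ ((:- :1) :* (:c (+ 3) :* l₆ :- l₃ :- :c (+ 2) :* e :^ 3 :* b) :+ (:- :c (+ 6) :* e :^ 3) :* (p :- a))))
      (lam 3) (lam 6) e (M (v⃗ 0 0 0 0 0 2 0 ⊘ v⃗ 0 0 3 0 0 0 0)) (M b⃗) (M b⃗ * M t⁺)) (times _ λ₃₆ ⊕ (times _ λ₆₃ ⊕ times _ (M-* b⃗ t⁺ ≡.refl))))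
    five₆ : fromℤ (+ 5) * lam 6 ≈ e ^ 3 * (M b⃗ * M t⁺ + fromℤ (+ 3) * M b⃗)
    five₆ = cancel 1 (by (solve 6 (λ l₃ l₆ e a b p → :c (+ 2) :* (:c (+ 5) :* l₆) := :c (+ 2) :* (e :^ 3 :* (p :+ :c (+ 3) :* b))
      :+ (:1 :* (:c (+ 3) :* l₃ :+ l₆ :- :c (+ 2) :* e :^ 3 :* a) :+ (:c (+ 3) :* (:c (+ 3) :* l₆ :- l₃ :- :c (+ 2) :* e :^ 3 :* b) :+ (:- :c (+ 2) :* e :^ 3) :* (p :- a))))
      (lam 3) (lam 6) e (M (v⃗ 0 0 0 0 0 2 0 ⊘ v⃗ 0 0 3 0 0 0 0)) (M b⃗) (M b⃗ * M t⁺)) (times _ λ₃₆ ⊕ (times _ λ₆₃ ⊕ times _ (M-* b⃗ t⁺ ≡.refl))))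
    quadratic : fromℤ (+ 2) * ((fromℤ (+ 5) * lam 3) ^ 2 + (fromℤ (+ 5) * lam 6) ^ 2) * R
      + - (fromℤ (+ 5) * ((fromℤ (+ 5) * lam 6) ^ 2 + fromℤ (+ 4) * (fromℤ (+ 5) * lam 3) * (fromℤ (+ 5) * lam 6) + - (fromℤ (+ 5) * lam 3) ^ 2) * (M t⁺ + M t⁻)) ≈ 0#
    quadratic = trans (+-cong (*-congʳ (*-congˡ (+-cong (^-cong 2 five₃) (^-cong 2 five₆))))
        (-‿cong (*-congʳ (*-congˡ (+-cong (+-cong (^-cong 2 five₆) (*-cong (*-congˡ five₃) five₆)) (-‿cong (^-cong 2 five₃)))))))
      (by (solve 4 (λ e b t s → :c (+ 2) :* ((e :^ 3 :* (:c (+ 3) :* (b :* t) :- b)) :^ 2 :+ (e :^ 3 :* (b :* t :+ :c (+ 3) :* b)) :^ 2) :* (t :+ :c (+ 11) :- s)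
        :- :c (+ 5) :* ((e :^ 3 :* (b :* t :+ :c (+ 3) :* b)) :^ 2 :+ :c (+ 4) :* (e :^ 3 :* (:c (+ 3) :* (b :* t) :- b)) :* (e :^ 3 :* (b :* t :+ :c (+ 3) :* b)) :- (e :^ 3 :* (:c (+ 3) :* (b :* t) :- b)) :^ 2) :* (t :+ s)
        := :0 :+ (:c (+ 20) :* e :^ 6 :* b :^ 2 :* (:- :c (+ 2) :* t :- :c (+ 11))) :* (t :* s :- :1)) e (M b⃗) (M t⁺) (M t⁻)) (times _ tt))

-- Modular forms of level 15

-- What the infinite products contribute, as opposed to the theta relations. The constants `s₃` and
-- `s₅` are the square roots of -3 and 5 that lead the products P₅ and P₃P₆.
record ProductSystem (S : CommutativeRing 0ℓ 0ℓ) (T : ThetaSystem S) : Set where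
  open CommutativeRing S hiding (zero)
  open Solver S using (fromℤ; _^_)
  open ThetaSystem T
  open Parametrisation S T using (rr)
  field
    E₃ E₅ E₁₅ E₃⁻¹ E₅⁻¹ E₁₅⁻¹ : Carrier
    E₃-inverse : E₃ * E₃⁻¹ ≈ 1#
    E₅-inverse : E₅ * E₅⁻¹ ≈ 1#
    E₁₅-inverse : E₁₅ * E₁₅⁻¹ ≈ 1#
    s₃ s₅ : Carrier
    s₃² : s₃ ^ 2 ≈ fromℤ -[1+ 2 ]
    s₅² : s₅ ^ 2 ≈ fromℤ (+ 5)
    D-s₃ : D s₃ ≈ 0#
    D-s₅ : D s₅ ≈ 0#
    P₅ : P 5 ≈ s₃ * E₃
    P₃₆ : P 3 * P 6 ≈ s₅ * (e * E₅)
    P₁₂₄₇ : P 1 * P 2 * P 4 * P 7 * (E₃ * E₅) ≈ E₁₅ * e ^ 5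
    F₁ F₃ F₅ F₁₅ : Carrier
    eisenstein₁ : fromℤ (+ 24) * D e ≈ (F₁ + - 1#) * e
    eisenstein₃ : fromℤ (+ 24) * D E₃ ≈ fromℤ (+ 3) * (F₃ + - 1#) * E₃
    eisenstein₅ : fromℤ (+ 24) * D E₅ ≈ fromℤ (+ 5) * (F₅ + - 1#) * E₅
    eisenstein₁₅ : fromℤ (+ 24) * D E₁₅ ≈ fromℤ (+ 15) * (F₁₅ + - 1#) * E₁₅
    q : Carrier
    rr-q : rr ≈ - q
    f g₁ g₂ g₃ g₄ h B₁₃ B₁₄ C₀ : Carrier
    g₁-def : fromℤ (+ 8) * g₁ ≈ - (F₁ + fromℤ (+ 3) * F₃ + - (fromℤ (+ 5) * F₅) + - (fromℤ (+ 15) * F₁₅))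
    g₂-def : fromℤ (+ 12) * g₂ ≈ - (F₁ + - (fromℤ (+ 3) * F₃) + fromℤ (+ 5) * F₅ + - (fromℤ (+ 15) * F₁₅))
    g₄-def : fromℤ (+ 8) * g₄ ≈ F₁ + - (fromℤ (+ 3) * F₃) + - (fromℤ (+ 5) * F₅) + fromℤ (+ 15) * F₁₅
    g₃-def : g₃ ≈ q * (e * E₃ * E₅ * E₁₅)
    f-def : f * (E₃ * E₅) ≈ q * (e ^ 2 * E₁₅ ^ 2)
    h-def : h ≈ q * (e ^ 4 * E₅ ^ 4) + - (fromℤ (+ 9) * (q ^ 3 * (E₃ ^ 4 * E₁₅ ^ 4)))
    B₁₃-def : B₁₃ * (e ^ 7 * E₁₅ ^ 7) ≈ E₃ ^ 14 * E₅ ^ 14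
    B₁₄-def : B₁₄ * (E₃ ^ 4 * E₁₅) ≈ e ^ 17 * E₅ ^ 2
    C₀-def : P 1 ^ 14 * P′ 1 + P 2 ^ 14 * P′ 2 + P 3 ^ 14 * P′ 3 + P 4 ^ 14 * P′ 4 + P 5 ^ 14 * P′ 5 + P 6 ^ 14 * P′ 6 + P 7 ^ 14 * P′ 7
           ≈ fromℤ -[1+ 14 ] * (E₁₅ ^ 3 * C₀)

module Identity (S : CommutativeRing 0ℓ 0ℓ) (T : ThetaSystem S) (U : ProductSystem S T) where
  open CommutativeRing S hiding (zero)
  open Parametrisation S T
  open ProductSystem U
  open Solver S
  open Monomials S
  open Curve S X X⁻¹ Y XX⁻¹ curve using (⟪_⟫; on-curve)

  σ : Carrier
  σ = s₃ * s₅

  σ² : σ ^ 2 ≈ fromℤ -[1+ 14 ]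
  σ² = trans (solve 2 (λ a b → (a :* b) :^ 2 := a :^ 2 :* b :^ 2) s₃ s₅) (trans (*-cong s₃² s₅²) (solve 0 (:c -[1+ 2 ] :* :c (+ 5) := :c -[1+ 14 ])))

  unit₂ : ∀ {a b c d} → a * b ≈ 1# → c * d ≈ 1# → a * c * (b * d) ≈ 1#
  unit₂ p q = trans (solve 4 (λ a b c d → a :* c :* (b :* d) := a :* b :* (c :* d)) _ _ _ _) (trans (*-cong p q) (*-identityˡ 1#))

  unit-^ : ∀ {a b} n → a * b ≈ 1# → a ^ n * b ^ n ≈ 1#
  unit-^ zero    p = *-identityˡ 1#
  unit-^ (suc n) p = unit₂ p (unit-^ n p)

  P₃₅₆ : P 3 * P 5 * P 6 ≈ σ * (e * (E₃ * E₅))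
  P₃₅₆ = trans (solve 3 (λ a b c → a :* b :* c := b :* (a :* c)) (P 3) (P 5) (P 6)) (trans (*-cong P₅ P₃₆)
    (solve 5 (λ a b c d x → a :* b :* (c :* (d :* x)) := a :* c :* (d :* (b :* x))) s₃ E₃ s₅ e E₅))

  Π : Carrier
  Π = P 1 * P 2 * P 4 * P 7 * (P 3 * P 5 * P 6)

  Π-σ : Π ≈ σ * (E₁₅ * e ^ 6)
  Π-σ = divide (unit₂ E₃-inverse E₅-inverse) (trans (*-congʳ (*-congˡ P₃₅₆)) (trans
    (solve 4 (λ p s e x → p :* (s :* (e :* x)) :* x := p :* x :* (s :* (e :* x))) (P 1 * P 2 * P 4 * P 7) σ e (E₃ * E₅))
    (trans (*-congʳ P₁₂₄₇) (solve 4 (λ y e s x → y :* e :^ 5 :* (s :* (e :* x)) := s :* (y :* e :^ 6) :* x) E₁₅ e σ (E₃ * E₅)))))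

  dE₃ dE₅ dE₁₅ : Carrier
  dE₃  = D E₃ * E₃⁻¹
  dE₅  = D E₅ * E₅⁻¹
  dE₁₅ = D E₁₅ * E₁₅⁻¹

  log-of : ∀ {x y} → x * y ≈ 1# → D x ≈ D x * y * x
  log-of {x} {y} i = by (solve 3 (λ a x y → a := a :* y :* x :+ (:- a) :* (x :* y :- :1)) (D x) x y) (times _ i)

  D-product : ∀ {x y δ δ′} → D x ≈ δ * x → D y ≈ δ′ * y → D (x * y) ≈ (δ + δ′) * (x * y)
  D-product p q = trans (D-* _ _) (trans (+-cong (*-congʳ p) (*-congˡ q)) (solve 4 (λ x y δ δ′ → δ :* x :* y :+ x :* (δ′ :* y) := (δ :+ δ′) :* (x :* y)) _ _ _ _))

  D-constant : ∀ {c x δ} → D c ≈ 0# → D x ≈ δ * x → D (c * x) ≈ δ * (c * x)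
  D-constant p q = trans (D-* _ _) (trans (+-cong (*-congʳ p) (*-congˡ q)) (solve 3 (λ c x δ → :0 :* x :+ c :* (δ :* x) := δ :* (c :* x)) _ _ _))

  compare : ∀ {x y u δ δ′} → x * u ≈ 1# → x ≈ y → D x ≈ δ * x → D y ≈ δ′ * y → δ ≈ δ′
  compare i e p q = divide i (trans (sym p) (trans (D-cong e) (trans q (*-congˡ (sym e)))))

  DP : ∀ r → r < 7 → D (P (suc r)) ≈ d (suc r) * P (suc r)
  DP = DP-d

  -- The product formulas are compared through their logarithmic q-derivatives, in which the
  -- constants `s₃` and `s₅` disappear.
  a₁ : d 5 ≈ dE₃
  a₁ = compare (P-inverse 4 (below 4)) P₅ (DP 4 (below 4)) (D-constant D-s₃ (log-of E₃-inverse))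

  a₂ : d 3 + d 6 ≈ de + dE₅
  a₂ = compare (unit₂ (P-inverse 2 (below 2)) (P-inverse 5 (below 5))) P₃₆ (D-product (DP 2 (below 2)) (DP 5 (below 5)))
    (D-constant D-s₅ (D-product De-de (log-of E₅-inverse)))

  a₃ : d 1 + d 2 + d 4 + d 7 + (dE₃ + dE₅) ≈ dE₁₅ + fromℕ 5 * de
  a₃ = compare (unit₂ (unit₂ (unit₂ (unit₂ (P-inverse 0 (below 0)) (P-inverse 1 (below 1))) (P-inverse 3 (below 3))) (P-inverse 6 (below 6))) (unit₂ E₃-inverse E₅-inverse)) P₁₂₄₇
    (D-product (D-product (D-product (D-product (DP 0 (below 0)) (DP 1 (below 1))) (DP 3 (below 3))) (DP 6 (below 6))) (D-product (log-of E₃-inverse) (log-of E₅-inverse)))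
    (D-product (log-of E₁₅-inverse) (D-pow De-de 5))

  eisenstein-log : ∀ {x y c z} → x * y ≈ 1# → c * D x ≈ z * x → c * (D x * y) ≈ z
  eisenstein-log {x} {y} {c} {z} i p = divide i (by (solve 5 (λ c a x y z → c :* (a :* y) :* x := z :* x :+ (:1 :* (c :* a :- z :* x) :+ (c :* a) :* (x :* y :- :1))) c (D x) x y z)
    (times _ p ⊕ times _ i))

  k₁ : fromℤ (+ 24) * de ≈ F₁ + - 1#
  k₁ = eisenstein-log e-inverse eisenstein₁
  k₃ : fromℤ (+ 24) * dE₃ ≈ fromℤ (+ 3) * (F₃ + - 1#)
  k₃ = eisenstein-log E₃-inverse eisenstein₃
  k₅ : fromℤ (+ 24) * dE₅ ≈ fromℤ (+ 5) * (F₅ + - 1#)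
  k₅ = eisenstein-log E₅-inverse eisenstein₅
  k₁₅ : fromℤ (+ 24) * dE₁₅ ≈ fromℤ (+ 15) * (F₁₅ + - 1#)
  k₁₅ = eisenstein-log E₁₅-inverse eisenstein₁₅

  q₄ : ∀ {n} → Expr n → Expr n → Expr n → Expr n → Expr n
  q₄ a b c d = a :* a :+ b :* b :+ c :* c :+ d :* d :- :c (+ 2) :* a :* b :- :c (+ 2) :* b :* c :+ :c (+ 2) :* c :* d :+ :c (+ 2) :* d :* a

  log-relation : ∀ {n} → Expr n → Expr n → Expr n → Expr n → Expr n → Expr n
  log-relation d d′ l l′ de = :c (+ 4) :* (:c (+ 2) :* d :+ d′) :+ :1 :+ l :* l :- :c (+ 2) :* l′ :* l :- :c (+ 12) :* de

  -- The quadratic parts of `log₁`, `log₂`, `log₄`, `log₇` added up. Up to sign 1, 2, 4, 7 is the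
  -- orbit of 1 under doubling modulo 15, so in the sum all q-derivatives of the orbit occur with
  -- the same factor 12.
  Q₄ : Carrier
  Q₄ = lam 1 * lam 1 + lam 2 * lam 2 + lam 4 * lam 4 + lam 7 * lam 7 + - (fromℤ (+ 2) * lam 1 * lam 2) + - (fromℤ (+ 2) * lam 2 * lam 4) + fromℤ (+ 2) * lam 4 * lam 7 + fromℤ (+ 2) * lam 7 * lam 1

  -- By the Eisenstein relations this combination of E₂'s is 24 (d₁ + d₂ + d₄ + d₇ - 4 de) + 8, and
  -- the logarithmic relations summed over the orbit turn it into -2 `Q₄`. For g₁ the orbit of 3 and
  -- 6 is added, for g₂ that of 5.
  g₄-λ : fromℤ (+ 8) * g₄ ≈ - (fromℤ (+ 2) * Q₄)
  g₄-λ = by (solve 23 (λ g l₁ l₂ l₃ l₄ l₅ l₆ l₇ d₁ d₂ d₃ d₄ d₅ d₆ d₇ de e₃ e₅ ef F₁ F₃ F₅ Ff → :c (+ 8) :* g := :- (:c (+ 2) :* q₄ l₁ l₂ l₄ l₇) :+ (:c (+ 1) :* (:c (+ 8) :* g :- (F₁ :- :c (+ 3) :* F₃ :- :c (+ 5) :* F₅ :+ :c (+ 15) :* Ff)) :+ (:c (+ 2) :* log-relation d₁ d₂ l₁ l₂ de :+ (:c (+ 2) :* log-relation d₂ d₄ l₂ l₄ de :+ (:c (+ 2) :* log-relation d₄ d₇ l₄ (:- l₇) de :+ (:c (+ 2) :* log-relation d₇ d₁ l₇ (:- l₁) de :+ (:c (-[1+ 23 ]) :* (d₁ :+ d₂ :+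 d₄ :+ d₇ :+ (e₃ :+ e₅) :- (ef :+ :c (+ 5) :* de)) :+ (:c (-[1+ 0 ]) :* (:c (+ 24) :* de :- (F₁ :- :1)) :+ (:c (+ 1) :* (:c (+ 24) :* e₃ :- :c (+ 3) :* (F₃ :- :1)) :+ (:c (+ 1) :* (:c (+ 24) :* e₅ :- :c (+ 5) :* (F₅ :- :1)) :+ (:c (-[1+ 0 ]) :* (:c (+ 24) :* ef :- :c (+ 15) :* (Ff :- :1)))))))))))))
    g₄ (lam 1) (lam 2) (lam 3) (lam 4) (lam 5) (lam 6) (lam 7) (d 1) (d 2) (d 3) (d 4) (d 5) (d 6) (d 7) de dE₃ dE₅ dE₁₅ F₁ F₃ F₅ F₁₅) (times _ g₄-def ⊕ times _ log₁ ⊕ times _ log₂ ⊕ times _ log₄ ⊕ times _ log₇ ⊕ times _ a₃ ⊕ times _ k₁ ⊕ times _ k₃ ⊕ times _ k₅ ⊕ times _ k₁₅)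

  g₁-λ : fromℤ (+ 8) * g₁ ≈ - (fromℤ (+ 4) * (lam 3 * lam 3 + lam 6 * lam 6) + fromℤ (+ 2) * Q₄)
  g₁-λ = by (solve 23 (λ g l₁ l₂ l₃ l₄ l₅ l₆ l₇ d₁ d₂ d₃ d₄ d₅ d₆ d₇ de e₃ e₅ ef F₁ F₃ F₅ Ff → :c (+ 8) :* g := :- (:c (+ 4) :* (l₃ :* l₃ :+ l₆ :* l₆) :+ :c (+ 2) :* q₄ l₁ l₂ l₄ l₇) :+ (:c (+ 1) :* (:c (+ 8) :* g :- (:- (F₁ :+ :c (+ 3) :* F₃ :- :c (+ 5) :* F₅ :- :c (+ 15) :* Ff))) :+ (:c (+ 4) :* log-relation d₃ d₆ l₃ l₆ de :+ (:c (+ 4) :* log-relation d₆ d₃ l₆ (:- l₃) de :+ (:c (+ 2) :* log-relation d₁ d₂ l₁ l₂ de :+ (:c (+ 2) :* log-relation d₂ d₄ l₂ l₄ de :+ (:c (+ 2) :* log-relation d₄ d₇ l₄ (:- l₇) de :+ (:c (+ 2) :* log-relation d₇ d₁ l₇ (:- l₁) de :+ (:c (-[1+ 47 ]) :* (d₃ :+ d₆ :- (de :+ e₅)) :+ (:c (-[1+ 23 ]) :* (d₁ :+ d₂ :+ d₄ :+ d₇ :+ (e₃ :+ e₅) :- (ef :+ :c (+ 5) :* de)) :+ (:c (+ 1) :* (:c (+ 24) :* de :- (F₁ :- :1)) :+ (:c (+ 1) :* (:c (+ 24) :* e₃ :- :c (+ 3) :* (F₃ :- :1)) :+ (:c (-[1+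 0 ]) :* (:c (+ 24) :* e₅ :- :c (+ 5) :* (F₅ :- :1)) :+ (:c (-[1+ 0 ]) :* (:c (+ 24) :* ef :- :c (+ 15) :* (Ff :- :1))))))))))))))))
    g₁ (lam 1) (lam 2) (lam 3) (lam 4) (lam 5) (lam 6) (lam 7) (d 1) (d 2) (d 3) (d 4) (d 5) (d 6) (d 7) de dE₃ dE₅ dE₁₅ F₁ F₃ F₅ F₁₅) (times _ g₁-def ⊕ times _ log₃ ⊕ times _ log₆ ⊕ times _ log₁ ⊕ times _ log₂ ⊕ times _ log₄ ⊕ times _ log₇ ⊕ times _ a₂ ⊕ times _ a₃ ⊕ times _ k₁ ⊕ times _ k₃ ⊕ times _ k₅ ⊕ times _ k₁₅)

  g₂-λ : fromℤ (+ 12) * g₂ ≈ - (fromℤ (+ 12) * (lam 5 * lam 5) + fromℤ (+ 2) * Q₄)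
  g₂-λ = by (solve 23 (λ g l₁ l₂ l₃ l₄ l₅ l₆ l₇ d₁ d₂ d₃ d₄ d₅ d₆ d₇ de e₃ e₅ ef F₁ F₃ F₅ Ff → :c (+ 12) :* g := :- (:c (+ 12) :* (l₅ :* l₅) :+ :c (+ 2) :* q₄ l₁ l₂ l₄ l₇) :+ (:c (+ 1) :* (:c (+ 12) :* g :- (:- (F₁ :- :c (+ 3) :* F₃ :+ :c (+ 5) :* F₅ :- :c (+ 15) :* Ff))) :+ (:c (+ 4) :* log-relation d₅ d₅ l₅ (:- l₅) de :+ (:c (+ 2) :* log-relation d₁ d₂ l₁ l₂ de :+ (:c (+ 2) :* log-relation d₂ d₄ l₂ l₄ de :+ (:c (+ 2) :* log-relation d₄ d₇ l₄ (:- l₇) de :+ (:c (+ 2) :* log-relation d₇ d₁ l₇ (:- l₁) de :+ (:c (-[1+ 47 ]) :* (d₅ :- e₃) :+ (:c (-[1+ 23 ]) :* (d₁ :+ d₂ :+ d₄ :+ d₇ :+ (e₃ :+ e₅) :- (ef :+ :c (+ 5) :* de)) :+ (:c (+ 1) :* (:c (+ 24) :* de :- (F₁ :- :1)) :+ (:c (-[1+ 0 ]) :* (:c (+ 24) :* e₃ :- :c (+ 3) :* (F₃ :- :1)) :+ (:c (+ 1) :* (:c (+ 24) :* e₅ :- :c (+ 5) :* (F₅ :- :1)) :+ (:c (-[1+ 0 ]) :* (:c (+ 24) :* ef :- :c (+ 15) :* (Ff :- :1)))))))))))))))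
    g₂ (lam 1) (lam 2) (lam 3) (lam 4) (lam 5) (lam 6) (lam 7) (d 1) (d 2) (d 3) (d 4) (d 5) (d 6) (d 7) de dE₃ dE₅ dE₁₅ F₁ F₃ F₅ F₁₅) (times _ g₂-def ⊕ times _ log₅ ⊕ times _ log₁ ⊕ times _ log₂ ⊕ times _ log₄ ⊕ times _ log₇ ⊕ times _ a₁ ⊕ times _ a₃ ⊕ times _ k₁ ⊕ times _ k₃ ⊕ times _ k₅ ⊕ times _ k₁₅)

  -- Coordinates on the curve: 15 gᵢ = ε² Gᵢ, 15 f = σ ε F and 225 h = ε⁴ H. The polynomial `G`
  -- comes from Ramanujan's expression for q, so the explicit powers of q in f, g₃ and h appear as
  -- powers of `G`.
  G₁ G₂ G₄ G F G₃ H : Expr 3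
  G₁ = :- :c (+ 2) :* x̂⁻ :^ 4 :- :c (+ 5) :* x̂⁻ :^ 3 :- :c (+ 8) :* x̂⁻ :^ 2 :+ :c (+ 2) :* x̂⁻ :^ 2 :* ŷ :- :c (+ 5) :* x̂⁻ :+ :c (+ 5) :* x̂⁻ :* ŷ :- :c (+ 9) :- :c (+ 12) :* ŷ :- :c (+ 10) :* x̂ :+ :c (+ 16) :* x̂ :* ŷ :- :c (+ 37) :* x̂ :^ 2 :+ :c (+ 16) :* x̂ :^ 2 :* ŷ :- :c (+ 24) :* x̂ :^ 3 :+ :c (+ 6) :* x̂ :^ 3 :* ŷ :- :c (+ 11) :* x̂ :^ 4 :+ :c (+ 5) :* x̂ :^ 4 :* ŷ :- :c (+ 7) :* x̂ :^ 5 :+ :c (+ 2) :* x̂ :^ 5 :* ŷ :- :c (+ 2) :* x̂ :^ 6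
  G₂ = :- x̂⁻ :^ 4 :- :c (+ 2) :* x̂⁻ :^ 3 :- :c (+ 4) :* x̂⁻ :^ 2 :- :c (+ 12) :* x̂⁻ :+ :c (+ 2) :* x̂⁻ :* ŷ :- :c (+ 16) :+ :c (+ 14) :* ŷ :- :c (+ 18) :* x̂ :- :c (+ 3) :* x̂ :^ 2 :- :c (+ 6) :* x̂ :^ 3 :+ :c (+ 5) :* x̂ :^ 3 :* ŷ :- :c (+ 8) :* x̂ :^ 4 :+ :c (+ 3) :* x̂ :^ 4 :* ŷ :- :c (+ 4) :* x̂ :^ 5 :+ x̂ :^ 5 :* ŷ :- x̂ :^ 6
  G₄ = x̂⁻ :^ 4 :+ :c (+ 7) :* x̂⁻ :^ 3 :+ :c (+ 4) :* x̂⁻ :^ 2 :- :c (+ 10) :* x̂⁻ :^ 2 :* ŷ :+ :c (+ 7) :* x̂⁻ :- :c (+ 7) :* x̂⁻ :* ŷ :- :c (+ 9) :+ :c (+ 6) :* ŷ :- :c (+ 22) :* x̂ :+ :c (+ 10) :* x̂ :* ŷ :- :c (+ 22) :* x̂ :^ 2 :+ :c (+ 10) :* x̂ :^ 2 :* ŷ :- :c (+ 24) :* x̂ :^ 3 :+ :c (+ 15) :* x̂ :^ 3 :* ŷ :- :c (+ 17) :* x̂ :^ 4 :+ :c (+ 2) :* x̂ :^ 4 :* ŷ :- x̂ :^ 5 :- x̂ :^ 5 :* ŷ :+ x̂ :^ 6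
  G  = x̂⁻ :^ 3 :+ :c (+ 4) :* x̂⁻ :^ 2 :- x̂⁻ :^ 2 :* ŷ :+ x̂⁻ :- :c (+ 3) :* x̂⁻ :* ŷ :- :c (+ 2) :+ :c (+ 2) :* ŷ :+ x̂ :* ŷ
  F  = G :* (uexpr -[1+ 0 ] -[1+ 0 ] (+ 2) 0 0 0)
  G₃ = G :* (uexpr -[1+ 1 ] -[1+ 2 ] (+ 3) 1 1 1)
  H  = :c (+ 9) :* G :* (:- (uexpr -[1+ 2 ] -[1+ 5 ] (+ 5) 1 1 3)) :+ G :^ 3 :* (uexpr -[1+ 4 ] -[1+ 5 ] (+ 7) 3 3 1)

  λ-values : Pointwise _≈_ (fromℤ (+ 15) * lam 1 ∷ fromℤ (+ 15) * lam 2 ∷ fromℤ (+ 15) * lam 3 ∷ fromℤ (+ 15) * lam 4 ∷ fromℤ (+ 15) * lam 5 ∷ fromℤ (+ 15) * lam 6 ∷ fromℤ (+ 15) * lam 7 ∷  []) (- (ε * ⟪ L₁ ⟫) ∷ - (ε * ⟪ L₂ ⟫) ∷ - (ε * ⟪ L₃ ⟫) ∷ - (ε * ⟪ L₄ ⟫) ∷ - (ε * ⟪ L₅ ⟫) ∷ - (ε * ⟪ L₆ ⟫) ∷ - (ε * ⟪ L₇ ⟫) ∷  [])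
  λ-values = λ₁ ∷ λ₂ ∷ λ₃ ∷ λ₄ ∷ λ₅ ∷ λ₆ ∷ λ₇ ∷ []

  g₄-ε : fromℤ (+ 15) * g₄ ≈ ε ^ 2 * ⟪ G₄ ⟫
  -- Here 120 = 8 · 15, and the factor 225 = 15² turns a product of two λ's into a product of two
  -- values 15 λ = - ε L.
  g₄-ε = cancel 119 (trans (solve 1 (λ g → :c (+ 120) :* (:c (+ 15) :* g) := :c (+ 225) :* (:c (+ 8) :* g)) g₄)
    (trans (*-congˡ g₄-λ) (trans (solve 7 (λ l₁ l₂ l₃ l₄ l₅ l₆ l₇ → :c (+ 225) :* (:- (:c (+ 2) :* q₄ l₁ l₂ l₄ l₇)) := :- (:c (+ 2) :* q₄ (:c (+ 15) :* l₁) (:c (+ 15) :* l₂) (:c (+ 15) :* l₄) (:c (+ 15) :* l₇))) (lam 1) (lam 2) (lam 3) (lam 4) (lam 5) (lam 6) (lam 7))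
    (trans (-‿cong (⟦⟧-cong (:c (+ 2) :* q₄ (:v (# 0)) (:v (# 1)) (:v (# 3)) (:v (# 6))) λ-values)) (trans
      (solve 8 (λ ε l₁ l₂ l₃ l₄ l₅ l₆ l₇ → :- (:c (+ 2) :* q₄ (:- (ε :* l₁)) (:- (ε :* l₂)) (:- (ε :* l₄)) (:- (ε :* l₇))) := ε :^ 2 :* (:- (:c (+ 2) :* q₄ l₁ l₂ l₄ l₇))) ε ⟪ L₁ ⟫ ⟪ L₂ ⟫ ⟪ L₃ ⟫ ⟪ L₄ ⟫ ⟪ L₅ ⟫ ⟪ L₆ ⟫ ⟪ L₇ ⟫)
      (trans (*-congˡ (on-curve (:- (:c (+ 2) :* q₄ L₁ L₂ L₄ L₇)) (:c (+ 120) :* G₄) ≡.refl)) (solve 2 (λ ε g → ε :^ 2 :* (:c (+ 120) :* g) := :c (+ 120) :* (ε :^ 2 :* g)) ε ⟪ G₄ ⟫)))))))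

  g₁-ε : fromℤ (+ 15) * g₁ ≈ ε ^ 2 * ⟪ G₁ ⟫
  g₁-ε = cancel 119 (trans (solve 1 (λ g → :c (+ 120) :* (:c (+ 15) :* g) := :c (+ 225) :* (:c (+ 8) :* g)) g₁)
    (trans (*-congˡ g₁-λ) (trans (solve 7 (λ l₁ l₂ l₃ l₄ l₅ l₆ l₇ → :c (+ 225) :* (:- (:c (+ 4) :* (l₃ :* l₃ :+ l₆ :* l₆) :+ :c (+ 2) :* q₄ l₁ l₂ l₄ l₇)) := :- (:c (+ 4) :* ((:c (+ 15) :* l₃) :* (:c (+ 15) :* l₃) :+ (:c (+ 15) :* l₆) :* (:c (+ 15) :* l₆)) :+ :c (+ 2) :* q₄ (:c (+ 15) :* l₁) (:c (+ 15) :* l₂) (:c (+ 15) :* l₄) (:c (+ 15) :* l₇))) (lam 1) (lam 2) (lam 3) (lam 4) (lam 5) (lam 6) (lam 7))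
    (trans (-‿cong (⟦⟧-cong (:c (+ 4) :* ((:v (# 2)) :* (:v (# 2)) :+ (:v (# 5)) :* (:v (# 5))) :+ :c (+ 2) :* q₄ (:v (# 0)) (:v (# 1)) (:v (# 3)) (:v (# 6))) λ-values)) (trans
      (solve 8 (λ ε l₁ l₂ l₃ l₄ l₅ l₆ l₇ → :- (:c (+ 4) :* ((:- (ε :* l₃)) :* (:- (ε :* l₃)) :+ (:- (ε :* l₆)) :* (:- (ε :* l₆))) :+ :c (+ 2) :* q₄ (:- (ε :* l₁)) (:- (ε :* l₂)) (:- (ε :* l₄)) (:- (ε :* l₇))) := ε :^ 2 :* (:- (:c (+ 4) :* (l₃ :* l₃ :+ l₆ :* l₆) :+ :c (+ 2) :* q₄ l₁ l₂ l₄ l₇))) ε ⟪ L₁ ⟫ ⟪ L₂ ⟫ ⟪ L₃ ⟫ ⟪ L₄ ⟫ ⟪ L₅ ⟫ ⟪ L₆ ⟫ ⟪ L₇ ⟫)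
      (trans (*-congˡ (on-curve (:- (:c (+ 4) :* (L₃ :* L₃ :+ L₆ :* L₆) :+ :c (+ 2) :* q₄ L₁ L₂ L₄ L₇)) (:c (+ 120) :* G₁) ≡.refl)) (solve 2 (λ ε g → ε :^ 2 :* (:c (+ 120) :* g) := :c (+ 120) :* (ε :^ 2 :* g)) ε ⟪ G₁ ⟫)))))))

  g₂-ε : fromℤ (+ 15) * g₂ ≈ ε ^ 2 * ⟪ G₂ ⟫
  g₂-ε = cancel 179 (trans (solve 1 (λ g → :c (+ 180) :* (:c (+ 15) :* g) := :c (+ 225) :* (:c (+ 12) :* g)) g₂)
    (trans (*-congˡ g₂-λ) (trans (solve 7 (λ l₁ l₂ l₃ l₄ l₅ l₆ l₇ → :c (+ 225) :* (:- (:c (+ 12) :* (l₅ :* l₅) :+ :c (+ 2) :* q₄ l₁ l₂ l₄ l₇)) := :- (:c (+ 12) :* ((:c (+ 15) :* l₅) :* (:c (+ 15) :* l₅)) :+ :c (+ 2) :* q₄ (:c (+ 15) :* l₁) (:c (+ 15) :* l₂) (:c (+ 15) :* l₄) (:c (+ 15) :* l₇))) (lam 1) (lam 2) (lam 3) (lam 4) (lam 5) (lam 6) (lam 7))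
    (trans (-‿cong (⟦⟧-cong (:c (+ 12) :* ((:v (# 4)) :* (:v (# 4))) :+ :c (+ 2) :* q₄ (:v (# 0)) (:v (# 1)) (:v (# 3)) (:v (# 6))) λ-values)) (trans
      (solve 8 (λ ε l₁ l₂ l₃ l₄ l₅ l₆ l₇ → :- (:c (+ 12) :* ((:- (ε :* l₅)) :* (:- (ε :* l₅))) :+ :c (+ 2) :* q₄ (:- (ε :* l₁)) (:- (ε :* l₂)) (:- (ε :* l₄)) (:- (ε :* l₇))) := ε :^ 2 :* (:- (:c (+ 12) :* (l₅ :* l₅) :+ :c (+ 2) :* q₄ l₁ l₂ l₄ l₇))) ε ⟪ L₁ ⟫ ⟪ L₂ ⟫ ⟪ L₃ ⟫ ⟪ L₄ ⟫ ⟪ L₅ ⟫ ⟪ L₆ ⟫ ⟪ L₇ ⟫)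
      (trans (*-congˡ (on-curve (:- (:c (+ 12) :* (L₅ :* L₅) :+ :c (+ 2) :* q₄ L₁ L₂ L₄ L₇)) (:c (+ 180) :* G₂) ≡.refl)) (solve 2 (λ ε g → ε :^ 2 :* (:c (+ 180) :* g) := :c (+ 180) :* (ε :^ 2 :* g)) ε ⟪ G₂ ⟫)))))))

-- All forms as functions on the curve, and the identity between them.

module Conclusion (S : CommutativeRing 0ℓ 0ℓ) (T : ThetaSystem S) (U : ProductSystem S T) where
  open CommutativeRing S hiding (zero)
  open Parametrisation S T
  open ProductSystem U
  open Identity S T U
  open Solver S
  open Monomials S
  open Curve S X X⁻¹ Y XX⁻¹ curve using (⟪_⟫; on-curve)

  M-pow : ∀ u n → M u ^ n ≈ M (+ n ⊗ u)
  M-pow u n = power-mono units u (+ n)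

  e-M-divide : ∀ {x y} n u z w → z ⊹ u ≡ w → x * (e ^ n * M u) ≈ y * (e ^ n * M w) → x ≈ y * M z
  e-M-divide {x} {y} n u z w p h = M-divide u w z p (divide (unit-^ n e-inverse) (trans (regroup x (M u)) (trans h (sym (regroup y (M w))))))
    where
    regroup : ∀ x m → x * m * e ^ n ≈ x * (e ^ n * m)
    regroup x m = solve 3 (λ x m k → x :* m :* k := x :* (k :* m)) x m (e ^ n)

  -- Multiplication by a common monomial leaves natural exponents of 1 + X, Y - 1 and `t̂` in all
  -- three terms of `R`. On the curve the result is divisible by the cube of `t̂`, with quotient
  -- `G`.
  R-G : R ≈ ⟪ G ⟫ * M (v⃗ 0 0 6 0 0 3 0 ⊘ v⃗ 1 2 0 1 2 0 3)
  R-G = M-divide (v⃗ 0 2 0 0 2 3 0 ⊘ v⃗ 2 0 3 2 0 0 0) (v⃗ 0 0 3 0 0 6 0 ⊘ v⃗ 3 0 0 3 0 0 3) (v⃗ 0 0 6 0 0 3 0 ⊘ v⃗ 1 2 0 1 2 0 3) ≡.refl (trans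
    (solve 4 (λ a b k m → (a :+ k :- b) :* m := a :* m :+ k :* m :- b :* m) (M t⁺) (M t⁻) (fromℤ (+ 11)) (M (v⃗ 0 2 0 0 2 3 0 ⊘ v⃗ 2 0 3 2 0 0 0)))
    (trans (+-cong (+-cong (trans (M-* t⁺ (v⃗ 0 2 0 0 2 3 0 ⊘ v⃗ 2 0 3 2 0 0 0) ≡.refl) (at-0 (M-expr (+ 2) (+ 4) -[1+ 5 ] 2 0 0 (v⃗ 0 0 0 0 0 0 0) (v⃗ 0 2 0 0 2 8 0 ⊘ v⃗ 2 0 8 2 0 0 0) ≡.refl))) (*-congˡ (at-0 (M-expr (+ 1) (+ 2) -[1+ 2 ] 1 1 0 (v⃗ 0 0 0 0 0 0 0) (v⃗ 0 2 0 0 2 3 0 ⊘ v⃗ 2 0 3 2 0 0 0) ≡.refl)))) (-‿cong (trans (M-* t⁻ (v⃗ 0 2 0 0 2 3 0 ⊘ v⃗ 2 0 3 2 0 0 0) ≡.refl) (at-0 (M-expr (+ 0) (+ 0) (+ 0) 0 2 0 (v⃗ 0 0 0 0 0 0 0) (v⃗ 0 2 2 0 2 0 0 ⊘ v⃗ 2 0 0 2 0 2 0) ≡.refl)))))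
    (trans (on-curve (uexpr (+ 2) (+ 4) -[1+ 5 ] 2 0 0 :+ :c (+ 11) :* uexpr (+ 1) (+ 2) -[1+ 2 ] 1 1 0 :- uexpr (+ 0) (+ 0) (+ 0) 0 2 0) (G :* (uexpr (+ 0) (+ 0) (+ 0) 0 0 3)) ≡.refl) (*-congˡ (sym (at-0 (M-expr (+ 0) (+ 0) (+ 0) 0 0 3 (v⃗ 0 0 0 0 0 0 0) (v⃗ 0 0 3 0 0 6 0 ⊘ v⃗ 3 0 0 3 0 0 3) ≡.refl)))))))
    where
    at-0 : ∀ {x y} → x ≈ y * M (v⃗ 0 0 0 0 0 0 0) → x ≈ y
    at-0 p = trans p (trans (*-congˡ M-0) (*-identityʳ _))

  q⃗ : Vec ℤ 7
  q⃗ = (v⃗ 0 0 0 0 0 0 0 ⊘ v⃗ 1 2 0 1 2 3 3)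

  q-G : q ≈ - (e ^ 12 * (⟪ G ⟫ * M q⃗))
  q-G = trans (solve 1 (λ q → q := :- (:- q)) q) (-‿cong (trans (sym rr-q) (trans (*-congˡ R-G)
    (trans (solve 4 (λ e m g r → e :* m :* (g :* r) := e :* (g :* (m :* r))) (e ^ 12) (M (v⃗ 0 0 0 0 0 0 0 ⊘ v⃗ 0 0 6 0 0 6 0)) ⟪ G ⟫ (M (v⃗ 0 0 6 0 0 3 0 ⊘ v⃗ 1 2 0 1 2 0 3)))
      (*-congˡ (*-congˡ (M-* (v⃗ 0 0 0 0 0 0 0 ⊘ v⃗ 0 0 6 0 0 6 0) (v⃗ 0 0 6 0 0 3 0 ⊘ v⃗ 1 2 0 1 2 0 3) ≡.refl)))))))

  1⃗ 356⃗ 36⃗ 5⃗ : Vec ℤ 7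
  1⃗ = (v⃗ 1 1 1 1 1 1 1)
  356⃗ = (v⃗ 0 0 1 0 1 1 0)
  36⃗ = (v⃗ 0 0 1 0 0 1 0)
  5⃗ = (v⃗ 0 0 0 0 1 0 0)

  M-Π : M 1⃗ ≈ σ * (E₁₅ * e ^ 6)
  M-Π = trans (solve 7 (λ a₁ a₂ a₃ a₄ a₅ a₆ a₇ → (mon a₁ a₂ a₃ a₄ a₅ a₆ a₇ 1 1 1 1 1 1 1) := a₁ :* a₂ :* a₄ :* a₇ :* (a₃ :* a₅ :* a₆)) (P 1) (P 2) (P 3) (P 4) (P 5) (P 6) (P 7)) Π-σ

  M-356 : M 356⃗ ≈ σ * (e * (E₃ * E₅))
  M-356 = trans (solve 7 (λ a₁ a₂ a₃ a₄ a₅ a₆ a₇ → (mon a₁ a₂ a₃ a₄ a₅ a₆ a₇ 0 0 1 0 1 1 0) := a₃ :* a₅ :* a₆) (P 1) (P 2) (P 3) (P 4) (P 5) (P 6) (P 7)) P₃₅₆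

  M-36 : M 36⃗ ≈ s₅ * (e * E₅)
  M-36 = trans (solve 7 (λ a₁ a₂ a₃ a₄ a₅ a₆ a₇ → (mon a₁ a₂ a₃ a₄ a₅ a₆ a₇ 0 0 1 0 0 1 0) := a₃ :* a₆) (P 1) (P 2) (P 3) (P 4) (P 5) (P 6) (P 7)) P₃₆

  M-5 : M 5⃗ ≈ s₃ * E₃
  M-5 = trans (solve 7 (λ a₁ a₂ a₃ a₄ a₅ a₆ a₇ → (mon a₁ a₂ a₃ a₄ a₅ a₆ a₇ 0 0 0 0 1 0 0) := a₅) (P 1) (P 2) (P 3) (P 4) (P 5) (P 6) (P 7)) P₅

  -- The Euler products are grouped so that they appear only through the theta monomials `M 356⃗`
  -- and `M 1⃗`. Each of these brings a factor σ, and the 15 is - σ²; the same happens for g₃.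
  f-ε : fromℤ (+ 15) * f ≈ σ * (ε * ⟪ F ⟫)
  f-ε = trans (e-M-divide 12 356⃗ (v⃗ 1 0 1 1 0 0 0 ⊘ v⃗ 0 0 0 0 1 2 1) (v⃗ 1 0 2 1 0 0 0 ⊘ v⃗ 0 0 0 0 0 1 1) ≡.refl
    (by (solve 13 (λ f σ e g mp mq m1 m1² mz q E₃ E₅ E₁₅ → :c (+ 15) :* f :* (e :^ 12 :* mp) := σ :* (e :^ 3 :* g) :* (e :^ 12 :* mz)
        :+ ((:c (+ 15) :* f :* e :^ 12) :* (mp :- σ :* (e :* (E₃ :* E₅)))
        :+ ((:c (+ 15) :* e :^ 13 :* σ) :* (f :* (E₃ :* E₅) :- q :* (e :^ 2 :* E₁₅ :^ 2))
        :+ ((:c (+ 15) :* e :^ 15 :* σ :* E₁₅ :^ 2) :* (q :- (:- (e :^ 12 :* (g :* mq))))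
        :+ ((:- (σ :* e :^ 15 :* g)) :* (mz :- mq :* m1²)
        :+ ((:- (σ :* e :^ 15 :* g :* mq)) :* (m1² :- m1 :^ 2)
        :+ ((:- (σ :* e :^ 15 :* g :* mq :* (m1 :+ σ :* (E₁₅ :* e :^ 6)))) :* (m1 :- σ :* (E₁₅ :* e :^ 6))
        :+ ((:- (σ :* e :^ 15 :* g :* mq :* (E₁₅ :* e :^ 6) :^ 2)) :* (σ :^ 2 :- :c -[1+ 14 ])))))))))
      f σ e ⟪ G ⟫ (M 356⃗) (M q⃗) (M 1⃗) (M (+ 2 ⊗ 1⃗)) (M (v⃗ 1 0 2 1 0 0 0 ⊘ v⃗ 0 0 0 0 0 1 1)) q E₃ E₅ E₁₅)
      (times _ M-356 ⊕ times _ f-def ⊕ times _ q-G ⊕ times _ (sym (M-* q⃗ (+ 2 ⊗ 1⃗) ≡.refl)) ⊕ times _ (sym (M-pow 1⃗ 2)) ⊕ times _ M-Π ⊕ times _ σ²)))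
    (trans (*-congˡ (M-expr -[1+ 0 ] -[1+ 0 ] (+ 2) 0 0 0 (v⃗ 0 1 0 0 0 0 0 ⊘ v⃗ 0 0 1 0 1 0 0) (v⃗ 1 0 1 1 0 0 0 ⊘ v⃗ 0 0 0 0 1 2 1) ≡.refl)) (solve 5 (λ σ e g k m → σ :* (e :* g) :* (k :* m) := σ :* (e :* m :* (g :* k))) σ (e ^ 3) ⟪ G ⟫ ⟪ uexpr -[1+ 0 ] -[1+ 0 ] (+ 2) 0 0 0 ⟫ (M ref)))

  g₃-ε : fromℤ (+ 15) * g₃ ≈ ε ^ 2 * ⟪ G₃ ⟫
  g₃-ε = trans (e-M-divide 6 (v⃗ 0 0 0 0 0 0 0) (v⃗ 0 0 2 0 0 0 0 ⊘ v⃗ 0 1 0 0 0 1 2) (v⃗ 0 0 2 0 0 0 0 ⊘ v⃗ 0 1 0 0 0 1 2) ≡.refl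
    (by (solve 14 (λ g₃ σ e g mp mq m1 mpq mz m0 q E₃ E₅ E₁₅ → :c (+ 15) :* g₃ :* (e :^ 6 :* m0) := e :^ 6 :* g :* (e :^ 6 :* mz)
        :+ ((:c (+ 15) :* g₃ :* e :^ 6) :* (m0 :- :1)
        :+ ((:c (+ 15) :* e :^ 6) :* (g₃ :- q :* (e :* E₃ :* E₅ :* E₁₅))
        :+ ((q :* E₁₅ :* e :^ 7 :* E₃ :* E₅) :* (σ :^ 2 :- :c -[1+ 14 ])
        :+ ((q :* mp) :* (m1 :- σ :* (E₁₅ :* e :^ 6))
        :+ ((q :* σ :* E₁₅ :* e :^ 6) :* (mp :- σ :* (e :* (E₃ :* E₅)))
        :+ ((:- (mp :* m1)) :* (q :- (:- (e :^ 12 :* (g :* mq))))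
        :+ ((:- (e :^ 12 :* g)) :* (mz :- mpq :* m1)
        :+ ((:- (e :^ 12 :* g :* m1)) :* (mpq :- mq :* mp))))))))))
      g₃ σ e ⟪ G ⟫ (M 356⃗) (M q⃗) (M 1⃗) (M (q⃗ ⊹ 356⃗)) (M (v⃗ 0 0 2 0 0 0 0 ⊘ v⃗ 0 1 0 0 0 1 2)) (M (v⃗ 0 0 0 0 0 0 0)) q E₃ E₅ E₁₅)
      (times _ M-0 ⊕ times _ g₃-def ⊕ times _ σ² ⊕ times _ M-Π ⊕ times _ M-356 ⊕ times _ q-G ⊕ times _ (sym (M-* (q⃗ ⊹ 356⃗) 1⃗ ≡.refl)) ⊕ times _ (sym (M-* q⃗ 356⃗ ≡.refl)))))
    (trans (*-congˡ (trans (M-expr -[1+ 1 ] -[1+ 2 ] (+ 3) 1 1 1 (v⃗ 0 2 0 0 0 0 0 ⊘ v⃗ 0 0 2 0 2 0 0) (v⃗ 0 0 2 0 0 0 0 ⊘ v⃗ 0 1 0 0 0 1 2) ≡.refl) (*-congˡ (sym (M-pow ref 2))))) (solve 4 (λ e g k m → e :^ 6 :* g :* (k :* m :^ 2) := (e :^ 3 :* m) :^ 2 :* (g :* k)) e ⟪ G ⟫ ⟪ uexpr -[1+ 1 ] -[1+ 2 ] (+ 3) 1 1 1 ⟫ (M ref)))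

  h-ε : fromℤ (+ 225) * h ≈ ε ^ 4 * ⟪ H ⟫
  h-ε = trans (divide (unit-^ 24 e-inverse) (trans
    (by (solve 8 (λ h s₃ s₅ e q E₃ E₅ E₁₅ → :c (+ 225) :* h :* e :^ 24 := :c (+ 9) :* e :^ 24 :* (q :* (s₅ :* (e :* E₅)) :^ 4) :- q :^ 3 :* ((s₃ :* E₃) :^ 4 :* (s₃ :* s₅ :* (E₁₅ :* e :^ 6)) :^ 4)
        :+ ((:c (+ 225) :* e :^ 24) :* (h :- (q :* (e :^ 4 :* E₅ :^ 4) :- :c (+ 9) :* (q :^ 3 :* (E₃ :^ 4 :* E₁₅ :^ 4)))) :+ ((:- (:c (+ 9) :* q :* e :^ 28 :* E₅ :^ 4)) :* ((s₅ :^ 2) :^ 2 :- (:c (+ 5)) :^ 2) :+ ((q :^ 3 :* E₃ :^ 4 :* E₁₅ :^ 4 :* e :^ 24) :* ((s₃ :^ 2) :^ 4 :* (s₅ :^ 2) :^ 2 :- (:c -[1+ 2 ]) :^ 4 :* (:c (+ 5)) :^ 2))))) h s₃ s₅ e q E₃ E₅ E₁₅)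
      (times _ h-def ⊕ times _ (^-cong 2 s₅²) ⊕ times _ (*-cong (^-cong 4 s₃²) (^-cong 2 s₅²))))
    (trans (+-cong (*-congˡ (*-cong q-G (^-cong 4 (sym M-36)))) (-‿cong (*-cong (^-cong 3 q-G) (*-cong (^-cong 4 (sym M-5)) (^-cong 4 (sym M-Π))))))
    (trans (solve 6 (λ e g mq x y z → :c (+ 9) :* e :^ 24 :* ((:- (e :^ 12 :* (g :* mq))) :* x) :- (:- (e :^ 12 :* (g :* mq))) :^ 3 :* (y :* z) := e :^ 12 :* (:c (+ 9) :* g :* (:- (mq :* x)) :+ g :^ 3 :* (mq :^ 3 :* (y :* z))) :* e :^ 24)
        e ⟪ G ⟫ (M q⃗) (M 36⃗ ^ 4) (M 5⃗ ^ 4) (M 1⃗ ^ 4))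
      (*-congʳ (*-congˡ (+-cong (*-congˡ (-‿cong (trans (*-congˡ (M-pow 36⃗ 4)) (M-* q⃗ (+ 4 ⊗ 36⃗) ≡.refl))))
        (*-congˡ (trans (*-cong (M-pow q⃗ 3) (trans (*-cong (M-pow 5⃗ 4) (M-pow 1⃗ 4)) (M-* (+ 4 ⊗ 5⃗) (+ 4 ⊗ 1⃗) ≡.refl))) (M-* (+ 3 ⊗ q⃗) (+ 4 ⊗ 5⃗ ⊹ + 4 ⊗ 1⃗) ≡.refl))))))))))
    (trans (*-congˡ (+-cong (*-congˡ (-‿cong (to-ref (M-expr -[1+ 2 ] -[1+ 5 ] (+ 5) 1 1 3 (v⃗ 0 4 0 0 0 0 0 ⊘ v⃗ 0 0 4 0 4 0 0) (v⃗ 0 0 4 0 0 1 0 ⊘ v⃗ 1 2 0 1 2 0 3) ≡.refl)))) (*-congˡ (to-ref (M-expr -[1+ 4 ] -[1+ 5 ] (+ 7) 3 3 1 (v⃗ 0 4 0 0 0 0 0 ⊘ v⃗ 0 0 4 0 4 0 0) (v⃗ 1 0 4 1 2 0 0 ⊘ v⃗ 0 2 0 0 0 5 5) ≡.refl)))))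
      (solve 5 (λ e g k l m → e :^ 12 :* (:c (+ 9) :* g :* (:- (k :* m :^ 4)) :+ g :^ 3 :* (l :* m :^ 4)) := (e :^ 3 :* m) :^ 4 :* (:c (+ 9) :* g :* (:- k) :+ g :^ 3 :* l)) e ⟪ G ⟫ ⟪ uexpr -[1+ 2 ] -[1+ 5 ] (+ 5) 1 1 3 ⟫ ⟪ uexpr -[1+ 4 ] -[1+ 5 ] (+ 7) 3 3 1 ⟫ (M ref)))
    where
    to-ref : ∀ {x k} → x ≈ k * M (+ 4 ⊗ ref) → x ≈ k * M ref ^ 4
    to-ref p = trans p (*-congˡ (sym (M-pow ref 4)))

  -- Here 50625 = 15⁴ = σ^8, from the surplus of σ in the fourteenth and seventh powers. In the next
  -- statement 9 and 5 are the fourth power of `s₃` and the square of `s₅`.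
  B₁₃-ε : fromℤ (+ 50625) * B₁₃ ≈ σ * (ε ^ 7 * ⟪ uexpr -[1+ 6 ] -[1+ 13 ] (+ 7) 7 7 7 ⟫)
  B₁₃-ε = trans (M-divide (+ 7 ⊗ 1⃗) (+ 14 ⊗ 356⃗) (v⃗ 0 0 7 0 7 7 0 ⊘ v⃗ 7 7 0 7 0 0 7) ≡.refl (trans (*-congˡ (trans (sym (M-pow 1⃗ 7)) (^-cong 7 M-Π)))
    (trans (by (solve 6 (λ b σ e E₃ E₅ E₁₅ → :c (+ 50625) :* b :* (σ :* (E₁₅ :* e :^ 6)) :^ 7 := σ :* e :^ 21 :* (σ :* (e :* (E₃ :* E₅))) :^ 14
        :+ ((:c (+ 50625) :* σ :^ 7 :* e :^ 35) :* (b :* (e :^ 7 :* E₁₅ :^ 7) :- E₃ :^ 14 :* E₅ :^ 14) :+ ((:- (σ :^ 7 :* e :^ 35 :* E₃ :^ 14 :* E₅ :^ 14)) :* ((σ :^ 2) :^ 4 :- (:c -[1+ 14 ]) :^ 4)))) B₁₃ σ e E₃ E₅ E₁₅)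
      (times _ B₁₃-def ⊕ times _ (^-cong 4 σ²)))
    (*-congˡ (trans (^-cong 14 (sym M-356)) (M-pow 356⃗ 14))))))
    (trans (*-congˡ (trans (M-expr -[1+ 6 ] -[1+ 13 ] (+ 7) 7 7 7 (v⃗ 0 7 0 0 0 0 0 ⊘ v⃗ 0 0 7 0 7 0 0) (v⃗ 0 0 7 0 7 7 0 ⊘ v⃗ 7 7 0 7 0 0 7) ≡.refl) (*-congˡ (sym (M-pow ref 7))))) (solve 4 (λ σ e k m → σ :* e :^ 21 :* (k :* m :^ 7) := σ :* ((e :^ 3 :* m) :^ 7 :* k)) σ e ⟪ uexpr -[1+ 6 ] -[1+ 13 ] (+ 7) 7 7 7 ⟫ (M ref)))

  B₁₄-ε : fromℤ (+ 5) * B₁₄ ≈ fromℤ (+ 9) * (σ * (ε ^ 7 * ⟪ uexpr -[1+ 2 ] -[1+ 7 ] (+ 5) 1 1 3 ⟫))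
  B₁₄-ε = trans (M-divide (+ 4 ⊗ 5⃗ ⊹ 1⃗) (+ 2 ⊗ 36⃗) (v⃗ 0 0 1 0 0 1 0 ⊘ v⃗ 1 1 0 1 5 0 1) ≡.refl (trans (*-congˡ (trans (sym (M-* (+ 4 ⊗ 5⃗) 1⃗ ≡.refl)) (*-cong (trans (sym (M-pow 5⃗ 4)) (^-cong 4 M-5)) M-Π)))
    (trans (by (solve 8 (λ b σ e E₃ E₅ E₁₅ s₃ s₅ → :c (+ 5) :* b :* ((s₃ :* E₃) :^ 4 :* (σ :* (E₁₅ :* e :^ 6))) := :c (+ 9) :* σ :* e :^ 21 :* (s₅ :* (e :* E₅)) :^ 2
        :+ ((:c (+ 45) :* σ :* e :^ 6) :* (b :* (E₃ :^ 4 :* E₁₅) :- e :^ 17 :* E₅ :^ 2) :+ ((:c (+ 5) :* b :* E₃ :^ 4 :* σ :* E₁₅ :* e :^ 6) :* ((s₃ :^ 2) :^ 2 :- (:c -[1+ 2 ]) :^ 2) :+ ((:- (:c (+ 9) :* σ :* e :^ 23 :* E₅ :^ 2)) :* (s₅ :^ 2 :- :c (+ 5)))))) B₁₄ σ e E₃ E₅ E₁₅ s₃ s₅)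
      (times _ B₁₄-def ⊕ times _ (^-cong 2 s₃²) ⊕ times _ s₅²))
    (*-congˡ (trans (^-cong 2 (sym M-36)) (M-pow 36⃗ 2))))))
    (trans (*-congˡ (trans (M-expr -[1+ 2 ] -[1+ 7 ] (+ 5) 1 1 3 (v⃗ 0 7 0 0 0 0 0 ⊘ v⃗ 0 0 7 0 7 0 0) (v⃗ 0 0 1 0 0 1 0 ⊘ v⃗ 1 1 0 1 5 0 1) ≡.refl) (*-congˡ (sym (M-pow ref 7))))) (solve 4 (λ σ e k m → :c (+ 9) :* σ :* e :^ 21 :* (k :* m :^ 7) := :c (+ 9) :* (σ :* ((e :^ 3 :* m) :^ 7 :* k))) σ e ⟪ uexpr -[1+ 2 ] -[1+ 7 ] (+ 5) 1 1 3 ⟫ (M ref)))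

  -- Since p^14 p′ = λ p^15, each summand of the root average is 15 λ = - ε L times a fifteenth
  -- power. The latter has degree 15 = 21 - 6 and becomes a function on the curve after division by
  -- the cube of the product of all seven values and by the sixth power of `ref`.
  Σ₁₅ : Expr 3
  Σ₁₅ = uexpr (+ 3) -[1+ 5 ] (+ 6) 3 0 0 :* L₁ :+ uexpr (+ 0) (+ 3) (+ 0) 0 3 0 :* L₂ :+ uexpr -[1+ 4 ] -[1+ 11 ] (+ 10) 0 3 5 :* L₃ :+ uexpr -[1+ 11 ] -[1+ 5 ] (+ 6) 3 0 0 :* L₄ :+ uexpr -[1+ 5 ] -[1+ 8 ] (+ 3) 9 9 0 :* L₅ :+ uexpr -[1+ 1 ] -[1+ 5 ] (+ 1) 3 0 5 :* L₆ :+ uexpr (+ 0) -[1+ 11 ] (+ 0) 0 3 0 :* L₇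

  power-λ : ∀ a {k L} → fromℤ (+ 15) * lam (suc a) ≈ - (ε * L) → P (suc a) ^ 15 ≈ k * M (+ 6 ⊗ ref) * M (+ 3 ⊗ 1⃗) → P′ (suc a) ≈ lam (suc a) * P (suc a) →
    fromℤ (+ 15) * (P (suc a) ^ 14 * P′ (suc a)) ≈ - (ε * M (+ 6 ⊗ ref) * (k * L)) * M (+ 3 ⊗ 1⃗)
  power-λ a {k} {L} p q r = by (solve 8 (λ ε l L p p′ k m n → :c (+ 15) :* (p :^ 14 :* p′) := :- (ε :* m :* (k :* L)) :* n
      :+ ((:c (+ 15) :* p :^ 14) :* (p′ :- l :* p) :+ ((p :^ 15) :* ((:c (+ 15) :* l) :- (:- (ε :* L))) :+ ((:- (ε :* L)) :* (p :^ 15 :- k :* m :* n))))) ε (lam (suc a)) L (P (suc a)) (P′ (suc a)) k (M (+ 6 ⊗ ref)) (M (+ 3 ⊗ 1⃗)))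
    (times _ r ⊕ times _ p ⊕ times _ q)

  P₁¹⁵ : P 1 ^ 15 ≈ ⟪ uexpr (+ 3) -[1+ 5 ] (+ 6) 3 0 0 ⟫ * M (+ 6 ⊗ ref) * M (+ 3 ⊗ 1⃗)
  P₁¹⁵ = trans (solve 7 (λ a₁ a₂ a₃ a₄ a₅ a₆ a₇ → a₁ :^ 15 := (mon a₁ a₂ a₃ a₄ a₅ a₆ a₇ 15 0 0 0 0 0 0)) (P 1) (P 2) (P 3) (P 4) (P 5) (P 6) (P 7)) (trans (sym (M-* (v⃗ 12 0 0 0 0 0 0 ⊘ v⃗ 0 3 3 3 3 3 3) (+ 3 ⊗ 1⃗) ≡.refl)) (*-congʳ (M-expr (+ 3) -[1+ 5 ] (+ 6) 3 0 0 (v⃗ 0 6 0 0 0 0 0 ⊘ v⃗ 0 0 6 0 6 0 0) (v⃗ 12 0 0 0 0 0 0 ⊘ v⃗ 0 3 3 3 3 3 3) ≡.refl)))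

  P₂¹⁵ : P 2 ^ 15 ≈ ⟪ uexpr (+ 0) (+ 3) (+ 0) 0 3 0 ⟫ * M (+ 6 ⊗ ref) * M (+ 3 ⊗ 1⃗)
  P₂¹⁵ = trans (solve 7 (λ a₁ a₂ a₃ a₄ a₅ a₆ a₇ → a₂ :^ 15 := (mon a₁ a₂ a₃ a₄ a₅ a₆ a₇ 0 15 0 0 0 0 0)) (P 1) (P 2) (P 3) (P 4) (P 5) (P 6) (P 7)) (trans (sym (M-* (v⃗ 0 12 0 0 0 0 0 ⊘ v⃗ 3 0 3 3 3 3 3) (+ 3 ⊗ 1⃗) ≡.refl)) (*-congʳ (M-expr (+ 0) (+ 3) (+ 0) 0 3 0 (v⃗ 0 6 0 0 0 0 0 ⊘ v⃗ 0 0 6 0 6 0 0) (v⃗ 0 12 0 0 0 0 0 ⊘ v⃗ 3 0 3 3 3 3 3) ≡.refl)))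

  P₃¹⁵ : P 3 ^ 15 ≈ ⟪ uexpr -[1+ 4 ] -[1+ 11 ] (+ 10) 0 3 5 ⟫ * M (+ 6 ⊗ ref) * M (+ 3 ⊗ 1⃗)
  P₃¹⁵ = trans (solve 7 (λ a₁ a₂ a₃ a₄ a₅ a₆ a₇ → a₃ :^ 15 := (mon a₁ a₂ a₃ a₄ a₅ a₆ a₇ 0 0 15 0 0 0 0)) (P 1) (P 2) (P 3) (P 4) (P 5) (P 6) (P 7)) (trans (sym (M-* (v⃗ 0 0 12 0 0 0 0 ⊘ v⃗ 3 3 0 3 3 3 3) (+ 3 ⊗ 1⃗) ≡.refl)) (*-congʳ (M-expr -[1+ 4 ] -[1+ 11 ] (+ 10) 0 3 5 (v⃗ 0 6 0 0 0 0 0 ⊘ v⃗ 0 0 6 0 6 0 0) (v⃗ 0 0 12 0 0 0 0 ⊘ v⃗ 3 3 0 3 3 3 3) ≡.refl)))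

  P₄¹⁵ : P 4 ^ 15 ≈ ⟪ uexpr -[1+ 11 ] -[1+ 5 ] (+ 6) 3 0 0 ⟫ * M (+ 6 ⊗ ref) * M (+ 3 ⊗ 1⃗)
  P₄¹⁵ = trans (solve 7 (λ a₁ a₂ a₃ a₄ a₅ a₆ a₇ → a₄ :^ 15 := (mon a₁ a₂ a₃ a₄ a₅ a₆ a₇ 0 0 0 15 0 0 0)) (P 1) (P 2) (P 3) (P 4) (P 5) (P 6) (P 7)) (trans (sym (M-* (v⃗ 0 0 0 12 0 0 0 ⊘ v⃗ 3 3 3 0 3 3 3) (+ 3 ⊗ 1⃗) ≡.refl)) (*-congʳ (M-expr -[1+ 11 ] -[1+ 5 ] (+ 6) 3 0 0 (v⃗ 0 6 0 0 0 0 0 ⊘ v⃗ 0 0 6 0 6 0 0) (v⃗ 0 0 0 12 0 0 0 ⊘ v⃗ 3 3 3 0 3 3 3) ≡.refl)))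

  P₅¹⁵ : P 5 ^ 15 ≈ ⟪ uexpr -[1+ 5 ] -[1+ 8 ] (+ 3) 9 9 0 ⟫ * M (+ 6 ⊗ ref) * M (+ 3 ⊗ 1⃗)
  P₅¹⁵ = trans (solve 7 (λ a₁ a₂ a₃ a₄ a₅ a₆ a₇ → a₅ :^ 15 := (mon a₁ a₂ a₃ a₄ a₅ a₆ a₇ 0 0 0 0 15 0 0)) (P 1) (P 2) (P 3) (P 4) (P 5) (P 6) (P 7)) (trans (sym (M-* (v⃗ 0 0 0 0 12 0 0 ⊘ v⃗ 3 3 3 3 0 3 3) (+ 3 ⊗ 1⃗) ≡.refl)) (*-congʳ (M-expr -[1+ 5 ] -[1+ 8 ] (+ 3) 9 9 0 (v⃗ 0 6 0 0 0 0 0 ⊘ v⃗ 0 0 6 0 6 0 0) (v⃗ 0 0 0 0 12 0 0 ⊘ v⃗ 3 3 3 3 0 3 3) ≡.refl)))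

  P₆¹⁵ : P 6 ^ 15 ≈ ⟪ uexpr -[1+ 1 ] -[1+ 5 ] (+ 1) 3 0 5 ⟫ * M (+ 6 ⊗ ref) * M (+ 3 ⊗ 1⃗)
  P₆¹⁵ = trans (solve 7 (λ a₁ a₂ a₃ a₄ a₅ a₆ a₇ → a₆ :^ 15 := (mon a₁ a₂ a₃ a₄ a₅ a₆ a₇ 0 0 0 0 0 15 0)) (P 1) (P 2) (P 3) (P 4) (P 5) (P 6) (P 7)) (trans (sym (M-* (v⃗ 0 0 0 0 0 12 0 ⊘ v⃗ 3 3 3 3 3 0 3) (+ 3 ⊗ 1⃗) ≡.refl)) (*-congʳ (M-expr -[1+ 1 ] -[1+ 5 ] (+ 1) 3 0 5 (v⃗ 0 6 0 0 0 0 0 ⊘ v⃗ 0 0 6 0 6 0 0) (v⃗ 0 0 0 0 0 12 0 ⊘ v⃗ 3 3 3 3 3 0 3) ≡.refl)))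

  P₇¹⁵ : P 7 ^ 15 ≈ ⟪ uexpr (+ 0) -[1+ 11 ] (+ 0) 0 3 0 ⟫ * M (+ 6 ⊗ ref) * M (+ 3 ⊗ 1⃗)
  P₇¹⁵ = trans (solve 7 (λ a₁ a₂ a₃ a₄ a₅ a₆ a₇ → a₇ :^ 15 := (mon a₁ a₂ a₃ a₄ a₅ a₆ a₇ 0 0 0 0 0 0 15)) (P 1) (P 2) (P 3) (P 4) (P 5) (P 6) (P 7)) (trans (sym (M-* (v⃗ 0 0 0 0 0 0 12 ⊘ v⃗ 3 3 3 3 3 3 0) (+ 3 ⊗ 1⃗) ≡.refl)) (*-congʳ (M-expr (+ 0) -[1+ 11 ] (+ 0) 0 3 0 (v⃗ 0 6 0 0 0 0 0 ⊘ v⃗ 0 0 6 0 6 0 0) (v⃗ 0 0 0 0 0 0 12 ⊘ v⃗ 3 3 3 3 3 3 0) ≡.refl)))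

  C₀-ε : fromℤ (+ 15) * C₀ ≈ - (σ * (ε ^ 7 * ⟪ Σ₁₅ ⟫))
  C₀-ε = trans (divide (mono-inverse units (+ 3 ⊗ 1⃗)) (trans (*-congˡ (trans (sym (M-pow 1⃗ 3)) (^-cong 3 M-Π)))
    (trans (by (solve 5 (λ c σ e y s → :c (+ 15) :* c :* (σ :* (y :* e :^ 6)) :^ 3 := σ :* e :^ 18 :* (:c (+ 15) :* s)
        :+ ((σ :^ 3 :* e :^ 18) :* (s :- (:c -[1+ 14 ] :* (y :^ 3 :* c))) :+ ((:- (σ :* e :^ 18 :* s)) :* (σ :^ 2 :- :c -[1+ 14 ])))) C₀ σ e E₁₅ (P 1 ^ 14 * P′ 1 + P 2 ^ 14 * P′ 2 + P 3 ^ 14 * P′ 3 + P 4 ^ 14 * P′ 4 + P 5 ^ 14 * P′ 5 + P 6 ^ 14 * P′ 6 + P 7 ^ 14 * P′ 7)) (times _ C₀-def ⊕ times _ σ²))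
    (trans (*-congˡ (trans (solve 7 (λ t₁ t₂ t₃ t₄ t₅ t₆ t₇ → :c (+ 15) :* (t₁ :+ t₂ :+ t₃ :+ t₄ :+ t₅ :+ t₆ :+ t₇) := :c (+ 15) :* t₁ :+ :c (+ 15) :* t₂ :+ :c (+ 15) :* t₃ :+ :c (+ 15) :* t₄ :+ :c (+ 15) :* t₅ :+ :c (+ 15) :* t₆ :+ :c (+ 15) :* t₇) (P 1 ^ 14 * P′ 1) (P 2 ^ 14 * P′ 2) (P 3 ^ 14 * P′ 3) (P 4 ^ 14 * P′ 4) (P 5 ^ 14 * P′ 5) (P 6 ^ 14 * P′ 6) (P 7 ^ 14 * P′ 7))
      (+-cong (+-cong (+-cong (+-cong (+-cong (+-cong (power-λ 0 λ₁ P₁¹⁵ (P′-lam 0 (below 0))) (power-λ 1 λ₂ P₂¹⁵ (P′-lam 1 (below 1)))) (power-λ 2 λ₃ P₃¹⁵ (P′-lam 2 (below 2)))) (power-λ 3 λ₄ P₄¹⁵ (P′-lam 3 (below 3)))) (power-λ 4 λ₅ P₅¹⁵ (P′-lam 4 (below 4)))) (power-λ 5 λ₆ P₆¹⁵ (P′-lam 5 (below 5)))) (power-λ 6 λ₇ P₇¹⁵ (P′-lam 6 (below 6))))))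
      (solve 12 (λ σ e ε m n x₁ x₂ x₃ x₄ x₅ x₆ x₇ → σ :* e :^ 18 :* ((:- (ε :* m :* x₁)) :* n :+ (:- (ε :* m :* x₂)) :* n :+ (:- (ε :* m :* x₃)) :* n :+ (:- (ε :* m :* x₄)) :* n :+ (:- (ε :* m :* x₅)) :* n :+ (:- (ε :* m :* x₆)) :* n :+ (:- (ε :* m :* x₇)) :* n) := :- (σ :* e :^ 18 :* ε :* m :* (x₁ :+ x₂ :+ x₃ :+ x₄ :+ x₅ :+ x₆ :+ x₇)) :* n) σ e ε (M (+ 6 ⊗ ref)) (M (+ 3 ⊗ 1⃗)) (⟪ uexpr (+ 3) -[1+ 5 ] (+ 6) 3 0 0 ⟫ * ⟪ L₁ ⟫) (⟪ uexpr (+ 0) (+ 3) (+ 0) 0 3 0 ⟫ * ⟪ L₂ ⟫) (⟪ uexpr -[1+ 4 ] -[1+ 11 ] (+ 10) 0 3 5 ⟫ * ⟪ L₃ ⟫) (⟪ uexpr -[1+ 11 ] -[1+ 5 ] (+ 6) 3 0 0 ⟫ * ⟪ L₄ ⟫) (⟪ uexpr -[1+ 5 ] -[1+ 8 ] (+ 3) 9 9 0 ⟫ * ⟪ L₅ ⟫) (⟪ uexpr -[1+ 1 ] -[1+ 5 ] (+ 1) 3 0 5 ⟫ * ⟪ L₆ ⟫) (⟪ uexpr (+ 0) -[1+ 11 ] (+ 0) 0 3 0 ⟫ * ⟪ L₇ ⟫))))))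
    (trans (-‿cong (*-congʳ (*-congˡ (sym (M-pow ref 6))))) (solve 4 (λ σ e m s → :- (σ :* e :^ 18 :* (e :^ 3 :* m) :* m :^ 6 :* s) := :- (σ :* ((e :^ 3 :* m) :^ 7 :* s))) σ e (M ref) ⟪ Σ₁₅ ⟫))

  eisenstein : ∀ {n} → Expr n → Expr n → Expr n → Expr n → Expr n → Expr n → Expr n
  eisenstein f g₁ g₂ g₃ g₄ h = :c ((+ 18125225)) :* (f :* g₁ :^ 3) :+ :c (-[1+ 28732685 ]) :* (f :* g₁ :^ 2 :* g₂) :+ :c (-[1+ 87564446 ]) :* (f :* g₁ :* g₂ :^ 2) :+ :c ((+ 84715794)) :* (f :* g₂ :^ 3) :+ :c ((+ 147166525)) :* (f :* g₁ :^ 2 :* g₃) :+ :c ((+ 5813269)) :* (f :* g₁ :^ 2 :* g₄) :+ :c (-[1+ 32849507 ]) :* (f :* g₁ :* g₂ :* g₃) :+ :c (-[1+ 8272046 ]) :* (f :* g₁ :* g₂ :* g₄) :+ :c (-[1+ 166339610 ]) :* (f :* g₂ :^ 2 :* g₃) :+ :c (-[1+ 39740525 ]) :* (f :* g₂ :^ 2 :* g₄) :+ :c ((+ 123484277)) :* (f :* g₁ :* h) :+ :c (-[1+ 28214780 ]) :* (f :* g₂ :* h)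

  -- The factor 1156 = 34² is the common denominator of the coefficients in the theorem. The factor
  -- 50625 = 15⁴, cancelled first, is that of f times three g's, and of f times g times h, under the
  -- normalisations with ε.
  conclusion : fromℤ (+ 1156) * C₀ ≈ fromℤ ((+ 18125225)) * (f * g₁ ^ 3) + fromℤ (-[1+ 28732685 ]) * (f * g₁ ^ 2 * g₂) + fromℤ (-[1+ 87564446 ]) * (f * g₁ * g₂ ^ 2) + fromℤ ((+ 84715794)) * (f * g₂ ^ 3) + fromℤ ((+ 147166525)) * (f * g₁ ^ 2 * g₃) + fromℤ ((+ 5813269)) * (f * g₁ ^ 2 * g₄) + fromℤ (-[1+ 32849507 ]) * (f * g₁ * g₂ * g₃) + fromℤ (-[1+ 8272046 ]) * (f * g₁ * g₂ * g₄) + fromℤ (-[1+ 166339610 ]) * (f * g₂ ^ 2 * g₃) + fromℤ (-[1+ 39740525 ]) * (f * g₂ ^ 2 * g₄) + fromℤ ((+ 123484277)) * (f * g₁ * h) + fromℤ (-[1+ 28214780 ]) * (f * g₂ * h) + fromℤ ((+ 3901500)) * B₁₃ + fromℤ (-[1+ 3900343 ]) * B₁₄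
  conclusion = cancel 50624 (trans
    (solve 1 (λ c → :c (+ 50625) :* (:c (+ 1156) :* c) := :c (+ 3901500) :* (:c (+ 15) :* c)) C₀)
    (trans (*-congˡ C₀-ε) (trans (solve 3 (λ σ e s → :c (+ 3901500) :* (:- (σ :* (e :* s))) := σ :* (e :* (:- (:c (+ 3901500) :* s)))) σ (ε ^ 7) ⟪ Σ₁₅ ⟫)
    -- The computational core: one normal-form evaluation in the coordinate ring. The last
    -- coefficient is -9 · 10125 · 1156 · 3374, where 10125 = 50625 / 5, because `B₁₄-ε` relates 5
    -- times the form to 9 times a function.
    (trans (*-congˡ (*-congˡ (on-curve (:- (:c (+ 3901500) :* Σ₁₅)) (eisenstein F G₁ G₂ G₃ G₄ H :+ :c ((+ 3901500)) :* uexpr -[1+ 6 ] -[1+ 13 ] (+ 7) 7 7 7 :+ :c (-[1+ 355418846999 ]) :* uexpr -[1+ 2 ] -[1+ 7 ] (+ 5) 1 1 3) ≡.refl)))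
    (trans (solve 10 (λ σ e f g₁ g₂ g₃ g₄ h b c → σ :* (e :^ 7 :* (eisenstein f g₁ g₂ g₃ g₄ h :+ :c ((+ 3901500)) :* b :+ :c (-[1+ 355418846999 ]) :* c))
        := eisenstein (σ :* (e :* f)) (e :^ 2 :* g₁) (e :^ 2 :* g₂) (e :^ 2 :* g₃) (e :^ 2 :* g₄) (e :^ 4 :* h) :+ :c ((+ 3901500)) :* (σ :* (e :^ 7 :* b)) :+ :c (-[1+ 39490982999 ]) :* (:c (+ 9) :* (σ :* (e :^ 7 :* c))))
        σ ε ⟪ F ⟫ ⟪ G₁ ⟫ ⟪ G₂ ⟫ ⟪ G₃ ⟫ ⟪ G₄ ⟫ ⟪ H ⟫ ⟪ uexpr -[1+ 6 ] -[1+ 13 ] (+ 7) 7 7 7 ⟫ ⟪ uexpr -[1+ 2 ] -[1+ 7 ] (+ 5) 1 1 3 ⟫)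
    (trans (⟦⟧-cong (eisenstein (:v (# 0)) (:v (# 1)) (:v (# 2)) (:v (# 3)) (:v (# 4)) (:v (# 5)) :+ :c ((+ 3901500)) :* :v (# 6) :+ :c (-[1+ 39490982999 ]) :* :v (# 7))
        (sym f-ε ∷ sym g₁-ε ∷ sym g₂-ε ∷ sym g₃-ε ∷ sym g₄-ε ∷ sym h-ε ∷ sym B₁₃-ε ∷ sym B₁₄-ε ∷ []))
      (solve 8 (λ f g₁ g₂ g₃ g₄ h b c → eisenstein (:c (+ 15) :* f) (:c (+ 15) :* g₁) (:c (+ 15) :* g₂) (:c (+ 15) :* g₃) (:c (+ 15) :* g₄) (:c (+ 225) :* h) :+ :c ((+ 3901500)) :* (:c (+ 50625) :* b) :+ :c (-[1+ 39490982999 ]) :* (:c (+ 5) :* c)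
        := :c (+ 50625) :* (eisenstein f g₁ g₂ g₃ g₄ h :+ :c ((+ 3901500)) :* b :+ :c (-[1+ 3900343 ]) :* c))
        f g₁ g₂ g₃ g₄ h B₁₃ B₁₄)))))))

ℚring : CommutativeRing 0ℓ 0ℓ
ℚring = ℚP.+-*-commutativeRing

-- Euler products and Eisenstein series with rational coefficients

module QSeries where
  open import Data.Nat.DivMod using (m*n/n≡m)
  open import Data.Nat.Divisibility as Div using (_∣_; _∣?_; divides)
  open import Data.Rational.Unnormalised using (mkℚᵘ; *≡*)
  import Data.Rational.Unnormalised.Properties as ℚᵘP
  open import Relation.Nullary.Decidable using (dec-true; dec-false)
  open import Defs

  open CommutativeRing ℚring using (+-cong; +-congˡ; +-congʳ; *-congˡ; *-congʳ; -‿cong; +-identityˡ; +-identityʳ; *-identityˡ; zeroˡ; zeroʳ; +-assoc)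
  open Solver ℚring using (fromℕ; fromℕ-suc; fromℕ-*; fromℤ)
  open Series ℚring
  open InfiniteProducts ℚring
  open FiniteSums ℚring using (sum; sum-last)
  open Solver ring𝕊 using (_^_; ^-cong) renaming (solve to solveˢ; _:+_ to _⊹_; _:*_ to _⊗_; _:-_ to _⊝_; :-_ to ⁻_; _:=_ to _≔_; :1 to ₁; :0 to ₀; :c to cˢ)
  module 𝕊 = CommutativeRing ring𝕊

  /1-+ : ∀ i j → i / 1 ℚ.+ j / 1 ≡ (i ℤ.+ j) / 1
  /1-+ i j = ℚP.toℚᵘ-injective (ℚᵘP.≃-trans (ℚP.toℚᵘ-homo-+ (i / 1) (j / 1)) (ℚᵘP.≃-trans
    (ℚᵘP.+-cong (ℚP.toℚᵘ-fromℚᵘ (mkℚᵘ i 0)) (ℚP.toℚᵘ-fromℚᵘ (mkℚᵘ j 0)))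
    (ℚᵘP.≃-trans (*≡* (≡.cong (ℤ._* + 1) (≡.cong₂ ℤ._+_ (ℤP.*-identityʳ i) (ℤP.*-identityʳ j)))) (ℚᵘP.≃-sym (ℚP.toℚᵘ-fromℚᵘ (mkℚᵘ (i ℤ.+ j) 0))))))

  fromℕ-/1 : ∀ n → fromℕ n ≡ (+ n) / 1
  fromℕ-/1 zero    = ≡.refl
  fromℕ-/1 (suc n) = ≡.trans (fromℕ-suc n) (≡.trans (≡.cong (1ℚ ℚ.+_) (fromℕ-/1 n)) (/1-+ (+ 1) (+ n)))

  sumTo-sum : ∀ f n → sumTo f n ≡ sum (suc n) f
  sumTo-sum f zero    = ≡.sym (+-identityʳ _)
  sumTo-sum f (suc n) = ≡.trans (≡.cong (ℚ._+ f (suc n)) (sumTo-sum f n)) (≡.sym (sum-last (suc n) f))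

  ⊛-⊠ : ∀ a b → a ⊛ b ≋ a ⊠ b
  ⊛-⊠ a b n = ≡.trans (sumTo-sum _ n) (≡.sym (⊠-coeff a b n))

  ⊛-cong : ∀ {a b a′ b′} → a ≋ a′ → b ≋ b′ → a ⊛ b ≋ a′ ⊠ b′
  ⊛-cong {a} {b} p q = 𝕊.trans (⊛-⊠ a b) (𝕊.*-cong p q)

  one-𝟙 : one ≋ 𝟙
  one-𝟙 zero    = ≡.refl
  one-𝟙 (suc n) = ≡.refl

  ^^-^ : ∀ {a b} n → a ≋ b → a ^^ n ≋ b ^ n
  ^^-^ zero    p = one-𝟙
  ^^-^ (suc n) p = ⊛-cong p (^^-^ n p)

  qshift-q^ : ∀ s {a b} → a ≋ b → qshift s a ≋ q^ s ⊠ b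
  qshift-q^ s {a} {b} p = 𝕊.trans (go s) (𝕊.trans (sh-cong s p) (𝕊.sym (q^-⊠ s b)))
    where
    go : ∀ s → qshift s a ≋ sh s a
    go zero    n       = ≡.refl
    go (suc s) zero    = ≡.refl
    go (suc s) (suc n) = go s n

  correction : Series → ℕ → List ℚ → ℚ
  correction a j []       = 0ℚ
  correction a j (b ∷ rs) = a (suc j) ℚ.* b ℚ.+ correction a (suc j) rs

  correction-unique : ∀ a (g : ℕ → List ℚ → ℚ) → (∀ j → g j [] ≡ 0ℚ) → (∀ j b rs → g j (b ∷ rs) ≡ a (suc j) ℚ.* b ℚ.+ g (suc j) rs) →
                      ∀ j l → g j l ≡ correction a j l
  correction-unique a g p q j []       = p j
  correction-unique a g p q j (b ∷ rs) = ≡.trans (q j b rs) (≡.cong (a (suc j) ℚ.* b ℚ.+_) (correction-unique a g p q (suc j) rs))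

  -- The recursion inside invList is local to Defs; abstracting its arguments lets unification find it.
  invUnit-suc : ∀ a n → invUnit a (suc n) ≡ ℚ.- correction a 0 (invList a n)
  invUnit-suc a n with correction-unique a _ (λ _ → ≡.refl) (λ _ _ _ → ≡.refl) | 0 | invList a n
  ... | h | j | l = ≡.cong ℚ.-_ (h j l)

  correction-⊠ : ∀ a n j → correction a j (invList a n) ≡ ((λ i → a (suc (j ℕ.+ i))) ⊠ invUnit a) n
  correction-⊠ a zero    j = ≡.trans (+-identityʳ _) (≡.cong (λ i → a (suc i) ℚ.* 1ℚ) (≡.sym (ℕP.+-identityʳ j)))
  correction-⊠ a (suc n) j = +-cong (≡.cong (λ i → a (suc i) ℚ.* invUnit a (suc n)) (≡.sym (ℕP.+-identityʳ j)))
    (≡.trans (correction-⊠ a n (suc j)) (⊠-cong {c = invUnit a} (λ i → ≡.cong (λ k → a (suc k)) (≡.sym (ℕP.+-suc j i))) (λ _ → ≡.refl) n))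

  invUnit-inverse : ∀ a → a 0 ≡ 1ℚ → a ⊠ invUnit a ≋ 𝟙
  invUnit-inverse a e zero    = ≡.cong (ℚ._* 1ℚ) e
  invUnit-inverse a e (suc n) = ≡.trans (+-cong (≡.trans (≡.cong (ℚ._* invUnit a (suc n)) e) (≡.trans (*-identityˡ (invUnit a (suc n))) (invUnit-suc a n)))
    (≡.sym (correction-⊠ a n 0))) (ℚP.+-inverseˡ (correction a 0 (invList a n)))

  ⊛-invUnit : ∀ {a b} c → a ≋ b → b 0 ≡ 1ℚ → (c ⊛ invUnit a) ⊠ b ≋ c
  ⊛-invUnit {a} {b} c p e = 𝕊.trans (𝕊.*-congʳ (⊛-⊠ c (invUnit a))) (𝕊.trans (𝕊.*-assoc c (invUnit a) b)
    (𝕊.trans (𝕊.*-congˡ (𝕊.trans (𝕊.*-comm (invUnit a) b) (𝕊.trans (𝕊.*-congʳ (𝕊.sym p)) (invUnit-inverse a (≡.trans (p 0) e))))) (𝕊.*-identityʳ c)))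

  oneMinusQ-euler : ∀ m i → oneMinusQ (suc m ℕ.* suc i) ≋ euler (suc m) i
  oneMinusQ-euler m i = go (i ℕ.+ m ℕ.* suc i)
    where
    shift : ∀ k n → q^ k n ≡ (if does (n ℕ.≟ k) then 1ℚ else 0ℚ)
    shift zero    zero    = ≡.refl
    shift zero    (suc n) = ≡.refl
    shift (suc k) zero    = ≡.refl
    shift (suc k) (suc n) = shift k n
    negate : ∀ b → (if b then ℚ.- 1ℚ else 0ℚ) ≡ 0ℚ ℚ.- (if b then 1ℚ else 0ℚ)
    negate true  = ≡.refl
    negate false = ≡.refl
    go : ∀ k → oneMinusQ (suc k) ≋ 𝟙 ⊞ ⊟ q^ (suc k)
    go k zero    = ≡.refl
    go k (suc n) = ≡.trans (negate (does (n ℕ.≟ k))) (≡.cong (λ x → 0ℚ ℚ.- x) (≡.sym (shift k n)))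

  Em-𝐄 : ∀ m → Em (suc m) ≋ 𝐄 (suc m)
  Em-𝐄 m n = go n n
    where
    go : ∀ N → finEuler (suc m) N ≋ Π (euler (suc m)) N
    go zero    = one-𝟙
    go (suc N) = ⊛-cong (go N) (oneMinusQ-euler m N)

  -- q^k / (1 - q^k)
  G : ℕ → Ser
  G k zero    = 0ℚ
  G k (suc n) = if does (k ∣? suc n) then 1ℚ else 0ℚ

  sh-below : ∀ k a n → n < k → sh k a n ≡ 0ℚ
  sh-below k a n p = O-sh k {a} {0} (λ _ ()) n (≡.subst (n <_) (≡.sym (ℕP.+-identityʳ k)) p)

  G-below : ∀ k n → n < k → G k n ≡ 0ℚ
  G-below k zero    p = ≡.refl
  G-below k (suc n) p = ≡.cong (if_then 1ℚ else 0ℚ) (dec-false (k ∣? suc n) (Div.>⇒∤ p))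

  -- For a modulus K = k + 1, the divisibility of K + n by K is that of n; this is the equation g =
  -- q^K + q^K g of the geometric series.
  G-geometric : ∀ k → G (suc k) ≋ q^ (suc k) ⊞ sh (suc k) (G (suc k))
  G-geometric k n with n ℕ.<? suc k
  ... | yes p = ≡.trans (G-below (suc k) n p) (≡.sym (+-cong (sh-below (suc k) 𝟙 n p) (sh-below (suc k) (G (suc k)) n p)))
  ... | no ¬p = ≡.subst (λ n → G (suc k) n ≡ (q^ (suc k) ⊞ sh (suc k) (G (suc k))) n) (ℕP.m+[n∸m]≡n (ℕP.≮⇒≥ ¬p))
      (≡.trans (case (n ∸ suc k)) (≡.sym (≡.cong₂ ℚ._+_ (sh-at (suc k) 𝟙 (n ∸ suc k)) (sh-at (suc k) (G (suc k)) (n ∸ suc k)))))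
    where
    case : ∀ n → G (suc k) (suc k ℕ.+ n) ≡ 𝟙 n ℚ.+ G (suc k) n
    case zero = ≡.trans (≡.cong (if_then 1ℚ else 0ℚ) (dec-true (suc k ∣? suc (k ℕ.+ 0)) (Div.∣-reflexive (≡.cong suc (≡.sym (ℕP.+-identityʳ k)))))) (≡.sym (+-identityʳ 1ℚ))
    case (suc n) = ≡.trans (again (suc k ∣? suc n)) (≡.sym (+-identityˡ _))
      where
      again : ∀ d → G (suc k) (suc k ℕ.+ suc n) ≡ (if does d then 1ℚ else 0ℚ)
      again (yes d) = ≡.cong (if_then 1ℚ else 0ℚ) (dec-true (suc k ∣? suc (k ℕ.+ suc n)) (Div.∣m∣n⇒∣m+n Div.∣-refl d))
      again (no ¬d) = ≡.cong (if_then 1ℚ else 0ℚ) (dec-false (suc k ∣? suc (k ℕ.+ suc n)) (λ d → ¬d (Div.∣m+n∣m⇒∣n {m = suc k} d Div.∣-refl)))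

  D-q^ : ∀ k → D (q^ k) ≋ C (fromℕ k) ⊠ q^ k
  D-q^ k n = ≡.trans (go 0 k n) (≡.sym (C-⊠ (fromℕ k) (q^ k) n))
    where
    go : ∀ c k n → fromℕ (c ℕ.+ n) ℚ.* sh k 𝟙 n ≡ fromℕ (c ℕ.+ k) ℚ.* sh k 𝟙 n
    go c zero    zero    = ≡.refl
    go c zero    (suc n) = ≡.trans (zeroʳ (fromℕ (c ℕ.+ suc n))) (≡.sym (zeroʳ (fromℕ (c ℕ.+ 0))))
    go c (suc k) zero    = ≡.trans (zeroʳ (fromℕ (c ℕ.+ 0))) (≡.sym (zeroʳ (fromℕ (c ℕ.+ suc k))))
    go c (suc k) (suc n) = ≡.trans (≡.cong (λ x → fromℕ x ℚ.* sh k 𝟙 n) (ℕP.+-suc c n))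
      (≡.trans (go (suc c) k n) (≡.cong (λ x → fromℕ x ℚ.* sh k 𝟙 n) (≡.sym (ℕP.+-suc c k))))

  module LogarithmicDerivative (m : ℕ) where

    k : ℕ → ℕ
    k N = suc m ℕ.* suc N

    -- Partial sums of Σ K q^K / (1 - q^K) over the multiples K of m + 1: minus the logarithmic
    -- derivatives of the partial products.
    S : ℕ → Ser
    S zero    = 𝟘
    S (suc N) = S N ⊞ C (fromℕ (k N)) ⊠ G (k N)

    D-Π : ∀ N → D (Π (euler (suc m)) N) ≋ ⊟ (Π (euler (suc m)) N ⊠ S N)
    D-Π zero    = 𝕊.trans (D-cong (𝕊.sym C-1)) (𝕊.trans (D-C 1ℚ) (solveˢ 0 (₀ ≔ ⁻ (₁ ⊗ ₀))))
    D-Π (suc N) = 𝕊.trans (D-⊠ _ _) (𝕊.trans (𝕊.+-cong (𝕊.*-congʳ (D-Π N)) (𝕊.*-congˡ D-euler))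
      (solveˢ 4 (λ p s e g → (⁻ (p ⊗ s)) ⊗ e ⊹ p ⊗ (⁻ (g ⊗ e)) ≔ ⁻ (p ⊗ e ⊗ (s ⊹ g))) (Π (euler (suc m)) N) (S N) (euler (suc m) N) (C (fromℕ (k N)) ⊠ G (k N))))
      where
      K = k N
      D-euler : D (euler (suc m) N) ≋ ⊟ (C (fromℕ K) ⊠ G K ⊠ euler (suc m) N)
      D-euler = 𝕊.trans (D-⊞ 𝟙 (⊟ q^ K)) (𝕊.trans (𝕊.+-cong (𝕊.trans (D-cong (𝕊.sym C-1)) (D-C 1ℚ))
          (𝕊.trans (λ n → ≡.sym (ℚP.neg-distribʳ-* (fromℕ n) (q^ K n))) (𝕊.-‿cong (D-q^ K))))
        (𝕊.trans (𝕊.trans (𝕊.+-identityˡ _) (𝕊.-‿cong (𝕊.*-congˡ q-G))) (solveˢ 3 (λ c g e → ⁻ (c ⊗ (g ⊗ e)) ≔ ⁻ (c ⊗ g ⊗ e)) (C (fromℕ K)) (G K) (euler (suc m) N))))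
        where
        q-G : q^ K ≋ G K ⊠ euler (suc m) N
        q-G = 𝕊.trans (solveˢ 2 (λ q s → q ≔ (q ⊹ s) ⊝ s) (q^ K) (sh K (G K)))
          (𝕊.trans (𝕊.+-cong (𝕊.sym (G-geometric _)) (𝕊.-‿cong (𝕊.sym (q^-⊠ K (G K)))))
          (solveˢ 2 (λ g q → g ⊝ q ⊗ g ≔ g ⊗ (₁ ⊝ q)) (G K) (q^ K)))

    S-suc : ∀ N i → S (suc N) i ≡ S N i ℚ.+ fromℕ (k N) ℚ.* G (k N) i
    S-suc N i = ≡.cong (S N i ℚ.+_) (C-⊠ (fromℕ (k N)) (G (k N)) i)

    S-stable : Stable S
    S-stable N i i≤N = ≡.trans (S-suc N i) (≡.trans (≡.cong (λ x → S N i ℚ.+ fromℕ (k N) ℚ.* x)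
        (G-below (k N) i (ℕP.≤-trans (s≤s i≤N) (ℕP.m≤m+n (suc N) (m ℕ.* suc N)))))
      (≡.trans (≡.cong (S N i ℚ.+_) (zeroʳ (fromℕ (k N)))) (+-identityʳ _)))

    T : Ser
    T = Lim S

    D-𝐄 : D (𝐄 (suc m)) ≋ ⊟ (𝐄 (suc m) ⊠ T)
    D-𝐄 n = ≡.trans (D-Π n n) (≡.cong ℚ.-_ (⊠-cong≤ n (λ i p → Lim-at (Π (euler (suc m))) (Π-stable _ (euler-convergent m)) n i p) (λ i p → Lim-at S S-stable n i p)))

    S-indivisible : ∀ n → ¬ (suc m ∣ n) → ∀ N → S N n ≡ 0ℚ
    S-indivisible n ¬d zero    = ≡.refl
    S-indivisible n ¬d (suc N) = ≡.trans (S-suc N n) (+-cong (S-indivisible n ¬d N) (≡.trans (≡.cong (fromℕ (k N) ℚ.*_) (G-zero n ¬d)) (zeroʳ (fromℕ (k N)))))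
      where
      G-zero : ∀ n → ¬ (suc m ∣ n) → G (k N) n ≡ 0ℚ
      G-zero zero    ¬d = ≡.refl
      G-zero (suc n) ¬d = ≡.cong (if_then 1ℚ else 0ℚ) (dec-false (k N ∣? suc n) (λ d → ¬d (Div.m*n∣⇒m∣ (suc m) (suc N) d)))

    term : ℕ → ℕ → ℚ
    term r j = if does (j ∣? r) then (+ j) / 1 else 0ℚ

    -- Among the multiples of m + 1, those dividing (r + 1)(m + 1) are j (m + 1) with j dividing r +
    -- 1, so the divisor sum of r + 1 appears.
    S-divisible : ∀ r N → S N (suc r ℕ.* suc m) ≡ fromℕ (suc m) ℚ.* sumTo (term (suc r)) N
    S-divisible r zero    = ≡.sym (zeroʳ (fromℕ (suc m)))
    S-divisible r (suc N) = ≡.trans (S-suc N (suc r ℕ.* suc m)) (≡.trans (+-cong (S-divisible r N) (last (suc N ∣? suc r)))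
        (≡.sym (ℚP.*-distribˡ-+ (fromℕ (suc m)) (sumTo (term (suc r)) N) _)))
      where
      last : ∀ d → fromℕ (k N) ℚ.* G (k N) (suc r ℕ.* suc m) ≡ fromℕ (suc m) ℚ.* (if does d then (+ suc N) / 1 else 0ℚ)
      last (yes d) = ≡.trans (≡.cong (λ b → fromℕ (k N) ℚ.* (if b then 1ℚ else 0ℚ))
          (dec-true (k N ∣? (suc r ℕ.* suc m)) (≡.subst (k N ∣_) (ℕP.*-comm (suc m) (suc r)) (Div.*-monoʳ-∣ (suc m) d))))
        (≡.trans (ℚP.*-identityʳ _) (≡.trans (fromℕ-* (suc m) (suc N)) (≡.cong (fromℕ (suc m) ℚ.*_) (fromℕ-/1 (suc N)))))
      last (no ¬d) = ≡.trans (≡.cong (λ b → fromℕ (k N) ℚ.* (if b then 1ℚ else 0ℚ))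
          (dec-false (k N ∣? (suc r ℕ.* suc m)) (λ d → ¬d (Div.*-cancelˡ-∣ (suc m) (≡.subst (k N ∣_) (ℕP.*-comm (suc r) (suc m)) d)))))
        (≡.trans (zeroʳ (fromℕ (k N))) (≡.sym (zeroʳ (fromℕ (suc m)))))

    sigma-stable : ∀ r j → sumTo (term (suc r)) (j ℕ.+ suc r) ≡ sigmaSum (suc r)
    sigma-stable r zero    = ≡.refl
    sigma-stable r (suc j) = ≡.trans (+-cong (sigma-stable r j)
      (≡.cong (if_then (+ suc (j ℕ.+ suc r)) / 1 else 0ℚ) (dec-false (suc (j ℕ.+ suc r) ∣? suc r) (Div.>⇒∤ (s≤s (ℕP.m≤n+m (suc r) j)))))) (+-identityʳ _)

    E2-T : C (fromℕ 24) ⊠ T ≋ ⊟ (C (fromℕ (suc m)) ⊠ (E2at (suc m) ⊞ ⊟ 𝟙))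
    E2-T n = ≡.trans (C-⊠ (fromℕ 24) T n) (≡.trans (value n (suc m ∣? n)) (≡.cong ℚ.-_ (≡.sym (C-⊠ (fromℕ (suc m)) (E2at (suc m) ⊞ ⊟ 𝟙) n))))
      where
      value : ∀ n (d : Dec (suc m ∣ n)) → fromℕ 24 ℚ.* T n ≡ ℚ.- (fromℕ (suc m) ℚ.* ((if does d then E2 (n ℕ./ suc m) else 0ℚ) ℚ.- 𝟙 n))
      value zero    (yes d) = ≡.sym (≡.cong ℚ.-_ (zeroʳ (fromℕ (suc m))))
      value zero    (no ¬d) = ⊥-elim (¬d (suc m Div.∣0))
      value (suc n) (no ¬d) = ≡.trans (≡.cong (fromℕ 24 ℚ.*_) (S-indivisible (suc n) ¬d (suc n))) (≡.sym (≡.cong ℚ.-_ (zeroʳ (fromℕ (suc m)))))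
      value (suc n) (yes (divides (suc r) e)) = ≡.trans (≡.cong (fromℕ 24 ℚ.*_) (≡.trans (≡.cong (λ x → S x x) e)
          (≡.trans (S-divisible r (suc r ℕ.* suc m)) (≡.cong (fromℕ (suc m) ℚ.*_)
            (≡.trans (≡.cong (sumTo (term (suc r))) (≡.sym (ℕP.m∸n+n≡m (ℕP.m≤m*n (suc r) (suc m))))) (sigma-stable r (suc r ℕ.* suc m ∸ suc r)))))))
        (≡.trans (scal (fromℕ (suc m)) (sigmaSum (suc r))) (≡.cong (λ x → ℚ.- (fromℕ (suc m) ℚ.* (E2 x ℚ.- 0ℚ))) (≡.sym (≡.trans (≡.cong (ℕ._/ suc m) e) (m*n/n≡m (suc r) (suc m))))))
        where
        open Solver ℚring using (solve; _:*_; _:=_; :-_; _:-_; :c; :0)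
        scal : ∀ a s → fromℕ 24 ℚ.* (a ℚ.* s) ≡ ℚ.- (a ℚ.* (ℚ.- ((+ 24) / 1) ℚ.* s ℚ.- 0ℚ))
        scal = solve 2 (λ a s → :c (+ 24) :* (a :* s) := :- (a :* ((:- :c (+ 24)) :* s :- :0)))

    -- The logarithmic derivative of the Euler product in q^m as an Eisenstein series. This is how
    -- the E₂'s of the theorem enter the differential relations of theta values.
    eisenstein : Solver.fromℤ ring𝕊 (+ 24) ⊠ D (𝐄 (suc m)) ≋ Solver.fromℤ ring𝕊 (+ suc m) ⊠ (E2at (suc m) ⊞ ⊟ 𝟙) ⊠ 𝐄 (suc m)
    eisenstein = 𝕊.trans (𝕊.*-cong (fromℤ-C (+ 24)) D-𝐄) (𝕊.trans (solveˢ 3 (λ a e t → a ⊗ (⁻ (e ⊗ t)) ≔ (⁻ (a ⊗ t)) ⊗ e) (C (fromℕ 24)) (𝐄 (suc m)) T)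
      (𝕊.*-congʳ (𝕊.trans (𝕊.-‿cong E2-T) (𝕊.trans (solveˢ 1 (λ a → ⁻ (⁻ a) ≔ a) (C (fromℕ (suc m)) ⊠ (E2at (suc m) ⊞ ⊟ 𝟙))) (𝕊.*-congʳ (𝕊.sym (fromℤ-C (+ suc m))))))))

-- The forms of the theorem in terms of Euler products.

module Forms where
  open import Defs
  open QSeries

  open Series ℚring
  open InfiniteProducts ℚring using (𝐄; Q-pow)
  open Solver ℚring using () renaming (fromℤ to fromℤ′)
  open Solver ring𝕊 using (_^_; fromℤ; solve; _:+_; _:*_; _:-_; :-_; _:=_; :1; :0; :c; _:^_)

  fromℤ-/1 : ∀ z → fromℤ′ z ≡ z / 1
  fromℤ-/1 (+ n)    = fromℕ-/1 n
  fromℤ-/1 -[1+ n ] = ≡.cong ℚ.-_ (fromℕ-/1 (suc n))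

  scalar : ∀ c a → c · a ≋ C c ⊠ a
  scalar c a n = ≡.sym (C-⊠ c a n)

  integer-scalar : ∀ {c} z {a b} → c ≡ z / 1 → a ≋ b → c · a ≋ fromℤ z ⊠ b
  integer-scalar {c} z {a} e p = 𝕊.trans (scalar c a) (𝕊.*-cong (𝕊.trans (C-cong (≡.trans e (≡.sym (fromℤ-/1 z)))) (𝕊.sym (fromℤ-C z))) p)

  C-integer : ∀ k {c} z → (k / 1) ℚ.* c ≡ z / 1 → fromℤ k ⊠ C c ≋ fromℤ z
  C-integer k {c} z e = 𝕊.trans (𝕊.*-congʳ (𝕊.trans (fromℤ-C k) (C-cong (fromℤ-/1 k)))) (𝕊.trans (𝕊.sym (C-* (k / 1) c))
    (𝕊.trans (C-cong (≡.trans e (≡.sym (fromℤ-/1 z)))) (𝕊.sym (fromℤ-C z))))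

  F₁ F₃ F₅ F₁₅ : Ser
  F₁  = E2at 1
  F₃  = E2at 3
  F₅  = E2at 5
  F₁₅ = E2at 15

  g₁-def : fromℤ (+ 8) ⊠ g1 ≋ ⊟ (F₁ ⊞ fromℤ (+ 3) ⊠ F₃ ⊞ ⊟ (fromℤ (+ 5) ⊠ F₅) ⊞ ⊟ (fromℤ (+ 15) ⊠ F₁₅))
  g₁-def = 𝕊.trans (𝕊.*-congˡ (𝕊.trans (scalar _ _) (𝕊.*-congˡ (𝕊.+-cong (𝕊.+-cong (𝕊.+-congˡ {F₁} (integer-scalar ((+ 3)) ≡.refl 𝕊.refl)) (integer-scalar (-[1+ 4 ]) ≡.refl 𝕊.refl)) (integer-scalar (-[1+ 14 ]) ≡.refl 𝕊.refl)))))
    (𝕊.trans (𝕊.sym (𝕊.*-assoc _ _ _)) (𝕊.trans (𝕊.*-congʳ (C-integer (+ 8) (-[1+ 0 ]) ≡.refl))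
    (solve 4 (λ a b c d → :c (-[1+ 0 ]) :* (a :+ :c ((+ 3)) :* b :+ :c (-[1+ 4 ]) :* c :+ :c (-[1+ 14 ]) :* d) := :- (a :+ :c (+ 3) :* b :- (:c (+ 5) :* c) :- (:c (+ 15) :* d))) F₁ F₃ F₅ F₁₅)))

  g₂-def : fromℤ (+ 12) ⊠ g2 ≋ ⊟ (F₁ ⊞ ⊟ (fromℤ (+ 3) ⊠ F₃) ⊞ fromℤ (+ 5) ⊠ F₅ ⊞ ⊟ (fromℤ (+ 15) ⊠ F₁₅))
  g₂-def = 𝕊.trans (𝕊.*-congˡ (𝕊.trans (scalar _ _) (𝕊.*-congˡ (𝕊.+-cong (𝕊.+-cong (𝕊.+-congˡ {F₁} (integer-scalar (-[1+ 2 ]) ≡.refl 𝕊.refl)) (integer-scalar ((+ 5)) ≡.refl 𝕊.refl)) (integer-scalar (-[1+ 14 ]) ≡.refl 𝕊.refl)))))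
    (𝕊.trans (𝕊.sym (𝕊.*-assoc _ _ _)) (𝕊.trans (𝕊.*-congʳ (C-integer (+ 12) (-[1+ 0 ]) ≡.refl))
    (solve 4 (λ a b c d → :c (-[1+ 0 ]) :* (a :+ :c (-[1+ 2 ]) :* b :+ :c ((+ 5)) :* c :+ :c (-[1+ 14 ]) :* d) := :- (a :- (:c (+ 3) :* b) :+ :c (+ 5) :* c :- (:c (+ 15) :* d))) F₁ F₃ F₅ F₁₅)))

  g₄-def : fromℤ (+ 8) ⊠ g4 ≋ F₁ ⊞ ⊟ (fromℤ (+ 3) ⊠ F₃) ⊞ ⊟ (fromℤ (+ 5) ⊠ F₅) ⊞ fromℤ (+ 15) ⊠ F₁₅
  g₄-def = 𝕊.trans (𝕊.*-congˡ (𝕊.trans (scalar _ _) (𝕊.*-congˡ (𝕊.+-cong (𝕊.+-cong (𝕊.+-congˡ {F₁} (integer-scalar (-[1+ 2 ]) ≡.refl 𝕊.refl)) (integer-scalar (-[1+ 4 ]) ≡.refl 𝕊.refl)) (integer-scalar ((+ 15)) ≡.refl 𝕊.refl)))))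
    (𝕊.trans (𝕊.sym (𝕊.*-assoc _ _ _)) (𝕊.trans (𝕊.*-congʳ (C-integer (+ 8) ((+ 1)) ≡.refl))
    (solve 4 (λ a b c d → :c ((+ 1)) :* (a :+ :c (-[1+ 2 ]) :* b :+ :c (-[1+ 4 ]) :* c :+ :c ((+ 15)) :* d) := a :- (:c (+ 3) :* b) :- (:c (+ 5) :* c) :+ :c (+ 15) :* d) F₁ F₃ F₅ F₁₅)))

  q : Ser
  q = q^ 1

  f-def : f15 ⊠ (𝐄 3 ⊠ 𝐄 5) ≋ q ⊠ (𝐄 1 ^ 2 ⊠ 𝐄 15 ^ 2)
  f-def = 𝕊.trans (𝕊.*-congʳ (qshift-q^ 1 𝕊.refl)) (𝕊.trans (𝕊.*-assoc q _ _) (𝕊.*-congˡ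
    (𝕊.trans (⊛-invUnit _ (⊛-cong (Em-𝐄 2) (Em-𝐄 4)) ≡.refl) (⊛-cong (^^-^ 2 (Em-𝐄 0)) (^^-^ 2 (Em-𝐄 14))))))

  g₃-def : g3 ≋ q ⊠ (𝐄 1 ⊠ 𝐄 3 ⊠ 𝐄 5 ⊠ 𝐄 15)
  g₃-def = qshift-q^ 1 (⊛-cong (⊛-cong (⊛-cong (Em-𝐄 0) (Em-𝐄 2)) (Em-𝐄 4)) (Em-𝐄 14))

  h-def : h15 ≋ q ⊠ (𝐄 1 ^ 4 ⊠ 𝐄 5 ^ 4) ⊞ ⊟ (fromℤ (+ 9) ⊠ (q ^ 3 ⊠ (𝐄 3 ^ 4 ⊠ 𝐄 15 ^ 4)))
  h-def = 𝕊.+-cong (qshift-q^ 1 (⊛-cong (^^-^ 4 (Em-𝐄 0)) (^^-^ 4 (Em-𝐄 4))))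
    (𝕊.trans (integer-scalar -[1+ 8 ] ≡.refl (𝕊.trans (qshift-q^ 3 (⊛-cong (^^-^ 4 (Em-𝐄 2)) (^^-^ 4 (Em-𝐄 14)))) (𝕊.*-congʳ (𝕊.sym (Q-pow 3 0)))))
      (solve 1 (λ x → :c -[1+ 8 ] :* x := :- (:c (+ 9) :* x)) (q ^ 3 ⊠ (𝐄 3 ^ 4 ⊠ 𝐄 15 ^ 4))))

  B₁₃-def : B13 ⊠ (𝐄 1 ^ 7 ⊠ 𝐄 15 ^ 7) ≋ 𝐄 3 ^ 14 ⊠ 𝐄 5 ^ 14
  B₁₃-def = 𝕊.trans (⊛-invUnit _ (⊛-cong (^^-^ 7 (Em-𝐄 0)) (^^-^ 7 (Em-𝐄 14))) ≡.refl) (⊛-cong (^^-^ 14 (Em-𝐄 2)) (^^-^ 14 (Em-𝐄 4)))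

  B₁₄-def : B14 ⊠ (𝐄 3 ^ 4 ⊠ 𝐄 15) ≋ 𝐄 1 ^ 17 ⊠ 𝐄 5 ^ 2
  B₁₄-def = 𝕊.trans (⊛-invUnit _ (⊛-cong (^^-^ 4 (Em-𝐄 2)) (Em-𝐄 14)) ≡.refl) (⊛-cong (^^-^ 17 (Em-𝐄 0)) (^^-^ 2 (Em-𝐄 4)))

  rhs-def : 𝐄 1 ^ 15 ⊠ rhs15 ≋ bracket15
  rhs-def = 𝕊.trans (𝕊.*-cong (𝕊.sym (^^-^ 15 (Em-𝐄 0))) (⊛-⊠ _ _)) (𝕊.trans (𝕊.sym (𝕊.*-assoc _ _ bracket15))
    (𝕊.trans (𝕊.*-congʳ (invUnit-inverse (Em 1 ^^ 15) ≡.refl)) (𝕊.*-identityˡ bracket15)))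

  scaled : ∀ {c} z {a b} → ((+ 1156) / 1) ℚ.* c ≡ z / 1 → a ≋ b → fromℤ (+ 1156) ⊠ (c · a) ≋ fromℤ z ⊠ b
  scaled {c} z {a} e p = 𝕊.trans (𝕊.*-congˡ (scalar c a)) (𝕊.trans (𝕊.sym (𝕊.*-assoc _ (C c) a)) (𝕊.*-cong (C-integer (+ 1156) z e) p))

  private
    infixl 7 _⊗_
    infixr 8 _↑_
    _⊗_ : ∀ {a b a′ b′} → a ≋ a′ → b ≋ b′ → a ⊛ b ≋ a′ ⊠ b′
    _⊗_ = ⊛-cong
    _↑_ : ∀ {a b} → a ≋ b → ∀ n → a ^^ n ≋ b ^ n
    p ↑ n = ^^-^ n p
    infixl 6 _⊹_
    _⊹_ : ∀ {a b a′ b′} → fromℤ (+ 1156) ⊠ a ≋ a′ → fromℤ (+ 1156) ⊠ b ≋ b′ → fromℤ (+ 1156) ⊠ (a ⊕ b) ≋ a′ ⊞ b′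
    p ⊹ q = 𝕊.trans (𝕊.distribˡ _ _ _) (𝕊.+-cong p q)
    [_] : ∀ a → a ≋ a
    [ _ ] = 𝕊.refl

  bracket-def : fromℤ (+ 1156) ⊠ bracket15 ≋ fromℤ ((+ 18125225)) ⊠ (f15 ⊠ g1 ^ 3) ⊞ fromℤ (-[1+ 28732685 ]) ⊠ (f15 ⊠ g1 ^ 2 ⊠ g2) ⊞ fromℤ (-[1+ 87564446 ]) ⊠ (f15 ⊠ g1 ⊠ g2 ^ 2) ⊞ fromℤ ((+ 84715794)) ⊠ (f15 ⊠ g2 ^ 3) ⊞ fromℤ ((+ 147166525)) ⊠ (f15 ⊠ g1 ^ 2 ⊠ g3) ⊞ fromℤ ((+ 5813269)) ⊠ (f15 ⊠ g1 ^ 2 ⊠ g4) ⊞ fromℤ (-[1+ 32849507 ]) ⊠ (f15 ⊠ g1 ⊠ g2 ⊠ g3) ⊞ fromℤ (-[1+ 8272046 ]) ⊠ (f15 ⊠ g1 ⊠ g2 ⊠ g4) ⊞ fromℤ (-[1+ 166339610 ]) ⊠ (f15 ⊠ g2 ^ 2 ⊠ g3) ⊞ fromℤ (-[1+ 39740525 ]) ⊠ (f15 ⊠ g2 ^ 2 ⊠ g4) ⊞ fromℤ ((+ 123484277)) ⊠ (f15 ⊠ g1 ⊠ h15) ⊞ fromℤ (-[1+ 28214780 ]) ⊠ (f15 ⊠ g2 ⊠ h15) ⊞ fromℤ ((+ 3901500)) ⊠ B13 ⊞ fromℤ (-[1+ 3900343 ]) ⊠ B14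
  bracket-def = scaled ((+ 18125225)) ≡.refl ([ f15 ] ⊗ [ g1 ] ↑ 3) ⊹ scaled (-[1+ 28732685 ]) ≡.refl ([ f15 ] ⊗ [ g1 ] ↑ 2 ⊗ [ g2 ]) ⊹ scaled (-[1+ 87564446 ]) ≡.refl ([ f15 ] ⊗ [ g1 ] ⊗ [ g2 ] ↑ 2) ⊹ scaled ((+ 84715794)) ≡.refl ([ f15 ] ⊗ [ g2 ] ↑ 3) ⊹ scaled ((+ 147166525)) ≡.refl ([ f15 ] ⊗ [ g1 ] ↑ 2 ⊗ [ g3 ]) ⊹ scaled ((+ 5813269)) ≡.refl ([ f15 ] ⊗ [ g1 ] ↑ 2 ⊗ [ g4 ]) ⊹ scaled (-[1+ 32849507 ]) ≡.refl ([ f15 ] ⊗ [ g1 ] ⊗ [ g2 ] ⊗ [ g3 ]) ⊹ scaled (-[1+ 8272046 ]) ≡.refl ([ f15 ] ⊗ [ g1 ] ⊗ [ g2 ] ⊗ [ g4 ]) ⊹ scaled (-[1+ 166339610 ]) ≡.refl ([ f15 ] ⊗ [ g2 ] ↑ 2 ⊗ [ g3 ]) ⊹ scaled (-[1+ 39740525 ]) ≡.refl ([ f15 ] ⊗ [ g2 ] ↑ 2 ⊗ [ g4 ]) ⊹ scaled ((+ 123484277)) ≡.refl ([ f15 ] ⊗ [ g1 ] ⊗ [ h15 ]) ⊹ scaled (-[1+ 28214780 ]) ≡.refl ([ f15 ] ⊗ [ g2 ] ⊗ [ h15 ]) ⊹ scaled ((+ 3901500)) ≡.refl 𝕊.refl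 ⊹ scaled (-[1+ 3900343 ]) ≡.refl 𝕊.refl

open QSeries using (fromℕ-/1; invUnit-inverse; module LogarithmicDerivative)
open import Defs using (invUnit; E2at; f15; g1; g2; g3; g4; h15; B13; B14; bracket15)

-- Transport of identities to an extension of ℚ.

module Transport {A B : CommutativeRing 0ℓ 0ℓ} (H : Hom A B) where
  open Hom H
  private
    module A = CommutativeRing A
    module B = CommutativeRing B
    module SA = Solver A
    module SB = Solver B
  open Expressions

  φ-⟦⟧ : ∀ {n} (e : Expr n) ρ → φ (SA.⟦ e ⟧ ρ) B.≈ SB.⟦ e ⟧ (Vec.map φ ρ)
  φ-⟦⟧ (:v i)   ρ = B.reflexive (≡.sym (lookup-map i φ ρ))
  φ-⟦⟧ (:c k)   ρ = φ-fromℤ k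
  φ-⟦⟧ :0       ρ = φ-0
  φ-⟦⟧ :1       ρ = φ-1
  φ-⟦⟧ (a :+ b) ρ = B.trans (φ-+ _ _) (B.+-cong (φ-⟦⟧ a ρ) (φ-⟦⟧ b ρ))
  φ-⟦⟧ (a :* b) ρ = B.trans (φ-* _ _) (B.*-cong (φ-⟦⟧ a ρ) (φ-⟦⟧ b ρ))
  φ-⟦⟧ (a :- b) ρ = B.trans (φ-+ _ _) (B.+-cong (φ-⟦⟧ a ρ) (B.trans (φ-neg _) (B.-‿cong (φ-⟦⟧ b ρ))))
  φ-⟦⟧ (:- a)   ρ = B.trans (φ-neg _) (B.-‿cong (φ-⟦⟧ a ρ))
  φ-⟦⟧ (a :^ k) ρ = B.trans (φ-^ _ k) (SB.^-cong k (φ-⟦⟧ a ρ))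

  -- Identities given as pairs of expressions move along a homomorphism: this carries the rational
  -- ones to the extension, and `reflect` expresses the final one as an equality of images.
  transport : ∀ {n} (e : Expr n × Expr n) ρ → SA.⟦ proj₁ e ⟧ ρ A.≈ SA.⟦ proj₂ e ⟧ ρ → SB.⟦ proj₁ e ⟧ (Vec.map φ ρ) B.≈ SB.⟦ proj₂ e ⟧ (Vec.map φ ρ)
  transport (a , b) ρ p = B.trans (B.sym (φ-⟦⟧ a ρ)) (B.trans (φ-cong p) (φ-⟦⟧ b ρ))

  reflect : ∀ {n} (e : Expr n × Expr n) ρ → SB.⟦ proj₁ e ⟧ (Vec.map φ ρ) B.≈ SB.⟦ proj₂ e ⟧ (Vec.map φ ρ) → φ (SA.⟦ proj₁ e ⟧ ρ) B.≈ φ (SA.⟦ proj₂ e ⟧ ρ)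
  reflect (a , b) ρ p = B.trans (φ-⟦⟧ a ρ) (B.trans p (B.sym (φ-⟦⟧ b ρ)))

module RationalAlgebra (R : CommutativeRing 0ℓ 0ℓ) (h : Hom ℚring R) where
  open CommutativeRing R hiding (zero)
  open Hom h
  open Series R
  open Solver R using (fromℕ; solve; _:*_; _:=_)
  private
    module 𝕊 = CommutativeRing ring𝕊
    module Sˢ = Solver ring𝕊
    module Q = Solver ℚring

  reciprocal : ℕ → ℚ
  reciprocal n = ℚ.1/_ ((+ suc n) ℚ./ 1) ⦃ ℚP.pos⇒nonZero ((+ suc n) ℚ./ 1) ⦃ ℚP.normalize-pos (suc n) 1 ⦄ ⦄

  fromℕ-reciprocal : ∀ n → fromℕ (suc n) * φ (reciprocal n) ≈ 1#
  fromℕ-reciprocal n = trans (*-congʳ (sym (φ-fromℕ (suc n)))) (trans (sym (φ-* _ _)) (trans (φ-cong (≡.trans (≡.cong (ℚ._* reciprocal n) (fromℕ-/1 (suc n)))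
    (ℚP.*-inverseʳ ((+ suc n) ℚ./ 1) ⦃ ℚP.pos⇒nonZero ((+ suc n) ℚ./ 1) ⦃ ℚP.normalize-pos (suc n) 1 ⦄ ⦄))) φ-1))

  cancel : ∀ n x → fromℕ (suc n) * x ≈ 0# → x ≈ 0#
  cancel n x e = trans (sym (*-identityˡ x)) (trans (*-congʳ (sym (fromℕ-reciprocal n)))
    (trans (solve 3 (λ a b x → a :* b :* x := b :* (a :* x)) (fromℕ (suc n)) (φ (reciprocal n)) x) (trans (*-congˡ e) (zeroʳ _))))

  1/ : ℕ → Ser
  1/ n = C (φ (reciprocal n))

  1/-inverse : ∀ n → Sˢ.fromℕ (suc n) ⊠ 1/ n ≋ 𝟙
  1/-inverse n = 𝕊.trans (𝕊.*-congʳ (fromℤ-C (+ suc n))) (𝕊.trans (𝕊.sym (C-* _ _)) (𝕊.trans (C-cong (fromℕ-reciprocal n)) C-1))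

  cancelˢ : ∀ n {x y} → Sˢ.fromℕ (suc n) ⊠ x ≋ Sˢ.fromℕ (suc n) ⊠ y → x ≋ y
  cancelˢ n {x} {y} e = 𝕊.trans (expand x) (𝕊.trans (𝕊.*-congˡ e) (𝕊.sym (expand y)))
    where
    expand : ∀ x → x ≋ 1/ n ⊠ (Sˢ.fromℕ (suc n) ⊠ x)
    expand x = 𝕊.trans (𝕊.sym (𝕊.*-identityˡ x)) (𝕊.trans (𝕊.*-congʳ (𝕊.sym (1/-inverse n)))
      (Sˢ.solve 3 (λ a b x → a Sˢ.:* b Sˢ.:* x Sˢ.:= b Sˢ.:* (a Sˢ.:* x)) (Sˢ.fromℕ (suc n)) (1/ n) x))

-- Theta series over an extension with a fifteenth root of unity.

module Instance (R : CommutativeRing 0ℓ 0ℓ) (h : Hom ℚring R) (ζ : CommutativeRing.Carrier R)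
  (Φζ : CommutativeRing._≈_ R (Φ₁₅ R ζ) (CommutativeRing.0# R)) where
  open CommutativeRing R hiding (zero)
  open RationalAlgebra R h
  open Series R
  open MapSeries h
  open InfiniteProducts R
  open FifteenthTheta R ζ Φζ cancel using (P; κ; z; C-^; P₅; P₃P₆; P₁P₂P₄P₇; product-formula; factor; p₀-0; p₁-0; theta-sum; module Zt)
  open ThetaRelations R ζ Φζ cancel using (P′; κ₁; three-term; addition; derivative; p₀-value; p₁-value; v; v′)
  open Solver ring𝕊 using (_^_; ^-cong; fromℕ; fromℤ; solve; _:+_; _:*_; _:-_; :-_; _:=_; :1; :0; :c; _:^_)
  open FiniteSums ring𝕊 using (sum; sum-cong)
  open Transport hom-series using (transport; reflect)
  private
    module 𝕊 = CommutativeRing ring𝕊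
    module Aℚ = Series ℚring
    module 𝔸 = CommutativeRing Aℚ.ring𝕊
    module Pℚ = InfiniteProducts ℚring

  Φ-Π : ∀ m N → Φ (Pℚ.Π (Pℚ.euler m) N) ≋ Π (euler m) N
  Φ-Π m zero    = Φ-𝟙
  Φ-Π m (suc N) = 𝕊.trans (Φ-⊠ _ _) (𝕊.*-cong (Φ-Π m N) (𝕊.trans (Φ-⊞ _ _) (𝕊.+-cong Φ-𝟙
    (𝕊.trans (λ n → Hom.φ-neg h _) (𝕊.-‿cong (Φ-q^ (m ℕ.* suc N)))))))

  E E⁻¹ : ℕ → Ser
  E m   = Φ (Pℚ.𝐄 m)
  E⁻¹ m = Φ (invUnit (Pℚ.𝐄 m))

  E-𝐄 : ∀ m → E m ≋ 𝐄 m
  E-𝐄 m n = Φ-Π m n n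

  E-inverse : ∀ m → E m ⊠ E⁻¹ m ≋ 𝟙
  E-inverse m = 𝕊.trans (𝕊.sym (Φ-⊠ _ _)) (𝕊.trans (Φ-cong (invUnit-inverse (Pℚ.𝐄 m) ≡.refl)) Φ-𝟙)

  s₃ s₅ : Ser
  s₃ = κ 10 5
  s₅ = κ 12 3 ⊠ κ 9 6

  P₅-E : P 5 ≋ s₃ ⊠ E 3
  P₅-E = 𝕊.trans P₅ (𝕊.*-congˡ (𝕊.sym (E-𝐄 3)))

  P₃₆-E : P 3 ⊠ P 6 ≋ s₅ ⊠ (E 1 ⊠ E 5)
  P₃₆-E = 𝕊.trans P₃P₆ (𝕊.*-congˡ (𝕊.*-cong (𝕊.sym (E-𝐄 1)) (𝕊.sym (E-𝐄 5))))

  P₁₂₄₇-E : P 1 ⊠ P 2 ⊠ P 4 ⊠ P 7 ⊠ (E 3 ⊠ E 5) ≋ E 15 ⊠ E 1 ^ 5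
  P₁₂₄₇-E = 𝕊.trans (𝕊.*-congˡ (𝕊.*-cong (E-𝐄 3) (E-𝐄 5))) (𝕊.trans P₁P₂P₄P₇ (𝕊.*-cong (𝕊.sym (E-𝐄 15)) (^-cong 5 (𝕊.sym (E-𝐄 1)))))

  P₃₆⁻¹ P₁₂₄₇⁻¹ : Ser
  P₃₆⁻¹   = s₅ ⊠ 1/ 4 ⊠ (E⁻¹ 1 ⊠ E⁻¹ 5)
  P₁₂₄₇⁻¹ = E 3 ⊠ E 5 ⊠ (E⁻¹ 15 ⊠ E⁻¹ 1 ^ 5)

  -- Inverses are obtained from the three product formulas, multiplying by the other theta values of
  -- the group. The squares -3 and 5 invert `s₃` and `s₅`; note that `1/ n` is the reciprocal of n +
  -- 1. The last clause is a default.
  P⁻¹ : ℕ → Ser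
  P⁻¹ 1 = P 2 ⊠ P 4 ⊠ P 7 ⊠ P₁₂₄₇⁻¹
  P⁻¹ 2 = P 1 ⊠ P 4 ⊠ P 7 ⊠ P₁₂₄₇⁻¹
  P⁻¹ 3 = P 6 ⊠ P₃₆⁻¹
  P⁻¹ 4 = P 1 ⊠ P 2 ⊠ P 7 ⊠ P₁₂₄₇⁻¹
  P⁻¹ 5 = s₃ ⊠ ⊟ 1/ 2 ⊠ E⁻¹ 3
  P⁻¹ 6 = P 3 ⊠ P₃₆⁻¹
  P⁻¹ 7 = P 1 ⊠ P 2 ⊠ P 4 ⊠ P₁₂₄₇⁻¹
  P⁻¹ _ = 𝟘

  s₃² : s₃ ^ 2 ≋ fromℤ -[1+ 2 ]
  s₃² = Zt.kappa₅

  s₅² : s₅ ^ 2 ≋ fromℤ (+ 5)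
  s₅² = Zt.kappa₃₆

  P₅-inverse : P 5 ⊠ P⁻¹ 5 ≋ 𝟙
  P₅-inverse = 𝕊.trans (𝕊.*-congʳ P₅-E) (𝕊.trans (solve 4 (λ s e r i → s :* e :* (s :* :- r :* i) := s :^ 2 :* :- r :* (e :* i)) s₃ (E 3) (1/ 2) (E⁻¹ 3))
    (𝕊.trans (𝕊.*-cong (𝕊.*-congʳ s₃²) (E-inverse 3)) (𝕊.trans (solve 1 (λ r → :c -[1+ 2 ] :* :- r :* :1 := :c (+ 3) :* r) (1/ 2)) (1/-inverse 2))))

  P₃₆-inverse : P 3 ⊠ P 6 ⊠ P₃₆⁻¹ ≋ 𝟙
  P₃₆-inverse = 𝕊.trans (𝕊.*-congʳ P₃₆-E) (𝕊.trans
    (solve 6 (λ s a b r i j → s :* (a :* b) :* (s :* r :* (i :* j)) := s :^ 2 :* r :* (a :* i :* (b :* j))) s₅ (E 1) (E 5) (1/ 4) (E⁻¹ 1) (E⁻¹ 5))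
    (𝕊.trans (𝕊.*-cong (𝕊.trans (𝕊.*-congʳ s₅²) (1/-inverse 4)) (𝕊.*-cong (E-inverse 1) (E-inverse 5))) (solve 0 (:1 :* (:1 :* :1) := :1))))

  P₁₂₄₇-inverse : P 1 ⊠ P 2 ⊠ P 4 ⊠ P 7 ⊠ P₁₂₄₇⁻¹ ≋ 𝟙
  P₁₂₄₇-inverse = 𝕊.trans (𝕊.sym (𝕊.*-assoc _ _ _)) (𝕊.trans (𝕊.*-congʳ P₁₂₄₇-E) (𝕊.trans
    (solve 4 (λ a b i j → a :* b :^ 5 :* (i :* j :^ 5) := a :* i :* (b :* j) :^ 5) (E 15) (E 1) (E⁻¹ 15) (E⁻¹ 1))
    (𝕊.trans (𝕊.*-cong (E-inverse 15) (^-cong 5 (E-inverse 1))) (solve 0 (:1 :* :1 :^ 5 := :1)))))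

  P-inverse : ∀ r → r < 7 → P (suc r) ⊠ P⁻¹ (suc r) ≋ 𝟙
  P-inverse 0 _ = 𝕊.trans (solve 5 (λ a b c d i → a :* (b :* c :* d :* i) := a :* b :* c :* d :* i) (P 1) (P 2) (P 4) (P 7) P₁₂₄₇⁻¹) P₁₂₄₇-inverse
  P-inverse 1 _ = 𝕊.trans (solve 5 (λ a b c d i → b :* (a :* c :* d :* i) := a :* b :* c :* d :* i) (P 1) (P 2) (P 4) (P 7) P₁₂₄₇⁻¹) P₁₂₄₇-inverse
  P-inverse 2 _ = 𝕊.trans (𝕊.sym (𝕊.*-assoc _ _ _)) P₃₆-inverse
  P-inverse 3 _ = 𝕊.trans (solve 5 (λ a b c d i → c :* (a :* b :* d :* i) := a :* b :* c :* d :* i) (P 1) (P 2) (P 4) (P 7) P₁₂₄₇⁻¹) P₁₂₄₇-inverse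
  P-inverse 4 _ = P₅-inverse
  P-inverse 5 _ = 𝕊.trans (solve 3 (λ a b i → b :* (a :* i) := a :* b :* i) (P 3) (P 6) P₃₆⁻¹) P₃₆-inverse
  P-inverse 6 _ = 𝕊.trans (solve 5 (λ a b c d i → d :* (a :* b :* c :* i) := a :* b :* c :* d :* i) (P 1) (P 2) (P 4) (P 7) P₁₂₄₇⁻¹) P₁₂₄₇-inverse
  P-inverse (suc (suc (suc (suc (suc (suc (suc r))))))) (s≤s (s≤s (s≤s (s≤s (s≤s (s≤s (s≤s ())))))))

  theta-functions : ThetaFunctions ring𝕊
  theta-functions = record
    { cancel = cancelˢ
    ; D = D ; D-cong = D-cong ; D-+ = D-⊞ ; D-* = D-⊠
    ; D-fromℤ = λ k → 𝕊.trans (D-cong (fromℤ-C k)) (D-C _)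
    ; P = P ; P′ = P′ ; P⁻¹ = P⁻¹ ; P-inverse = P-inverse
    ; e = E 1 ; e⁻¹ = E⁻¹ 1 ; κ = κ₁ ; e-inverse = E-inverse 1
    ; κ-e = 𝕊.trans p₁-0 (𝕊.*-congˡ (𝕊.trans (𝕊.*-cong 𝓔-E (𝕊.*-cong 𝓔-E 𝓔-E)) (solve 1 (λ e → e :* (e :* e) := e :^ 3) (E 1)))) }
    where
    𝓔-E : J.𝓔 ≋ E 1
    𝓔-E = 𝕊.trans 𝓔≋𝐄 (𝕊.sym (E-𝐄 1))

  theta-system : ThetaSystem ring𝕊
  theta-system = record { functions = theta-functions ; three-term = three-term ; addition = addition ; derivative = derivative }

  open Parametrisation ring𝕊 theta-system using (rr; D-rr; M; M-*; t⁺; t⁻)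
  open Solver R using () renaming (_^_ to _^ᴿ_; ^-cong to ^ᴿ-cong; fromℤ to fromℤᴿ; fromℕ to fromℕᴿ; solve to solveᴿ)

  -- Clears the negative powers of theta values, so that the coefficients of 1 and q can be compared
  -- on both sides.
  rr-expanded : rr ⊠ (P 3 ⊠ P 6) ^ 11 ≋ E 1 ^ 12 ⊠ (P 6 ^ 10 ⊞ fromℤ (+ 11) ⊠ (P 3 ^ 5 ⊠ P 6 ^ 5) ⊞ ⊟ (P 3 ^ 10))
  rr-expanded = 𝕊.trans (𝕊.*-congˡ (solve 7 (λ a₁ a₂ a₃ a₄ a₅ a₆ a₇ → (a₃ :* a₆) :^ 11 := mon a₁ a₂ a₃ a₄ a₅ a₆ a₇ 11 11) (P 1) (P 2) (P 3) (P 4) (P 5) (P 6) (P 7)))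
    (𝕊.trans (solve 6 (λ e m t k u n → e :* m :* (t :+ k :- u) :* n := e :* (t :* (m :* n) :+ k :* (m :* n) :- u :* (m :* n))) (E 1 ^ 12) (M m⃗) (M t⁺) (fromℤ (+ 11)) (M t⁻) (M n⃗))
    (𝕊.*-congˡ (𝕊.trans (𝕊.+-cong (𝕊.+-cong (𝕊.trans (𝕊.*-congˡ mn) (M-* t⁺ k⃗ ≡.refl)) (𝕊.*-congˡ mn)) (𝕊.-‿cong (𝕊.trans (𝕊.*-congˡ mn) (M-* t⁻ k⃗ ≡.refl))))
      (solve 7 (λ a₁ a₂ a₃ a₄ a₅ a₆ a₇ → mon a₁ a₂ a₃ a₄ a₅ a₆ a₇ 0 10 :+ :c (+ 11) :* mon a₁ a₂ a₃ a₄ a₅ a₆ a₇ 5 5 :- mon a₁ a₂ a₃ a₄ a₅ a₆ a₇ 10 0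
        := a₆ :^ 10 :+ :c (+ 11) :* (a₃ :^ 5 :* a₆ :^ 5) :- a₃ :^ 10) (P 1) (P 2) (P 3) (P 4) (P 5) (P 6) (P 7)))))
    where
    open Solver ring𝕊 using (Expr)
    m⃗ n⃗ k⃗ : Vec ℤ 7
    m⃗ = + 0 ∷ + 0 ∷ -[1+ 5 ] ∷ + 0 ∷ + 0 ∷ -[1+ 5 ] ∷ + 0 ∷ []
    n⃗ = + 0 ∷ + 0 ∷ + 11 ∷ + 0 ∷ + 0 ∷ + 11 ∷ + 0 ∷ []
    k⃗ = + 0 ∷ + 0 ∷ + 5 ∷ + 0 ∷ + 0 ∷ + 5 ∷ + 0 ∷ []
    mn : M m⃗ ⊠ M n⃗ ≋ M k⃗
    mn = M-* m⃗ n⃗ ≡.refl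
    mon : Expr 7 → Expr 7 → Expr 7 → Expr 7 → Expr 7 → Expr 7 → Expr 7 → ℕ → ℕ → Expr 7
    mon a₁ a₂ a₃ a₄ a₅ a₆ a₇ m n = a₁ :^ 0 :* (a₂ :^ 0 :* (a₃ :^ m :* (a₄ :^ 0 :* (a₅ :^ 0 :* (a₆ :^ n :* (a₇ :^ 0 :* :1))))))

  pow₁ : ∀ n a → (a ^ suc n) 1 ≈ fromℕᴿ (suc n) * (a 0 ^ᴿ n * a 1)
  pow₀ : ∀ n a → (a ^ n) 0 ≈ a 0 ^ᴿ n
  pow₀ zero    a = refl
  pow₀ (suc n) a = *-congˡ (pow₀ n a)
  pow₁ zero    a = solveᴿ 2 (λ x y → x :* :0 :+ y :* :1 := :1 :* (:1 :* y)) (a 0) (a 1)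
  pow₁ (suc n) a = trans (+-cong (*-congˡ (pow₁ n a)) (*-congˡ (pow₀ (suc n) a)))
    (solveᴿ 4 (λ x y k p → x :* (k :* (p :* y)) :+ y :* (x :* p) := (:1 :+ k) :* (x :* p :* y)) (a 0) (a 1) (fromℕᴿ (suc n)) (a 0 ^ᴿ n))

  private
    z₀ : ∀ n → (z ^ n) 0 ≈ ζ ^ᴿ n
    z₀ n = sym (C-^ n 0)
    z₁ : ∀ n → (z ^ n) 1 ≈ 0#
    z₁ n = sym (C-^ n 1)

  theta-0 : ∀ a b k n l → 14 ℕ.* a ≡ 15 ℕ.* k ℕ.+ b → 14 ℕ.* (a ℕ.+ a) ≡ 15 ℕ.* l ℕ.+ n → P a 0 ≈ ζ ^ᴿ b + - ζ ^ᴿ a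
  theta-0 a b k n l e f = trans (product-formula a b k n l e f 0) (trans (*-identityʳ _) (+-cong (z₀ b) (-‿cong (z₀ a))))

  theta-1 : ∀ a b k n l → 14 ℕ.* a ≡ 15 ℕ.* k ℕ.+ b → 14 ℕ.* (a ℕ.+ a) ≡ 15 ℕ.* l ℕ.+ n → P a 1 ≈ (ζ ^ᴿ b + - ζ ^ᴿ a) * - (1# + ζ ^ᴿ (a ℕ.+ a) + ζ ^ᴿ n)
  theta-1 a b k n l e f = trans (product-formula a b k n l e f 1) (trans
    (+-cong (*-cong (+-cong (z₀ b) (-‿cong (z₀ a))) (trans (solveᴿ 4 (λ x y z w →
          :1 :* ((:1 :- :0) :* ((:1 :- x :* :0) :* (:0 :- (y :* :1 :+ w :* :0)) :+ (:0 :- (x :* :1 :+ z :* :0)) :* (:1 :- y :* :0))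
            :+ (:0 :- :1) :* ((:1 :- x :* :0) :* (:1 :- y :* :0))) :+ :0 :* ((:1 :- :0) :* ((:1 :- x :* :0) :* (:1 :- y :* :0)))
          := :- (:1 :+ x :+ y)) ((z ^ (a ℕ.+ a)) 0) ((z ^ n) 0) ((z ^ (a ℕ.+ a)) 1) ((z ^ n) 1))
        (-‿cong (+-cong (+-congˡ (z₀ (a ℕ.+ a))) (z₀ n)))))
      (*-congʳ (+-cong (z₁ b) (-‿cong (z₁ a)))))
    (solveᴿ 2 (λ x y → x :+ (:0 :- :0) :* y := x) _ _))

  private
    A₃ A₆ η : Carrier
    A₃ = ζ ^ᴿ 12 + - ζ ^ᴿ 3
    A₆ = ζ ^ᴿ 9 + - ζ ^ᴿ 6
    η  = ζ ^ᴿ 6 + ζ ^ᴿ 9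
    module Rt = FifteenthRoot R ζ Φζ

    P₃-1 : P 3 1 ≈ A₃ * - (1# + η)
    P₃-1 = trans (theta-1 3 12 2 9 5 ≡.refl ≡.refl) (*-congˡ (-‿cong (+-assoc _ _ _)))

    P₆-1 : P 6 1 ≈ A₆ * η
    P₆-1 = trans (theta-1 6 9 5 3 11 ≡.refl ≡.refl) (*-congˡ (trans (solveᴿ 4 (λ a b c d →
        :- (:1 :+ d :+ a) := b :+ c :- (:1 :+ a :+ b :+ c :+ d)) (ζ ^ᴿ 3) (ζ ^ᴿ 6) (ζ ^ᴿ 9) (ζ ^ᴿ 12))
      (trans (+-congˡ (-‿cong Rt.quintic)) (solveᴿ 1 (λ x → x :- :0 := x) η))))

    E-0 : E 1 0 ≈ 1#
    E-0 = E-𝐄 1 0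

    E-1 : E 1 1 ≈ - 1#
    E-1 = trans (E-𝐄 1 1) (solveᴿ 0 (:1 :* (:0 :- :1) :+ :0 :* (:1 :- :0) := :- :1))

  rr-0 : rr 0 ≈ 0#
  rr-0 = trans (sym (D-rr 0)) (zeroˡ _)

  rr-higher : ∀ n → rr (suc (suc n)) ≈ 0#
  rr-higher n = cancel n _ (trans (solveᴿ 2 (λ k x → k :* x := (:1 :+ k) :* x :- x) (fromℕᴿ (suc n)) (rr (suc (suc n))))
    (trans (+-congʳ (D-rr (suc (suc n)))) (-‿inverseʳ _)))

  module RamanujanConstant where
    open Solver R using (-≈0⇒≈)

    leading : (P 3 ⊠ P 6) 0 ≈ A₃ * A₆
    leading = *-cong (theta-0 3 12 2 9 5 ≡.refl ≡.refl) (theta-0 6 9 5 3 11 ≡.refl ≡.refl)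

    power-0 : ∀ n a {x} → a 0 ≈ x → (a ^ n) 0 ≈ x ^ᴿ n
    power-0 n a p = trans (pow₀ n a) (^ᴿ-cong n p)

    power-1 : ∀ n a {x y} → a 0 ≈ x → a 1 ≈ y → (a ^ suc n) 1 ≈ fromℕᴿ (suc n) * (x ^ᴿ n * y)
    power-1 n a p q = trans (pow₁ n a) (*-congˡ (*-cong (^ᴿ-cong n p) q))

    p₃ : P 3 0 ≈ A₃
    p₃ = theta-0 3 12 2 9 5 ≡.refl ≡.refl
    p₆ : P 6 0 ≈ A₆
    p₆ = theta-0 6 9 5 3 11 ≡.refl ≡.refl

    value : Carrier → Carrier → Carrier → Carrier
    value a b s = fromℤᴿ (+ 10) * η * b + fromℤᴿ (+ 55) * η * s + - (fromℤᴿ (+ 55) * (1# + η) * s) + fromℤᴿ (+ 10) * (1# + η) * a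
      + - (fromℤᴿ (+ 12) * (b + fromℤᴿ (+ 11) * s + - a))

    -- The coefficient of q in `rr-expanded`. As `rr 0` vanishes, the left side has a single term;
    -- the right side is arranged in `A₃ ^ 2`, `A₆ ^ 2` and `A₃ * A₆`, all of which are polynomials
    -- in η.
    coefficient : rr 1 * (A₃ * A₆) ^ᴿ 11 ≈ value ((A₃ ^ᴿ 2) ^ᴿ 5) ((A₆ ^ᴿ 2) ^ᴿ 5) ((A₃ * A₆) ^ᴿ 5)
    coefficient = trans (trans (sym (+-identityˡ _)) (+-cong (sym (trans (*-congʳ rr-0) (zeroˡ _))) (*-congˡ (sym (power-0 11 (P 3 ⊠ P 6) leading))))) (trans (rr-expanded 1) (trans
      (+-cong (*-cong (power-0 12 (E 1) E-0) (+-cong (+-cong (power-1 9 (P 6) p₆ P₆-1)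
          (+-cong (*-cong (fromℤ-C (+ 11) 0) (+-cong (*-cong (power-0 5 (P 3) p₃) (power-1 4 (P 6) p₆ P₆-1)) (*-cong (power-1 4 (P 3) p₃ P₃-1) (power-0 5 (P 6) p₆)))) (trans (*-congʳ (fromℤ-C (+ 11) 1)) (zeroˡ _))))
          (-‿cong (power-1 9 (P 3) p₃ P₃-1))))
        (*-cong (power-1 11 (E 1) E-0 E-1) (+-cong (+-cong (power-0 10 (P 6) p₆) (*-cong (fromℤ-C (+ 11) 0) (*-cong (power-0 5 (P 3) p₃) (power-0 5 (P 6) p₆)))) (-‿cong (power-0 10 (P 3) p₃)))))
      (solveᴿ 3 (λ A B h → :1 :^ 12 :* (:c (+ 10) :* (B :^ 9 :* (B :* h)) :+ (:c (+ 11) :* (A :^ 5 :* (:c (+ 5) :* (B :^ 4 :* (B :* h))) :+ :c (+ 5) :* (A :^ 4 :* (A :* :- (:1 :+ h))) :* B :^ 5) :+ :0)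
          :- :c (+ 10) :* (A :^ 9 :* (A :* :- (:1 :+ h)))) :+ :c (+ 12) :* (:1 :^ 11 :* :- :1) :* (B :^ 10 :+ :c (+ 11) :* (A :^ 5 :* B :^ 5) :- A :^ 10)
        := :c (+ 10) :* h :* (B :^ 2) :^ 5 :+ :c (+ 55) :* h :* (A :* B) :^ 5 :- :c (+ 55) :* (:1 :+ h) :* (A :* B) :^ 5 :+ :c (+ 10) :* (:1 :+ h) :* (A :^ 2) :^ 5
          :- :c (+ 12) :* ((B :^ 2) :^ 5 :+ :c (+ 11) :* (A :* B) :^ 5 :- (A :^ 2) :^ 5)) A₃ A₆ η)))

    value-cong : ∀ {a b s a′ b′ s′} → a ≈ a′ → b ≈ b′ → s ≈ s′ → value a b s ≈ value a′ b′ s′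
    value-cong p q r = +-cong (+-cong (+-cong (+-cong (*-congˡ q) (*-congˡ r)) (-‿cong (*-congˡ r))) (*-congˡ p)) (-‿cong (*-congˡ (+-cong (+-cong q (*-congˡ r)) (-‿cong p))))

    golden-value : value ((η + - fromℤᴿ (+ 2)) ^ᴿ 5) ((fromℤᴿ -[1+ 2 ] + - η) ^ᴿ 5) ((1# + fromℤᴿ (+ 2) * η) ^ᴿ 5) ≈ - (1# + fromℤᴿ (+ 2) * η) ^ᴿ 11
    golden-value = Rt.mod (trans (+-congʳ Rt.golden) (solveᴿ 1 (λ h → :1 :- h :+ (h :- :1) := :0) η)) (solveᴿ 1 (λ h →
      :c (+ 10) :* h :* (:c -[1+ 2 ] :- h) :^ 5 :+ :c (+ 55) :* h :* (:1 :+ :c (+ 2) :* h) :^ 5 :- :c (+ 55) :* (:1 :+ h) :* (:1 :+ :c (+ 2) :* h) :^ 5 :+ :c (+ 10) :* (:1 :+ h) :* (h :- :c (+ 2)) :^ 5 :- :c (+ 12) :* ((:c -[1+ 2 ] :- h) :^ 5 :+ :c (+ 11) :* (:1 :+ :c (+ 2) :* h) :^ 5 :- (h :- :c (+ 2)) :^ 5)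
      -- The long factor is the quotient by h² + h - 1, which vanishes at η.
      := :- (:1 :+ :c (+ 2) :* h) :^ 11 :+ (h :^ 2 :+ (h :- :1)) :* (:c -[1+ 2025 ] :* h :^ 0 :+ :c -[1+ 4047 ] :* h :^ 1 :+ :c (+ 2956) :* h :^ 2 :+ :c (+ 14088) :* h :^ 3 :+ :c (+ 27264) :* h :^ 4 :+ :c (+ 32768) :* h :^ 5 :+ :c (+ 30464) :* h :^ 6 :+ :c (+ 20992) :* h :^ 7 :+ :c (+ 9216) :* h :^ 8 :+ :c (+ 2048) :* h :^ 9)) η)

    √5 : Carrier
    √5 = 1# + fromℤᴿ (+ 2) * η

    √5² : √5 ^ᴿ 2 ≈ fromℤᴿ (+ 5)
    √5² = Rt.mod (trans (+-congʳ Rt.golden) (solveᴿ 1 (λ h → :1 :- h :+ (h :- :1) := :0) η))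
      (solveᴿ 1 (λ h → (:1 :+ :c (+ 2) :* h) :^ 2 := :c (+ 5) :+ (h :^ 2 :+ (h :- :1)) :* :c (+ 4)) η)

    -- With 1 + 2η as the square root of 5, the coefficient of q reads c √5^11 = - √5^11. One more
    -- factor √5 gives the integer 5^6 = 15625, which can be cancelled.
    rr-1 : rr 1 ≈ - 1#
    rr-1 = -≈0⇒≈ (cancel 15624 _ (trans (*-congʳ (solveᴿ 0 (:c (+ 15625) := :c (+ 5) :^ 6))) (trans (*-congʳ (^ᴿ-cong 6 (sym √5²)))
      (trans (solveᴿ 2 (λ c s → (s :^ 2) :^ 6 :* (c :- :- :1) := s :* (c :* s :^ 11 :- :- s :^ 11)) (rr 1) √5)
      (trans (*-congˡ (trans (+-congʳ (trans (*-congˡ (^ᴿ-cong 11 (sym Rt.golden₃₆))) (trans coefficient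
        (trans (value-cong (^ᴿ-cong 5 Rt.golden₃) (^ᴿ-cong 5 Rt.golden₆) (^ᴿ-cong 5 Rt.golden₃₆)) golden-value)))) (-‿inverseʳ _))) (zeroʳ _))))))

  -- By `D-rr` the n-th coefficient equals n times itself, so all but the first vanish, and the
  -- first is `rr-1`. This proves Ramanujan's identity in the form needed.
  rr-q : rr ≋ ⊟ Φ (Aℚ.q^ 1)
  rr-q = 𝕊.trans go (𝕊.-‿cong (𝕊.sym (Φ-q^ 1)))
    where
    go : rr ≋ ⊟ q^ 1
    go zero          = trans rr-0 (solveᴿ 0 (:0 := :- :0))
    go (suc zero)    = RamanujanConstant.rr-1
    go (suc (suc n)) = trans (rr-higher n) (solveᴿ 0 (:0 := :- :0))

  private
    module CR = Coloured R fifteenColours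
    module Cℚ = Coloured ℚring fifteenColours

  D-z^ : ∀ n → D (z ^ n) ≋ 𝟘
  D-z^ n = 𝕊.trans (D-cong (𝕊.sym (C-^ n))) (D-C _)

  D-κ : ∀ b a → D (κ b a) ≋ 𝟘
  D-κ b a = 𝕊.trans (D-⊞ _ _) (𝕊.trans (𝕊.+-cong (D-z^ b) (𝕊.trans (Parametrisation.D-neg ring𝕊 theta-system (z ^ a)) (𝕊.-‿cong (D-z^ a)))) (solve 0 (:0 :- :0 := :0)))

  C₀ : Ser
  C₀ = E 1 ^ 15 ⊠ Φ (Cℚ.Cs 0)

  -- In `theta-sum` the root a = 0 contributes nothing and the roots a and -a contribute equally,
  -- since p^14 and p′ are even. Hence the factor 2 · 15 = 30, and -450 = 30 · (-15).
  C₀-def : P 1 ^ 14 ⊠ P′ 1 ⊞ P 2 ^ 14 ⊠ P′ 2 ⊞ P 3 ^ 14 ⊠ P′ 3 ⊞ P 4 ^ 14 ⊠ P′ 4 ⊞ P 5 ^ 14 ⊠ P′ 5 ⊞ P 6 ^ 14 ⊠ P′ 6 ⊞ P 7 ^ 14 ⊠ P′ 7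
         ≋ fromℤ -[1+ 14 ] ⊠ (E 15 ^ 3 ⊠ C₀)
  C₀-def = cancelˢ 29 (𝕊.trans (solve 15 (λ o a₁ a₂ a₃ a₄ a₅ a₆ a₇ b₁ b₂ b₃ b₄ b₅ b₆ b₇ →
      :c (+ 30) :* (a₁ :^ 14 :* b₁ :+ a₂ :^ 14 :* b₂ :+ a₃ :^ 14 :* b₃ :+ a₄ :^ 14 :* b₄ :+ a₅ :^ 14 :* b₅ :+ a₆ :^ 14 :* b₆ :+ a₇ :^ 14 :* b₇)
      := t :0 o :+ (t a₁ b₁ :+ (t a₂ b₂ :+ (t a₃ b₃ :+ (t a₄ b₄ :+ (t a₅ b₅ :+ (t a₆ b₆ :+ (t a₇ b₇ :+ (t (:- a₇) b₇ :+ (t (:- a₆) b₆ :+ (t (:- a₅) b₅ :+ (t (:- a₄) b₄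
        :+ (t (:- a₃) b₃ :+ (t (:- a₂) b₂ :+ (t (:- a₁) b₁ :+ :0))))))))))))))) (P′ 0) (P 1) (P 2) (P 3) (P 4) (P 5) (P 6) (P 7) (P′ 1) (P′ 2) (P′ 3) (P′ 4) (P′ 5) (P′ 6) (P′ 7))
    (𝕊.trans (sum-cong 15 (λ a → 𝕊.*-congˡ {x = fromℕ 15} (𝕊.*-cong (^-cong 14 (𝕊.sym (p₀-value (+ a)))) (𝕊.sym (p₁-value (+ a))))))
    (𝕊.trans theta-sum (𝕊.trans (𝕊.*-cong (^-cong 15 𝓔-E) (𝕊.*-cong (𝕊.*-congˡ (𝕊.*-cong 𝓔₁₅-E (𝕊.*-cong 𝓔₁₅-E 𝓔₁₅-E))) (𝕊.sym (Φ-Cs fifteenColours 0))))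
      (solve 3 (λ e y c → e :^ 15 :* (:c -[1+ 449 ] :* (y :* (y :* y)) :* c) := :c (+ 30) :* (:c -[1+ 14 ] :* (y :^ 3 :* (e :^ 15 :* c)))) (E 1) (E 15) (Φ (Cℚ.Cs 0)))))))
    where
    open Solver ring𝕊 using (Expr)
    t : ∀ {n} → Expr n → Expr n → Expr n
    t a b = :c (+ 15) :* (a :^ 14 :* b)
    𝓔-E : J.𝓔 ≋ E 1
    𝓔-E = 𝕊.trans 𝓔≋𝐄 (𝕊.sym (E-𝐄 1))
    𝓔₁₅-E : Spread.dilation R 14 J.𝓔 ≋ E 15
    𝓔₁₅-E = 𝕊.trans dilation-𝓔 (𝕊.sym (E-𝐄 15))

  open Solver ring𝕊 using (close)

  F : ℕ → Ser
  F m = Φ (E2at m)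

  eisenstein : ∀ m → fromℤ (+ 24) ⊠ D (E (suc m)) ≋ fromℤ (+ suc m) ⊠ (F (suc m) ⊞ ⊟ 𝟙) ⊠ E (suc m)
  eisenstein m = 𝕊.trans (𝕊.*-congˡ (𝕊.sym (Φ-D (Pℚ.𝐄 (suc m)))))
    (transport (close 3 (λ d f e → :c (+ 24) :* d := :c (+ suc m) :* (f :- :1) :* e)) (Aℚ.D (Pℚ.𝐄 (suc m)) ∷ E2at (suc m) ∷ Pℚ.𝐄 (suc m) ∷ []) (LogarithmicDerivative.eisenstein m))

  product-system : ProductSystem ring𝕊 theta-system
  product-system = record
    { E₃ = E 3 ; E₅ = E 5 ; E₁₅ = E 15 ; E₃⁻¹ = E⁻¹ 3 ; E₅⁻¹ = E⁻¹ 5 ; E₁₅⁻¹ = E⁻¹ 15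
    ; E₃-inverse = E-inverse 3 ; E₅-inverse = E-inverse 5 ; E₁₅-inverse = E-inverse 15
    ; s₃ = s₃ ; s₅ = s₅ ; s₃² = s₃² ; s₅² = s₅²
    ; D-s₃ = D-κ 10 5
    ; D-s₅ = 𝕊.trans (D-⊠ _ _) (𝕊.trans (𝕊.+-cong (𝕊.*-congʳ (D-κ 12 3)) (𝕊.*-congˡ (D-κ 9 6))) (solve 2 (λ a b → :0 :* a :+ b :* :0 := :0) (κ 9 6) (κ 12 3)))
    ; P₅ = P₅-E ; P₃₆ = P₃₆-E ; P₁₂₄₇ = P₁₂₄₇-E
    ; F₁ = F 1 ; F₃ = F 3 ; F₅ = F 5 ; F₁₅ = F 15
    ; eisenstein₁ = 𝕊.trans (eisenstein 0) (solve 2 (λ f e → :c (+ 1) :* f :* e := f :* e) (F 1 ⊞ ⊟ 𝟙) (E 1))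
    ; eisenstein₃ = eisenstein 2 ; eisenstein₅ = eisenstein 4 ; eisenstein₁₅ = eisenstein 14
    ; q = Φ Forms.q ; rr-q = rr-q
    ; f = Φ f15 ; g₁ = Φ g1 ; g₂ = Φ g2 ; g₃ = Φ g3 ; g₄ = Φ g4 ; h = Φ h15 ; B₁₃ = Φ B13 ; B₁₄ = Φ B14 ; C₀ = C₀
    ; g₁-def = transport (close 5 (λ g a b c d → :c (+ 8) :* g := :- (a :+ :c (+ 3) :* b :- :c (+ 5) :* c :- :c (+ 15) :* d))) (g1 ∷ E2at 1 ∷ E2at 3 ∷ E2at 5 ∷ E2at 15 ∷ []) Forms.g₁-def
    ; g₂-def = transport (close 5 (λ g a b c d → :c (+ 12) :* g := :- (a :- :c (+ 3) :* b :+ :c (+ 5) :* c :- :c (+ 15) :* d))) (g2 ∷ E2at 1 ∷ E2at 3 ∷ E2at 5 ∷ E2at 15 ∷ []) Forms.g₂-def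
    ; g₄-def = transport (close 5 (λ g a b c d → :c (+ 8) :* g := a :- :c (+ 3) :* b :- :c (+ 5) :* c :+ :c (+ 15) :* d)) (g4 ∷ E2at 1 ∷ E2at 3 ∷ E2at 5 ∷ E2at 15 ∷ []) Forms.g₄-def
    ; g₃-def = transport (close 6 (λ g q a b c d → g := q :* (a :* b :* c :* d))) (g3 ∷ Forms.q ∷ Pℚ.𝐄 1 ∷ Pℚ.𝐄 3 ∷ Pℚ.𝐄 5 ∷ Pℚ.𝐄 15 ∷ []) Forms.g₃-def
    ; f-def = transport (close 6 (λ f q a b c d → f :* (b :* c) := q :* (a :^ 2 :* d :^ 2))) (f15 ∷ Forms.q ∷ Pℚ.𝐄 1 ∷ Pℚ.𝐄 3 ∷ Pℚ.𝐄 5 ∷ Pℚ.𝐄 15 ∷ []) Forms.f-def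
    ; h-def = transport (close 6 (λ h q a b c d → h := q :* (a :^ 4 :* c :^ 4) :- :c (+ 9) :* (q :^ 3 :* (b :^ 4 :* d :^ 4)))) (h15 ∷ Forms.q ∷ Pℚ.𝐄 1 ∷ Pℚ.𝐄 3 ∷ Pℚ.𝐄 5 ∷ Pℚ.𝐄 15 ∷ []) Forms.h-def
    ; B₁₃-def = transport (close 5 (λ g a b c d → g :* (a :^ 7 :* d :^ 7) := b :^ 14 :* c :^ 14)) (B13 ∷ Pℚ.𝐄 1 ∷ Pℚ.𝐄 3 ∷ Pℚ.𝐄 5 ∷ Pℚ.𝐄 15 ∷ []) Forms.B₁₃-def
    ; B₁₄-def = transport (close 5 (λ g a b c d → g :* (b :^ 4 :* d) := a :^ 17 :* c :^ 2)) (B14 ∷ Pℚ.𝐄 1 ∷ Pℚ.𝐄 3 ∷ Pℚ.𝐄 5 ∷ Pℚ.𝐄 15 ∷ []) Forms.B₁₄-def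
    ; C₀-def = C₀-def
    }

  bracket-image : Φ (Solver.fromℤ Aℚ.ring𝕊 (+ 1156) Aℚ.⊠ (Solver._^_ Aℚ.ring𝕊 (Pℚ.𝐄 1) 15 Aℚ.⊠ Cℚ.Cs 0)) ≋ Φ (Solver.fromℤ Aℚ.ring𝕊 (+ 1156) Aℚ.⊠ Defs.bracket15)
  bracket-image = 𝕊.trans (reflect (close 10 (λ e c f g₁ g₂ g₃ g₄ h b₁₃ b₁₄ → :c (+ 1156) :* (e :^ 15 :* c) := :c (+ 18125225) :* (f :* g₁ :^ 3) :+ :c -[1+ 28732685 ] :* (f :* g₁ :^ 2 :* g₂) :+ :c -[1+ 87564446 ] :* (f :* g₁ :* g₂ :^ 2) :+ :c (+ 84715794) :* (f :* g₂ :^ 3) :+ :c (+ 147166525) :* (f :* g₁ :^ 2 :* g₃) :+ :c (+ 5813269) :* (f :* g₁ :^ 2 :* g₄) :+ :c -[1+ 32849507 ] :* (f :* g₁ :* g₂ :* g₃) :+ :c -[1+ 8272046 ] :* (f :* g₁ :* g₂ :* g₄) :+ :c -[1+ 166339610 ] :* (f :* g₂ :^ 2 :* g₃) :+ :c -[1+ 39740525 ] :* (f :* g₂ :^ 2 :* g₄) :+ :c (+ 123484277) :* (f :* g₁ :* h) :+ :c -[1+ 28214780 ] :* (f :* g₂ :* h) :+ :c (+ 3901500) :* b₁₃ :+ :c -[1+ 3900343 ] :* b₁₄))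
    (Pℚ.𝐄 1 ∷ Cℚ.Cs 0 ∷ f15 ∷ g1 ∷ g2 ∷ g3 ∷ g4 ∷ h15 ∷ B13 ∷ B14 ∷ []) (Conclusion.conclusion ring𝕊 theta-system product-system)) (Φ-cong (𝔸.sym Forms.bracket-def))

  -- Both sides have rational coefficients, so the identity over the extension descends to ℚ
  -- coefficient by coefficient.
  bracket-identity : (∀ x y → Hom.φ h x ≈ Hom.φ h y → x ≡ y) → Solver.fromℤ Aℚ.ring𝕊 (+ 1156) Aℚ.⊠ (Solver._^_ Aℚ.ring𝕊 (Pℚ.𝐄 1) 15 Aℚ.⊠ Cℚ.Cs 0) Aℚ.≋ Solver.fromℤ Aℚ.ring𝕊 (+ 1156) Aℚ.⊠ Defs.bracket15
  bracket-identity injective n = injective _ _ (bracket-image n)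

-- A ring containing ℚ and a fifteenth root of unity.

module Field where
  -- A tower of three quadratic steps, by a cube root of unity ω, the golden ratio φ and a fifth
  -- root of unity. Elements are eight rational coordinates, so `ζ-root` holds by evaluation and the
  -- embedding of ℚ is visibly injective.
  ℚ[ω] ℚ[ω,φ] 𝕂 : CommutativeRing 0ℓ 0ℓ

  private
    module Q = CommutativeRing ℚring

  ℚ[ω] = QuadraticExtension.quadratic ℚring (Q.- Q.1#) (Q.- Q.1#)

  private
    module A = CommutativeRing ℚ[ω]

  ℚ[ω,φ] = QuadraticExtension.quadratic ℚ[ω] A.1# A.1#

  private
    module B = CommutativeRing ℚ[ω,φ]

  -- η² = (φ - 1) η - 1 for a primitive fifth root of unity η.
  𝕂 = QuadraticExtension.quadratic ℚ[ω,φ] (A.- A.1# , A.1#) (B.- B.1#)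

  embedding : Hom ℚring 𝕂
  embedding = compose {ℚring} {ℚ[ω,φ]} {𝕂} (embed ℚ[ω,φ] (A.- A.1# , A.1#) (B.- B.1#))
    (compose {ℚring} {ℚ[ω]} {ℚ[ω,φ]} (embed ℚ[ω] A.1# A.1#) (embed ℚring (Q.- Q.1#) (Q.- Q.1#)))

  open CommutativeRing 𝕂 using (Carrier; _≈_; _+_; _*_; -_; 0#; 1#)
  open Solver 𝕂 using (_^_; fromℤ)

  -- ω η, a primitive fifteenth root of unity.
  ζ : Carrier
  ζ = CommutativeRing.0# ℚ[ω,φ] , ((0ℚ , 1ℚ) , (0ℚ , 0ℚ))

  ζ-root : ζ ^ 8 + - ζ ^ 7 + ζ ^ 5 + - ζ ^ 4 + ζ ^ 3 + - ζ + 1# ≈ 0#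
  ζ-root = ((≡.refl , ≡.refl) , (≡.refl , ≡.refl)) , ((≡.refl , ≡.refl) , (≡.refl , ≡.refl))

open import Data.Empty using (⊥)
open import Data.Fin as Fin using (toℕ; fromℕ<)
import Data.Fin.Properties as FinP
open import Data.List using (length; map)
open import Data.List.Relation.Unary.Linked as Linked using ([]; [-]; _∷_)
open import Data.Nat.DivMod using (m*n/n≡m; +-distrib-/-∣ʳ; m≡m%n+[m/n]*n; m%n<n)
open import Data.Nat.Divisibility using (n∣m*n)
open import Data.Nat.ListAction using () renaming (sum to total)
open import Data.Product.Function.NonDependent.Propositional using (_×-↔_)
open import Data.Sum.Function.Propositional using (_⊎-↔_)
open import Data.Unit using (⊤; tt)
open import Function.Bundles using (mk↔ₛ′)
open import Function.Properties.Inverse using (↔-sym; ↔-trans)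
open import Relation.Binary using (tri<; tri≈; tri>)
open import Defs using (ColInt; _≺_; _≻_; StrictDec; frob; FrobPartition)

-- Frobenius symbols

-- The position of a coloured integer in the order ≺, so that colours become residues and values
-- become quotients modulo 15, as in `fifteenColours`.
code : ColInt 15 → ℕ
code (a , c) = toℕ c ℕ.+ a ℕ.* 15

level-code : ∀ x → code x ℕ./ 15 ≡ proj₁ x
level-code (a , c) = ≡.trans (+-distrib-/-∣ʳ (toℕ c) (n∣m*n a)) (≡.cong₂ ℕ._+_ (m<n⇒m/n≡0 (FinP.toℕ<n c)) (m*n/n≡m a 15))

code-injective : ∀ {x y} → code x ≡ code y → x ≡ y
code-injective {a , c} {b , d} e with ≡.trans (≡.sym (level-code (a , c))) (≡.trans (≡.cong (ℕ._/ 15) e) (level-code (b , d)))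
... | ≡.refl = ≡.cong (a ,_) (FinP.toℕ-injective (ℕP.+-cancelʳ-≡ (a ℕ.* 15) (toℕ c) (toℕ d) e))

decode : ℕ → ColInt 15
decode v = v ℕ./ 15 , fromℕ< (m%n<n v 15)

code-decode : ∀ v → code (decode v) ≡ v
code-decode v = ≡.trans (≡.cong (ℕ._+ v ℕ./ 15 ℕ.* 15) (FinP.toℕ-fromℕ< (m%n<n v 15))) (≡.sym (m≡m%n+[m/n]*n v 15))

≺⇒< : ∀ {x y : ColInt 15} → x ≺ y → code x < code y
≺⇒< {a , c} {b , d} (inj₁ a<b) = ℕP.<-≤-trans (ℕP.+-monoˡ-< (a ℕ.* 15) (FinP.toℕ<n c))
  (ℕP.≤-trans (ℕP.*-monoˡ-≤ 15 a<b) (ℕP.m≤n+m (b ℕ.* 15) (toℕ d)))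
≺⇒< {a , c} (inj₂ (≡.refl , c<d)) = ℕP.+-monoˡ-< (a ℕ.* 15) c<d

<⇒≺ : ∀ {x y : ColInt 15} → code x < code y → x ≺ y
<⇒≺ {a , c} {b , d} p with ℕP.<-cmp a b
... | tri< a<b _ _ = inj₁ a<b
... | tri≈ _ ≡.refl _ = inj₂ (≡.refl , ℕP.+-cancelʳ-< (a ℕ.* 15) (toℕ c) (toℕ d) p)
... | tri> _ _ b<a = ⊥-elim (ℕP.<-asym p (≺⇒< {b , d} {a , c} (inj₁ b<a)))

-- Symbols and rows carry their proofs as fields. Uniqueness of these proofs lets the bijections
-- below be checked on entries only.
≻-irrelevant : ∀ {x y : ColInt 15} (p q : x ≻ y) → p ≡ q
≻-irrelevant (inj₁ p) (inj₁ q) = ≡.cong inj₁ (ℕP.<-irrelevant p q)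
≻-irrelevant (inj₁ p) (inj₂ (≡.refl , _)) = ⊥-elim (ℕP.<-irrefl ≡.refl p)
≻-irrelevant (inj₂ (≡.refl , _)) (inj₁ q) = ⊥-elim (ℕP.<-irrefl ≡.refl q)
≻-irrelevant (inj₂ (e , p)) (inj₂ (f , q)) = ≡.cong inj₂ (≡.cong₂ _,_ (ℕP.≡-irrelevant e f) (ℕP.<-irrelevant p q))

Below : ℕ → List (ColInt 15) → Set
Below M []      = ⊤
Below M (x ∷ _) = code x < M

Below-irrelevant : ∀ {M} l (p q : Below M l) → p ≡ q
Below-irrelevant []      p q = ≡.refl
Below-irrelevant (x ∷ l) p q = ℕP.<-irrelevant p q

Below-mono : ∀ {M N} l → M ≤ N → Below M l → Below N l
Below-mono []      p b = tt
Below-mono (x ∷ l) p b = ℕP.<-≤-trans b p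

StrictDec-irrelevant : ∀ {l : List (ColInt 15)} (p q : StrictDec l) → p ≡ q
StrictDec-irrelevant = Linked.irrelevant (λ {x} {y} → ≻-irrelevant {x} {y})

tail-dec : ∀ {x : ColInt 15} {l} → StrictDec (x ∷ l) → StrictDec l
tail-dec [-]     = []
tail-dec (_ ∷ d) = d

tail-below : ∀ {x : ColInt 15} l → StrictDec (x ∷ l) → Below (code x) l
tail-below []      d           = tt
tail-below (y ∷ l) (x≻y ∷ _)   = ≺⇒< x≻y

cons-dec : ∀ x l → Below (code x) l → StrictDec l → StrictDec (x ∷ l)
cons-dec x []      b d = [-]
cons-dec x (y ∷ l) b d = <⇒≺ b ∷ d

total-of : List (ColInt 15) → ℕ
total-of l = total (map proj₁ l)

record Row (M ℓ w : ℕ) : Set where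
  constructor row
  field
    entries    : List (ColInt 15)
    decreasing : StrictDec entries
    below      : Below M entries
    size       : length entries ≡ ℓ
    totals     : total-of entries ≡ w

open Row

Row-≡ : ∀ {M ℓ w} {r s : Row M ℓ w} → entries r ≡ entries s → r ≡ s
Row-≡ {r = row l d b s t} {row .l d′ b′ s′ t′} ≡.refl
  rewrite StrictDec-irrelevant d d′ | Below-irrelevant l b b′ | ℕP.≡-irrelevant s s′ | ℕP.≡-irrelevant t t′ = ≡.refl

Shifted : ℕ → (ℕ → Set) → ℕ → Set
Shifted k T n = Σ[ u ∈ ℕ ] (k ℕ.+ u ≡ n) × T u

-- The combinatorial form of the recursion of `A`: the first entry of a row is its largest, and it
-- either has code M, in which case removing it lowers the total by M / 15, or a smaller code.
Row-largest : ∀ M ℓ w → Row (suc M) (suc ℓ) w ↔ (Row M (suc ℓ) w ⊎ Shifted (M ℕ./ 15) (Row M ℓ) w)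
Row-largest M ℓ w = mk↔ₛ′ to from to-from from-to
  where
  top : ∀ {x} → code x < suc M → ¬ code x < M → code x ≡ M
  top p q = ℕP.≤-antisym (ℕP.≤-pred p) (ℕP.≮⇒≥ q)
  to : Row (suc M) (suc ℓ) w → Row M (suc ℓ) w ⊎ Shifted (M ℕ./ 15) (Row M ℓ) w
  to (row (x ∷ l) d b s t) with code x ℕ.<? M
  ... | yes p = inj₁ (row (x ∷ l) d p s t)
  ... | no ¬p = inj₂ (total-of l , ≡.trans (≡.cong (ℕ._+ total-of l) (≡.trans (≡.cong (ℕ._/ 15) (≡.sym (top {x} b ¬p))) (level-code x))) t
    , row l (tail-dec d) (≡.subst (λ N → Below N l) (top {x} b ¬p) (tail-below l d)) (ℕP.suc-injective s) ≡.refl)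
  from : Row M (suc ℓ) w ⊎ Shifted (M ℕ./ 15) (Row M ℓ) w → Row (suc M) (suc ℓ) w
  from (inj₁ (row l d b s t)) = row l d (Below-mono l (ℕP.n≤1+n M) b) s t
  from (inj₂ (u , e , row l d b s t)) = row (decode M ∷ l) (cons-dec (decode M) l (≡.subst (λ N → Below N l) (≡.sym (code-decode M)) b) d)
    (ℕP.≤-reflexive (≡.cong suc (code-decode M))) (≡.cong suc s) (≡.trans (≡.cong (M ℕ./ 15 ℕ.+_) t) e)
  to-from : ∀ y → to (from y) ≡ y
  to-from (inj₁ (row (x ∷ l) d b s t)) with code x ℕ.<? M
  ... | yes p = ≡.cong inj₁ (Row-≡ ≡.refl)
  ... | no ¬p = ⊥-elim (¬p b)
  to-from (inj₂ (.(total-of l) , e , row l d b s ≡.refl)) with code (decode M) ℕ.<? M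
  ... | yes p = ⊥-elim (ℕP.<-irrefl (code-decode M) p)
  ... | no ¬p = ≡.cong (λ z → inj₂ (total-of l , z)) (≡.cong₂ _,_ (ℕP.≡-irrelevant _ _) (Row-≡ ≡.refl))
  from-to : ∀ x → from (to x) ≡ x
  from-to (row (x ∷ l) d b s t) with code x ℕ.<? M
  ... | yes p = Row-≡ ≡.refl
  ... | no ¬p = Row-≡ (≡.cong (_∷ l) (code-injective (≡.trans (code-decode M) (≡.sym (top {x} b ¬p)))))

Row-empty : ∀ M w → Row (suc M) 0 w ↔ Row M 0 w
Row-empty M w = mk↔ₛ′ (λ { (row [] d b s t) → row [] d tt s t }) (λ { (row [] d b s t) → row [] d tt s t })
  (λ { (row [] d b s t) → ≡.refl }) (λ { (row [] d b s t) → ≡.refl })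

-- Counting Frobenius symbols by the coefficients of the series.

module Counting (R : CommutativeRing 0ℓ 0ℓ) where
  open CommutativeRing R hiding (zero)
  open Solver R using (fromℕ; fromℕ-+; fromℕ-*)
  open FiniteSums R using (sum)
  open Series R
  private module 𝕊 = CommutativeRing ring𝕊

  -- A bijection with some `Fin m`, together with the value of m in the ring. It is built along the
  -- operations on series, so bijection and coefficient are obtained in one induction.
  Counted : Set → Carrier → Set
  Counted T x = Σ[ m ∈ ℕ ] (T ↔ Fin m) × (fromℕ m ≈ x)

  counted-↔ : ∀ {T U x} → T ↔ U → Counted U x → Counted T x
  counted-↔ i (m , j , e) = m , ↔-trans i j , e

  counted-≈ : ∀ {T x y} → x ≈ y → Counted T x → Counted T y
  counted-≈ p (m , j , e) = m , j , trans e p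

  counted-⊥ : ∀ {T : Set} → (T → ⊥) → Counted T 0#
  counted-⊥ f = 0 , mk↔ₛ′ (λ t → ⊥-elim (f t)) (λ ()) (λ ()) (λ t → ⊥-elim (f t)) , refl

  counted-1 : ∀ {T : Set} (t : T) → (∀ u → t ≡ u) → Counted T 1#
  counted-1 t f = 1 , mk↔ₛ′ (λ _ → Fin.zero) (λ _ → t) (λ { Fin.zero → ≡.refl ; (Fin.suc ()) }) f , refl

  counted-⊎ : ∀ {T U x y} → Counted T x → Counted U y → Counted (T ⊎ U) (x + y)
  counted-⊎ (m , i , e) (n , j , f) = m ℕ.+ n , ↔-trans (i ⊎-↔ j) (↔-sym FinP.+↔⊎) , trans (fromℕ-+ m n) (+-cong e f)

  counted-× : ∀ {T U x y} → Counted T x → Counted U y → Counted (T × U) (x * y)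
  counted-× (m , i , e) (n , j , f) = m ℕ.* n , ↔-trans (i ×-↔ j) (↔-sym FinP.*↔×) , trans (fromℕ-* m n) (*-cong e f)

  counted-sh : ∀ k {T a} → (∀ n → Counted (T n) (a n)) → ∀ n → Counted (Shifted k T n) (sh k a n)
  counted-sh zero    c n       = counted-↔ (mk↔ₛ′ (λ { (_ , ≡.refl , t) → t }) (λ t → n , ≡.refl , t) (λ _ → ≡.refl) (λ { (_ , ≡.refl , _) → ≡.refl })) (c n)
  counted-sh (suc k) c zero    = counted-⊥ (λ { (_ , () , _) })
  counted-sh (suc k) c (suc n) = counted-↔ (mk↔ₛ′ (λ { (u , e , t) → u , ℕP.suc-injective e , t }) (λ { (u , e , t) → u , ≡.cong suc e , t })
    (λ { (u , ≡.refl , t) → ≡.refl }) (λ { (u , ≡.refl , t) → ≡.refl })) (counted-sh k c n)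

  Convolved : (ℕ → Set) → (ℕ → Set) → ℕ → Set
  Convolved T U n = Σ[ u ∈ ℕ ] Σ[ v ∈ ℕ ] (u ℕ.+ v ≡ n) × T u × U v

  counted-⊠ : ∀ n {T U a b} → (∀ n → Counted (T n) (a n)) → (∀ n → Counted (U n) (b n)) → Counted (Convolved T U n) ((a ⊠ b) n)
  counted-⊠ zero    c d = counted-↔ (mk↔ₛ′ (λ { (zero , zero , ≡.refl , t , u) → t , u }) (λ { (t , u) → 0 , 0 , ≡.refl , t , u })
    (λ _ → ≡.refl) (λ { (zero , zero , ≡.refl , t , u) → ≡.refl })) (counted-× (c 0) (d 0))
  counted-⊠ (suc n) {T} {U} c d = counted-↔ (mk↔ₛ′ to from (λ { (inj₁ _) → ≡.refl ; (inj₂ (_ , _ , ≡.refl , _)) → ≡.refl })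
      (λ { (zero , _ , ≡.refl , _) → ≡.refl ; (suc _ , _ , ≡.refl , _) → ≡.refl }))
    (counted-⊎ (counted-× (c 0) (d (suc n))) (counted-⊠ n (λ n → c (suc n)) d))
    where
    to : Convolved T U (suc n) → T 0 × U (suc n) ⊎ Convolved (λ n → T (suc n)) U n
    to (zero  , v , ≡.refl , t , u) = inj₁ (t , u)
    to (suc x , v , e , t , u)      = inj₂ (x , v , ℕP.suc-injective e , t , u)
    from : T 0 × U (suc n) ⊎ Convolved (λ n → T (suc n)) U n → Convolved T U (suc n)
    from (inj₁ (t , u))             = 0 , suc n , ≡.refl , t , u
    from (inj₂ (x , v , e , t , u)) = suc x , v , ≡.cong suc e , t , u

  counted-sum : ∀ n {T : ℕ → Set} {a} → (∀ i → Counted (T i) (a i)) → Counted (Σ[ i ∈ ℕ ] (i < n) × T i) (sum n a)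
  counted-sum zero    c = counted-⊥ (λ { (_ , () , _) })
  counted-sum (suc n) {T} c = counted-↔ (mk↔ₛ′ to from (λ { (inj₁ _) → ≡.refl ; (inj₂ _) → ≡.refl })
      (λ { (zero , s≤s z≤n , _) → ≡.refl ; (suc _ , s≤s _ , _) → ≡.refl }))
    (counted-⊎ (c 0) (counted-sum n (λ i → c (suc i))))
    where
    to : Σ[ i ∈ ℕ ] (i < suc n) × T i → T 0 ⊎ Σ[ i ∈ ℕ ] (i < n) × T (suc i)
    to (zero  , _     , t) = inj₁ t
    to (suc i , s≤s p , t) = inj₂ (i , p , t)
    from : T 0 ⊎ Σ[ i ∈ ℕ ] (i < n) × T (suc i) → Σ[ i ∈ ℕ ] (i < suc n) × T i
    from (inj₁ t)           = 0 , s≤s z≤n , t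
    from (inj₂ (i , p , t)) = suc i , s≤s p , t

  open Coloured R fifteenColours

  counted-row : ∀ M ℓ w → Counted (Row M ℓ w) (A M ℓ w)
  counted-row zero    zero    zero    = counted-1 (row [] [] tt ≡.refl ≡.refl) λ { (row [] [] tt ≡.refl ≡.refl) → ≡.refl ; (row (x ∷ l) d () s t) }
  counted-row zero    zero    (suc w) = counted-⊥ λ { (row [] d b s ()) ; (row (x ∷ l) d () s t) }
  counted-row zero    (suc ℓ) w       = counted-⊥ λ { (row [] d b () t) ; (row (x ∷ l) d () s t) }
  counted-row (suc M) zero    w       = counted-↔ (Row-empty M w) (counted-row M zero w)
  counted-row (suc M) (suc ℓ) w       = counted-↔ (Row-largest M ℓ w) (counted-⊎ (counted-row M (suc ℓ) w) (counted-sh (M ℕ./ 15) (counted-row M ℓ) w))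

  -- In a row of total w every value is at most w, so every code is below 15 (w + 1); the bound is
  -- no restriction and matches the truncation in `A∞`.
  Row∞ : ℕ → ℕ → Set
  Row∞ ℓ w = Row (suc w ℕ.* 15) ℓ w

  bounded : ∀ l → Below (suc (total-of l) ℕ.* 15) l
  bounded []            = tt
  bounded ((a , c) ∷ l) = ℕP.<-≤-trans (ℕP.+-monoˡ-< (a ℕ.* 15) (FinP.toℕ<n c)) (ℕP.*-monoˡ-≤ 15 (s≤s (ℕP.m≤m+n a (total-of l))))

  -- Frobenius symbols arranged like the series `Cs 0`: ℓ is the number of columns, and n splits
  -- into the total of the top row and ℓ plus the total of the bottom row. The addition of 0 mirrors
  -- the index m + s at s = 0.
  Symbols : ℕ → Set
  Symbols n = Σ[ ℓ ∈ ℕ ] (ℓ < suc (n ℕ.+ 0)) × Convolved (Row∞ (ℓ ℕ.+ 0)) (Shifted ℓ (Row∞ ℓ)) n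

  frobenius↔symbols : ∀ n → FrobPartition 15 n ↔ Symbols n
  frobenius↔symbols n = mk↔ₛ′ to from to-from from-to
    where
    weigh : ∀ ℓ a b → ℓ ℕ.+ a ℕ.+ b ≡ a ℕ.+ (ℓ ℕ.+ b)
    weigh ℓ a b = ≡.trans (≡.cong (ℕ._+ b) (ℕP.+-comm ℓ a)) (ℕP.+-assoc a ℓ b)
    to : FrobPartition 15 n → Symbols n
    to (frob t b e dt db , w) = length t , s≤s (ℕP.≤-trans (ℕP.≤-trans (ℕP.m≤m+n (length t) _) (ℕP.≤-trans (ℕP.m≤m+n _ _) (ℕP.≤-reflexive w))) (ℕP.≤-reflexive (≡.sym (ℕP.+-identityʳ n)))) ,
      total-of t , length t ℕ.+ total-of b , ≡.trans (≡.sym (weigh (length t) (total-of t) (total-of b))) w ,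
      row t dt (bounded t) (≡.sym (ℕP.+-identityʳ _)) ≡.refl , total-of b , ≡.refl , row b db (bounded b) (≡.sym e) ≡.refl
    from : Symbols n → FrobPartition 15 n
    from (ℓ , _ , u , v , e , row t dt _ s w , x , f , row b db _ s′ w′) =
      frob t b (≡.trans s (≡.trans (ℕP.+-identityʳ ℓ) (≡.sym s′))) dt db ,
      ≡.trans (≡.cong₂ ℕ._+_ (≡.cong₂ ℕ._+_ (≡.trans s (ℕP.+-identityʳ ℓ)) w) w′) (≡.trans (weigh ℓ u x) (≡.trans (≡.cong (u ℕ.+_) f) e))
    to-from : ∀ y → to (from y) ≡ y
    to-from (ℓ , p , u , v , e , row t dt bt s ≡.refl , x , ≡.refl , row b db bb s′ ≡.refl) with ≡.trans s (ℕP.+-identityʳ ℓ)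
    ... | ≡.refl = same (ℕP.<-irrelevant _ _) (ℕP.≡-irrelevant _ _) (Row-≡ ≡.refl) (Row-≡ ≡.refl)
      where
      same : ∀ {p p′ : length t < suc (n ℕ.+ 0)} {e e′ : total-of t ℕ.+ (length t ℕ.+ total-of b) ≡ n} {r r′ : Row∞ (length t ℕ.+ 0) (total-of t)} {q q′ : Row∞ (length t) (total-of b)} →
        p ≡ p′ → e ≡ e′ → r ≡ r′ → q ≡ q′ →
        _≡_ {A = Symbols n} (length t , p , total-of t , length t ℕ.+ total-of b , e , r , total-of b , ≡.refl , q) (length t , p′ , total-of t , length t ℕ.+ total-of b , e′ , r′ , total-of b , ≡.refl , q′)
      same ≡.refl ≡.refl ≡.refl ≡.refl = ≡.refl
    from-to : ∀ x → from (to x) ≡ x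
    from-to (frob t b e dt db , w) = same (ℕP.≡-irrelevant _ _) (ℕP.≡-irrelevant _ _)
      where
      same : ∀ {e e′ : length t ≡ length b} {w w′ : length t ℕ.+ total-of t ℕ.+ total-of b ≡ n} → e ≡ e′ → w ≡ w′ →
        _≡_ {A = FrobPartition 15 n} (frob t b e dt db , w) (frob t b e′ dt db , w′)
      same ≡.refl ≡.refl = ≡.refl

  counted-frobenius : ∀ n → Counted (FrobPartition 15 n) (Cs 0 n)
  counted-frobenius n = counted-↔ (frobenius↔symbols n) (counted-sum (suc (n ℕ.+ 0)) (λ ℓ →
    counted-≈ (⊠-cong {a = A∞ (ℓ ℕ.+ 0)} (λ _ → refl) (𝕊.sym (q^-⊠ ℓ (A∞ ℓ))) n)
      (counted-⊠ n (λ w → counted-row (suc w ℕ.* 15) (ℓ ℕ.+ 0) w) (counted-sh ℓ (λ w → counted-row (suc w ℕ.* 15) ℓ w)))))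

-- Descent to ℚ and the theorem.

open Field
open QSeries using (fromℕ-/1; invUnit-inverse; module 𝕊)
open import Defs

embedding-injective : ∀ x y → CommutativeRing._≈_ 𝕂 (Hom.φ embedding x) (Hom.φ embedding y) → x ≡ y
embedding-injective x y e = proj₁ (proj₁ (proj₁ e))

open Series ℚring
open Coloured ℚring fifteenColours using (Cs)
open InfiniteProducts ℚring using (𝐄)
open Solver ring𝕊 using (_^_; solve; _:*_; _:=_)

-- Both sides are compared after multiplication by the fifteenth power of the Euler product, which
-- is invertible, and by 1156, which can be cancelled over ℚ.
rhs-Cs : rhs15 ≋ Cs 0
rhs-Cs = 𝕊.trans (unfold rhs15) (𝕊.trans (𝕊.*-congˡ (𝕊.trans Forms.rhs-def (𝕊.sym bracket-Cs))) (𝕊.sym (unfold (Cs 0))))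
  where
  I = invUnit (𝐄 1 ^ 15)
  unfold : ∀ a → a ≋ I ⊠ (𝐄 1 ^ 15 ⊠ a)
  unfold a = 𝕊.trans (𝕊.sym (𝕊.*-identityˡ a)) (𝕊.trans (𝕊.*-congʳ (𝕊.sym (invUnit-inverse (𝐄 1 ^ 15) ≡.refl)))
    (solve 3 (λ e i a → e :* i :* a := i :* (e :* a)) (𝐄 1 ^ 15) I a))
  bracket-Cs : 𝐄 1 ^ 15 ⊠ Cs 0 ≋ bracket15
  bracket-Cs = RationalAlgebra.cancelˢ ℚring identity 1155 (Instance.bracket-identity 𝕂 embedding ζ ζ-root embedding-injective)
    where
    identity : Hom ℚring ℚring
    identity = record { φ = λ x → x ; φ-cong = λ e → e ; φ-+ = λ _ _ → ≡.refl ; φ-* = λ _ _ → ≡.refl ; φ-neg = λ _ → ≡.refl ; φ-0 = ≡.refl ; φ-1 = ≡.refl }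

theorem5p4 : (n : ℕ) → Σ[ m ∈ ℕ ] ((FrobPartition 15 n ↔ Fin m) × (rhs15 n ≡ (+ m) / 1))
theorem5p4 n = finish (Counting.counted-frobenius ℚring n)
  where
  finish : Counting.Counted ℚring (FrobPartition 15 n) (Cs 0 n) → Σ[ m ∈ ℕ ] ((FrobPartition 15 n ↔ Fin m) × (rhs15 n ≡ (+ m) / 1))
  finish (m , bijection , e) = m , bijection , ≡.trans (rhs-Cs n) (≡.trans (≡.sym e) (fromℕ-/1 m))
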